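{- For every $\gamma\in(0,1)$ there exists $\epsilon=\epsilon(\gamma)>0$ such that the following holds. Let $p$ be a sufficiently large prime, and let $E\subseteq\mathbb{F}_p^2\setminus\{(0,0)\}$ with $|E|\le p$ such that every line through the origin contains at most $k_1$ points of $E$ and $E$ determines at most $k_2$ distinct directions through the origin. Let $S\subseteq SL_2(\mathbb{F}_p)$ be a symmetric subset with $p^{\gamma}<|S|<p^{3-2\gamma}$ and $|S\cap gH|<p^{ -\gamma/2}|S|$ for every proper subgroup $H\subsetneq SL_2(\mathbb{F}_p)$ and every $g\in SL_2(\mathbb{F}_p)$. Then \[|S(E)|\gtrsim\min\left\{\frac{|E||S|^{1/2}p^{\epsilon/2}}{k_1^{1/2}k_2^{1/2}},~\frac{|E|^{1/2}|S|^{1/2}p^{\epsilon/2}}{k_1^{1/4}},~\frac{|E||S|^{1/2}p^{\epsilon/2}}{k_1},~\frac{|E|^2}{k_1}\right\}.\]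
   Context: $S$ symmetric means $S=S^{ -1}$. Matrices act on $\mathbb{F}_p^2$ on column vectors and $S(E)=\{\theta x:x\in E,\theta\in S\}$. A line through the origin is a one-dimensional subspace; "$E$ determines at most $k_2$ directions" means $E$ can be covered by at most $k_2$ lines through the origin. $X\gtrsim Y$ means $Y\le C\log_2 p\cdot X$ for a constant $C>0$ independent of $p,E,S,k_1,k_2$. -}

module Defs where

open import Data.Nat using (ℕ; zero; suc; _+_; _*_; NonZero; _∸_)
open import Data.Nat.DivMod using (_%_; m%n<n)
open import Data.Fin using (Fin; toℕ; fromℕ<) renaming (_≟_ to _≟F_)
open import Data.Bool using (Bool; true; false; _∧_; not)
open import Data.Product using (_×_; _,_)
open import Data.List using (List; []; _∷_; length; filterᵇ; allFin; cartesianProduct)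
open import Data.Bool.ListAction using (any)
open import Relation.Nullary using (does)

module _ (p : ℕ) .{{_ : NonZero p}} where

  F : Set
  F = Fin p

  res : ℕ → F
  res n = fromℕ< (m%n<n n p)

  0F 1F : F
  0F = res 0
  1F = res 1

  _+F_ _*F_ : F → F → F
  a +F b = res (toℕ a + toℕ b)
  a *F b = res (toℕ a * toℕ b)

  -- additive inverse: -a is the residue of (p - a)  (for a = 0 this is p mod p = 0)
  negF : F → F
  negF a = res (p ∸ toℕ a)

  _==F_ : F → F → Bool
  a ==F b = does (a ≟F b)

  Pt : Set
  Pt = F × F

  origin : Pt
  origin = (0F , 0F)

  _==P_ : Pt → Pt → Bool
  (x₁ , y₁) ==P (x₂ , y₂) = (x₁ ==F x₂) ∧ (y₁ ==F y₂)

  scale : F → Pt → Pt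
  scale t (x , y) = (t *F x , t *F y)

  allF : List F
  allF = allFin p

  allPts : List Pt
  allPts = cartesianProduct allF allF

  -- ===== 2x2 matrices ((a b) (c d)) stored as (a , b , c , d) =====
  Mat : Set
  Mat = F × F × F × F

  allMats : List Mat
  allMats = cartesianProduct allF (cartesianProduct allF (cartesianProduct allF allF))

  _==M_ : Mat → Mat → Bool
  (a , b , c , d) ==M (a' , b' , c' , d') =
    (a ==F a') ∧ ((b ==F b') ∧ ((c ==F c') ∧ (d ==F d')))

  act : Mat → Pt → Pt
  act (a , b , c , d) (x , y) = ((a *F x) +F (b *F y) , (c *F x) +F (d *F y))

  _·M_ : Mat → Mat → Mat
  (a , b , c , d) ·M (a' , b' , c' , d') =
    ( (a *F a') +F (b *F c') , (a *F b') +F (b *F d')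
    , (c *F a') +F (d *F c') , (c *F b') +F (d *F d') )

  idM : Mat
  idM = (1F , 0F , 0F , 1F)

  -- inverse of a determinant-one matrix
  invM : Mat → Mat
  invM (a , b , c , d) = (d , negF b , negF c , a)

  -- membership in SL_2(F_p): ad - bc = 1, i.e. ad = 1 + bc
  inSL2 : Mat → Bool
  inSL2 (a , b , c , d) = (a *F d) ==F (1F +F (b *F c))

  cardPt : (Pt → Bool) → ℕ
  cardPt E = length (filterᵇ E allPts)

  cardMat : (Mat → Bool) → ℕ
  cardMat S = length (filterᵇ S allMats)

  image : (Mat → Bool) → (Pt → Bool) → (Pt → Bool)
  image S E y = any (λ θ → S θ ∧ any (λ x → E x ∧ (act θ x ==P y)) allPts) allMats

  -- the line through the origin spanned by v (a 1-dim subspace when v ≠ 0)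
  onLine : Pt → Pt → Bool
  onLine v x = any (λ t → scale t v ==P x) allF

  coset : Mat → (Mat → Bool) → (Mat → Bool)
  coset g H M = any (λ h → H h ∧ ((g ·M h) ==M M)) allMats

  _∩M_ : (Mat → Bool) → (Mat → Bool) → (Mat → Bool)
  (S ∩M T) M = S M ∧ T M

  _∩P_ : (Pt → Bool) → (Pt → Bool) → (Pt → Bool)
  (E ∩P L) x = E x ∧ L x

open import Relation.Binary.PropositionalEquality using (_≡_)
open import Data.Product using (Σ; ∃)
open import Data.Nat using (_≤_)
open import Relation.Nullary using (¬_)
open import Data.List.Relation.Unary.All using (All)
open import Data.List.Relation.Unary.Any using (Any)

module _ (p : ℕ) .{{_ : NonZero p}} where

  IsSubgroupSL2 : (Mat p → Bool) → Set
  IsSubgroupSL2 H =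
    (∀ M → H M ≡ true → inSL2 p M ≡ true) ×
    (H (idM p) ≡ true) ×
    (∀ M N → H M ≡ true → H N ≡ true → H (_·M_ p M N) ≡ true) ×
    (∀ M → H M ≡ true → H (invM p M) ≡ true)

  IsProperSubgroupSL2 : (Mat p → Bool) → Set
  IsProperSubgroupSL2 H =
    IsSubgroupSL2 H × ∃ (λ M → (inSL2 p M ≡ true) × (H M ≡ false))

  LinesContainAtMost : (Pt p → Bool) → ℕ → Set
  LinesContainAtMost E k₁ =
    ∀ v → v ≢ origin p → cardPt p (_∩P_ p E (onLine p v)) ≤ k₁
    where
      _≢_ : Pt p → Pt p → Set
      x ≢ y = ¬ (x ≡ y)

  -- E can be covered by at most k₂ lines through the origin
  DeterminesAtMostDirections : (Pt p → Bool) → ℕ → Set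
  DeterminesAtMostDirections E k₂ =
    Σ (List (Pt p)) λ vs →
      (length vs ≤ k₂) ×
      All (λ v → ¬ (v ≡ origin p)) vs ×
      (∀ x → E x ≡ true → Any (λ v → onLine p v x ≡ true) vs)

-- By Cauchy–Schwarz over the image, (|S||E|)² ≤ |S(E)| Σ_g r(g) i(g), where r counts quotients of S and i(g) = |E ∩ g⁻¹E|.
-- Flattening: Balog–Szemerédi–Gowers and the pivot argument for SL₂ (tori, conjugacy classes, Borel subgroups) show that a set
-- of large energy either concentrates on a coset of a proper subgroup or fills SL₂, so Σ r² is at most |S|³ / K with K a power of p.
-- Joints: i(g) = Σ_x wt(x, g x) over directions x, and {θ : θ x = y} is a line in the quadric SL₂ ⊂ F⁴. A form of low degree vanishing
-- on many such lines has vanishing partial derivatives on them, being tangent to second order along every further line through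
-- their rich points, so few g lie on many lines. Cauchy–Schwarz and a dyadic decomposition of the weights combine the two bounds.


module Submission where

-- The flattening loses fixed powers of the energy parameter `K` and never a power of p, so `K` may
-- be a tiny power of p. The exponents of `K` are carried explicitly, up to 3404, and `K` is taken
-- so small that `K ^ 3404` raised to the power h is at most p. `K` is a square: one root of it
-- absorbs a surplus logarithm of the dyadic sums, the other is the gain, and ε is the reciprocal of
-- f = 13616·h. In the joints bound the second-order terms depend on the rich point u at which they
-- are taken, so they cannot be removed one point at a time. The rich points of a line only show
-- that a ratio of two polynomials takes the value u at u and is stationary there; a Wronskian makes
-- this ratio constant, which contradicts the varying values. Derivatives detect forms only in
-- degrees below p, while up to |E|² lines may occur and a form vanishing on n lines needs a degree
-- of about the square root of 6n; hence E is cut to a third of its size beforehand.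

module Arith where
 open import Data.Nat.Solver using (module +-*-Solver)
 open +-*-Solver public using () renaming (solve to solveℕ; _:+_ to _⊕_; _:*_ to _⊗_; _:=_ to _⊜_; con to #)

-- Finite sums and enumerated types

module Sums where
 open import Data.Bool using (Bool; true; false; _∧_; not; T)
 open import Data.Empty using (⊥-elim)
 open import Data.Maybe using (Maybe; just; nothing)
 open import Data.List using (List; []; _∷_; length; filterᵇ; map; _++_; cartesianProduct)
 open import Data.Bool.ListAction using (any)
 open import Data.Nat using (ℕ; suc; _+_; _*_; _≤_; _<_; z≤n; s≤s; _≤ᵇ_)
 open import Data.Nat.Properties hiding (_≟_)
 open import Data.Nat.Solver using (module +-*-Solver)
 open import Data.Product using (Σ; ∃; _×_; _,_; proj₁; proj₂)
 open import Data.Sum using (_⊎_; inj₁; inj₂)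
 open import Relation.Binary.Definitions using (DecidableEquality)
 open import Relation.Binary.PropositionalEquality
 open import Relation.Nullary using (Dec; yes; no; does; ¬_)
 open +-*-Solver using (solve; _:=_; _:+_; _:*_; con)

 private variable
   A B : Set

 ∑ : List A → (A → ℕ) → ℕ
 ∑ []       f = 0
 ∑ (x ∷ xs) f = f x + ∑ xs f

 𝟙 : Bool → ℕ
 𝟙 true  = 1
 𝟙 false = 0

 𝟙≤1 : ∀ b → 𝟙 b ≤ 1
 𝟙≤1 true  = ≤-refl
 𝟙≤1 false = z≤n

 𝟙² : ∀ b → 𝟙 b * 𝟙 b ≡ 𝟙 b
 𝟙² true  = refl
 𝟙² false = refl

 𝟙-∧ : ∀ a b → 𝟙 (a ∧ b) ≡ 𝟙 a * 𝟙 b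
 𝟙-∧ true  b = sym (+-identityʳ _)
 𝟙-∧ false b = refl

 𝟙-mono : ∀ {a b} → (a ≡ true → b ≡ true) → 𝟙 a ≤ 𝟙 b
 𝟙-mono {true}  h rewrite h refl = ≤-refl
 𝟙-mono {false} h = z≤n

 𝟙-positive : ∀ {b} → 0 < 𝟙 b → b ≡ true
 𝟙-positive {true} _ = refl

 𝟙*-≤ : ∀ b {m n} → (b ≡ true → m ≤ n) → 𝟙 b * m ≤ 𝟙 b * n
 𝟙*-≤ true  h = *-monoʳ-≤ 1 (h refl)
 𝟙*-≤ false h = z≤n

 𝟙*≤ : ∀ b n → 𝟙 b * n ≤ n
 𝟙*≤ true  n = ≤-reflexive (+-identityʳ n)
 𝟙*≤ false n = z≤n

 1≤𝟙 : ∀ {b} → b ≡ true → 1 ≤ 𝟙 b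
 1≤𝟙 refl = ≤-refl

 ∧-true : ∀ {a b} → a ∧ b ≡ true → a ≡ true × b ≡ true
 ∧-true {true} h = refl , h

 ∧-intro : ∀ {a b} → a ≡ true → b ≡ true → a ∧ b ≡ true
 ∧-intro refl refl = refl

 ≤ᵇ-true : ∀ {m n} → (m ≤ᵇ n) ≡ true → m ≤ n
 ≤ᵇ-true {m} {n} h = ≤ᵇ⇒≤ m n (subst T (sym h) _)

 ≤ᵇ-intro : ∀ {m n} → m ≤ n → (m ≤ᵇ n) ≡ true
 ≤ᵇ-intro {m} {n} h with m ≤ᵇ n in e
 ... | true  = refl
 ... | false = ⊥-elim (subst T e (≤⇒≤ᵇ h))

 ≤ᵇ-false : ∀ {m n} → (m ≤ᵇ n) ≡ false → n < m
 ≤ᵇ-false {m} {n} h = ≰⇒> λ le → case (trans (sym h) (≤ᵇ-intro le))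
   where case : ¬ (false ≡ true)
         case ()

 not-true : ∀ {b} → not b ≡ true → b ≡ false
 not-true {false} _ = refl

 not-intro : ∀ {b} → b ≡ false → not b ≡ true
 not-intro refl = refl

 does-true : {P : Set} (d : Dec P) → does d ≡ true → P
 does-true (yes p) _ = p

 does-intro : {P : Set} (d : Dec P) → P → does d ≡ true
 does-intro (yes _) _ = refl
 does-intro (no ¬p) p = ⊥-elim (¬p p)

 does-elim : {P : Set} (d : Dec P) → ¬ P → does d ≡ false
 does-elim (yes p) ¬p = ⊥-elim (¬p p)
 does-elim (no _) _ = refl

 ≢true : ∀ {b} → ¬ (b ≡ true) → b ≡ false
 ≢true {true}  h = ⊥-elim (h refl)
 ≢true {false} _ = refl

 true≢false : ∀ {b} {C : Set} → b ≡ true → b ≡ false → C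
 true≢false refl ()

 ≡-iff : ∀ {a b} → (a ≡ true → b ≡ true) → (b ≡ true → a ≡ true) → a ≡ b
 ≡-iff {true}  {b}     f g = sym (f refl)
 ≡-iff {false} {true}  f g = g refl
 ≡-iff {false} {false} f g = refl

 2ab≤a²+b² : ∀ a b → 2 * (a * b) ≤ a * a + b * b
 2ab≤a²+b² a b with ≤-total a b
 ... | inj₁ a≤b with m≤n⇒∃[o]m+o≡n a≤b
 ...   | k , refl = ≤-trans (m≤m+n _ (k * k))
         (≤-reflexive (solve 2 (λ a k → con 2 :* (a :* (a :+ k)) :+ k :* k := a :* a :+ (a :+ k) :* (a :+ k)) refl a k))
 2ab≤a²+b² a b | inj₂ b≤a with m≤n⇒∃[o]m+o≡n b≤a
 ...   | k , refl = ≤-trans (m≤m+n _ (k * k))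
         (≤-reflexive (solve 2 (λ b k → con 2 :* ((b :+ k) :* b) :+ k :* k := (b :+ k) :* (b :+ k) :+ b :* b) refl b k))

 ∑-cong : ∀ (xs : List A) {f g} → (∀ x → f x ≡ g x) → ∑ xs f ≡ ∑ xs g
 ∑-cong []       h = refl
 ∑-cong (x ∷ xs) h = cong₂ _+_ (h x) (∑-cong xs h)

 ∑-mono : ∀ (xs : List A) {f g} → (∀ x → f x ≤ g x) → ∑ xs f ≤ ∑ xs g
 ∑-mono []       h = z≤n
 ∑-mono (x ∷ xs) h = +-mono-≤ (h x) (∑-mono xs h)

 ∑-0 : ∀ (xs : List A) → ∑ xs (λ _ → 0) ≡ 0
 ∑-0 []       = refl
 ∑-0 (x ∷ xs) = ∑-0 xs

 interchange : ∀ a b c d → (a + b) + (c + d) ≡ (a + c) + (b + d)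
 interchange = solve 4 (λ a b c d → (a :+ b) :+ (c :+ d) := (a :+ c) :+ (b :+ d)) refl

 ∑-+ : ∀ (xs : List A) (f g : A → ℕ) → ∑ xs (λ x → f x + g x) ≡ ∑ xs f + ∑ xs g
 ∑-+ []       f g = refl
 ∑-+ (x ∷ xs) f g = trans (cong (f x + g x +_) (∑-+ xs f g)) (interchange (f x) (g x) _ _)

 ∑-*ˡ : ∀ (xs : List A) c f → ∑ xs (λ x → c * f x) ≡ c * ∑ xs f
 ∑-*ˡ []       c f = sym (*-zeroʳ c)
 ∑-*ˡ (x ∷ xs) c f = trans (cong (c * f x +_) (∑-*ˡ xs c f)) (sym (*-distribˡ-+ c (f x) _))

 ∑-*ʳ : ∀ (xs : List A) c f → ∑ xs (λ x → f x * c) ≡ ∑ xs f * c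
 ∑-*ʳ xs c f = trans (∑-cong xs λ x → *-comm (f x) c) (trans (∑-*ˡ xs c f) (*-comm c _))

 ∑-swap : ∀ (xs : List A) (ys : List B) (f : A → B → ℕ) →
          ∑ xs (λ x → ∑ ys (f x)) ≡ ∑ ys (λ y → ∑ xs (λ x → f x y))
 ∑-swap []       ys f = sym (∑-0 ys)
 ∑-swap (x ∷ xs) ys f = trans (cong (∑ ys (f x) +_) (∑-swap xs ys f)) (sym (∑-+ ys (f x) _))

 ∑-const : ∀ (xs : List A) c → ∑ xs (λ _ → c) ≡ length xs * c
 ∑-const []       c = refl
 ∑-const (x ∷ xs) c = cong (c +_) (∑-const xs c)

 ∑-* : ∀ (xs : List A) (ys : List B) f g → ∑ xs f * ∑ ys g ≡ ∑ xs (λ x → ∑ ys (λ y → f x * g y))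
 ∑-* xs ys f g = trans (sym (∑-*ʳ xs (∑ ys g) f)) (∑-cong xs λ x → sym (∑-*ˡ ys (f x) g))

 ∑-exists : ∀ (xs : List A) (f g : A → ℕ) → ∑ xs g < ∑ xs f → ∃ λ x → g x < f x
 ∑-exists (x ∷ xs) f g h with ≤-<-connex (f x) (g x)
 ... | inj₂ lt = x , lt
 ... | inj₁ le = ∑-exists xs f g (+-cancelˡ-< (g x) _ _ (<-≤-trans h (+-monoˡ-≤ _ le)))

 ∑-map : ∀ (φ : A → B) xs f → ∑ (map φ xs) f ≡ ∑ xs (λ x → f (φ x))
 ∑-map φ []       f = refl
 ∑-map φ (x ∷ xs) f = cong (f (φ x) +_) (∑-map φ xs f)

 ∑-++ : ∀ (xs ys : List A) f → ∑ (xs ++ ys) f ≡ ∑ xs f + ∑ ys f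
 ∑-++ []       ys f = refl
 ∑-++ (x ∷ xs) ys f = trans (cong (f x +_) (∑-++ xs ys f)) (sym (+-assoc (f x) _ _))

 ∑-product : ∀ (xs : List A) (ys : List B) f → ∑ (cartesianProduct xs ys) f ≡ ∑ xs (λ x → ∑ ys (λ y → f (x , y)))
 ∑-product []       ys f = refl
 ∑-product (x ∷ xs) ys f = trans (∑-++ (map (x ,_) ys) _ f) (cong₂ _+_ (∑-map (x ,_) ys f) (∑-product xs ys f))

 ∑-filter : ∀ P (xs : List A) f → ∑ (filterᵇ P xs) f ≡ ∑ xs (λ x → 𝟙 (P x) * f x)
 ∑-filter P []       f = refl
 ∑-filter P (x ∷ xs) f with P x
 ... | true  = cong₂ _+_ (sym (+-identityʳ (f x))) (∑-filter P xs f)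
 ... | false = ∑-filter P xs f

 length-filter : ∀ P (xs : List A) → length (filterᵇ P xs) ≡ ∑ xs (λ x → 𝟙 (P x))
 length-filter P []       = refl
 length-filter P (x ∷ xs) with P x
 ... | true  = cong suc (length-filter P xs)
 ... | false = length-filter P xs

 -- Both sides are expanded over pairs (x, y) and `2ab≤a²+b²` is applied to f x·g y and g x·f y; the
 -- factor 2 keeps the argument free of subtraction.
 cauchy-schwarz : ∀ (xs : List A) (f g : A → ℕ) →
   ∑ xs (λ x → f x * g x) * ∑ xs (λ x → f x * g x) ≤ ∑ xs (λ x → f x * f x) * ∑ xs (λ x → g x * g x)
 cauchy-schwarz xs f g = *-cancelˡ-≤ 2 (begin
   2 * (∑ xs (λ x → f x * g x) * ∑ xs (λ x → f x * g x))
     ≡⟨ cong (2 *_) (∑-* xs xs _ _) ⟩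
   2 * ∑ xs (λ x → ∑ xs (λ y → f x * g x * (f y * g y)))
     ≡⟨ trans (sym (∑-*ˡ xs 2 _)) (∑-cong xs λ x → sym (∑-*ˡ xs 2 _)) ⟩
   ∑ xs (λ x → ∑ xs (λ y → 2 * (f x * g x * (f y * g y))))
     ≤⟨ ∑-mono xs (λ x → ∑-mono xs λ y → ≤-trans (≤-reflexive (e₁ (f x) (g x) (f y) (g y)))
          (≤-trans (2ab≤a²+b² (f x * g y) (g x * f y)) (≤-reflexive (e₂ (f x) (g x) (f y) (g y))))) ⟩
   ∑ xs (λ x → ∑ xs (λ y → f x * f x * (g y * g y) + g x * g x * (f y * f y)))
     ≡⟨ trans (∑-cong xs λ x → ∑-+ xs _ _) (∑-+ xs _ _) ⟩
   ∑ xs (λ x → ∑ xs (λ y → f x * f x * (g y * g y))) + ∑ xs (λ x → ∑ xs (λ y → g x * g x * (f y * f y)))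
     ≡⟨ cong₂ _+_ (sym (∑-* xs xs _ _)) (sym (∑-* xs xs _ _)) ⟩
   U * V + V * U ≡⟨ cong (U * V +_) (trans (*-comm V U) (sym (+-identityʳ _))) ⟩
   2 * (U * V) ∎)
   where
   open ≤-Reasoning
   U = ∑ xs (λ x → f x * f x)
   V = ∑ xs (λ x → g x * g x)
   e₁ : ∀ a b c d → 2 * (a * b * (c * d)) ≡ 2 * (a * d * (b * c))
   e₁ = solve 4 (λ a b c d → con 2 :* (a :* b :* (c :* d)) := con 2 :* (a :* d :* (b :* c))) refl
   e₂ : ∀ a b c d → a * d * (a * d) + b * c * (b * c) ≡ a * a * (d * d) + b * b * (c * c)
   e₂ = solve 4 (λ a b c d → a :* d :* (a :* d) :+ b :* c :* (b :* c) := a :* a :* (d :* d) :+ b :* b :* (c :* c)) refl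

 any-true : ∀ (P : A → Bool) xs → any P xs ≡ true → ∃ λ x → P x ≡ true
 any-true P (x ∷ xs) h with P x in e
 ... | true  = x , e
 ... | false = any-true P xs h

 -- `once` says in one equation that the list is complete and free of repetition, in the form needed
 -- under a sum: a Kronecker delta.
 record Finite (A : Set) : Set where
   field
     elems : List A
     _≟_   : DecidableEquality A
     once  : ∀ x → ∑ elems (λ y → 𝟙 (does (x ≟ y))) ≡ 1
   _==_ : A → A → Bool
   x == y = does (x ≟ y)
   ==-refl : ∀ x → (x == x) ≡ true
   ==-refl x = does-intro (x ≟ x) refl
   ∑ᴬ : (A → ℕ) → ℕ
   ∑ᴬ = ∑ elems
   count : (A → Bool) → ℕ
   count P = ∑ elems (λ x → 𝟙 (P x))
   ==-transport : ∀ x y (f : A → ℕ) → 𝟙 (x == y) * f y ≡ 𝟙 (x == y) * f x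
   ==-transport x y f with x ≟ y
   ... | yes refl = refl
   ... | no _     = refl
   ∑-δ : ∀ x f → ∑ᴬ (λ y → 𝟙 (x == y) * f y) ≡ f x
   ∑-δ x f = trans (∑-cong elems λ y → ==-transport x y f)
     (trans (∑-*ʳ elems (f x) _) (trans (cong (_* f x) (once x)) (+-identityʳ (f x))))
   ≤∑ : ∀ x f → f x ≤ ∑ᴬ f
   ≤∑ x f = ≤-trans (≤-reflexive (sym (∑-δ x f))) (∑-mono elems λ y → 𝟙*≤ (x == y) (f y))
   any-intro : ∀ P x → P x ≡ true → any P elems ≡ true
   any-intro P x h with any P elems in e
   ... | true  = refl
   ... | false = ⊥-elim (<-irrefl refl (<-≤-trans (1≤𝟙 h) (≤-trans (≤∑ x (λ y → 𝟙 (P y))) (≤-reflexive (none elems e)))))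
     where
     none : ∀ xs → any P xs ≡ false → ∑ xs (λ y → 𝟙 (P y)) ≡ 0
     none []       _ = refl
     none (x ∷ xs) h with P x
     ... | false = none xs h
   search : ∀ P → (∃ λ x → P x ≡ true) ⊎ (∀ x → P x ≡ false)
   search P with any P elems in e
   ... | true  = inj₁ (any-true P elems e)
   ... | false = inj₂ λ x → ≢true λ h → true≢false (any-intro P x h) e
   count-mono : ∀ {P Q} → (∀ x → P x ≡ true → Q x ≡ true) → count P ≤ count Q
   count-mono h = ∑-mono elems λ x → 𝟙-mono (h x)
   count-cong : ∀ {P Q} → (∀ x → P x ≡ Q x) → count P ≡ count Q
   count-cong h = ∑-cong elems λ x → cong 𝟙 (h x)
   count-≤2 : ∀ {P} a b → (∀ x → P x ≡ true → a ≡ x ⊎ b ≡ x) → count P ≤ 2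
   count-≤2 {P} a b h = ≤-trans (∑-mono elems bound) (≤-reflexive (trans (∑-+ elems _ _) (cong₂ _+_ (once a) (once b))))
     where
     bound : ∀ x → 𝟙 (P x) ≤ 𝟙 (a == x) + 𝟙 (b == x)
     bound x with P x in e
     ... | false = z≤n
     ... | true with h x e
     ...   | inj₁ refl rewrite ==-refl x = s≤s z≤n
     ...   | inj₂ refl rewrite ==-refl x = m≤n+m 1 _
   count-<∃ : ∀ {P Q} → count Q < count P → ∃ λ x → P x ≡ true × Q x ≡ false
   count-<∃ {P} {Q} lt with ∑-exists elems (λ x → 𝟙 (P x)) (λ x → 𝟙 (Q x)) lt
   ... | x , l with P x in eP | Q x in eQ
   ...   | true  | true  = ⊥-elim (<-irrefl refl l)
   ...   | true  | false = x , eP , eQ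
   count-0 : ∀ {P} → (∀ x → P x ≡ false) → count P ≡ 0
   count-0 h = trans (∑-cong elems λ x → cong 𝟙 (h x)) (∑-0 elems)

 module _ (𝓐 : Finite A) (𝓑 : Finite B) where
   private module 𝓐 = Finite 𝓐
   private module 𝓑 = Finite 𝓑
   ∑-fibre : ∀ (φ : A → B) f → 𝓐.∑ᴬ f ≡ 𝓑.∑ᴬ (λ b → 𝓐.∑ᴬ (λ a → 𝟙 (φ a 𝓑.== b) * f a))
   ∑-fibre φ f = trans (∑-cong 𝓐.elems λ a → sym (trans (∑-*ʳ 𝓑.elems (f a) _)
       (trans (cong (_* f a) (𝓑.once (φ a))) (+-identityʳ _))))
     (∑-swap 𝓐.elems 𝓑.elems _)
   count-fibre-≤ : ∀ (φ : A → B) P Q k → (∀ a → P a ≡ true → Q (φ a) ≡ true) →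
     (∀ b → Q b ≡ true → 𝓐.count (λ a → P a ∧ (φ a 𝓑.== b)) ≤ k) → 𝓐.count P ≤ k * 𝓑.count Q
   count-fibre-≤ φ P Q k hQ hk = begin
     𝓐.count P ≡⟨ ∑-fibre φ (λ a → 𝟙 (P a)) ⟩
     𝓑.∑ᴬ (λ b → 𝓐.∑ᴬ (λ a → 𝟙 (φ a 𝓑.== b) * 𝟙 (P a))) ≤⟨ ∑-mono 𝓑.elems bound ⟩
     𝓑.∑ᴬ (λ b → k * 𝟙 (Q b)) ≡⟨ ∑-*ˡ 𝓑.elems k _ ⟩
     k * 𝓑.count Q ∎
     where
     open ≤-Reasoning
     bound : ∀ b → 𝓐.∑ᴬ (λ a → 𝟙 (φ a 𝓑.== b) * 𝟙 (P a)) ≤ k * 𝟙 (Q b)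
     bound b with Q b in e
     ... | true  = ≤-trans (≤-reflexive (∑-cong 𝓐.elems λ a → trans (*-comm _ (𝟙 (P a))) (sym (𝟙-∧ (P a) _))))
                     (≤-trans (hk b e) (≤-reflexive (sym (*-identityʳ k))))
     ... | false = ≤-trans (≤-reflexive (trans (∑-cong 𝓐.elems zero′) (∑-0 𝓐.elems))) z≤n
       where
       zero′ : ∀ a → 𝟙 (φ a 𝓑.== b) * 𝟙 (P a) ≡ 0
       zero′ a with φ a 𝓑.≟ b
       ... | no _ = refl
       ... | yes refl with P a in e′
       ...   | false = refl
       ...   | true  = true≢false (hQ a e′) e
   ∑-reindex : ∀ (φ : A → B) (ψ : B → A) → (∀ a → ψ (φ a) ≡ a) → (∀ b → φ (ψ b) ≡ b) →
               ∀ f → 𝓐.∑ᴬ (λ a → f (φ a)) ≡ 𝓑.∑ᴬ f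
   ∑-reindex φ ψ ψφ φψ f = begin
     𝓐.∑ᴬ (λ a → f (φ a))                                   ≡⟨ ∑-fibre φ (λ a → f (φ a)) ⟩
     𝓑.∑ᴬ (λ b → 𝓐.∑ᴬ (λ a → 𝟙 (φ a 𝓑.== b) * f (φ a)))     ≡⟨ ∑-cong 𝓑.elems (λ b → ∑-cong 𝓐.elems (step b)) ⟩
     𝓑.∑ᴬ (λ b → 𝓐.∑ᴬ (λ a → 𝟙 (ψ b 𝓐.== a) * f b))         ≡⟨ ∑-cong 𝓑.elems (λ b → 𝓐.∑-δ (ψ b) (λ _ → f b)) ⟩
     𝓑.∑ᴬ f                                                 ∎
     where
     open ≡-Reasoning
     step : ∀ b a → 𝟙 (φ a 𝓑.== b) * f (φ a) ≡ 𝟙 (ψ b 𝓐.== a) * f b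
     step b a with φ a 𝓑.≟ b | ψ b 𝓐.≟ a
     ... | yes refl | yes _    = refl
     ... | yes refl | no ¬e    = ⊥-elim (¬e (ψφ a))
     ... | no ¬e    | yes refl = ⊥-elim (¬e (φψ b))
     ... | no _     | no _     = refl

 module _ (𝓐 : Finite A) where
   private module 𝓐 = Finite 𝓐
   -- Serves to count the roots of quadratic equations without exhibiting them: it is enough that
   -- two solutions different from a third one coincide.
   count-≤2′ : ∀ {P} → (∀ x y z → P x ≡ true → P y ≡ true → P z ≡ true → ¬ (x ≡ y) → ¬ (x ≡ z) → y ≡ z) → 𝓐.count P ≤ 2
   count-≤2′ {P} h with 𝓐.search P
   ... | inj₂ none = ≤-trans (≤-reflexive (𝓐.count-0 none)) z≤n
   ... | inj₁ (x , px) with 𝓐.search (λ y → P y ∧ not (x 𝓐.== y))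
   ...   | inj₂ none = 𝓐.count-≤2 x x λ y py → inj₁ (only y py)
     where
     only : ∀ y → P y ≡ true → x ≡ y
     only y py with x 𝓐.≟ y in e
     ... | yes p = p
     ... | no ¬p = true≢false (∧-intro py (cong not (cong does e))) (none y)
   ...   | inj₁ (y , hy) = 𝓐.count-≤2 x y both
     where
     py = proj₁ (∧-true {P y} hy)
     x≢y : ¬ (x ≡ y)
     x≢y e = true≢false (does-intro (x 𝓐.≟ y) e) (not-true (proj₂ (∧-true {P y} hy)))
     both : ∀ z → P z ≡ true → x ≡ z ⊎ y ≡ z
     both z pz with x 𝓐.≟ z
     ... | yes p = inj₁ p
     ... | no ¬p = inj₂ (h x y z px py pz x≢y ¬p)

 finite-× : Finite A → Finite B → Finite (A × B)
 finite-× 𝓐 𝓑 = record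
   { elems = cartesianProduct 𝓐.elems 𝓑.elems
   ; _≟_   = λ { (a , b) (x , y) → map′ (λ { (refl , refl) → refl }) (λ { refl → refl , refl }) ((a 𝓐.≟ x) ×-dec (b 𝓑.≟ y)) }
   ; once  = λ { (a , b) → trans (∑-product 𝓐.elems 𝓑.elems _) (trans
       (∑-cong 𝓐.elems λ x → trans (∑-cong 𝓑.elems λ y → 𝟙-∧ (a 𝓐.== x) (b 𝓑.== y)) (trans (∑-*ˡ 𝓑.elems (𝟙 (a 𝓐.== x)) _)
         (trans (cong (𝟙 (a 𝓐.== x) *_) (𝓑.once b)) (*-identityʳ _)))) (𝓐.once a)) } }
   where
   open import Relation.Nullary.Decidable using (map′; _×-dec_)
   module 𝓐 = Finite 𝓐
   module 𝓑 = Finite 𝓑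

 -- The value of the test and its equation are separate arguments, so that the equation can be
 -- stored with x after the case split.
 consIf : (P : A → Bool) (x : A) (b : Bool) → P x ≡ b → List (Σ A λ x → P x ≡ true) → List (Σ A λ x → P x ≡ true)
 consIf P x true  e xs = (x , e) ∷ xs
 consIf P x false e xs = xs

 restrict : (P : A → Bool) → List A → List (Σ A λ x → P x ≡ true)
 restrict P []       = []
 restrict P (x ∷ xs) = consIf P x (P x) refl (restrict P xs)

 ∑-consIf : ∀ (P : A → Bool) x b e xs (f : A → ℕ) → ∑ (consIf P x b e xs) (λ x → f (proj₁ x)) ≡ 𝟙 b * f x + ∑ xs (λ x → f (proj₁ x))
 ∑-consIf P x true  e xs f = cong (_+ ∑ xs (λ x → f (proj₁ x))) (sym (+-identityʳ _))
 ∑-consIf P x false e xs f = refl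

 ∑-restrict : ∀ (P : A → Bool) xs (f : A → ℕ) → ∑ (restrict P xs) (λ x → f (proj₁ x)) ≡ ∑ xs (λ x → 𝟙 (P x) * f x)
 ∑-restrict P []       f = refl
 ∑-restrict P (x ∷ xs) f = trans (∑-consIf P x (P x) refl (restrict P xs) f) (cong (𝟙 (P x) * f x +_) (∑-restrict P xs f))

 finite-Σ : Finite A → (P : A → Bool) → Finite (Σ A λ x → P x ≡ true)
 finite-Σ 𝓐 P = record
   { elems = restrict P 𝓐.elems
   ; _≟_   = λ x y → map′ (ext {x} {y}) (cong proj₁) (proj₁ x 𝓐.≟ proj₁ y)
   ; once  = λ { (x , e) → trans (∑-restrict P 𝓐.elems (λ y → 𝟙 (x 𝓐.== y))) (trans
       (∑-cong 𝓐.elems λ y → trans (*-comm (𝟙 (P y)) _) (𝓐.==-transport x y (λ y → 𝟙 (P y))))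
       (trans (∑-*ʳ 𝓐.elems (𝟙 (P x)) _) (trans (cong₂ _*_ (𝓐.once x) (cong 𝟙 e)) refl))) } }
   where
   open import Relation.Nullary.Decidable using (map′)
   module 𝓐 = Finite 𝓐
   ext : ∀ {x y : Σ _ λ x → P x ≡ true} → proj₁ x ≡ proj₁ y → x ≡ y
   ext {x , e} {.x , e'} refl = cong (x ,_) (uip e e')
     where
     uip : ∀ {b c : Bool} (e e' : b ≡ c) → e ≡ e'
     uip refl refl = refl

 finite-Maybe : Finite A → Finite (Maybe A)
 finite-Maybe 𝓐 = record
   { elems = nothing ∷ map just 𝓐.elems
   ; _≟_   = dec
   ; once  = λ { nothing → cong suc (trans (∑-map just 𝓐.elems _) (∑-0 𝓐.elems))
               ; (just x) → trans (∑-map just 𝓐.elems _) (trans (∑-cong 𝓐.elems λ y → same x y) (𝓐.once x)) } }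
   where
   module 𝓐 = Finite 𝓐
   dec : DecidableEquality (Maybe _)
   dec nothing  nothing  = yes refl
   dec nothing  (just _) = no λ ()
   dec (just _) nothing  = no λ ()
   dec (just x) (just y) with x 𝓐.≟ y
   ... | yes refl = yes refl
   ... | no ¬e    = no λ { refl → ¬e refl }
   same : ∀ x y → 𝟙 (does (dec (just x) (just y))) ≡ 𝟙 (x 𝓐.== y)
   same x y with x 𝓐.≟ y
   ... | yes refl = refl
   ... | no _     = refl

-- A reflective solver for identities in commutative rings

open import Algebra.Bundles using (CommutativeRing)
module RingTactic {c ℓ} (R : CommutativeRing c ℓ) where
 open CommutativeRing R
 open import Algebra.Properties.Ring ring using (-0#≈0#; -‿distribˡ-*; -‿+-comm; -‿involutive)
 open import Data.Bool using (Bool; true; false; if_then_else_)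
 open import Data.Integer as ℤ using (ℤ; +_)
 open import Data.List using (List; []; _∷_)
 open import Data.Nat as ℕ using (ℕ; zero; suc)
 open import Data.Nat.Properties using (≡ᵇ⇒≡)
 open import Data.Product using (_×_; _,_; proj₁; proj₂)
 open import Data.Fin using (Fin; zero; suc)
 open import Data.Vec using (Vec; []; _∷_; lookup; tabulate)
 open import Data.Vec.N-ary using (N-ary; _$ⁿ_; curryⁿ; Eq; curryⁿ-cong)
 import Relation.Binary.PropositionalEquality as ≡
 open ≡ using (_≡_)
 open import Relation.Binary.Reasoning.Setoid setoid

 infixl 6 _:+_ _:-_
 infixl 7 _:*_
 infix  8 :-_
 infix  3 _:=_

 data Expr (n : ℕ) : Set where
   var       : Fin n → Expr n
   :0 :1     : Expr n
   _:+_ _:*_ : Expr n → Expr n → Expr n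
   :-_       : Expr n → Expr n

 _:-_ : ∀ {n} → Expr n → Expr n → Expr n
 a :- b = a :+ (:- b)

 _:=_ : ∀ {n} → Expr n → Expr n → Expr n × Expr n
 _:=_ = _,_

 ⟦_⟧ : ∀ {n} → Expr n → Vec Carrier n → Carrier
 ⟦ var i ⟧  ρ = lookup ρ i
 ⟦ :0 ⟧     ρ = 0#
 ⟦ :1 ⟧     ρ = 1#
 ⟦ a :+ b ⟧ ρ = ⟦ a ⟧ ρ + ⟦ b ⟧ ρ
 ⟦ a :* b ⟧ ρ = ⟦ a ⟧ ρ * ⟦ b ⟧ ρ
 ⟦ :- a ⟧   ρ = - ⟦ a ⟧ ρ

 Mono : Set
 Mono = List ℕ

 -- Exponents, and an integer coefficient a - b given by two naturals: equality in an abstract ring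
 -- is not decidable, equality of a and b is.
 Term : Set
 Term = Mono × ℕ × ℕ

 Poly : Set
 Poly = List Term

 private
   nat : ℕ → Carrier
   nat zero    = 0#
   nat (suc n) = 1# + nat n
   pow : Carrier → ℕ → Carrier
   pow x zero    = 1#
   pow x (suc n) = x * pow x n
   mono : ∀ {n} → Mono → Vec Carrier n → Carrier
   mono []      ρ       = 1#
   mono (e ∷ m) []      = 1#
   mono (e ∷ m) (x ∷ ρ) = pow x e * mono m ρ
   term : ∀ {n} → Term → Vec Carrier n → Carrier
   term (m , a , b) ρ = (nat a - nat b) * mono m ρ
   poly : ∀ {n} → Poly → Vec Carrier n → Carrier
   poly []      ρ = 0#
   poly (t ∷ P) ρ = term t ρ + poly P ρ
   -- Only equality carries evidence. The order serves to bring like terms together; a wrong order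
   -- could make the solver fail, but could not make it unsound.
   data Cmp (m m' : Mono) : Set where
     lt gt : Cmp m m'
     eq    : m ≡ m' → Cmp m m'
   T⇒≡ : ∀ a b → (a ℕ.≡ᵇ b) ≡ true → a ≡ b
   T⇒≡ a b e = ≡ᵇ⇒≡ a b (≡.subst (λ z → Data.Bool.T z) (≡.sym e) _)
   cmp : ∀ m m' → Cmp m m'
   cmp []      []        = eq ≡.refl
   cmp []      (_ ∷ _)   = lt
   cmp (_ ∷ _) []        = gt
   cmp (a ∷ m) (b ∷ m') with a ℕ.≡ᵇ b in e
   ... | false = if a ℕ.<ᵇ b then lt else gt
   ... | true with cmp m m'
   ...   | lt    = lt
   ...   | gt    = gt
   ...   | eq e' = eq (≡.cong₂ _∷_ (T⇒≡ a b e) e')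
   insert : Term → Poly → Poly
   insert t [] = t ∷ []
   insert t@(m , a , b) (t'@(m' , a' , b') ∷ P) with cmp m m'
   ... | lt   = t ∷ t' ∷ P
   ... | gt   = t' ∷ insert t P
   ... | eq _ = (m , a ℕ.+ a' , b ℕ.+ b') ∷ P
   add : Poly → Poly → Poly
   add []      Q = Q
   add (t ∷ P) Q = insert t (add P Q)
   mulMono : Mono → Mono → Mono
   mulMono []      m'       = m'
   mulMono (a ∷ m) []       = a ∷ m
   mulMono (a ∷ m) (b ∷ m') = a ℕ.+ b ∷ mulMono m m'
   mulTerm : Term → Term → Term
   mulTerm (m , a , b) (m' , a' , b') =
     mulMono m m' , a ℕ.* a' ℕ.+ b ℕ.* b' , a ℕ.* b' ℕ.+ b ℕ.* a'
   scale : Term → Poly → Poly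
   scale t []      = []
   scale t (s ∷ P) = insert (mulTerm t s) (scale t P)
   mul : Poly → Poly → Poly
   mul []      Q = []
   mul (t ∷ P) Q = add (scale t Q) (mul P Q)
   neg : Poly → Poly
   neg []                = []
   neg ((m , a , b) ∷ P) = (m , b , a) ∷ neg P
   unit : ∀ {n} → Fin n → Mono
   unit zero    = 1 ∷ []
   unit (suc i) = 0 ∷ unit i
   norm : ∀ {n} → Expr n → Poly
   norm (var i)  = (unit i , 1 , 0) ∷ []
   norm :0       = []
   norm :1       = ([] , 1 , 0) ∷ []
   norm (a :+ b) = add (norm a) (norm b)
   norm (a :* b) = mul (norm a) (norm b)
   norm (:- a)   = neg (norm a)
   vanishes : Poly → Bool
   vanishes []                = true
   vanishes ((_ , a , b) ∷ P) = if a ℕ.≡ᵇ b then vanishes P else false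
   interchange : ∀ a b c d → (a + b) + (c + d) ≈ (a + c) + (b + d)
   interchange a b c d = begin
     (a + b) + (c + d) ≈⟨ +-assoc a b _ ⟩
     a + (b + (c + d)) ≈⟨ +-congˡ (trans (sym (+-assoc b c d)) (trans (+-congʳ (+-comm b c)) (+-assoc c b d))) ⟩
     a + (c + (b + d)) ≈⟨ +-assoc a c _ ⟨
     (a + c) + (b + d) ∎
   *-interchange : ∀ a b c d → (a * b) * (c * d) ≈ (a * c) * (b * d)
   *-interchange a b c d = begin
     (a * b) * (c * d) ≈⟨ *-assoc a b _ ⟩
     a * (b * (c * d)) ≈⟨ *-congˡ (trans (sym (*-assoc b c d)) (trans (*-congʳ (*-comm b c)) (*-assoc c b d))) ⟩
     a * (c * (b * d)) ≈⟨ *-assoc a c _ ⟨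
     (a * c) * (b * d) ∎
   nat-+ : ∀ a b → nat (a ℕ.+ b) ≈ nat a + nat b
   nat-+ zero    b = sym (+-identityˡ _)
   nat-+ (suc a) b = trans (+-congˡ (nat-+ a b)) (sym (+-assoc _ _ _))
   nat-* : ∀ a b → nat (a ℕ.* b) ≈ nat a * nat b
   nat-* zero    b = sym (zeroˡ _)
   nat-* (suc a) b = begin
     nat (b ℕ.+ a ℕ.* b)   ≈⟨ nat-+ b _ ⟩
     nat b + nat (a ℕ.* b) ≈⟨ +-cong (sym (*-identityˡ _)) (nat-* a b) ⟩
     1# * nat b + nat a * nat b ≈⟨ distribʳ _ _ _ ⟨
     (1# + nat a) * nat b ∎
   pow-+ : ∀ x a b → pow x (a ℕ.+ b) ≈ pow x a * pow x b
   pow-+ x zero    b = sym (*-identityˡ _)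
   pow-+ x (suc a) b = trans (*-congˡ (pow-+ x a b)) (sym (*-assoc _ _ _))
   sub-+ : ∀ a b a' b' → (a + a') - (b + b') ≈ (a - b) + (a' - b')
   sub-+ a b a' b' = trans (+-congˡ (sym (-‿+-comm b b'))) (interchange a a' (- b) (- b'))
   neg-*-neg : ∀ x y → (- x) * (- y) ≈ x * y
   neg-*-neg x y = begin
     (- x) * (- y) ≈⟨ -‿distribˡ-* x (- y) ⟨
     - (x * (- y)) ≈⟨ -‿cong (*-comm x (- y)) ⟩
     - ((- y) * x) ≈⟨ -‿cong (-‿distribˡ-* y x) ⟨
     - (- (y * x)) ≈⟨ -‿involutive _ ⟩
     y * x         ≈⟨ *-comm y x ⟩
     x * y         ∎
   neg-* : ∀ x y → x * (- y) ≈ - (x * y)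
   neg-* x y = trans (*-comm x (- y)) (trans (sym (-‿distribˡ-* y x)) (-‿cong (*-comm y x)))
   sub-* : ∀ a b a' b' → (a * a' + b * b') - (a * b' + b * a') ≈ (a - b) * (a' - b')
   sub-* a b a' b' = begin
     (a * a' + b * b') - (a * b' + b * a')           ≈⟨ sub-+ _ _ _ _ ⟩
     (a * a' - a * b') + (b * b' - b * a')           ≈⟨ +-cong (+-congˡ (sym (neg-* a b'))) (+-comm _ _) ⟩
     (a * a' + a * (- b')) + (- (b * a') + b * b')   ≈⟨ +-cong (sym (distribˡ a a' (- b'))) (+-cong (-‿distribˡ-* b a') (sym (neg-*-neg b b'))) ⟩
     a * (a' - b') + ((- b) * a' + (- b) * (- b'))   ≈⟨ +-congˡ (sym (distribˡ (- b) a' (- b'))) ⟩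
     a * (a' - b') + (- b) * (a' - b')               ≈⟨ distribʳ _ a (- b) ⟨
     (a - b) * (a' - b')                             ∎
   module _ {n : ℕ} where
     insert-sound : ∀ t P (ρ : Vec Carrier n) → poly (insert t P) ρ ≈ term t ρ + poly P ρ
     insert-sound t [] ρ = refl
     insert-sound t@(m , a , b) (t'@(m' , a' , b') ∷ P) ρ with cmp m m'
     ... | lt = refl
     ... | gt = begin
       term t' ρ + poly (insert t P) ρ   ≈⟨ +-congˡ (insert-sound t P ρ) ⟩
       term t' ρ + (term t ρ + poly P ρ) ≈⟨ +-assoc _ _ _ ⟨
       (term t' ρ + term t ρ) + poly P ρ ≈⟨ +-congʳ (+-comm _ _) ⟩
       (term t ρ + term t' ρ) + poly P ρ ≈⟨ +-assoc _ _ _ ⟩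
       term t ρ + (term t' ρ + poly P ρ) ∎
     ... | eq ≡.refl = begin
       (nat (a ℕ.+ a') - nat (b ℕ.+ b')) * mono m ρ + poly P ρ
         ≈⟨ +-congʳ (*-congʳ (+-cong (nat-+ a a') (-‿cong (nat-+ b b')))) ⟩
       ((nat a + nat a') - (nat b + nat b')) * mono m ρ + poly P ρ
         ≈⟨ +-congʳ (trans (*-congʳ (sub-+ _ _ _ _)) (distribʳ _ _ _)) ⟩
       (term t ρ + term t' ρ) + poly P ρ ≈⟨ +-assoc _ _ _ ⟩
       term t ρ + (term t' ρ + poly P ρ) ∎
     add-sound : ∀ P Q (ρ : Vec Carrier n) → poly (add P Q) ρ ≈ poly P ρ + poly Q ρ
     add-sound []      Q ρ = sym (+-identityˡ _)
     add-sound (t ∷ P) Q ρ = trans (insert-sound t (add P Q) ρ) (trans (+-congˡ (add-sound P Q ρ)) (sym (+-assoc _ _ _)))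
   mulMono-sound : ∀ m m' {n} (ρ : Vec Carrier n) → mono (mulMono m m') ρ ≈ mono m ρ * mono m' ρ
   mulMono-sound []      m'       ρ       = sym (*-identityˡ _)
   mulMono-sound (a ∷ m) []       ρ       = sym (*-identityʳ _)
   mulMono-sound (a ∷ m) (b ∷ m') []      = sym (*-identityʳ _)
   mulMono-sound (a ∷ m) (b ∷ m') (x ∷ ρ) =
     trans (*-cong (pow-+ x a b) (mulMono-sound m m' ρ)) (*-interchange _ _ _ _)
   module _ {n : ℕ} where
     mulTerm-sound : ∀ t s (ρ : Vec Carrier n) → term (mulTerm t s) ρ ≈ term t ρ * term s ρ
     mulTerm-sound (m , a , b) (m' , a' , b') ρ = begin
       (nat (a ℕ.* a' ℕ.+ b ℕ.* b') - nat (a ℕ.* b' ℕ.+ b ℕ.* a')) * mono (mulMono m m') ρ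
         ≈⟨ *-cong (+-cong (h a a' b b') (-‿cong (h a b' b a'))) (mulMono-sound m m' ρ) ⟩
       ((nat a * nat a' + nat b * nat b') - (nat a * nat b' + nat b * nat a')) * (mono m ρ * mono m' ρ)
         ≈⟨ *-congʳ (sub-* _ _ _ _) ⟩
       ((nat a - nat b) * (nat a' - nat b')) * (mono m ρ * mono m' ρ) ≈⟨ *-interchange _ _ _ _ ⟩
       term (m , a , b) ρ * term (m' , a' , b') ρ ∎
       where
       h : ∀ x y z w → nat (x ℕ.* y ℕ.+ z ℕ.* w) ≈ nat x * nat y + nat z * nat w
       h x y z w = trans (nat-+ (x ℕ.* y) _) (+-cong (nat-* x y) (nat-* z w))
     scale-sound : ∀ t P (ρ : Vec Carrier n) → poly (scale t P) ρ ≈ term t ρ * poly P ρ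
     scale-sound t []      ρ = sym (zeroʳ _)
     scale-sound t (s ∷ P) ρ = trans (insert-sound (mulTerm t s) (scale t P) ρ)
       (trans (+-cong (mulTerm-sound t s ρ) (scale-sound t P ρ)) (sym (distribˡ _ _ _)))
     mul-sound : ∀ P Q (ρ : Vec Carrier n) → poly (mul P Q) ρ ≈ poly P ρ * poly Q ρ
     mul-sound []      Q ρ = sym (zeroˡ _)
     mul-sound (t ∷ P) Q ρ = trans (add-sound (scale t Q) (mul P Q) ρ)
       (trans (+-cong (scale-sound t Q ρ) (mul-sound P Q ρ)) (sym (distribʳ _ _ _)))
     neg-sound : ∀ P (ρ : Vec Carrier n) → poly (neg P) ρ ≈ - poly P ρ
     neg-sound []                ρ = sym -0#≈0#
     neg-sound ((m , a , b) ∷ P) ρ = begin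
       (nat b - nat a) * mono m ρ + poly (neg P) ρ ≈⟨ +-cong (*-congʳ (flip (nat a) (nat b))) (neg-sound P ρ) ⟩
       (- (nat a - nat b)) * mono m ρ + - poly P ρ ≈⟨ +-congʳ (-‿distribˡ-* _ _) ⟨
       - ((nat a - nat b) * mono m ρ) + - poly P ρ ≈⟨ -‿+-comm _ _ ⟩
       - (term (m , a , b) ρ + poly P ρ)           ∎
       where
       flip : ∀ x y → y - x ≈ - (x - y)
       flip x y = trans (+-comm _ _) (trans (+-congˡ (sym (-‿involutive y))) (-‿+-comm x (- y)))
     unit-sound : ∀ {k} (i : Fin k) (ρ : Vec Carrier k) → mono (unit i) ρ ≈ lookup ρ i
     unit-sound zero    (x ∷ ρ) = trans (*-identityʳ _) (*-identityʳ _)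
     unit-sound (suc i) (x ∷ ρ) = trans (*-identityˡ _) (unit-sound i ρ)
     one-term : ∀ m (ρ : Vec Carrier n) → term (m , 1 , 0) ρ ≈ mono m ρ
     one-term m ρ = trans (*-congʳ (trans (+-cong (+-identityʳ _) -0#≈0#) (+-identityʳ _))) (*-identityˡ _)
     norm-sound : ∀ (e : Expr n) ρ → poly (norm e) ρ ≈ ⟦ e ⟧ ρ
     norm-sound (var i)  ρ = trans (+-identityʳ _) (trans (one-term (unit i) ρ) (unit-sound i ρ))
     norm-sound :0       ρ = refl
     norm-sound :1       ρ = trans (+-identityʳ _) (one-term [] ρ)
     norm-sound (a :+ b) ρ = trans (add-sound (norm a) (norm b) ρ) (+-cong (norm-sound a ρ) (norm-sound b ρ))
     norm-sound (a :* b) ρ = trans (mul-sound (norm a) (norm b) ρ) (*-cong (norm-sound a ρ) (norm-sound b ρ))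
     norm-sound (:- a)   ρ = trans (neg-sound (norm a) ρ) (-‿cong (norm-sound a ρ))
     vanishes-sound : ∀ P (ρ : Vec Carrier n) → vanishes P ≡ true → poly P ρ ≈ 0#
     vanishes-sound []                ρ h = refl
     vanishes-sound ((m , a , b) ∷ P) ρ h with a ℕ.≡ᵇ b in e
     ... | true rewrite T⇒≡ a b e = trans (+-cong (trans (*-congʳ (-‿inverseʳ _)) (zeroˡ _)) (vanishes-sound P ρ h)) (+-identityˡ _)
     prove : ∀ (e e' : Expr n) → vanishes (norm (e :- e')) ≡ true → ∀ ρ → ⟦ e ⟧ ρ ≈ ⟦ e' ⟧ ρ
     prove e e' h ρ = begin
       ⟦ e ⟧ ρ                           ≈⟨ +-identityʳ _ ⟨
       ⟦ e ⟧ ρ + 0#                      ≈⟨ +-congˡ (-‿inverseˡ (⟦ e' ⟧ ρ)) ⟨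
       ⟦ e ⟧ ρ + (- ⟦ e' ⟧ ρ + ⟦ e' ⟧ ρ) ≈⟨ +-assoc _ _ _ ⟨
       ⟦ e :- e' ⟧ ρ + ⟦ e' ⟧ ρ          ≈⟨ +-congʳ (trans (sym (norm-sound (e :- e') ρ)) (vanishes-sound (norm (e :- e')) ρ h)) ⟩
       0# + ⟦ e' ⟧ ρ                     ≈⟨ +-identityˡ _ ⟩
       ⟦ e' ⟧ ρ                          ∎

 close : ∀ n → N-ary n (Expr n) (Expr n × Expr n) → Expr n × Expr n
 close n f = f $ⁿ tabulate var

 solve : ∀ n (f : N-ary n (Expr n) (Expr n × Expr n)) →
         vanishes (norm (proj₁ (close n f) :- proj₂ (close n f))) ≡ true →
         Eq n _≈_ (curryⁿ ⟦ proj₁ (close n f) ⟧) (curryⁿ ⟦ proj₂ (close n f) ⟧)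
 solve n f h = curryⁿ-cong _≈_ _ _ (prove (proj₁ (close n f)) (proj₂ (close n f)) h)

-- Formal power series over a commutative ring

module PowerSeries where
 open import Algebra.Bundles using (CommutativeRing)
 open import Data.Nat using (ℕ; zero; suc)
 open import Data.Product using (_,_)
 open import Level using (0ℓ)

 nfold : {A : Set} → (A → A → A) → A → ℕ → A → A
 nfold _∙_ ε zero    x = ε
 nfold _∙_ ε (suc n) x = x ∙ nfold _∙_ ε n x

 Ring₀ : Set₁
 Ring₀ = CommutativeRing 0ℓ 0ℓ

 Π : Set → Ring₀ → Ring₀
 Π I R = record
   { Carrier = I → Carrier ; _≈_ = λ f g → ∀ i → f i ≈ g i
   ; _+_ = λ f g i → f i + g i ; _*_ = λ f g i → f i * g i ; -_ = λ f i → - f i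
   ; 0# = λ _ → 0# ; 1# = λ _ → 1#
   ; isCommutativeRing = record
     { isRing = record
       { +-isAbelianGroup = record
         { isGroup = record
           { isMonoid = record
             { isSemigroup = record
               { isMagma = record
                 { isEquivalence = record
                   { refl = λ _ → refl ; sym = λ p i → sym (p i) ; trans = λ p q i → trans (p i) (q i) }
                 ; ∙-cong = λ p q i → +-cong (p i) (q i) }
               ; assoc = λ f g h i → +-assoc _ _ _ }
             ; identity = (λ f i → +-identityˡ _) , (λ f i → +-identityʳ _) }
           ; inverse = (λ f i → -‿inverseˡ _) , (λ f i → -‿inverseʳ _)
           ; ⁻¹-cong = λ p i → -‿cong (p i) }
         ; comm = λ f g i → +-comm _ _ }
       ; *-cong = λ p q i → *-cong (p i) (q i)
       ; *-assoc = λ f g h i → *-assoc _ _ _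
       ; *-identity = (λ f i → *-identityˡ _) , (λ f i → *-identityʳ _)
       ; distrib = (λ f g h i → distribˡ _ _ _) , (λ f g h i → distribʳ _ _ _) }
     ; *-comm = λ f g i → *-comm _ _ } }
   where open CommutativeRing R

 module Series (R : Ring₀) where
   open CommutativeRing R
   open import Relation.Binary.Reasoning.Setoid setoid
   open RingTactic R using (solve; _:=_; _:+_; _:*_)
   import Relation.Binary.PropositionalEquality as ≡
   Seq : Set
   Seq = ℕ → Carrier
   tail : Seq → Seq
   tail f n = f (suc n)
   mul : Seq → Seq → Seq
   mul f g zero    = f 0 * g 0
   mul f g (suc n) = f 0 * g (suc n) + mul (tail f) g n
   unit : Seq
   unit zero    = 1#
   unit (suc _) = 0#
   mul-cong : ∀ {f f' g g'} → (∀ n → f n ≈ f' n) → (∀ n → g n ≈ g' n) → ∀ n → mul f g n ≈ mul f' g' n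
   mul-cong p q zero    = *-cong (p 0) (q 0)
   mul-cong p q (suc n) = +-cong (*-cong (p 0) (q (suc n))) (mul-cong (λ k → p (suc k)) q n)
   mul-sucʳ : ∀ f g n → mul f g (suc n) ≈ mul f (tail g) n + f (suc n) * g 0
   mul-sucʳ f g zero    = refl
   mul-sucʳ f g (suc n) = trans (+-congˡ (mul-sucʳ (tail f) g n)) (sym (+-assoc _ _ _))
   mul-comm : ∀ f g n → mul f g n ≈ mul g f n
   mul-comm f g zero    = *-comm _ _
   mul-comm f g (suc n) = trans (+-cong (*-comm _ _) (mul-comm (tail f) g n)) (trans (+-comm _ _) (sym (mul-sucʳ g f n)))
   mul-distribˡ : ∀ f g h n → mul f (λ k → g k + h k) n ≈ mul f g n + mul f h n
   mul-distribˡ f g h zero    = distribˡ _ _ _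
   mul-distribˡ f g h (suc n) = trans (+-cong (distribˡ _ _ _) (mul-distribˡ (tail f) g h n))
     (solve 4 (λ a b c d → (a :+ b) :+ (c :+ d) := (a :+ c) :+ (b :+ d)) ≡.refl _ _ _ _)
   mul-distribʳ : ∀ f g h n → mul (λ k → g k + h k) f n ≈ mul g f n + mul h f n
   mul-distribʳ f g h n = trans (mul-comm _ f n)
     (trans (mul-distribˡ f g h n) (+-cong (mul-comm f g n) (mul-comm f h n)))
   mul-scale : ∀ c f g n → mul (λ k → c * f k) g n ≈ c * mul f g n
   mul-scale c f g zero    = *-assoc _ _ _
   mul-scale c f g (suc n) = trans (+-cong (*-assoc _ _ _) (mul-scale c (tail f) g n)) (sym (distribˡ _ _ _))
   mul-assoc : ∀ f g h n → mul (mul f g) h n ≈ mul f (mul g h) n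
   mul-assoc f g h zero    = *-assoc _ _ _
   mul-assoc f g h (suc n) = begin
     f 0 * g 0 * h (suc n) + mul (λ k → f 0 * g (suc k) + mul (tail f) g k) h n
       ≈⟨ +-congˡ (mul-distribʳ h (λ k → f 0 * g (suc k)) (mul (tail f) g) n) ⟩
     f 0 * g 0 * h (suc n) + (mul (λ k → f 0 * g (suc k)) h n + mul (mul (tail f) g) h n)
       ≈⟨ +-congˡ (+-cong (mul-scale (f 0) (tail g) h n) (mul-assoc (tail f) g h n)) ⟩
     f 0 * g 0 * h (suc n) + (f 0 * mul (tail g) h n + mul (tail f) (mul g h) n)
       ≈⟨ solve 5 (λ a b c d e → a :* b :* c :+ (a :* d :+ e) := a :* (b :* c :+ d) :+ e) ≡.refl _ _ _ _ _ ⟩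
     f 0 * mul g h (suc n) + mul (tail f) (mul g h) n ∎
   mul-zeroˡ : ∀ g n → mul (λ _ → 0#) g n ≈ 0#
   mul-zeroˡ g zero    = zeroˡ _
   mul-zeroˡ g (suc n) = trans (+-cong (zeroˡ _) (mul-zeroˡ g n)) (+-identityˡ _)
   mul-unitˡ : ∀ g n → mul unit g n ≈ g n
   mul-unitˡ g zero    = *-identityˡ _
   mul-unitˡ g (suc n) = trans (+-cong (*-identityˡ _) (mul-zeroˡ g n)) (+-identityʳ _)
   const : Carrier → Seq
   const c zero    = c
   const c (suc _) = 0#
   shift : Seq → Seq
   shift f zero    = 0#
   shift f (suc n) = f n
   X : Seq
   X = shift unit
   mul-const : ∀ c f n → mul (const c) f n ≈ c * f n
   mul-const c f zero    = refl
   mul-const c f (suc n) = trans (+-congˡ (mul-zeroˡ f n)) (+-identityʳ _)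
   mul-shift : ∀ f g n → mul (shift f) g n ≈ shift (mul f g) n
   mul-shift f g zero    = zeroˡ _
   mul-shift f g (suc n) = trans (+-congʳ (zeroˡ _)) (+-identityˡ _)
   shift-cong : ∀ {f g} → (∀ n → f n ≈ g n) → ∀ n → shift f n ≈ shift g n
   shift-cong p zero    = refl
   shift-cong p (suc n) = p n
   mul-X : ∀ f n → mul X f n ≈ shift f n
   mul-X f n = trans (mul-shift unit f n) (shift-cong (mul-unitˡ f) n)

 PS : Ring₀ → Ring₀
 PS R = record
   { Carrier = Seq ; _≈_ = λ f g → ∀ n → f n ≈ g n
   ; _+_ = λ f g n → f n + g n ; _*_ = mul ; -_ = λ f n → - f n
   ; 0# = λ _ → 0# ; 1# = unit
   ; isCommutativeRing = record
     { isRing = record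
       { +-isAbelianGroup = CommutativeRing.+-isAbelianGroup (Π ℕ R)
       ; *-cong = mul-cong
       ; *-assoc = mul-assoc
       ; *-identity = mul-unitˡ , (λ f n → trans (mul-comm f unit n) (mul-unitˡ f n))
       ; distrib = mul-distribˡ , mul-distribʳ }
     ; *-comm = mul-comm } }
   where
   open CommutativeRing R
   open Series R

 module _ (R : Ring₀) where
   open CommutativeRing R
   open import Relation.Binary.Reasoning.Setoid setoid
   open RingTactic R using (solve; _:=_; _:+_; _:*_)
   import Relation.Binary.PropositionalEquality as ≡
   private
     module S  = Series R
     module SS = Series (PS R)
   inner-0 : ∀ (a b : ℕ → S.Seq) k → SS.mul a b k 0 ≈ S.mul (λ i → a i 0) (λ i → b i 0) k
   inner-0 a b zero    = refl
   inner-0 a b (suc k) = +-congˡ (inner-0 (SS.tail a) b k)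
   inner-suc : ∀ (a b : ℕ → S.Seq) k j →
     SS.mul a b k (suc j) ≈ S.mul (λ i → a i 0) (λ i → b i (suc j)) k + SS.mul (λ i → S.tail (a i)) b k j
   inner-suc a b zero    j = refl
   inner-suc a b (suc k) j = trans (+-congˡ (inner-suc (SS.tail a) b k j))
     (solve 4 (λ a b c d → (a :+ b) :+ (c :+ d) := (a :+ c) :+ (b :+ d)) ≡.refl _ _ _ _)
   -- The product of double series recurses on the outer variable; `inner-0` and `inner-suc` unfold
   -- it along the inner one, which shows that exchanging the two variables preserves products.
   swap-* : ∀ (a b : ℕ → S.Seq) j k → SS.mul a b j k ≈ SS.mul (λ k j → a j k) (λ k j → b j k) k j
   swap-* a b zero    k = sym (inner-0 (λ k j → a j k) (λ k j → b j k) k)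
   swap-* a b (suc j) k = trans (+-congˡ (swap-* (SS.tail a) b j k)) (sym (inner-suc (λ k j → a j k) (λ k j → b j k) k j))
   pow : Carrier → ℕ → Carrier
   pow v zero    = 1#
   pow v (suc n) = v * pow v n
   -- This is what makes the substitution of v·X for X a ring homomorphism.
   scale-* : ∀ v f g n → pow v n * S.mul f g n ≈ S.mul (λ k → pow v k * f k) (λ k → pow v k * g k) n
   scale-* v f g zero    = trans (sym (*-assoc _ _ _)) fix
     where
     fix : 1# * f 0 * g 0 ≈ 1# * f 0 * (1# * g 0)
     fix = *-congˡ (sym (*-identityˡ _))
   scale-* v f g (suc n) = begin
     v * pow v n * (f 0 * g (suc n) + S.mul (S.tail f) g n)
       ≈⟨ solve 5 (λ v p a b c → v :* p :* (a :* b :+ c) := a :* (v :* p :* b) :+ v :* (p :* c)) ≡.refl _ _ _ _ _ ⟩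
     f 0 * (v * pow v n * g (suc n)) + v * (pow v n * S.mul (S.tail f) g n)
       ≈⟨ +-cong (*-congʳ (sym (*-identityˡ _))) (*-congˡ (scale-* v (S.tail f) g n)) ⟩
     1# * f 0 * (v * pow v n * g (suc n)) + v * S.mul (λ k → pow v k * f (suc k)) (λ k → pow v k * g k) n
       ≈⟨ +-congˡ (S.mul-scale v _ _ n) ⟨
     1# * f 0 * (v * pow v n * g (suc n)) + S.mul (λ k → v * (pow v k * f (suc k))) (λ k → pow v k * g k) n
       ≈⟨ +-congˡ (S.mul-cong (λ k → sym (*-assoc v (pow v k) (f (suc k)))) (λ _ → refl) n) ⟩
     1# * f 0 * (v * pow v n * g (suc n)) + S.mul (λ k → v * pow v k * f (suc k)) (λ k → pow v k * g k) n ∎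
   multiple : ℕ → Carrier → Carrier
   multiple = nfold _+_ 0#
   multiple-cong : ∀ n {x y} → x ≈ y → multiple n x ≈ multiple n y
   multiple-cong zero    e = refl
   multiple-cong (suc n) e = +-cong e (multiple-cong n e)
   multiple-+ : ∀ n x y → multiple n (x + y) ≈ multiple n x + multiple n y
   multiple-+ zero    x y = sym (+-identityˡ _)
   multiple-+ (suc n) x y = trans (+-congˡ (multiple-+ n x y))
     (solve 4 (λ a b c d → (a :+ b) :+ (c :+ d) := (a :+ c) :+ (b :+ d)) ≡.refl _ _ _ _)
   multiple-* : ∀ n c x → multiple n (c * x) ≈ c * multiple n x
   multiple-* zero    c x = sym (zeroʳ _)
   multiple-* (suc n) c x = trans (+-congˡ (multiple-* n c x)) (sym (distribˡ _ _ _))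
   multiple-0 : ∀ n → multiple n 0# ≈ 0#
   multiple-0 zero    = refl
   multiple-0 (suc n) = trans (+-identityˡ _) (multiple-0 n)
   deriv : S.Seq → S.Seq
   deriv f n = multiple (suc n) (f (suc n))

-- Finite fields with as many elements as their characteristic

module Fields where
 open import Algebra.Bundles using (CommutativeRing)
 open import Algebra.Structures using (IsCommutativeRing)
 open import Data.Nat as ℕ using (ℕ; zero; suc)
 open import Data.Product using (∃; proj₁; proj₂)
 open import Data.Sum using (_⊎_; inj₁; inj₂)
 open import Level using (0ℓ)
 open import Relation.Binary.PropositionalEquality
 open import Relation.Nullary using (¬_; yes; no)
 open PowerSeries using (nfold)
 open Sums

 -- `order` and `char` describe a prime field: p elements, and j·1 is nonzero for 0 < j < p, so
 -- derivatives in degree below p lose nothing. The algebra is done over this interface and residues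
 -- mod p are plugged in at the end.
 record FiniteField : Set₁ where
   infixl 6 _+_
   infixl 7 _*_
   infix  8 -_
   field
     F           : Set
     _+_ _*_     : F → F → F
     -_          : F → F
     0# 1#       : F
     isCommutativeRing : IsCommutativeRing _≡_ _+_ _*_ -_ 0# 1#
     finite      : Finite F
     inverse     : ∀ x → ¬ (x ≡ 0#) → ∃ λ y → x * y ≡ 1#
     p           : ℕ
     order       : ∑ (Finite.elems finite) (λ _ → 1) ≡ p
     1<p         : 1 ℕ.< p
     char        : ∀ j → 0 ℕ.< j → j ℕ.< p → ¬ (nfold _+_ 0# j 1# ≡ 0#)
   multiple : ℕ → F → F
   multiple = nfold _+_ 0#

 module FieldTheory (𝔽 : FiniteField) where
   open FiniteField 𝔽 public
   module Fᶠ = Finite finite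
   open Fᶠ public using (_≟_; _==_)
   commutativeRing : CommutativeRing 0ℓ 0ℓ
   commutativeRing = record { isCommutativeRing = isCommutativeRing }
   open IsCommutativeRing isCommutativeRing public
     using (+-identityˡ; +-identityʳ; *-identityˡ; *-identityʳ; zeroˡ; zeroʳ; *-comm; *-assoc; +-comm; +-assoc; distribˡ; distribʳ)
   infixl 6 _-_
   _-_ : F → F → F
   a - b = a + - b
   open RingTactic commutativeRing public
   invert : ∀ {x} → ¬ (x ≡ 0#) → F
   invert h = proj₁ (inverse _ h)
   *-invert : ∀ {x} (h : ¬ (x ≡ 0#)) → x * invert h ≡ 1#
   *-invert h = proj₂ (inverse _ h)
   *-cancel0 : ∀ {x y} → ¬ (x ≡ 0#) → x * y ≡ 0# → y ≡ 0#
   *-cancel0 {x} {y} h e = begin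
     y                  ≡⟨ *-identityˡ y ⟨
     1# * y             ≡⟨ cong (_* y) (*-invert h) ⟨
     x * invert h * y   ≡⟨ solve 3 (λ x i y → x :* i :* y := i :* (x :* y)) refl x (invert h) y ⟩
     invert h * (x * y) ≡⟨ trans (cong (invert h *_) e) (zeroʳ _) ⟩
     0#                 ∎
     where open ≡-Reasoning
   *-zero : ∀ {x y} → x * y ≡ 0# → x ≡ 0# ⊎ y ≡ 0#
   *-zero {x} e with x ≟ 0#
   ... | yes z = inj₁ z
   ... | no  z = inj₂ (*-cancel0 z e)
   *-nonzero : ∀ {x y} → ¬ (x ≡ 0#) → ¬ (y ≡ 0#) → ¬ (x * y ≡ 0#)
   *-nonzero hx hy e = hy (*-cancel0 hx e)
   sub-zero : ∀ {x y} → x - y ≡ 0# → x ≡ y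
   sub-zero {x} {y} e = trans (solve 2 (λ x y → x := (x :- y) :+ y) refl x y) (trans (cong (_+ y) e) (+-identityˡ y))
   zero-sub : ∀ {x y} → x ≡ y → x - y ≡ 0#
   zero-sub {x} refl = solve 1 (λ x → x :- x := :0) refl x
   *-cancelˡ : ∀ {x y z} → ¬ (x ≡ 0#) → x * y ≡ x * z → y ≡ z
   *-cancelˡ {x} {y} {z} h e = sub-zero (*-cancel0 h
     (trans (solve 3 (λ x y z → x :* (y :- z) := x :* y :- x :* z) refl x y z) (zero-sub e)))
   neg-zero : ∀ {x} → - x ≡ 0# → x ≡ 0#
   neg-zero {x} e = trans (solve 1 (λ x → x := :- (:- x)) refl x) (trans (cong -_ e) (solve 0 (:- :0 := :0) refl))
   multiple-≡ : ∀ n x → multiple n x ≡ multiple n 1# * x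
   multiple-≡ zero    x = sym (zeroˡ x)
   multiple-≡ (suc n) x = trans (cong₂ _+_ (sym (*-identityˡ x)) (multiple-≡ n x)) (sym (distribʳ x _ _))
   1≢0 : ¬ (1# ≡ 0#)
   1≢0 e = char 1 (ℕ.s≤s ℕ.z≤n) 1<p (trans (+-identityʳ 1#) e)

-- Homogeneous forms, their derivatives and Taylor terms

module Forms (𝔽 : Fields.FiniteField) where
 open Fields

 open FieldTheory 𝔽 using (F; commutativeRing; char; p; multiple; multiple-≡; *-cancel0)
 private module 𝔽 = FieldTheory 𝔽
 open import Algebra.Bundles using (CommutativeRing)
 open import Data.Fin using (Fin; zero; suc)
 open import Data.Nat as ℕ using (ℕ; zero; suc; z≤n; s≤s; _<_)
 open import Data.Nat.Properties as ℕ using ()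
 import Relation.Binary.PropositionalEquality as ≡
 open ≡ using (_≡_)
 open PowerSeries hiding (multiple)

 -- An algebra over the field. One evaluation of forms then serves for points, for power series and
 -- double series, and for families of these.
 record Alg : Set₁ where
   field
     ring : Ring₀
   open CommutativeRing ring public hiding (ring; zero)
   field
     ι   : F → Carrier
     ι-+ : ∀ a b → ι (a 𝔽.+ b) ≈ ι a + ι b
     ι-* : ∀ a b → ι (a 𝔽.* b) ≈ ι a * ι b
     ι-0 : ι 𝔽.0# ≈ 0#
     ι-1 : ι 𝔽.1# ≈ 1#

 baseAlg : Alg
 baseAlg = record { ring = commutativeRing ; ι = λ a → a ; ι-+ = λ _ _ → ≡.refl ; ι-* = λ _ _ → ≡.refl ; ι-0 = ≡.refl ; ι-1 = ≡.refl }

 ΠAlg : Set → Alg → Alg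
 ΠAlg I A = record { ring = Π I ring ; ι = λ a _ → ι a ; ι-+ = λ a b _ → ι-+ a b ; ι-* = λ a b _ → ι-* a b ; ι-0 = λ _ → ι-0 ; ι-1 = λ _ → ι-1 }
   where open Alg A

 PSAlg : Alg → Alg
 PSAlg A = record { ring = PS ring ; ι = λ a → const (ι a) ; ι-+ = p+ ; ι-* = p* ; ι-0 = p0 ; ι-1 = p1 }
   where
   open Alg A
   open Series ring
   p+ : ∀ a b n → const (ι (a 𝔽.+ b)) n ≈ const (ι a) n + const (ι b) n
   p+ a b zero    = ι-+ a b
   p+ a b (suc n) = sym (+-identityˡ _)
   p* : ∀ a b n → const (ι (a 𝔽.* b)) n ≈ mul (const (ι a)) (const (ι b)) n
   p* a b zero    = ι-* a b
   p* a b (suc n) = sym (trans (mul-const (ι a) (const (ι b)) (suc n)) (zeroʳ _))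
   p0 : ∀ n → const (ι 𝔽.0#) n ≈ 0#
   p0 zero    = ι-0
   p0 (suc n) = refl
   p1 : ∀ n → const (ι 𝔽.1#) n ≈ unit n
   p1 zero    = ι-1
   p1 (suc n) = refl

 record Hom (A B : Alg) : Set where
   private
     module A = Alg A
     module B = Alg B
   field
     fun  : A.Carrier → B.Carrier
     pres-≈ : ∀ {x y} → x A.≈ y → fun x B.≈ fun y
     pres-+ : ∀ x y → fun (x A.+ y) B.≈ fun x B.+ fun y
     pres-* : ∀ x y → fun (x A.* y) B.≈ fun x B.* fun y
     pres-ι : ∀ a → fun (A.ι a) B.≈ B.ι a

 -- `node G H` stands for G + x₀·H with G free of x₀, so every form has exactly one representation
 -- and its coefficients can be counted. `void` is the only form of positive degree in no variables,
 -- namely zero.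
 data Form : ℕ → ℕ → Set where
   void  : ∀ {a} → Form zero (suc a)
   const : ∀ {k} → F → Form k zero
   node  : ∀ {k a} → Form k (suc a) → Form (suc k) a → Form (suc k) (suc a)

 data IsZero : ∀ {k a} → Form k a → Set where
   void  : ∀ {a} → IsZero (void {a})
   const : ∀ {k} → IsZero (const {k} 𝔽.0#)
   node  : ∀ {k a} {G : Form k (suc a)} {H : Form (suc k) a} → IsZero G → IsZero H → IsZero (node G H)

 sub : ∀ {k a} → Form k a → Form k a → Form k a
 sub void       void         = void
 sub (const c)  (const d)    = const (c 𝔽.- d)
 sub (node G H) (node G' H') = node (sub G G') (sub H H')

 sub-zero : ∀ {k a} (f g : Form k a) → IsZero (sub f g) → f ≡ g
 sub-zero void       void         z          = ≡.refl
 sub-zero (const c)  (const d)    z          = ≡.cong const (𝔽.sub-zero (h z))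
   where
   h : ∀ {k c} → IsZero (const {k} c) → c ≡ 𝔽.0#
   h const = ≡.refl
 sub-zero (node G H) (node G' H') (node z w) = ≡.cong₂ node (sub-zero G G' z) (sub-zero H H' w)

 scale : ∀ {k a} → ℕ → Form k a → Form k a
 scale m void       = void
 scale m (const c)  = const (multiple m c)
 scale m (node G H) = node (scale m G) (scale m H)

 -- The operator m + x₀·∂₀. It enters because ∂₀(G + x₀·H) = H + x₀·∂₀H, and it multiplies the terms
 -- with x₀ to the power i by m + i.
 euler₀ : ∀ {k a} → ℕ → Form (suc k) a → Form (suc k) a
 euler₀ m (const c)  = const (multiple m c)
 euler₀ m (node G H) = node (scale m G) (euler₀ (suc m) H)

 lift₀ : ∀ {k} → Form k zero → Form (suc k) zero
 lift₀ (const c) = const c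

 ∂ : ∀ {k a} → Fin k → Form k (suc a) → Form k a
 ∂ zero    (node G H)             = euler₀ 1 H
 ∂ (suc i) (node {a = zero}  G H) = lift₀ (∂ i G)
 ∂ (suc i) (node {a = suc a} G H) = node (∂ i G) (∂ (suc i) H)

 private
   multiple-zero : ∀ j c → 0 < j → j < p → multiple j c ≡ 𝔽.0# → c ≡ 𝔽.0#
   multiple-zero j c pos lt e = *-cancel0 (char j pos lt) (≡.trans (≡.sym (multiple-≡ j c)) e)
   const-zero : ∀ {k c} → IsZero (const {k} c) → c ≡ 𝔽.0#
   const-zero const = ≡.refl
   zero-const : ∀ {k c} → c ≡ 𝔽.0# → IsZero (const {k} c)
   zero-const ≡.refl = const

 scale-zero : ∀ {k a} m (f : Form k a) → 0 < m → m < p → IsZero (scale m f) → IsZero f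
 scale-zero m void       pos lt z          = void
 scale-zero m (const c)  pos lt z          = zero-const (multiple-zero m c pos lt (const-zero z))
 scale-zero m (node G H) pos lt (node z w) = node (scale-zero m G pos lt z) (scale-zero m H pos lt w)

 euler₀-zero : ∀ {k a} m (f : Form (suc k) a) → 0 < m → m ℕ.+ a < p → IsZero (euler₀ m f) → IsZero f
 euler₀-zero m (const c)  pos lt z = zero-const (multiple-zero m c pos (≡.subst (_< p) (ℕ.+-identityʳ m) lt) (const-zero z))
 euler₀-zero m (node {a = a} G H) pos lt (node z w) =
   node (scale-zero m G pos (ℕ.≤-<-trans (ℕ.m≤m+n m (suc a)) lt) z)
        (euler₀-zero (suc m) H (s≤s z≤n) (≡.subst (_< p) (ℕ.+-suc m a) lt) w)

 -- A monomial of positive degree contains some variable; its exponent lies between 1 and the degree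
 -- and is therefore invertible when the degree is below p.
 ∂-zero : ∀ {k a} (f : Form k (suc a)) → suc a < p → (∀ i → IsZero (∂ i f)) → IsZero f
 ∂-zero void                   lt z = void
 ∂-zero (node {a = zero}  G H) lt z = node (∂-zero G lt (λ i → lower (∂ i G) (z (suc i)))) (euler₀-zero 1 H (s≤s z≤n) lt (z zero))
   where
   lower : ∀ {k} (f : Form k zero) → IsZero (lift₀ f) → IsZero f
   lower (const c) const = const
 ∂-zero (node {a = suc a} G H) lt z = node (∂-zero G lt (λ i → left (z (suc i)))) (euler₀-zero 1 H (s≤s z≤n) lt (z zero))
   where
   left : ∀ {k a} {G : Form k (suc a)} {H : Form (suc k) a} → IsZero (node G H) → IsZero G
   left (node z _) = z

 module Eval (A : Alg) where
   open Alg A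
   open RingTactic ring hiding (⟦_⟧; var)
   eval : ∀ {k a} → (Fin k → Carrier) → Form k a → Carrier
   eval x void       = 0#
   eval x (const c)  = ι c
   eval x (node G H) = eval (λ i → x (suc i)) G + x zero * eval x H
   eval-cong : ∀ {k a} {x y : Fin k → Carrier} → (∀ i → x i ≈ y i) → (f : Form k a) → eval x f ≈ eval y f
   eval-cong e void       = refl
   eval-cong e (const c)  = refl
   eval-cong e (node G H) = +-cong (eval-cong (λ i → e (suc i)) G) (*-cong (e zero) (eval-cong e H))
   -- The derivative at x towards w, by the product rule. Unlike the formal ∂ it is available at
   -- points of any algebra.
   dir : ∀ {k a} → (x w : Fin k → Carrier) → Form k a → Carrier
   dir x w void       = 0#
   dir x w (const c)  = 0#
   dir x w (node G H) = dir (λ i → x (suc i)) (λ i → w (suc i)) G + (w zero * eval x H + x zero * dir x w H)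
   dir-cong : ∀ {k a} {x y v w : Fin k → Carrier} → (∀ i → x i ≈ y i) → (∀ i → v i ≈ w i) → (f : Form k a) → dir x v f ≈ dir y w f
   dir-cong e e' void       = refl
   dir-cong e e' (const c)  = refl
   dir-cong e e' (node G H) = +-cong (dir-cong (λ i → e (suc i)) (λ i → e' (suc i)) G)
     (+-cong (*-cong (e' zero) (eval-cong e H)) (*-cong (e zero) (dir-cong e e' H)))
   dir-+ : ∀ {k a} (x v w : Fin k → Carrier) (f : Form k a) → dir x (λ i → v i + w i) f ≈ dir x v f + dir x w f
   dir-+ x v w void       = sym (+-identityˡ _)
   dir-+ x v w (const c)  = sym (+-identityˡ _)
   dir-+ x v w (node G H) = trans (+-cong (dir-+ _ _ _ G) (+-congˡ (*-congˡ (dir-+ x v w H))))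
     (solve 8 (λ a b v w e x c d → (a :+ b) :+ ((v :+ w) :* e :+ x :* (c :+ d)) := (a :+ (v :* e :+ x :* c)) :+ (b :+ (w :* e :+ x :* d))) ≡.refl
       _ _ _ _ _ _ _ _)
   dir-* : ∀ {k a} (x w : Fin k → Carrier) s (f : Form k a) → dir x (λ i → s * w i) f ≈ s * dir x w f
   dir-* x w s void       = sym (zeroʳ _)
   dir-* x w s (const c)  = sym (zeroʳ _)
   dir-* x w s (node G H) = trans (+-cong (dir-* _ _ s G) (+-congˡ (*-congˡ (dir-* x w s H))))
     (solve 6 (λ s g w e x d → s :* g :+ (s :* w :* e :+ x :* (s :* d)) := s :* (g :+ (w :* e :+ x :* d))) ≡.refl _ _ _ _ _ _)
   -- Euler's identity: the derivative of a form of degree a at x towards x itself is a times the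
   -- value.
   dir-euler : ∀ {k a} (x : Fin k → Carrier) (f : Form k a) → eval x f ≈ 0# → dir x x f ≈ 0#
   dir-euler {a = a} x f z = trans (h x f) (trans (PowerSeries.multiple-cong ring a z) (PowerSeries.multiple-0 ring a))
     where
     M = PowerSeries.multiple ring
     h : ∀ {k a} (x : Fin k → Carrier) (f : Form k a) → dir x x f ≈ M a (eval x f)
     h {a = a} x void = sym (PowerSeries.multiple-0 ring a)
     h x (const c)  = refl
     h {a = suc a} x (node G H) = trans (+-cong (h _ G) (+-congˡ (*-congˡ (h x H))))
       (trans (solve 5 (λ g mg xh x mh → (g :+ mg) :+ (xh :+ x :* mh) := (g :+ xh) :+ (mg :+ x :* mh)) ≡.refl _ _ _ _ _)
         (+-congˡ (trans (+-congˡ (sym (PowerSeries.multiple-* ring a _ _))) (sym (PowerSeries.multiple-+ ring a _ _)))))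
   power : Carrier → ℕ → Carrier
   power s zero    = 1#
   power s (suc n) = s * power s n
   eval-scale : ∀ {k a} s (x : Fin k → Carrier) (f : Form k a) → eval (λ i → s * x i) f ≈ power s a * eval x f
   eval-scale s x void       = sym (zeroʳ _)
   eval-scale s x (const c)  = sym (*-identityˡ _)
   eval-scale s x (node G H) = trans (+-cong (eval-scale s _ G) (*-congˡ (eval-scale s x H)))
     (solve 5 (λ s q g x h → s :* q :* g :+ s :* x :* (q :* h) := s :* q :* (g :+ x :* h)) ≡.refl _ _ _ _ _)
   eval-sub : ∀ {k a} (x : Fin k → Carrier) (f g : Form k a) → eval x f ≈ eval x g → eval x (sub f g) ≈ 0#
   eval-sub x f g e = trans (h x f g) (trans (+-congʳ e) (-‿inverseʳ _))
     where
     ι-neg : ∀ c → ι (𝔽.- c) ≈ - ι c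
     ι-neg c = trans (solve 2 (λ m c → m := (m :+ c) :- c) ≡.refl (ι (𝔽.- c)) (ι c))
       (trans (+-congʳ (trans (sym (ι-+ _ _)) (trans (reflexive (≡.cong ι (𝔽.solve 1 (λ c → (𝔽.:- c) 𝔽.:+ c 𝔽.:= 𝔽.:0) ≡.refl c))) ι-0))) (+-identityˡ _))
     h : ∀ {k a} (x : Fin k → Carrier) (f g : Form k a) → eval x (sub f g) ≈ eval x f - eval x g
     h x void       void         = sym (-‿inverseʳ _)
     h x (const c)  (const d)    = trans (ι-+ _ _) (+-congˡ (ι-neg d))
     h x (node G H) (node G' H') = trans (+-cong (h _ G G') (*-congˡ (h x H H')))
       (solve 5 (λ a b x c d → (a :- b) :+ x :* (c :- d) := (a :+ x :* c) :- (b :+ x :* d)) ≡.refl _ _ _ _ _)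
   basis : ∀ {k} → Fin k → Fin k → Carrier
   basis zero    zero    = 1#
   basis zero    (suc j) = 0#
   basis (suc i) zero    = 0#
   basis (suc i) (suc j) = basis i j
   private
     dir-0 : ∀ {k a} (x : Fin k → Carrier) (f : Form k a) → dir x (λ _ → 0#) f ≈ 0#
     dir-0 x f = trans (dir-cong (λ _ → refl) (λ _ → sym (zeroˡ 0#)) f) (trans (dir-* x (λ _ → 0#) 0# f) (zeroˡ _))
     ι-multiple : ∀ m c → ι (multiple m c) ≈ PowerSeries.multiple ring m (ι c)
     ι-multiple zero    c = ι-0
     ι-multiple (suc m) c = trans (ι-+ _ _) (+-congˡ (ι-multiple m c))
     eval-multiple : ∀ {k a} m (x : Fin k → Carrier) (f : Form k a) → eval x (scale m f) ≈ PowerSeries.multiple ring m (eval x f)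
     eval-multiple m x void       = sym (PowerSeries.multiple-0 ring m)
     eval-multiple m x (const c)  = ι-multiple m c
     eval-multiple m x (node G H) = trans (+-cong (eval-multiple m _ G) (*-congˡ (eval-multiple m x H)))
       (trans (+-congˡ (sym (PowerSeries.multiple-* ring m _ _))) (sym (PowerSeries.multiple-+ ring m _ _)))
     eval-euler₀ : ∀ {k a} m (x : Fin (suc k) → Carrier) (f : Form (suc k) a) →
       eval x (euler₀ m f) ≈ PowerSeries.multiple ring m (eval x f) + x zero * dir x (basis zero) f
     eval-euler₀ m x (const c)  = trans (ι-multiple m c) (sym (trans (+-congˡ (zeroʳ _)) (+-identityʳ _)))
     eval-euler₀ m x (node G H) = trans (+-cong (eval-multiple m _ G) (*-congˡ (eval-euler₀ (suc m) x H)))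
       (trans (solve 5 (λ g x h mh d → g :+ x :* ((h :+ mh) :+ x :* d) := (g :+ x :* mh) :+ x :* (:0 :+ (:1 :* h :+ x :* d))) ≡.refl _ _ _ _ _)
         (+-cong (trans (+-congˡ (sym (PowerSeries.multiple-* ring m _ _))) (sym (PowerSeries.multiple-+ ring m _ _)))
           (*-congˡ (+-congʳ (sym (dir-0 _ G))))))
   eval-∂ : ∀ {k a} (x : Fin k → Carrier) i (f : Form k (suc a)) → eval x (∂ i f) ≈ dir x (basis i) f
   eval-∂ x zero    (node G H) = trans (eval-euler₀ 1 x H)
     (trans (solve 2 (λ h d → (h :+ :0) :+ d := :0 :+ (:1 :* h :+ d)) ≡.refl _ _) (+-congʳ (sym (dir-0 _ G))))
   eval-∂ x (suc i) (node {a = zero} G (const c)) = trans (h x (∂ i G)) (trans (eval-∂ (λ j → x (suc j)) i G)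
     (solve 3 (λ d c x → d := d :+ (:0 :* c :+ x :* :0)) ≡.refl _ _ _))
     where
     h : ∀ {k} (x : Fin (suc k) → Carrier) (f : Form k zero) → eval x (lift₀ f) ≈ eval (λ i → x (suc i)) f
     h x (const c) = refl
   eval-∂ x (suc i) (node {a = suc a} G H) = +-cong (eval-∂ (λ j → x (suc j)) i G)
     (trans (*-congˡ (eval-∂ x (suc i) H)) (solve 2 (λ h d → d := :0 :* h :+ d) ≡.refl _ _))
   -- A graded predicate that holds in degree 1 for the coordinates holds in degree a for a form of
   -- degree a; this is how degrees of restrictions to lines are bounded.
   eval-closed : (P : ℕ → Carrier → Set) → (∀ {d x y} → P d x → P d y → P d (x + y)) →
     (∀ {d e x y} → P d x → P e y → P (d ℕ.+ e) (x * y)) → (∀ {d} c → P d (ι c)) → (∀ {d} → P d 0#) →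
     ∀ {k a} {x : Fin k → Carrier} → (∀ i → P 1 (x i)) → (f : Form k a) → P a (eval x f)
   eval-closed P p+ p* pι p0 h void       = p0
   eval-closed P p+ p* pι p0 h (const c)  = pι c
   eval-closed P p+ p* pι p0 h (node G H) = p+ (eval-closed P p+ p* pι p0 (λ i → h (suc i)) G) (p* (h zero) (eval-closed P p+ p* pι p0 h H))

 module _ {A B : Alg} (h : Hom A B) where
   open Hom h
   open Alg B
   private
     module A = Eval A
     module B = Eval B
   eval-hom : ∀ {k a} (x : Fin k → Alg.Carrier A) (f : Form k a) → fun (A.eval x f) ≈ B.eval (λ i → fun (x i)) f
   eval-hom x void       = trans (trans (pres-≈ (Alg.sym A (Alg.ι-0 A))) (pres-ι 𝔽.0#)) ι-0
   eval-hom x (const c)  = pres-ι c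
   eval-hom x (node G H) = trans (pres-+ _ _) (+-cong (eval-hom _ G) (trans (pres-* _ _) (*-congˡ (eval-hom x H))))
   dir-hom : ∀ {k a} (x w : Fin k → Alg.Carrier A) (f : Form k a) → fun (A.dir x w f) ≈ B.dir (λ i → fun (x i)) (λ i → fun (w i)) f
   dir-hom x w void       = trans (trans (pres-≈ (Alg.sym A (Alg.ι-0 A))) (pres-ι 𝔽.0#)) ι-0
   dir-hom x w (const c)  = trans (trans (pres-≈ (Alg.sym A (Alg.ι-0 A))) (pres-ι 𝔽.0#)) ι-0
   dir-hom x w (node G H) = trans (pres-+ _ _) (+-cong (dir-hom _ _ G) (trans (pres-+ _ _)
     (+-cong (trans (pres-* _ _) (*-congˡ (eval-hom x H))) (trans (pres-* _ _) (*-congˡ (dir-hom x w H))))))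

 module Taylor (A : Alg) where
   open Alg A
   open RingTactic ring hiding (⟦_⟧; var)
   open Series ring using (Seq; mul; unit) renaming (const to constant)
   open Eval A
   private module T = Eval (PSAlg A)
   coefficient-0 : Hom (PSAlg A) A
   coefficient-0 = record { fun = λ x → x 0 ; pres-≈ = λ e → e 0 ; pres-+ = λ _ _ → refl ; pres-* = λ _ _ → refl ; pres-ι = λ _ → refl }
   taylor₁ : ∀ {k a} (x : Fin k → Seq) (f : Form k a) → T.eval x f 1 ≈ dir (λ i → x i 0) (λ i → x i 1) f
   taylor₁ x void       = refl
   taylor₁ x (const c)  = refl
   taylor₁ x (node G H) = +-cong (taylor₁ _ G) (trans (+-cong (*-congˡ (taylor₁ x H)) (*-congˡ (eval-hom coefficient-0 x H))) (+-comm _ _))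
   linear : ∀ {k} → (Fin k → Seq) → Fin k → Seq
   linear x i 0 = x i 0
   linear x i 1 = x i 1
   linear x i (suc (suc _)) = 0#
   -- The second-order part of the argument enters the coefficient of order 2 only linearly, through
   -- the first derivative; the rest depends on the argument truncated to first order.
   taylor₂ : ∀ {k a} (x : Fin k → Seq) (f : Form k a) → T.eval x f 2 ≈ T.eval (linear x) f 2 + dir (λ i → x i 0) (λ i → x i 2) f
   taylor₂ x void       = sym (+-identityˡ _)
   taylor₂ x (const c)  = sym (+-identityˡ _)
   taylor₂ x (node G H) = trans
     (+-cong (trans (taylor₂ _ G) (+-congʳ (lin G)))
       (+-cong (*-congˡ (taylor₂ x H)) (+-cong (*-congˡ (trans (taylor₁ x H) (sym (taylor₁ (linear x) H))))
         (*-congˡ (eval-hom coefficient-0 x H)))))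
     (trans (solve 9 (λ g dg x₀ h dh x₁ h₁ x₂ h₀ → (g :+ dg) :+ (x₀ :* (h :+ dh) :+ (x₁ :* h₁ :+ x₂ :* h₀))
         := (g :+ (x₀ :* h :+ (x₁ :* h₁ :+ :0 ))) :+ (dg :+ (x₂ :* h₀ :+ x₀ :* dh))) ≡.refl _ _ _ _ _ _ _ _ _)
       (+-congʳ (+-congˡ (+-congˡ (+-congˡ (sym (zeroˡ _)))))))
     where
     lin : ∀ {k a} {x : Fin (suc k) → Seq} (G : Form k a) → T.eval (linear (λ i → x (suc i))) G 2 ≈ T.eval (λ i → linear x (suc i)) G 2
     lin G = T.eval-cong (λ { i 0 → refl ; i 1 → refl ; i (suc (suc _)) → refl }) G 2

open Fields
open Sums using (Finite; module Finite)
open import Data.Bool using (Bool; true; false; _∧_; not)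
open import Data.Bool.ListAction using (any)
open import Data.Empty using (⊥; ⊥-elim)
open import Data.Product using (Σ; ∃; _×_; _,_; proj₁; proj₂)
open import Data.Sum using (_⊎_; inj₁; inj₂)
open import Relation.Nullary using (¬_; Dec; yes; no; does)
open import Data.Nat as ℕ using (ℕ; zero; suc; _≤_; _<_; z≤n; s≤s)
open import Data.Nat.Properties as ℕ using (≤-trans; ≤-reflexive; ≤-refl)
open import Relation.Binary.PropositionalEquality

-- Finite groups, quotients and multiplicative energy

module Groups where
 open Sums

 record FiniteGroup : Set₁ where
   infixl 7 _∙_
   infix  8 _⁻¹
   field
     G      : Set
     _∙_    : G → G → G
     ε      : G
     _⁻¹    : G → G
     assoc  : ∀ x y z → (x ∙ y) ∙ z ≡ x ∙ (y ∙ z)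
     idˡ    : ∀ x → ε ∙ x ≡ x
     idʳ    : ∀ x → x ∙ ε ≡ x
     invˡ   : ∀ x → x ⁻¹ ∙ x ≡ ε
     invʳ   : ∀ x → x ∙ x ⁻¹ ≡ ε
     finite : Finite G
   open Finite finite public
   cancelˡ : ∀ x y → x ⁻¹ ∙ (x ∙ y) ≡ y
   cancelˡ x y = trans (sym (assoc _ _ _)) (trans (cong (_∙ y) (invˡ x)) (idˡ y))
   cancelˡ′ : ∀ x y → x ∙ (x ⁻¹ ∙ y) ≡ y
   cancelˡ′ x y = trans (sym (assoc _ _ _)) (trans (cong (_∙ y) (invʳ x)) (idˡ y))
   cancelʳ : ∀ x y → (x ∙ y) ∙ y ⁻¹ ≡ x
   cancelʳ x y = trans (assoc _ _ _) (trans (cong (x ∙_) (invʳ y)) (idʳ x))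
   cancelʳ′ : ∀ x y → (x ∙ y ⁻¹) ∙ y ≡ x
   cancelʳ′ x y = trans (assoc _ _ _) (trans (cong (x ∙_) (invˡ y)) (idʳ x))
   inv-unique : ∀ {x y} → x ∙ y ≡ ε → y ≡ x ⁻¹
   inv-unique {x} {y} e = trans (sym (cancelˡ x y)) (trans (cong (x ⁻¹ ∙_) e) (idʳ _))
   inv-inv : ∀ x → (x ⁻¹) ⁻¹ ≡ x
   inv-inv x = sym (inv-unique (invˡ x))
   inv-∙ : ∀ x y → (x ∙ y) ⁻¹ ≡ y ⁻¹ ∙ x ⁻¹
   inv-∙ x y = sym (inv-unique (trans (assoc _ _ _) (trans (cong (x ∙_) (cancelˡ′ y (x ⁻¹))) (invʳ x))))
   inv-div : ∀ x y → (x ⁻¹ ∙ y) ⁻¹ ≡ y ⁻¹ ∙ x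
   inv-div x y = trans (inv-∙ _ _) (cong (y ⁻¹ ∙_) (inv-inv x))
   ∑-left : ∀ a f → ∑ᴬ (λ g → f (a ∙ g)) ≡ ∑ᴬ f
   ∑-left a = ∑-reindex finite finite (a ∙_) (a ⁻¹ ∙_) (cancelˡ a) (cancelˡ′ a)
   ∑-right : ∀ a f → ∑ᴬ (λ g → f (g ∙ a)) ≡ ∑ᴬ f
   ∑-right a = ∑-reindex finite finite (_∙ a) (_∙ a ⁻¹) (λ g → cancelʳ g a) (λ g → cancelʳ′ g a)
   ∑-inv : ∀ f → ∑ᴬ (λ g → f (g ⁻¹)) ≡ ∑ᴬ f
   ∑-inv = ∑-reindex finite finite _⁻¹ _⁻¹ inv-inv inv-inv
   -- The number of ways to write g as a ⁻¹ ∙ b with a and b in S; the summation variable is a.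
   quotients : (G → Bool) → G → ℕ
   quotients S g = ∑ᴬ (λ a → 𝟙 (S a) ℕ.* 𝟙 (S (a ∙ g)))
   energy : (G → Bool) → ℕ
   energy S = ∑ᴬ (λ g → quotients S g ℕ.* quotients S g)
   ∑-quotients : ∀ S (f : G → ℕ) → ∑ᴬ (λ a → ∑ᴬ (λ b → 𝟙 (S a) ℕ.* 𝟙 (S b) ℕ.* f (a ⁻¹ ∙ b))) ≡ ∑ᴬ (λ g → quotients S g ℕ.* f g)
   ∑-quotients S f = begin
     ∑ᴬ (λ a → ∑ᴬ (λ b → 𝟙 (S a) ℕ.* 𝟙 (S b) ℕ.* f (a ⁻¹ ∙ b)))
       ≡⟨ ∑-cong elems (λ a → sym (∑-left a _)) ⟩
     ∑ᴬ (λ a → ∑ᴬ (λ g → 𝟙 (S a) ℕ.* 𝟙 (S (a ∙ g)) ℕ.* f (a ⁻¹ ∙ (a ∙ g))))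
       ≡⟨ ∑-cong elems (λ a → ∑-cong elems (λ g → cong (λ z → 𝟙 (S a) ℕ.* 𝟙 (S (a ∙ g)) ℕ.* f z) (cancelˡ a g))) ⟩
     ∑ᴬ (λ a → ∑ᴬ (λ g → 𝟙 (S a) ℕ.* 𝟙 (S (a ∙ g)) ℕ.* f g))
       ≡⟨ ∑-swap elems elems _ ⟩
     ∑ᴬ (λ g → ∑ᴬ (λ a → 𝟙 (S a) ℕ.* 𝟙 (S (a ∙ g)) ℕ.* f g))
       ≡⟨ ∑-cong elems (λ g → ∑-*ʳ elems (f g) _) ⟩
     ∑ᴬ (λ g → quotients S g ℕ.* f g) ∎
     where open ≡-Reasoning
   quotients-inv : ∀ S g → quotients S (g ⁻¹) ≡ quotients S g
   quotients-inv S g = trans (sym (∑-right g _)) (∑-cong elems λ a →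
     trans (cong (λ z → 𝟙 (S (a ∙ g)) ℕ.* 𝟙 (S z)) (cancelʳ a g)) (ℕ-comm (𝟙 (S (a ∙ g))) (𝟙 (S a))))
     where open import Data.Nat.Properties renaming (*-comm to ℕ-comm)
   quotients-≤ : ∀ S g → quotients S g ℕ.≤ count S
   quotients-≤ S g = ∑-mono elems λ a → ≤-trans (*-monoʳ-≤ (𝟙 (S a)) (𝟙≤1 (S (a ∙ g)))) (≤-reflexive (*-identityʳ _))
     where open import Data.Nat.Properties
   ∑-quotients-total : ∀ S → ∑ᴬ (quotients S) ≡ count S ℕ.* count S
   ∑-quotients-total S = trans (∑-swap elems elems _) (trans (∑-cong elems λ a → trans (∑-*ˡ elems (𝟙 (S a)) _) (cong (𝟙 (S a) ℕ.*_) (∑-left a _))) (∑-*ʳ elems (count S) _))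

open Groups

-- Inequalities up to powers of the parameter K

module Calculus (K : ℕ) (4≤K : 4 ≤ K) where
 open import Data.Nat using (_+_; _*_; _^_; >-nonZero)

 open import Data.Nat.Properties
 import Data.Empty
 import Data.Sum
 open Arith

 infix 4 _≲[_]_

 -- The exponent c replaces an implied constant. It is explicit because the size of `K` against p is
 -- computed from the largest exponents that occur; numerical factors are absorbed through 4 ≤ `K`.
 record _≲[_]_ (a c b : ℕ) : Set where
   constructor mk
   field le : a ≤ K ^ c * b
 open _≲[_]_ public

 private
   pos : ∀ c → 1 ≤ K ^ c
   pos zero    = ≤-refl
   pos (suc c) = *-mono-≤ (≤-trans (s≤s z≤n) 4≤K) (pos c)

 ≲-≤ : ∀ {a b} → a ≤ b → a ≲[ 0 ] b
 ≲-≤ {b = b} h = mk (≤-trans h (≤-reflexive (sym (*-identityˡ b))))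

 ≲-trans : ∀ {a b d c c'} → a ≲[ c ] b → b ≲[ c' ] d → a ≲[ c + c' ] d
 ≲-trans {a} {b} {d} {c} {c'} (mk h) (mk h') = mk (≤-trans h (≤-trans (*-monoʳ-≤ (K ^ c) h')
   (≤-reflexive (trans (sym (*-assoc (K ^ c) (K ^ c') d)) (cong (_* d) (sym (^-distribˡ-+-* K c c')))))))

 ≲-* : ∀ {a b a' b' c c'} → a ≲[ c ] b → a' ≲[ c' ] b' → a * a' ≲[ c + c' ] b * b'
 ≲-* {b = b} {b' = b'} {c} {c'} (mk h) (mk h') = mk (≤-trans (*-mono-≤ h h') (≤-reflexive
   (trans (solveℕ 4 (λ x b y d → x ⊗ b ⊗ (y ⊗ d) ⊜ x ⊗ y ⊗ (b ⊗ d)) refl (K ^ c) b (K ^ c') b') (cong (_* (b * b')) (sym (^-distribˡ-+-* K c c'))))))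

 ≲-weaken : ∀ {a b c c'} → c ≤ c' → a ≲[ c ] b → a ≲[ c' ] b
 ≲-weaken {b = b} h (mk h') = mk (≤-trans h' (*-monoˡ-≤ b (^-monoʳ-≤ K {{>-nonZero (≤-trans (s≤s z≤n) 4≤K)}} h)))

 ≲-cancel : ∀ {a b c x} → 0 < x → a * x ≲[ c ] b * x → a ≲[ c ] b
 ≲-cancel {a} {b} {c} {x} h (mk h') = mk (*-cancelʳ-≤ _ _ x {{>-nonZero h}} (≤-trans h' (≤-reflexive (sym (*-assoc (K ^ c) b x)))))

 ≲-4 : ∀ {a b c} → a ≲[ c ] b → 4 * a ≲[ suc c ] b
 ≲-4 {b = b} {c} (mk h) = mk (≤-trans (*-mono-≤ 4≤K h) (≤-reflexive (sym (*-assoc K (K ^ c) b))))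

 ≲-2 : ∀ {a b c} → a ≲[ c ] b → 2 * a ≲[ suc c ] b
 ≲-2 {a} h = mk (≤-trans (*-monoˡ-≤ a {2} {4} (s≤s (s≤s z≤n))) (le (≲-4 h)))

 ≤-≲ : ∀ {a b d c} → a ≤ b → b ≲[ c ] d → a ≲[ c ] d
 ≤-≲ h (mk h') = mk (≤-trans h h')

 ≲-≤ʳ : ∀ {a b d c} → a ≲[ c ] b → b ≤ d → a ≲[ c ] d
 ≲-≤ʳ {c = c} (mk h) h' = mk (≤-trans h (*-monoʳ-≤ (K ^ c) h'))

 squares-≤ : ∀ {a b} → a * a ≤ b * b → a ≤ b
 squares-≤ {a} {b} h with ≤-<-connex a b
 ... | Data.Sum.inj₁ l = l
 ... | Data.Sum.inj₂ l = Data.Empty.⊥-elim (<-irrefl refl (<-≤-trans (*-mono-< l l) h))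

 ≲-sqrt : ∀ {a b} c → a * a ≲[ c + c ] b * b → a ≲[ c ] b
 ≲-sqrt {a} {b} c (mk h) = mk (squares-≤ (≤-trans h (≤-reflexive (trans (cong (_* (b * b)) (^-distribˡ-+-* K c c))
   (solveℕ 2 (λ k b → k ⊗ k ⊗ (b ⊗ b) ⊜ k ⊗ b ⊗ (k ⊗ b)) refl (K ^ c) b)))))

-- The Balog-Szemerédi-Gowers theorem in a finite group

module BSG (𝔾 : FiniteGroup) (K : ℕ) (4≤K : 4 ≤ K) where
 open FiniteGroup 𝔾
 open import Data.Nat using (_+_; _*_; _^_; _≤ᵇ_; >-nonZero)
 open import Data.Nat.Properties hiding (_≟_)
 open Arith
 open Sums hiding (interchange)
 open Calculus K 4≤K

 opaque
   quotientSet : (G → Bool) → G → Bool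
   quotientSet A g = any (λ a → A a ∧ A (a ∙ g)) elems
   quotientSet-intro : ∀ A g a → A a ≡ true → A (a ∙ g) ≡ true → quotientSet A g ≡ true
   quotientSet-intro A g a h h' = any-intro (λ a → A a ∧ A (a ∙ g)) a (∧-intro h h')
   quotientSet-elim : ∀ A g → quotientSet A g ≡ true → ∃ λ a → A a ≡ true × A (a ∙ g) ≡ true
   quotientSet-elim A g h with any-true (λ a → A a ∧ A (a ∙ g)) elems h
   ... | a , h' = a , ∧-true h'

 private
   k : ℕ
   k = K
   instance
     k≢0 : ℕ.NonZero K
     k≢0 = >-nonZero (≤-trans (s≤s z≤n) 4≤K)

 module _ (S : G → Bool) (0<N : 0 < count S) (energetic : count S * count S * count S ≤ K * energy S) where
   private
     N = count S
     r = quotients S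
     opaque
       -- Popular quotients. Those with r g below N/K² contribute at most N³/K² to the energy, less
       -- than half of it, so the popular ones carry the rest.
       D : G → Bool
       D g = N ≤ᵇ K * K * r g
       D-def : ∀ g → D g ≡ (N ≤ᵇ K * K * r g)
       D-def g = refl
       D-inv : ∀ g → D (g ⁻¹) ≡ D g
       D-inv g = cong (λ z → N ≤ᵇ K * K * z) (quotients-inv S g)
     M : ℕ
     M = ∑ᴬ (λ g → r g * 𝟙 (D g))
     N²≤K²M : N * N ≤ K * K * M
     N²≤K²M = *-cancelˡ-≤ N {{>-nonZero 0<N}} (+-cancelʳ-≤ (N * (N * N)) _ _ (begin
       N * (N * N) + N * (N * N) ≡⟨ solveℕ 1 (λ n → n ⊗ (n ⊗ n) ⊕ n ⊗ (n ⊗ n) ⊜ # 2 ⊗ (n ⊗ n ⊗ n)) refl N ⟩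
       2 * (N * N * N)           ≤⟨ *-mono-≤ (≤-trans (s≤s (s≤s z≤n)) 4≤K) energetic ⟩
       K * (K * energy S)        ≡⟨ *-assoc K K _ ⟨
       K * K * energy S          ≡⟨ ∑-*ˡ elems (K * K) _ ⟨
       ∑ᴬ (λ g → K * K * (r g * r g)) ≤⟨ ∑-mono elems bound ⟩
       ∑ᴬ (λ g → N * (K * K) * (r g * 𝟙 (D g)) + N * r g) ≡⟨ ∑-+ elems _ _ ⟩
       ∑ᴬ (λ g → N * (K * K) * (r g * 𝟙 (D g))) + ∑ᴬ (λ g → N * r g) ≡⟨ cong₂ _+_ (∑-*ˡ elems (N * (K * K)) _) (trans (∑-*ˡ elems N _) (cong (N *_) (∑-quotients-total S))) ⟩
       N * (K * K) * M + N * (N * N) ≡⟨ cong (_+ N * (N * N)) (*-assoc N (K * K) M) ⟩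
       N * (K * K * M) + N * (N * N) ∎))
       where
       open ≤-Reasoning
       bound : ∀ g → K * K * (r g * r g) ≤ N * (K * K) * (r g * 𝟙 (D g)) + N * r g
       bound g with D g in e
       ... | true  = ≤-trans (*-monoʳ-≤ (K * K) (*-monoˡ-≤ (r g) (quotients-≤ S g))) (≤-trans (≤-reflexive (solveℕ 3 (λ k n r → k ⊗ k ⊗ (n ⊗ r) ⊜ n ⊗ (k ⊗ k) ⊗ (r ⊗ # 1)) refl K N (r g))) (m≤m+n _ _))
       ... | false = ≤-trans (≤-reflexive (sym (*-assoc (K * K) (r g) (r g)))) (≤-trans (*-monoˡ-≤ (r g) {K * K * r g} {N} (<⇒≤ (≤ᵇ-false {N} {K * K * r g} (trans (sym (D-def g)) e)))) (m≤n+m _ _))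
     D≲N : count D ≲[ 2 ] N
     D≲N = ≲-cancel 0<N (mk (begin
       count D * N                   ≡⟨ ∑-*ʳ elems N _ ⟨
       ∑ᴬ (λ g → 𝟙 (D g) * N)        ≤⟨ ∑-mono elems (λ g → bound g) ⟩
       ∑ᴬ (λ g → K * K * r g)        ≡⟨ trans (∑-*ˡ elems (K * K) r) (cong (K * K *_) (∑-quotients-total S)) ⟩
       K * K * (N * N)               ≡⟨ cong (λ z → K * z * (N * N)) (*-identityʳ K) ⟨
       K ^ 2 * (N * N)               ∎))
       where
       open ≤-Reasoning
       bound : ∀ g → 𝟙 (D g) * N ≤ K * K * r g
       bound g with D g in e
       ... | true  = ≤-trans (≤-reflexive (*-identityˡ N)) (≤ᵇ-true (trans (sym (D-def g)) e))
       ... | false = z≤n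
     opaque
       -- The graph on S that joins a and b when their quotient is popular; by `N²≤K²M` it has at
       -- least N²/K² ordered edges.
       Γ : G → G → Bool
       Γ a b = S a ∧ (S b ∧ D (a ⁻¹ ∙ b))
       Γ-def : ∀ a b → Γ a b ≡ S a ∧ (S b ∧ D (a ⁻¹ ∙ b))
       Γ-def a b = refl
     γ : G → G → ℕ
     γ a b = 𝟙 (Γ a b)
     Γ-sym : ∀ a b → Γ a b ≡ true → Γ b a ≡ true
     Γ-sym a b h with ∧-true {S a} (trans (sym (Γ-def a b)) h)
     ... | sa , h' with ∧-true {S b} h'
     ...   | sb , d = trans (Γ-def b a) (∧-intro sb (∧-intro sa (trans (cong D (sym (inv-div a b))) (trans (D-inv _) d))))
     Γ-false : ∀ a b → S a ≡ false → γ a b ≡ 0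
     Γ-false a b e = cong 𝟙 (trans (Γ-def a b) (cong (_∧ (S b ∧ D (a ⁻¹ ∙ b))) e))
     γ-sym : ∀ a b → γ a b ≡ γ b a
     γ-sym a b = cong 𝟙 (≡-iff (Γ-sym a b) (Γ-sym b a))
     γ-form : ∀ a b → γ a b ≡ 𝟙 (S a) * 𝟙 (S b) * 𝟙 (D (a ⁻¹ ∙ b))
     γ-form a b = trans (trans (cong 𝟙 (Γ-def a b)) (𝟙-∧ (S a) _)) (trans (cong (𝟙 (S a) *_) (𝟙-∧ (S b) _)) (sym (*-assoc (𝟙 (S a)) _ _)))
     d : G → ℕ
     d v = ∑ᴬ (γ v)
     ∑d≡M : ∑ᴬ d ≡ M
     ∑d≡M = trans (∑-cong elems λ a → ∑-cong elems (γ-form a)) (∑-quotients S (λ g → 𝟙 (D g)))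
     S-d : ∀ v → 𝟙 (S v) * d v ≡ d v
     S-d v = go (S v) refl
       where
       go : ∀ b → S v ≡ b → 𝟙 b * d v ≡ d v
       go true  e = +-identityʳ _
       go false e = sym (trans (∑-cong elems λ b → Γ-false v b e) (∑-0 elems))
     M²≤N∑d² : M * M ≤ N * ∑ᴬ (λ v → d v * d v)
     M²≤N∑d² = subst₂ _≤_ (cong₂ _*_ e e) (cong (_* ∑ᴬ (λ v → d v * d v)) (∑-cong elems λ v → 𝟙² (S v)))
       (cauchy-schwarz elems (λ v → 𝟙 (S v)) d)
       where
       e : ∑ᴬ (λ v → 𝟙 (S v) * d v) ≡ M
       e = trans (∑-cong elems S-d) ∑d≡M
     k4 k5 k8 Δ : ℕ
     k4 = K * K * (K * K)
     k5 = K * k4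
     k8 = k4 * k4
     Δ = ∑ᴬ (λ v → d v * d v)
     N³≤K⁴Δ : N * N * N ≤ k4 * Δ
     N³≤K⁴Δ = *-cancelˡ-≤ N {{>-nonZero 0<N}} (begin
       N * (N * N * N)           ≡⟨ solveℕ 1 (λ n → n ⊗ (n ⊗ n ⊗ n) ⊜ n ⊗ n ⊗ (n ⊗ n)) refl N ⟩
       N * N * (N * N)           ≤⟨ *-mono-≤ N²≤K²M N²≤K²M ⟩
       K * K * M * (K * K * M)   ≡⟨ solveℕ 2 (λ q m → q ⊗ m ⊗ (q ⊗ m) ⊜ q ⊗ q ⊗ (m ⊗ m)) refl (K * K) M ⟩
       k4 * (M * M)              ≤⟨ *-monoʳ-≤ k4 M²≤N∑d² ⟩
       k4 * (N * Δ)              ≡⟨ solveℕ 3 (λ q n m → q ⊗ (n ⊗ m) ⊜ n ⊗ (q ⊗ m)) refl k4 N Δ ⟩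
       N * (k4 * Δ)              ∎)
       where open ≤-Reasoning
     codeg : G → G → ℕ
     codeg a c = ∑ᴬ (λ b → γ a b * γ b c)
     opaque
       -- Pairs with at least N/K⁸ common neighbours. Bad pairs have fewer, so together they are
       -- joined by at most N³/K⁸ paths of length two, while the graph has at least N³/K⁴ such
       -- paths.
       good : G → G → Bool
       good a c = N ≤ᵇ k8 * codeg a c
       good-def : ∀ a c → good a c ≡ (N ≤ᵇ k8 * codeg a c)
       good-def a c = refl
     bad : G → G → ℕ
     bad a c = 𝟙 (not (good a c))
     badness : G → ℕ
     badness v = ∑ᴬ (λ a → ∑ᴬ (λ c → γ v a * γ v c * bad a c))
     codeg-0ˡ : ∀ a c → S a ≡ false → codeg a c ≡ 0
     codeg-0ˡ a c e = trans (∑-cong elems λ b → cong (_* γ b c) (Γ-false a b e)) (∑-0 elems)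
     codeg-0ʳ : ∀ a c → S c ≡ false → codeg a c ≡ 0
     codeg-0ʳ a c e = trans (∑-cong elems λ b → trans (cong (γ a b *_) (trans (γ-sym b c) (Γ-false c b e))) (*-zeroʳ (γ a b))) (∑-0 elems)
     codeg-bad : ∀ a c → k8 * (bad a c * codeg a c) ≤ 𝟙 (S a) * (𝟙 (S c) * N)
     codeg-bad a c = go (S a) (S c) (good a c) refl refl refl
       where
       none : ∀ {n} → codeg a c ≡ 0 → k8 * (bad a c * codeg a c) ≤ n
       none e = ≤-trans (≤-reflexive (trans (cong (λ z → k8 * (bad a c * z)) e) (trans (cong (k8 *_) (*-zeroʳ (bad a c))) (*-zeroʳ k8)))) z≤n
       go : ∀ x y z → S a ≡ x → S c ≡ y → good a c ≡ z → k8 * (bad a c * codeg a c) ≤ 𝟙 x * (𝟙 y * N)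
       go false y     z     ea ec eg = none (codeg-0ˡ a c ea)
       go true  false z     ea ec eg = none (codeg-0ʳ a c ec)
       go true  true  true  ea ec eg = ≤-trans (≤-reflexive (trans (cong (λ z → k8 * (𝟙 (not z) * codeg a c)) eg) (*-zeroʳ k8))) z≤n
       go true  true  false ea ec eg = ≤-trans (≤-reflexive (trans (cong (λ z → k8 * (𝟙 (not z) * codeg a c)) eg) (cong (k8 *_) (*-identityˡ _))))
         (≤-trans (<⇒≤ (≤ᵇ-false (trans (sym (good-def a c)) eg))) (≤-reflexive (solveℕ 1 (λ n → n ⊜ # 1 ⊗ (# 1 ⊗ n)) refl N)))
     ∑badness : k8 * ∑ᴬ badness ≤ N * N * N
     ∑badness = begin
       k8 * ∑ᴬ badness
         ≡⟨ cong (k8 *_) (trans (∑-swap elems elems _) (∑-cong elems λ a → ∑-swap elems elems _)) ⟩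
       k8 * ∑ᴬ (λ a → ∑ᴬ (λ c → ∑ᴬ (λ v → γ v a * γ v c * bad a c)))
         ≡⟨ cong (k8 *_) (∑-cong elems λ a → ∑-cong elems λ c → trans (∑-*ʳ elems (bad a c) _) (trans (cong (_* bad a c) (∑-cong elems λ v → cong (_* γ v c) (γ-sym v a))) (*-comm _ (bad a c)))) ⟩
       k8 * ∑ᴬ (λ a → ∑ᴬ (λ c → bad a c * codeg a c))
         ≡⟨ trans (sym (∑-*ˡ elems k8 _)) (∑-cong elems λ a → sym (∑-*ˡ elems k8 _)) ⟩
       ∑ᴬ (λ a → ∑ᴬ (λ c → k8 * (bad a c * codeg a c)))
         ≤⟨ ∑-mono elems (λ a → ∑-mono elems (codeg-bad a)) ⟩
       ∑ᴬ (λ a → ∑ᴬ (λ c → 𝟙 (S a) * (𝟙 (S c) * N)))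
         ≡⟨ trans (∑-cong elems λ a → trans (∑-*ˡ elems (𝟙 (S a)) _) (cong (𝟙 (S a) *_) (∑-*ʳ elems N _))) (∑-*ʳ elems (N * N) _) ⟩
       N * (N * N) ≡⟨ *-assoc N N N ⟨
       N * N * N ∎
       where open ≤-Reasoning
     -- Two defects are averaged at once: the first summand makes bad pairs rare among the
     -- neighbours of v, and the second one forces the degree of v to be large.
     centre : ∃ λ v → k8 * badness v + 𝟙 (S v) * (N * N) < k5 * (d v * d v)
     centre = ∑-exists elems _ _ (begin-strict
       ∑ᴬ (λ v → k8 * badness v + 𝟙 (S v) * (N * N))  ≡⟨ trans (∑-+ elems _ _) (cong₂ _+_ (∑-*ˡ elems k8 badness) (∑-*ʳ elems (N * N) _)) ⟩
       k8 * ∑ᴬ badness + N * (N * N)                  ≤⟨ +-mono-≤ (≤-trans ∑badness N³≤K⁴Δ) (≤-trans (≤-reflexive (sym (*-assoc N N N))) N³≤K⁴Δ) ⟩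
       k4 * Δ + k4 * Δ                                ≡⟨ cong (k4 * Δ +_) (+-identityʳ _) ⟨
       2 * (k4 * Δ)                                   <⟨ *-monoˡ-< (k4 * Δ) {{>-nonZero (<-≤-trans (*-mono-< (*-mono-< 0<N 0<N) 0<N) N³≤K⁴Δ)}} (≤-trans (s≤s (s≤s (s≤s z≤n))) 4≤K) ⟩
       K * (k4 * Δ)                                   ≡⟨ *-assoc K k4 Δ ⟨
       k5 * Δ                                         ≡⟨ ∑-*ˡ elems k5 _ ⟨
       ∑ᴬ (λ v → k5 * (d v * d v)) ∎)
       where open ≤-Reasoning
     opaque
       v : G
       v = proj₁ centre
       v-def : k8 * badness v + 𝟙 (S v) * (N * N) < k5 * (d v * d v)
       v-def = proj₂ centre
     n₁ : ℕ
     n₁ = d v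
     badness-small : K * K * K * badness v < n₁ * n₁
     badness-small = *-cancelˡ-< k5 _ _ (≤-trans (s≤s (≤-trans (≤-reflexive (solveℕ 2 (λ k b → k ⊗ (k ⊗ k ⊗ (k ⊗ k)) ⊗ (k ⊗ k ⊗ k ⊗ b) ⊜ k ⊗ k ⊗ (k ⊗ k) ⊗ (k ⊗ k ⊗ (k ⊗ k)) ⊗ b) refl K (badness v))) (m≤m+n _ _))) v-def)
     0<n₁ : 0 < n₁
     0<n₁ = positive n₁ badness-small
       where
       positive : ∀ n {b} → b < n * n → 0 < n
       positive (suc n) _ = s≤s z≤n
     N≲n₁ : N ≲[ 3 ] n₁
     N≲n₁ = ≲-sqrt 3 (mk (≤-trans (≤-reflexive (sym (trans (cong (_* (N * N)) Sv) (*-identityˡ _)))) (≤-trans (m≤n+m _ _) (≤-trans (<⇒≤ v-def)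
       (≤-trans (≤-reflexive (cong (_* (n₁ * n₁)) (solveℕ 1 (λ k → k ⊗ (k ⊗ k ⊗ (k ⊗ k)) ⊜ k ⊗ (k ⊗ (k ⊗ (k ⊗ (k ⊗ # 1))))) refl K))) (*-monoˡ-≤ (n₁ * n₁) (^-monoʳ-≤ K (n≤1+n 5))))))))
       where
       Sv : 𝟙 (S v) ≡ 1
       Sv = go (S v) refl
         where
         go : ∀ b → S v ≡ b → 𝟙 b ≡ 1
         go true  e = refl
         go false e = ⊥-elim (<-irrefl refl (<-≤-trans 0<n₁ (≤-reflexive (trans (sym (S-d v)) (cong (λ z → 𝟙 z * d v) e)))))
     degBad : G → ℕ
     degBad a = ∑ᴬ (λ c → γ v c * bad a c)
     opaque
       few : G → Bool
       few a = K * degBad a ≤ᵇ n₁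
       few-def : ∀ a → few a ≡ (K * degBad a ≤ᵇ n₁)
       few-def a = refl
     -- Neighbours of the centre that form a bad pair with at most a K-th part of all neighbours. By
     -- Markov's inequality at least half of the neighbours qualify.
     A : G → Bool
     A a = Γ v a ∧ few a
     n₁≤2A : n₁ ≤ 2 * count A
     n₁≤2A = *-cancelˡ-≤ (K * K) {{m*n≢0 K K}} (begin
       K * K * n₁                              ≡⟨ cong (K * K *_) split ⟩
       K * K * (count A + exc)                 ≡⟨ *-distribˡ-+ (K * K) _ _ ⟩
       K * K * count A + K * K * exc           ≤⟨ +-monoʳ-≤ _ excess ⟩
       K * K * count A + n₁                    ≡⟨ cong (K * K * count A +_) split ⟩
       K * K * count A + (count A + exc)       ≤⟨ +-monoʳ-≤ (K * K * count A) (+-monoʳ-≤ (count A) small) ⟩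
       K * K * count A + (count A + count A)   ≤⟨ +-monoʳ-≤ _ (≤-trans (≤-reflexive (cong (count A +_) (sym (+-identityʳ _)))) (*-monoˡ-≤ (count A) {2} {K * K} (*-mono-≤ (≤-trans (s≤s (s≤s z≤n)) 4≤K) (≤-trans (s≤s z≤n) 4≤K)))) ⟩
       K * K * count A + K * K * count A       ≡⟨ solveℕ 2 (λ q a → q ⊗ a ⊕ q ⊗ a ⊜ q ⊗ (# 2 ⊗ a)) refl (K * K) (count A) ⟩
       K * K * (2 * count A)                   ∎)
       where
       open ≤-Reasoning
       exc = ∑ᴬ (λ a → γ v a * 𝟙 (not (few a)))
       split : n₁ ≡ count A + exc
       split = trans (∑-cong elems e) (∑-+ elems _ _)
         where
         e : ∀ a → γ v a ≡ 𝟙 (A a) + γ v a * 𝟙 (not (few a))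
         e a with Γ v a | few a
         ... | true  | true  = refl
         ... | true  | false = refl
         ... | false | _     = refl
       excess : K * K * exc ≤ n₁
       excess = *-cancelʳ-≤ _ _ n₁ {{>-nonZero 0<n₁}} (begin
         K * K * exc * n₁          ≡⟨ *-assoc (K * K) exc n₁ ⟩
         K * K * (exc * n₁)        ≡⟨ cong (K * K *_) (∑-*ʳ elems n₁ _) ⟨
         K * K * ∑ᴬ (λ a → γ v a * 𝟙 (not (few a)) * n₁) ≤⟨ *-monoʳ-≤ (K * K) (∑-mono elems pointwise) ⟩
         K * K * ∑ᴬ (λ a → K * (γ v a * degBad a))       ≡⟨ cong (K * K *_) (trans (∑-*ˡ elems K _) (cong (K *_) (∑-cong elems λ a → trans (sym (∑-*ˡ elems (γ v a) _)) (∑-cong elems λ c → sym (*-assoc (γ v a) _ _))))) ⟩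
         K * K * (K * badness v)   ≡⟨ *-assoc (K * K) K _ ⟨
         K * K * K * badness v     ≤⟨ <⇒≤ badness-small ⟩
         n₁ * n₁ ∎)
         where
         pointwise : ∀ a → γ v a * 𝟙 (not (few a)) * n₁ ≤ K * (γ v a * degBad a)
         pointwise a with few a in e
         ... | true  = ≤-trans (≤-reflexive (cong (_* n₁) (*-zeroʳ (γ v a)))) z≤n
         ... | false = ≤-trans (*-monoʳ-≤ (γ v a * 1) (<⇒≤ (≤ᵇ-false (trans (sym (few-def a)) e)))) (≤-reflexive (solveℕ 3 (λ g k d → g ⊗ # 1 ⊗ (k ⊗ d) ⊜ k ⊗ (g ⊗ d)) refl (γ v a) K (degBad a)))
       small : exc ≤ count A
       small = +-cancelʳ-≤ exc _ _ (begin
         exc + exc      ≡⟨ cong (exc +_) (+-identityʳ exc) ⟨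
         2 * exc        ≤⟨ *-monoˡ-≤ exc {2} {K * K} (*-mono-≤ (≤-trans (s≤s (s≤s z≤n)) 4≤K) (≤-trans (s≤s z≤n) 4≤K)) ⟩
         K * K * exc    ≤⟨ excess ⟩
         n₁             ≡⟨ split ⟩
         count A + exc  ∎)
     R₂ : G → ℕ
     R₂ g = ∑ᴬ (λ x → 𝟙 (D x) * 𝟙 (D (x ⁻¹ ∙ g)))
     opaque
       -- Elements with at least N/K⁸ factorisations into two popular quotients. Quotients of good
       -- pairs are such elements, and there are at most K¹²·N of them, as K²·N bounds the popular
       -- quotients.
       R : G → Bool
       R g = N ≤ᵇ k8 * R₂ g
       R-def : ∀ g → R g ≡ (N ≤ᵇ k8 * R₂ g)
       R-def g = refl
     R₂-inv : ∀ g → R₂ (g ⁻¹) ≡ R₂ g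
     R₂-inv g = trans (sym (∑-left (g ⁻¹) _)) (∑-cong elems λ x → trans (cong₂ _*_ (cong 𝟙 (trans (sym (D-inv _)) (cong D (inv-div g x)))) (cong 𝟙 (e x))) (*-comm (𝟙 (D (x ⁻¹ ∙ g))) (𝟙 (D x))))
       where
       e : ∀ x → D ((g ⁻¹ ∙ x) ⁻¹ ∙ g ⁻¹) ≡ D x
       e x = trans (cong D (trans (cong (_∙ g ⁻¹) (inv-div g x)) (cancelʳ (x ⁻¹) g))) (D-inv x)
     R-inv : ∀ c b → R (b ⁻¹ ∙ c) ≡ R (c ⁻¹ ∙ b)
     R-inv c b = trans (R-def _) (trans (cong (λ z → N ≤ᵇ k8 * z) (trans (cong R₂ (sym (inv-div c b))) (R₂-inv (c ⁻¹ ∙ b)))) (sym (R-def _)))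
     good⇒R : ∀ a c → good a c ≡ true → R (a ⁻¹ ∙ c) ≡ true
     good⇒R a c h = trans (R-def _) (≤ᵇ-intro {N} {k8 * R₂ (a ⁻¹ ∙ c)} (≤-trans (≤ᵇ-true {N} {k8 * codeg a c} (trans (sym (good-def a c)) h)) (*-monoʳ-≤ k8 (begin
       codeg a c ≤⟨ ∑-mono elems (λ b → *-mono-≤ (γ≤D a b) (γ≤D b c)) ⟩
       ∑ᴬ (λ b → 𝟙 (D (a ⁻¹ ∙ b)) * 𝟙 (D (b ⁻¹ ∙ c))) ≡⟨ ∑-left a _ ⟨
       ∑ᴬ (λ x → 𝟙 (D (a ⁻¹ ∙ (a ∙ x))) * 𝟙 (D ((a ∙ x) ⁻¹ ∙ c))) ≡⟨ ∑-cong elems (λ x → cong₂ (λ y z → 𝟙 (D y) * 𝟙 (D z)) (cancelˡ a x) (trans (cong (_∙ c) (inv-∙ a x)) (assoc _ _ _))) ⟩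
       R₂ (a ⁻¹ ∙ c) ∎))))
       where
       open ≤-Reasoning
       γ≤D : ∀ a b → γ a b ≤ 𝟙 (D (a ⁻¹ ∙ b))
       γ≤D a b = 𝟙-mono λ h → proj₂ (∧-true {S b} (proj₂ (∧-true {S a} (trans (sym (Γ-def a b)) h))))
     R≲N : count R ≲[ 12 ] N
     R≲N = ≲-cancel 0<N (≲-trans {b = count D * count D} {c = 8} (mk (begin
       count R * N             ≡⟨ ∑-*ʳ elems N _ ⟨
       ∑ᴬ (λ g → 𝟙 (R g) * N)  ≤⟨ ∑-mono elems bound ⟩
       ∑ᴬ (λ g → k8 * R₂ g)    ≡⟨ ∑-*ˡ elems k8 R₂ ⟩
       k8 * ∑ᴬ R₂              ≡⟨ cong (k8 *_) (trans (∑-swap elems elems _) (trans (∑-cong elems λ x → trans (∑-*ˡ elems (𝟙 (D x)) _) (cong (𝟙 (D x) *_) (∑-left (x ⁻¹) _))) (∑-*ʳ elems (count D) _))) ⟩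
       k8 * (count D * count D) ≡⟨ cong (_* (count D * count D)) (solveℕ 1 (λ k → k ⊗ k ⊗ (k ⊗ k) ⊗ (k ⊗ k ⊗ (k ⊗ k)) ⊜ k ⊗ (k ⊗ (k ⊗ (k ⊗ (k ⊗ (k ⊗ (k ⊗ (k ⊗ # 1)))))))) refl K) ⟩
       K ^ 8 * (count D * count D) ∎)) (≲-* D≲N D≲N))
       where
       open ≤-Reasoning
       bound : ∀ g → 𝟙 (R g) * N ≤ k8 * R₂ g
       bound g with R g in e
       ... | true  = ≤-trans (≤-reflexive (*-identityˡ N)) (≤ᵇ-true (trans (sym (R-def g)) e))
       ... | false = z≤n
     Q = quotientSet A
     -- Two elements a and c of `A` are each bad with at most a quarter of the neighbours of the
     -- centre, so at least half of the neighbours b are good with both, and each b splits a ⁻¹ ∙ c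
     -- into two elements of `R`. Counting these factorisations bounds the quotient set.
     many-paths : ∀ g → Q g ≡ true → n₁ ≤ 2 * ∑ᴬ (λ y → 𝟙 (R y) * 𝟙 (R (y ⁻¹ ∙ g)))
     many-paths g h with quotientSet-elim A g h
     ... | a , ha , hc = +-cancelʳ-≤ n₁ _ _ (begin
       n₁ + n₁                    ≡⟨ cong (n₁ +_) (+-identityʳ n₁) ⟨
       2 * n₁                     ≤⟨ *-monoʳ-≤ 2 (begin
           n₁ ≤⟨ ∑-mono elems split ⟩
           ∑ᴬ (λ b → P b + (γ v b * bad a b + γ v b * bad c b)) ≡⟨ trans (∑-+ elems _ _) (cong (∑ᴬ P +_) (∑-+ elems _ _)) ⟩
           ∑ᴬ P + (degBad a + degBad c) ∎) ⟩
       2 * (∑ᴬ P + (degBad a + degBad c)) ≡⟨ solveℕ 3 (λ p x y → # 2 ⊗ (p ⊕ (x ⊕ y)) ⊜ # 2 ⊗ p ⊕ # 2 ⊗ (x ⊕ y)) refl (∑ᴬ P) (degBad a) (degBad c) ⟩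
       2 * ∑ᴬ P + 2 * (degBad a + degBad c) ≤⟨ +-mono-≤ (*-monoʳ-≤ 2 (≤-reflexive shifted)) small ⟩
       2 * ∑ᴬ (λ y → 𝟙 (R y) * 𝟙 (R (y ⁻¹ ∙ g))) + n₁ ∎)
       where
       open ≤-Reasoning
       c = a ∙ g
       P : G → ℕ
       P b = 𝟙 (R (a ⁻¹ ∙ b)) * 𝟙 (R (b ⁻¹ ∙ c))
       shifted : ∑ᴬ P ≡ ∑ᴬ (λ y → 𝟙 (R y) * 𝟙 (R (y ⁻¹ ∙ g)))
       shifted = trans (sym (∑-left a P)) (∑-cong elems λ y → cong₂ (λ y z → 𝟙 (R y) * 𝟙 (R z)) (cancelˡ a y)
         (trans (cong (_∙ c) (inv-∙ a y)) (trans (assoc _ _ _) (cong (y ⁻¹ ∙_) (cancelˡ a g)))))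
       small : 2 * (degBad a + degBad c) ≤ n₁
       small = *-cancelˡ-≤ 2 (begin
         2 * (2 * (degBad a + degBad c)) ≡⟨ solveℕ 2 (λ x y → # 2 ⊗ (# 2 ⊗ (x ⊕ y)) ⊜ # 4 ⊗ x ⊕ # 4 ⊗ y) refl (degBad a) (degBad c) ⟩
         4 * degBad a + 4 * degBad c     ≤⟨ +-mono-≤ (4deg a ha) (4deg c hc) ⟩
         n₁ + n₁                         ≡⟨ cong (n₁ +_) (+-identityʳ n₁) ⟨
         2 * n₁ ∎)
         where
         4deg : ∀ a → A a ≡ true → 4 * degBad a ≤ n₁
         4deg a h = ≤-trans (*-monoˡ-≤ (degBad a) 4≤K) (≤ᵇ-true (trans (sym (few-def a)) (proj₂ (∧-true {Γ v a} h))))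
       split : ∀ b → γ v b ≤ P b + (γ v b * bad a b + γ v b * bad c b)
       split b with Γ v b | good a b in ea | good c b in ec
       ... | false | _     | _     = z≤n
       ... | true  | false | _     = ≤-trans (s≤s z≤n) (m≤n+m _ (P b))
       ... | true  | true  | false = ≤-trans (≤-reflexive refl) (m≤n+m _ (P b))
       ... | true  | true  | true  rewrite good⇒R a b ea | trans (R-inv c b) (good⇒R c b ec) = s≤s z≤n
     Q≲n₁ : count Q ≲[ 31 ] n₁
     Q≲n₁ = ≲-cancel 0<n₁ (≲-trans {b = N * N} {c = 25} (≤-≲ (begin
       count Q * n₁            ≡⟨ ∑-*ʳ elems n₁ _ ⟨
       ∑ᴬ (λ g → 𝟙 (Q g) * n₁) ≤⟨ ∑-mono elems (λ g → ≤-trans (𝟙*-≤ (Q g) (many-paths g)) (𝟙*≤ (Q g) _)) ⟩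
       ∑ᴬ (λ g → 2 * ∑ᴬ (λ y → 𝟙 (R y) * 𝟙 (R (y ⁻¹ ∙ g)))) ≡⟨ ∑-*ˡ elems 2 _ ⟩
       2 * ∑ᴬ (λ g → ∑ᴬ (λ y → 𝟙 (R y) * 𝟙 (R (y ⁻¹ ∙ g)))) ≡⟨ cong (2 *_) (trans (∑-swap elems elems _) (trans (∑-cong elems λ x → trans (∑-*ˡ elems (𝟙 (R x)) _) (cong (𝟙 (R x) *_) (∑-left (x ⁻¹) _))) (∑-*ʳ elems (count R) _))) ⟩
       2 * (count R * count R) ∎) (≲-2 (≲-* R≲N R≲N))) (≲-* N≲n₁ N≲n₁))
       where open ≤-Reasoning
   -- The degree `n₁` of the centre has been compared with N and with the quotient set; replacing it
   -- by `count A`, which is at least half as large, costs the last factor `K`.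
   balog-szemerédi-gowers : Σ (G → Bool) λ A → (∀ g → A g ≡ true → S g ≡ true) × (N ≲[ 4 ] count A) × (count (quotientSet A) ≲[ 32 ] count A)
   balog-szemerédi-gowers = A , (λ g h → proj₁ (∧-true (proj₂ (∧-true {S v} (trans (sym (Γ-def v g)) (proj₁ (∧-true {Γ v g} h))))))) ,
     ≲-trans N≲n₁ n₁≲A , ≲-trans Q≲n₁ n₁≲A
     where
     n₁≲A : n₁ ≲[ 1 ] count A
     n₁≲A = ≤-≲ n₁≤2A (≲-2 (≲-≤ ≤-refl))

-- Popular quotients of a set with few quotients, and their product sets

module Popular (𝔾 : FiniteGroup) (K : ℕ) (4≤K : 4 ≤ K) where
 open FiniteGroup 𝔾
 open import Data.Nat using (_+_; _*_; _^_; _≤ᵇ_; >-nonZero)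
 open import Data.Nat.Properties hiding (_≟_)
 open Arith
 open Sums hiding (interchange)
 open Calculus K 4≤K
 open BSG 𝔾 K 4≤K using (quotientSet; quotientSet-intro)

 module PopularQuotients (A : G → Bool) (0<α : 0 < count A) (few-quotients : count (quotientSet A) ≲[ 32 ] count A) where
   α : ℕ
   α = count A
   private
     Q = quotientSet A
   -- Representations s = a ∙ b ⁻¹, on the other side than in `quotientSet`, so that products of
   -- popular elements act on A from the left.
   rep : G → ℕ
   rep s = ∑ᴬ (λ b → 𝟙 (A b) * 𝟙 (A (s ∙ b)))
   opaque
     -- One factor `K` more than the loss in the size of the quotient set: elements with fewer than
     -- α/T representations then carry at most half of the energy of A.
     T : ℕ
     T = K ^ 33
     T≲ : ∀ {a b} → a ≤ T * b → a ≲[ 33 ] b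
     T≲ = mk
     T-def : ∀ {a b} → a ≲[ 32 ] b → K * a ≤ T * b
     T-def {a} {b} (mk h) = ≤-trans (*-monoʳ-≤ K h) (≤-reflexive (sym (*-assoc K (K ^ 32) b)))
     D : G → Bool
     D s = α ≤ᵇ T * rep s
     D-def : ∀ s → D s ≡ (α ≤ᵇ T * rep s)
     D-def s = refl
   rep-inv : ∀ s → rep (s ⁻¹) ≡ rep s
   rep-inv s = trans (sym (∑-left s _)) (∑-cong elems λ b →
     trans (cong (λ z → 𝟙 (A (s ∙ b)) * 𝟙 (A z)) (cancelˡ s b)) (*-comm (𝟙 (A (s ∙ b))) (𝟙 (A b))))
   D-inv : ∀ s → D (s ⁻¹) ≡ D s
   D-inv s = trans (D-def _) (trans (cong (λ z → α ≤ᵇ T * z) (rep-inv s)) (sym (D-def s)))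
   rep-energy : ∑ᴬ (λ s → rep s * rep s) ≡ energy A
   rep-energy = begin
     ∑ᴬ (λ s → rep s * rep s)
       ≡⟨ ∑-cong elems (λ s → ∑-* elems elems _ _) ⟩
     ∑ᴬ (λ s → ∑ᴬ (λ b → ∑ᴬ (λ d → 𝟙 (A b) * 𝟙 (A (s ∙ b)) * (𝟙 (A d) * 𝟙 (A (s ∙ d))))))
       ≡⟨ trans (∑-swap elems elems _) (∑-cong elems λ b → ∑-swap elems elems _) ⟩
     ∑ᴬ (λ b → ∑ᴬ (λ d → ∑ᴬ (λ s → 𝟙 (A b) * 𝟙 (A (s ∙ b)) * (𝟙 (A d) * 𝟙 (A (s ∙ d))))))
       ≡⟨ ∑-cong elems (λ b → ∑-cong elems λ d → trans (∑-cong elems λ s →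
            solveℕ 4 (λ x y z w → x ⊗ y ⊗ (z ⊗ w) ⊜ x ⊗ z ⊗ (y ⊗ w)) refl (𝟙 (A b)) (𝟙 (A (s ∙ b))) (𝟙 (A d)) (𝟙 (A (s ∙ d)))) (∑-*ˡ elems (𝟙 (A b) * 𝟙 (A d)) _)) ⟩
     ∑ᴬ (λ b → ∑ᴬ (λ d → 𝟙 (A b) * 𝟙 (A d) * ∑ᴬ (λ s → 𝟙 (A (s ∙ b)) * 𝟙 (A (s ∙ d)))))
       ≡⟨ ∑-cong elems (λ b → ∑-cong elems λ d → cong (𝟙 (A b) * 𝟙 (A d) *_) (trans (sym (∑-right (b ⁻¹) _))
            (∑-cong elems λ s → cong₂ (λ x y → 𝟙 (A x) * 𝟙 (A y)) (cancelʳ′ s b) (assoc s (b ⁻¹) d)))) ⟩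
     ∑ᴬ (λ b → ∑ᴬ (λ d → 𝟙 (A b) * 𝟙 (A d) * quotients A (b ⁻¹ ∙ d)))
       ≡⟨ ∑-quotients A (quotients A) ⟩
     energy A ∎
     where open ≡-Reasoning
   quotients-supported : ∀ g → 𝟙 (Q g) * quotients A g ≡ quotients A g
   quotients-supported g with Q g in e
   ... | true  = +-identityʳ _
   ... | false = sym (trans (∑-cong elems zero′) (∑-0 elems))
     where
     zero′ : ∀ a → 𝟙 (A a) * 𝟙 (A (a ∙ g)) ≡ 0
     zero′ a = trans (sym (𝟙-∧ (A a) _)) (cong 𝟙 (≢true λ h → true≢false (quotientSet-intro A g a (proj₁ (∧-true {A a} h)) (proj₂ (∧-true {A a} h))) e))
   -- Cauchy-Schwarz on the support: α² pairs are spread over at most K³²·α quotients.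
   α³≲energy : α * α * α ≲[ 32 ] energy A
   α³≲energy = ≲-cancel 0<α (≤-≲ (begin
     α * α * α * α   ≡⟨ *-assoc (α * α) α α ⟩
     α * α * (α * α) ≡⟨ cong₂ _*_ e e ⟩
     ∑ᴬ (λ g → 𝟙 (Q g) * quotients A g) * ∑ᴬ (λ g → 𝟙 (Q g) * quotients A g) ≤⟨ cauchy-schwarz elems (λ g → 𝟙 (Q g)) (quotients A) ⟩
     ∑ᴬ (λ g → 𝟙 (Q g) * 𝟙 (Q g)) * energy A ≡⟨ cong (_* energy A) (∑-cong elems λ g → 𝟙² (Q g)) ⟩
     count Q * energy A ≡⟨ *-comm (count Q) _ ⟩
     energy A * count Q ∎) (≲-* (≲-≤ {energy A} ≤-refl) few-quotients))
     where
     open ≤-Reasoning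
     e : α * α ≡ ∑ᴬ (λ g → 𝟙 (Q g) * quotients A g)
     e = trans (sym (∑-quotients-total A)) (∑-cong elems λ g → sym (quotients-supported g))
   rep-total : ∑ᴬ rep ≡ α * α
   rep-total = trans (∑-swap elems elems _) (trans (∑-cong elems λ b → trans (∑-*ˡ elems (𝟙 (A b)) _) (cong (𝟙 (A b) *_) (∑-right b _))) (∑-*ʳ elems α _))
   rep≤α : ∀ s → rep s ≤ α
   rep≤α s = ∑-mono elems λ b → ≤-trans (*-monoʳ-≤ (𝟙 (A b)) (𝟙≤1 (A (s ∙ b)))) (≤-reflexive (*-identityʳ _))
   α²≤ : α * α ≤ T * ∑ᴬ (λ s → 𝟙 (D s) * rep s)
   α²≤ = *-cancelˡ-≤ α {{>-nonZero 0<α}} (+-cancelʳ-≤ (α * (α * α)) _ _ (begin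
     α * (α * α) + α * (α * α)       ≡⟨ solveℕ 1 (λ n → n ⊗ (n ⊗ n) ⊕ n ⊗ (n ⊗ n) ⊜ # 2 ⊗ (n ⊗ n ⊗ n)) refl α ⟩
     2 * (α * α * α)                 ≤⟨ *-monoˡ-≤ (α * α * α) {2} {K} (≤-trans (s≤s (s≤s z≤n)) 4≤K) ⟩
     K * (α * α * α)                 ≤⟨ T-def α³≲energy ⟩
     T * energy A                    ≡⟨ cong (T *_) rep-energy ⟨
     T * ∑ᴬ (λ s → rep s * rep s)    ≡⟨ ∑-*ˡ elems T _ ⟨
     ∑ᴬ (λ s → T * (rep s * rep s))  ≤⟨ ∑-mono elems bound ⟩
     ∑ᴬ (λ s → α * T * (𝟙 (D s) * rep s) + α * rep s) ≡⟨ trans (∑-+ elems _ _) (cong₂ _+_ (∑-*ˡ elems (α * T) _) (trans (∑-*ˡ elems α _) (cong (α *_) rep-total))) ⟩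
     α * T * ∑ᴬ (λ s → 𝟙 (D s) * rep s) + α * (α * α) ≡⟨ cong (_+ α * (α * α)) (*-assoc α T _) ⟩
     α * (T * ∑ᴬ (λ s → 𝟙 (D s) * rep s)) + α * (α * α) ∎))
     where
     open ≤-Reasoning
     unpopular : ∀ s → D s ≡ false → T * rep s ≤ α
     unpopular s e = <⇒≤ (≤ᵇ-false (trans (sym (D-def s)) e))
     bound : ∀ s → T * (rep s * rep s) ≤ α * T * (𝟙 (D s) * rep s) + α * rep s
     bound s with D s in e
     ... | true  = ≤-trans (*-monoʳ-≤ T (*-monoˡ-≤ (rep s) (rep≤α s))) (≤-trans (≤-reflexive (solveℕ 3 (λ t a r → t ⊗ (a ⊗ r) ⊜ a ⊗ t ⊗ (# 1 ⊗ r)) refl T α (rep s))) (m≤m+n _ _))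
     ... | false = ≤-trans (≤-reflexive (sym (*-assoc T (rep s) (rep s)))) (≤-trans (*-monoˡ-≤ (rep s) (unpopular s e)) (m≤n+m _ _))
   D-rep : ∀ s → D s ≡ true → α ≤ T * rep s
   D-rep s h = ≤ᵇ-true (trans (sym (D-def s)) h)
   ε∈D : D ε ≡ true
   ε∈D = trans (D-def ε) (≤ᵇ-intro (≤-trans (≤-reflexive (sym rep-ε)) (≤-trans (≤-reflexive (sym (+-identityʳ _))) (*-monoˡ-≤ (rep ε) T>0))))
     where
     rep-ε : rep ε ≡ α
     rep-ε = ∑-cong elems λ b → trans (cong (λ z → 𝟙 (A b) * 𝟙 (A z)) (idˡ b)) (𝟙² (A b))
     T>0 : 1 ≤ T
     T>0 = pos T (≤-trans (*-mono-≤ 0<α 0<α) α²≤)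
       where
       pos : ∀ t {m} → 1 ≤ t * m → 1 ≤ t
       pos (suc t) _ = s≤s z≤n
   α≲D : α ≲[ 33 ] count D
   α≲D = ≲-cancel 0<α (T≲ (≤-trans α²≤ (*-monoʳ-≤ T (≤-trans (∑-mono elems λ s → *-monoʳ-≤ (𝟙 (D s)) (rep≤α s)) (≤-reflexive (∑-*ʳ elems α _))))))
   opaque
     -- The n-fold product set of `D`. It increases with n because `ε∈D`.
     P : ℕ → G → Bool
     P zero    g = ε == g
     P (suc n) g = any (λ z → P n z ∧ D (z ⁻¹ ∙ g)) elems
     P-∙D : ∀ n {g h} → P n g ≡ true → D h ≡ true → P (suc n) (g ∙ h) ≡ true
     P-∙D n {g} {h} p d = any-intro _ g (∧-intro p (trans (cong D (cancelˡ g h)) d))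
     P-ε : P 0 ε ≡ true
     P-ε = ==-refl ε
     P-zero : ∀ {g} → P 0 g ≡ true → ε ≡ g
     P-zero {g} h = does-true (ε ≟ g) h
     P-suc : ∀ n {g} → P (suc n) g ≡ true → ∃ λ z → P n z ≡ true × D (z ⁻¹ ∙ g) ≡ true
     P-suc n {g} h with any-true (λ z → P n z ∧ D (z ⁻¹ ∙ g)) elems h
     ... | z , e = z , ∧-true e
   P-∙ : ∀ m n {g h} → P m g ≡ true → P n h ≡ true → P (n + m) (g ∙ h) ≡ true
   P-∙ m zero    {g} {h} p q with P-zero q
   ... | refl = trans (cong (P m) (idʳ g)) p
   P-∙ m (suc n) {g} {h} p q with P-suc n q
   ... | z , pz , dz = trans (cong (P (suc (n + m))) (trans (cong (g ∙_) (sym (cancelˡ′ z h))) (sym (assoc g z _))))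
       (P-∙D (n + m) (P-∙ m n p pz) dz)
   D⇒P₁ : ∀ {g} → D g ≡ true → P 1 g ≡ true
   D⇒P₁ {g} d = trans (cong (P 1) (sym (idˡ g))) (P-∙D 0 P-ε d)
   P-mono : ∀ n {g} → P n g ≡ true → P (suc n) g ≡ true
   P-mono n {g} p = trans (cong (P (suc n)) (sym (idʳ g))) (P-∙D n p ε∈D)
   P-inv : ∀ n {g} → P n g ≡ true → P n (g ⁻¹) ≡ true
   P-inv zero    {g} p with P-zero p
   ... | refl = trans (cong (P 0) (trans (sym (idʳ _)) (invˡ ε))) P-ε
   P-inv (suc n) {g} p with P-suc n p
   ... | z , pz , dz = trans (cong₂ (λ k x → P k x) (+-comm 1 n) e) (P-∙ 1 n (D⇒P₁ (trans (D-inv (z ⁻¹ ∙ g)) dz)) (P-inv n pz))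
     where
     e : g ⁻¹ ≡ (z ⁻¹ ∙ g) ⁻¹ ∙ z ⁻¹
     e = sym (trans (cong (_∙ z ⁻¹) (inv-div z g)) (cancelʳ (g ⁻¹) z))
   opaque
     PA : ℕ → G → Bool
     PA n w = any (λ z → P n z ∧ A (z ⁻¹ ∙ w)) elems
     PA-intro : ∀ n {z x} → P n z ≡ true → A x ≡ true → PA n (z ∙ x) ≡ true
     PA-intro n {z} {x} p a = any-intro (λ y → P n y ∧ A (y ⁻¹ ∙ (z ∙ x))) z (∧-intro p (trans (cong A (cancelˡ z x)) a))
     PA-elim : ∀ n {w} → PA n w ≡ true → ∃ λ z → P n z ≡ true × A (z ⁻¹ ∙ w) ≡ true
     PA-elim n {w} h with any-true (λ z → P n z ∧ A (z ⁻¹ ∙ w)) elems h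
     ... | z , e = z , ∧-true e
   -- Write w = z ∙ x with x in A and z = z' ∙ s with s popular. Each of the α/T elements b of A
   -- with s ∙ b in A gives w = (z ∙ b) ∙ (b ⁻¹ ∙ x), where z ∙ b = z' ∙ (s ∙ b) uses one popular
   -- factor less and b ⁻¹ ∙ x is a quotient of A. So a further popular factor costs only K to the
   -- power 33 + 32.
   PA-step : ∀ n w → PA (suc n) w ≡ true → α ≤ T * ∑ᴬ (λ y → 𝟙 (PA n y) * 𝟙 (Q (y ⁻¹ ∙ w)))
   PA-step n w h with PA-elim (suc n) h
   ... | z , pz , ax with P-suc n pz
   ...   | z' , pz' , ds = ≤-trans (D-rep s ds) (*-monoʳ-≤ T (≤-trans (∑-mono elems bound) (≤-reflexive (∑-left z _))))
     where
     s = z' ⁻¹ ∙ z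
     bound : ∀ b → 𝟙 (A b) * 𝟙 (A (s ∙ b)) ≤ 𝟙 (PA n (z ∙ b)) * 𝟙 (Q ((z ∙ b) ⁻¹ ∙ w))
     bound b with A b in eb | A (s ∙ b) in es
     ... | false | _     = z≤n
     ... | true  | false = z≤n
     ... | true  | true  = ≤-reflexive (sym (cong₂ (λ x y → 𝟙 x * 𝟙 y) pa q))
       where
       pa : PA n (z ∙ b) ≡ true
       pa = trans (cong (PA n) (sym (trans (cong (z' ∙_) (assoc _ _ _)) (cancelˡ′ z' (z ∙ b))))) (PA-intro n pz' es)
       q : Q ((z ∙ b) ⁻¹ ∙ w) ≡ true
       q = quotientSet-intro A _ b eb (trans (cong A e) ax)
         where
         e : b ∙ ((z ∙ b) ⁻¹ ∙ w) ≡ z ⁻¹ ∙ w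
         e = trans (cong (λ x → b ∙ (x ∙ w)) (inv-∙ z b)) (trans (cong (b ∙_) (assoc _ _ _)) (cancelˡ′ b _))
   PA-size : ∀ n → count (PA n) ≲[ n * 65 ] α
   PA-size zero = ≲-≤ (count-mono λ w h → sub w h)
     where
     sub : ∀ w → PA 0 w ≡ true → A w ≡ true
     sub w h with PA-elim 0 h
     ... | z , p , a with P-zero p
     ...   | refl = trans (cong A (sym (trans (cong (_∙ w) (trans (sym (idʳ _)) (invˡ ε))) (idˡ w)))) a
   PA-size (suc n) = ≲-cancel 0<α (≲-weaken (≤-reflexive (solveℕ 1 (λ n → # 33 ⊕ (n ⊕ # 32) ⊜ # 65 ⊕ n) refl (n * 65)))
     (≲-trans {b = count (PA n) * count Q} {c = 33} (T≲ (begin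
       count (PA (suc n)) * α ≡⟨ ∑-*ʳ elems α _ ⟨
       ∑ᴬ (λ w → 𝟙 (PA (suc n) w) * α) ≤⟨ ∑-mono elems (λ w → ≤-trans (𝟙*-≤ (PA (suc n) w) (PA-step n w)) (𝟙*≤ (PA (suc n) w) _)) ⟩
       ∑ᴬ (λ w → T * ∑ᴬ (λ y → 𝟙 (PA n y) * 𝟙 (Q (y ⁻¹ ∙ w)))) ≡⟨ ∑-*ˡ elems T _ ⟩
       T * ∑ᴬ (λ w → ∑ᴬ (λ y → 𝟙 (PA n y) * 𝟙 (Q (y ⁻¹ ∙ w)))) ≡⟨ cong (T *_) (trans (∑-swap elems elems _) (trans (∑-cong elems λ y → trans (∑-*ˡ elems (𝟙 (PA n y)) _) (cong (𝟙 (PA n y) *_) (∑-left (y ⁻¹) _))) (∑-*ʳ elems (count Q) _))) ⟩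
       T * (count (PA n) * count Q) ∎)) (≲-* (PA-size n) few-quotients)))
     where open ≤-Reasoning
   P-size : ∀ n → count (P n) ≲[ n * 65 ] α
   P-size n with ∑-exists elems (λ x → 𝟙 (A x)) (λ _ → 0) (≤-trans (≤-reflexive (cong suc (∑-0 elems))) 0<α)
   ... | x , px = ≤-≲ (≤-trans (∑-mono elems λ z → 𝟙-mono λ p → PA-intro n p (𝟙-positive px)) (≤-reflexive (∑-right x (λ w → 𝟙 (PA n w))))) (PA-size n)
   opaque
     -- Averages the representations of the popular elements over their second factor b. The added 1
     -- makes the averaged inequality strict, which also ensures that b lies in A.
     dense-translate : ∃ λ b → α ≤ T * ∑ᴬ (λ s → 𝟙 (D s) * 𝟙 (A (s ∙ b)))
     dense-translate = proj₁ found , ≤-pred (≤-trans (unit (A (proj₁ found)) (proj₂ found)) (≤-reflexive (+-comm _ 1)))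
       where
       open ≤-Reasoning
       c : G → ℕ
       c b = ∑ᴬ (λ s → 𝟙 (D s) * 𝟙 (A (s ∙ b)))
       e : ∑ᴬ (λ s → 𝟙 (D s) * rep s) ≡ ∑ᴬ (λ b → 𝟙 (A b) * c b)
       e = trans (∑-cong elems λ s → sym (∑-*ˡ elems (𝟙 (D s)) _)) (trans (∑-swap elems elems _)
         (∑-cong elems λ b → trans (∑-cong elems λ s → solveℕ 3 (λ d a x → d ⊗ (a ⊗ x) ⊜ a ⊗ (d ⊗ x)) refl (𝟙 (D s)) (𝟙 (A b)) (𝟙 (A (s ∙ b)))) (∑-*ˡ elems (𝟙 (A b)) _)))
       found : ∃ λ b → 𝟙 (A b) * α < 𝟙 (A b) * (T * c b + 1)
       found = ∑-exists elems (λ b → 𝟙 (A b) * (T * c b + 1)) (λ b → 𝟙 (A b) * α) (begin-strict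
         ∑ᴬ (λ b → 𝟙 (A b) * α)               ≡⟨ ∑-*ʳ elems α _ ⟩
         α * α                                <⟨ m<m+n (α * α) 0<α ⟩
         α * α + α                            ≤⟨ +-monoˡ-≤ α α²≤ ⟩
         T * ∑ᴬ (λ s → 𝟙 (D s) * rep s) + α   ≡⟨ cong (λ z → T * z + α) e ⟩
         T * ∑ᴬ (λ b → 𝟙 (A b) * c b) + α     ≡⟨ cong (_+ α) (trans (sym (∑-*ˡ elems T _)) (∑-cong elems λ b → solveℕ 3 (λ t a c → t ⊗ (a ⊗ c) ⊜ a ⊗ (t ⊗ c)) refl T (𝟙 (A b)) (c b))) ⟩
         ∑ᴬ (λ b → 𝟙 (A b) * (T * c b)) + α   ≡⟨ cong (∑ᴬ (λ b → 𝟙 (A b) * (T * c b)) +_) (∑-cong elems λ b → sym (*-identityʳ _)) ⟩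
         ∑ᴬ (λ b → 𝟙 (A b) * (T * c b)) + ∑ᴬ (λ b → 𝟙 (A b) * 1) ≡⟨ ∑-+ elems _ _ ⟨
         ∑ᴬ (λ b → 𝟙 (A b) * (T * c b) + 𝟙 (A b) * 1) ≡⟨ ∑-cong elems (λ b → sym (*-distribˡ-+ (𝟙 (A b)) (T * c b) 1)) ⟩
         ∑ᴬ (λ b → 𝟙 (A b) * (T * c b + 1))   ∎)
       unit : ∀ x {m n} → 𝟙 x * m < 𝟙 x * n → m < n
       unit true  h = subst₂ _<_ (+-identityʳ _) (+-identityʳ _) h
   -- A translate of A meets `D` in at least α/T points s. As S is symmetric, (s ∙ b) ⁻¹ = b ⁻¹ ∙ s
   -- ⁻¹ lies in S, and if `D` were covered by two cosets of H these points would lie in two cosets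
   -- of H as well. One of the two would then contain too large a part of S.
   escape : ∀ (S : G → Bool) → (∀ g → A g ≡ true → S g ≡ true) → (∀ g → S g ≡ S (g ⁻¹)) → count S ≲[ 4 ] α →
     ∀ (C : ℕ) → (∀ {a b} → a ≲[ 38 ] b → 0 < b → a < C * b) → ∀ (H : G → Bool) → (∀ x → C * count (λ y → S y ∧ H (x ⁻¹ ∙ y)) ≤ count S) →
     ∀ g₁ g₂ → (∀ d → D d ≡ true → H (g₁ ⁻¹ ∙ d) ≡ true ⊎ H (g₂ ⁻¹ ∙ d) ≡ true) → ⊥
   escape S A⊂S S-sym N≲α C large H sparse g₁ g₂ cover = contradiction
     where
     b = proj₁ dense-translate
     dense = proj₂ dense-translate
     member : G → G → Bool
     member g y = S y ∧ H ((b ⁻¹ ∙ g) ⁻¹ ∙ y)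
     c : G → ℕ
     c g = count (member g)
     move : ∀ s g → (b ⁻¹ ∙ g) ⁻¹ ∙ (s ∙ b) ⁻¹ ≡ g ⁻¹ ∙ s ⁻¹
     move s g = trans (cong₂ _∙_ (inv-div b g) (inv-∙ s b)) (trans (assoc _ _ _) (cong (g ⁻¹ ∙_) (cancelˡ′ b _)))
     covered : ∀ s → D s ≡ true → A (s ∙ b) ≡ true → member g₁ ((s ∙ b) ⁻¹) ≡ true ⊎ member g₂ ((s ∙ b) ⁻¹) ≡ true
     covered s ed ea with cover (s ⁻¹) (trans (D-inv s) ed)
     ... | inj₁ h = inj₁ (∧-intro (trans (sym (S-sym _)) (A⊂S _ ea)) (trans (cong H (move s g₁)) h))
     ... | inj₂ h = inj₂ (∧-intro (trans (sym (S-sym _)) (A⊂S _ ea)) (trans (cong H (move s g₂)) h))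
     pointwise : ∀ s → 𝟙 (D s) * 𝟙 (A (s ∙ b)) ≤ 𝟙 (member g₁ ((s ∙ b) ⁻¹)) + 𝟙 (member g₂ ((s ∙ b) ⁻¹))
     pointwise s = go (D s) (A (s ∙ b)) refl refl
       where
       go : ∀ x y → D s ≡ x → A (s ∙ b) ≡ y → 𝟙 x * 𝟙 y ≤ 𝟙 (member g₁ ((s ∙ b) ⁻¹)) + 𝟙 (member g₂ ((s ∙ b) ⁻¹))
       go false _     _  _  = z≤n
       go true  false _  _  = z≤n
       go true  true  ed ea with covered s ed ea
       ... | inj₁ h = ≤-trans (1≤𝟙 h) (m≤m+n _ _)
       ... | inj₂ h = ≤-trans (1≤𝟙 h) (m≤n+m _ _)
     α≲ : α ≲[ 33 ] c g₁ + c g₂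
     α≲ = T≲ (≤-trans dense (*-monoʳ-≤ T (≤-trans (∑-mono elems pointwise) (≤-reflexive (trans (∑-right b (λ s → f (s ⁻¹))) (trans (∑-inv f) (∑-+ elems _ _)))))))
       where
       f : G → ℕ
       f y = 𝟙 (member g₁ y) + 𝟙 (member g₂ y)
     N≲ : count S ≲[ 37 ] c g₁ + c g₂
     N≲ = ≲-trans N≲α α≲
     contradiction : ⊥
     contradiction = <-irrefl refl (begin-strict
       C * (c g₁ + c g₂)       ≡⟨ *-distribˡ-+ C (c g₁) (c g₂) ⟩
       C * c g₁ + C * c g₂     ≤⟨ +-mono-≤ (sparse _) (sparse _) ⟩
       count S + count S       ≡⟨ cong (count S +_) (+-identityʳ _) ⟨
       2 * count S             <⟨ large (≲-2 N≲) (positive (c g₁ + c g₂) α≲) ⟩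
       C * (c g₁ + c g₂) ∎)
       where
       open ≤-Reasoning
       positive : ∀ x → α ≲[ 33 ] x → 0 < x
       positive (suc _) _ = s≤s z≤n
       positive zero    h = ⊥-elim (<-irrefl refl (<-≤-trans 0<α (≤-trans (le h) (≤-reflexive (*-zeroʳ (K ^ 33))))))

-- Counting by pigeonhole

module Pigeonhole where
 open import Data.List using (List; []; _∷_)
 open import Data.Nat using (_+_; _*_; _^_)
 open import Data.Nat.Properties hiding (_≟_)
 open Sums

 module _ {A : Set} (𝓐 : Finite A) where
   open Finite 𝓐
   without : (A → Bool) → A → A → Bool
   without P a z = P z ∧ not (a == z)
   ∑-without : ∀ P a → P a ≡ true → ∀ f → ∑ᴬ (λ z → 𝟙 (P z) * f z) ≡ f a + ∑ᴬ (λ z → 𝟙 (without P a z) * f z)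
   ∑-without P a pa f = trans (∑-cong elems split) (trans (∑-+ elems _ _) (cong (_+ ∑ᴬ (λ z → 𝟙 (without P a z) * f z)) (∑-δ a f)))
     where
     split : ∀ z → 𝟙 (P z) * f z ≡ 𝟙 (a == z) * f z + 𝟙 (without P a z) * f z
     split z with a ≟ z
     ... | yes refl = trans (cong (λ b → 𝟙 b * f z) pa) (trans (sym (+-identityʳ _)) (cong (λ b → f z + 0 + 𝟙 (b ∧ false) * f z) (sym pa)))
     ... | no _ with P z
     ...   | true  = refl
     ...   | false = refl
   count-without : ∀ P a → P a ≡ true → count P ≡ suc (count (without P a))
   count-without P a pa = trans (∑-cong elems λ z → sym (*-identityʳ _)) (trans (∑-without P a pa (λ _ → 1)) (cong suc (∑-cong elems λ z → *-identityʳ _)))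
   count-∃ : ∀ {P} → 0 < count P → ∃ λ x → P x ≡ true
   count-∃ {P} lt with search P
   ... | inj₁ r = r
   ... | inj₂ none with () ← ≤-trans lt (≤-reflexive (count-0 none))
   count-≤1 : ∀ {P} a → (∀ x → P x ≡ true → a ≡ x) → count P ≤ 1
   count-≤1 a h = ≤-trans (count-mono λ x px → does-intro (a ≟ x) (h x px)) (≤-reflexive (once a))
   count-injective : ∀ {B : Set} (𝓑 : Finite B) (φ : A → B) P Q → (∀ a → P a ≡ true → Q (φ a) ≡ true) →
     (∀ a a' → P a ≡ true → P a' ≡ true → φ a ≡ φ a' → a ≡ a') → count P ≤ Finite.count 𝓑 Q
   count-injective 𝓑 φ P Q h inj = ≤-trans (count-fibre-≤ 𝓐 𝓑 φ P Q 1 h one-each) (≤-reflexive (+-identityʳ _))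
     where
     module 𝓑 = Finite 𝓑
     one-each : ∀ b → Q b ≡ true → count (λ a → P a ∧ (φ a 𝓑.== b)) ≤ 1
     one-each b _ with search (λ a → P a ∧ (φ a 𝓑.== b))
     ... | inj₂ none = ≤-trans (≤-reflexive (count-0 none)) z≤n
     ... | inj₁ (a , e) = count-≤1 a λ a' e' → inj a a' (proj₁ (∧-true e)) (proj₁ (∧-true e'))
             (trans (does-true (φ a 𝓑.≟ b) (proj₂ (∧-true {P a} e))) (sym (does-true (φ a' 𝓑.≟ b) (proj₂ (∧-true {P a'} e')))))
   subset-of-size : ∀ d m P → count P ≡ d + m → ∃ λ Q → (∀ x → Q x ≡ true → P x ≡ true) × count Q ≡ m
   subset-of-size zero    m P e = P , (λ _ h → h) , e
   subset-of-size (suc d) m P e with count-∃ {P} (≤-trans (s≤s z≤n) (≤-reflexive (sym e)))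
   ... | a , pa with subset-of-size d m (without P a) (suc-injective (trans (sym (count-without P a pa)) e))
   ...   | Q , Q⊂ , c = Q , (λ x h → proj₁ (∧-true (Q⊂ x h))) , c
   module _ {I B : Set} (𝓑 : Finite B) (e : I → A → B) (W : I → Bool) where
     private
       module 𝓑 = Finite 𝓑
       b = ∑ 𝓑.elems (λ _ → 1)
     disagreements : List I → A → A → ℕ
     disagreements xs x y = ∑ xs (λ i → 𝟙 (W i) * 𝟙 (not (e i x 𝓑.== e i y)))
     -- Splits P along one condition at a time and keeps a class that is still large enough. This
     -- takes the place of a dimension count for linear systems: the difference of two agreeing
     -- forms is a nonzero solution.
     agreeing-pair : ∀ xs P → b ^ ∑ xs (λ i → 𝟙 (W i)) < count P →
       ∃ λ x → ∃ λ y → (P x ≡ true × P y ≡ true) × ¬ (x ≡ y) × disagreements xs x y ≡ 0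
     agreeing-pair [] P lt with count-∃ {P} (≤-trans (s≤s z≤n) lt)
     ... | x , px with search (without P x)
     ...   | inj₁ (y , h) = x , y , (px , proj₁ (∧-true h)) , (λ q → true≢false (does-intro (x ≟ y) q) (not-true (proj₂ (∧-true {P y} h)))) , refl
     ...   | inj₂ none = ⊥-elim (<-irrefl refl (≤-trans lt (≤-trans (≤-reflexive (count-without P x px)) (s≤s (≤-reflexive (count-0 none))))))
     agreeing-pair (i ∷ xs) P lt with W i
     ... | false = agreeing-pair xs P lt
     ... | true with ∑-exists 𝓑.elems (λ c → ∑ᴬ (λ a → 𝟙 (e i a 𝓑.== c) * 𝟙 (P a))) (λ _ → b ^ ∑ xs (λ i → 𝟙 (W i)))
            (≤-trans (≤-trans (s≤s (≤-reflexive (trans (∑-cong 𝓑.elems λ _ → sym (+-identityʳ _)) (∑-*ʳ 𝓑.elems (b ^ ∑ xs (λ i → 𝟙 (W i))) (λ _ → 1))))) lt) (≤-reflexive (∑-fibre 𝓐 𝓑 (e i) (λ a → 𝟙 (P a)))))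
     ...   | c , big with agreeing-pair xs (λ a → (e i a 𝓑.== c) ∧ P a) (≤-trans big (≤-reflexive (∑-cong elems λ a → sym (𝟙-∧ (e i a 𝓑.== c) (P a)))))
     ...     | x , y , (hx , hy) , ne , z = x , y , (proj₂ (∧-true {e i x 𝓑.== c} hx) , proj₂ (∧-true {e i y 𝓑.== c} hy)) , ne ,
               trans (cong (λ b → 𝟙 (not b) + 0 + disagreements xs x y) (does-intro (e i x 𝓑.≟ e i y)
                 (trans (does-true (e i x 𝓑.≟ c) (proj₁ (∧-true hx))) (sym (does-true (e i y 𝓑.≟ c) (proj₁ (∧-true hy))))))) z

 transport-finite : ∀ {A B : Set} → Finite B → (φ : A → B) (ψ : B → A) → (∀ a → ψ (φ a) ≡ a) → (∀ b → φ (ψ b) ≡ b) → Finite A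
 transport-finite 𝓑 φ ψ ψφ φψ = record
   { elems = Data.List.map ψ 𝓑.elems
   ; _≟_ = dec
   ; once = λ a → trans (∑-map ψ 𝓑.elems _) (trans (∑-cong 𝓑.elems (same a)) (𝓑.once (φ a)))
   }
   where
   open import Relation.Nullary.Decidable using (map′)
   open import Relation.Nullary using (Dec)
   module 𝓑 = Finite 𝓑
   dec : ∀ x y → Dec (x ≡ y)
   dec x y = map′ (λ h → trans (sym (ψφ x)) (trans (cong ψ h) (ψφ y))) (cong φ) (φ x 𝓑.≟ φ y)
   same : ∀ a b → 𝟙 (does (dec a (ψ b))) ≡ 𝟙 (φ a 𝓑.== b)
   same a b = cong (λ z → 𝟙 (φ a 𝓑.== z)) (φψ b)

-- Pruning a bipartite graph to large minimum degree

module Prune {A B : Set} (𝓐 : Finite A) (𝓑 : Finite B) where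
 open Sums

 open import Data.Nat using (_+_; _*_; _≤ᵇ_)
 open import Data.Nat.Properties hiding (_≟_)
 open Arith
 open Pigeonhole

 private
   module 𝓐 = Finite 𝓐
   module 𝓑 = Finite 𝓑

 module _ (_∼_ : A → B → Bool) where
   degᴬ : (B → Bool) → A → ℕ
   degᴬ L a = 𝓑.count (λ b → L b ∧ (a ∼ b))
   degᴮ : (A → Bool) → B → ℕ
   degᴮ J b = 𝓐.count (λ a → J a ∧ (a ∼ b))
   edges : (A → Bool) → (B → Bool) → ℕ
   edges J L = 𝓐.∑ᴬ (λ a → 𝟙 (J a) * degᴬ L a)
   edges-swap : ∀ J L → edges J L ≡ 𝓑.∑ᴬ (λ b → 𝟙 (L b) * degᴮ J b)
   edges-swap J L = begin
     𝓐.∑ᴬ (λ a → 𝟙 (J a) * degᴬ L a) ≡⟨ ∑-cong 𝓐.elems (λ a → sym (∑-*ˡ 𝓑.elems (𝟙 (J a)) _)) ⟩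
     𝓐.∑ᴬ (λ a → 𝓑.∑ᴬ (λ b → 𝟙 (J a) * 𝟙 (L b ∧ (a ∼ b)))) ≡⟨ ∑-swap 𝓐.elems 𝓑.elems _ ⟩
     𝓑.∑ᴬ (λ b → 𝓐.∑ᴬ (λ a → 𝟙 (J a) * 𝟙 (L b ∧ (a ∼ b)))) ≡⟨ ∑-cong 𝓑.elems (λ b → trans (∑-cong 𝓐.elems λ a → exchange (J a) (L b) (a ∼ b)) (∑-*ˡ 𝓐.elems (𝟙 (L b)) _)) ⟩
     𝓑.∑ᴬ (λ b → 𝟙 (L b) * degᴮ J b) ∎
     where
     open ≡-Reasoning
     exchange : ∀ x y z → 𝟙 x * 𝟙 (y ∧ z) ≡ 𝟙 y * 𝟙 (x ∧ z)
     exchange false false z = refl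
     exchange false true  z = refl
     exchange true  false z = refl
     exchange true  true  z = refl
   module _ (α β : ℕ) where
     Stable : (A → Bool) → (B → Bool) → Set
     Stable J L = (∀ a → J a ≡ true → α < degᴬ L a) × (∀ b → L b ≡ true → β < degᴮ J b)
     private
       above : ∀ {P d k} → P ≡ true → P ∧ (d ≤ᵇ k) ≡ false → k < d
       above {d = d} {k} refl h = ≰⇒> λ le → true≢false (≤ᵇ-intro le) h
       bounded : ∀ {e e' d α β m m' n} → e ≡ d + e' → d ≤ α → m ≡ suc m' → e' ≤ α * m' + β * n → e ≤ α * m + β * n
       bounded {e' = e'} {d} {α} {β} {m' = m'} {n} refl le refl h = ≤-trans (+-mono-≤ le h) (≤-reflexive
         (solveℕ 4 (λ a m b n → a ⊕ (a ⊗ m ⊕ b ⊗ n) ⊜ a ⊗ (# 1 ⊕ m) ⊕ b ⊗ n) refl α m' β n))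
     -- Vertices of degree at most α on the left, or β on the right, are deleted as long as there
     -- are any. If this exhausts the left side, the deletions have accounted for every edge. `fuel`
     -- exceeds the number of vertices left.
     prune : ∀ fuel J L → 𝓐.count J + 𝓑.count L < fuel →
       (∃ λ J' → ∃ λ L' → (∃ λ a → J' a ≡ true) × (∀ b → L' b ≡ true → L b ≡ true) × Stable J' L') ⊎ edges J L ≤ α * 𝓐.count J + β * 𝓑.count L
     prune (suc fuel) J L (s≤s bound) with 𝓐.search (λ a → J a ∧ (degᴬ L a ≤ᵇ α))
     ... | inj₁ (a , h) = go (prune fuel (without 𝓐 J a) L (≤-trans (+-monoˡ-≤ (𝓑.count L) (≤-reflexive (sym fewer))) bound))
       where
       ja = proj₁ (∧-true {J a} h)
       fewer = count-without 𝓐 J a ja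
       go : _ → _
       go (inj₁ r) = inj₁ r
       go (inj₂ e) = inj₂ (bounded {β = β} (∑-without 𝓐 J a ja (degᴬ L)) (≤ᵇ-true (proj₂ (∧-true {J a} h))) fewer e)
     ... | inj₂ all-α with 𝓑.search (λ b → L b ∧ (degᴮ J b ≤ᵇ β))
     ...   | inj₁ (b , h) = go (prune fuel J (without 𝓑 L b) (≤-trans (≤-reflexive (trans (sym (+-suc (𝓐.count J) _)) (cong (𝓐.count J +_) (sym fewer)))) bound))
       where
       lb = proj₁ (∧-true {L b} h)
       fewer = count-without 𝓑 L b lb
       go : _ → _
       go (inj₁ (J' , L' , r , sub , st)) = inj₁ (J' , L' , r , (λ b h → proj₁ (∧-true (sub b h))) , st)
       go (inj₂ e) = inj₂ (≤-trans (bounded {α = β} {β = α} (trans (edges-swap J L) (∑-without 𝓑 L b lb (degᴮ J))) (≤ᵇ-true (proj₂ (∧-true {L b} h))) fewer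
           (≤-trans (≤-reflexive (sym (edges-swap J (without 𝓑 L b)))) (≤-trans e (≤-reflexive (+-comm (α * 𝓐.count J) _))))) (≤-reflexive (+-comm (β * 𝓑.count L) _)))
     ...   | inj₂ all-β with 𝓐.search J
     ...     | inj₁ r = inj₁ (J , L , r , (λ _ h → h) , (λ a ja → above ja (all-α a)) , (λ b lb → above lb (all-β b)))
     ...     | inj₂ none = inj₂ (≤-trans (≤-reflexive (trans (∑-cong 𝓐.elems λ a → cong (λ j → 𝟙 j * degᴬ L a) (none a)) (∑-0 𝓐.elems))) z≤n)

-- Dyadic sums, the degree of the form and the final trichotomy

module Dyadic where
 open import Data.List using (downFrom)
 open import Data.Nat
 open import Data.Nat.Properties
 open Arith
 open Sums hiding (interchange)

 geometric : ∀ J → suc (∑ (downFrom J) (2 ^_)) ≡ 2 ^ J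
 geometric zero    = refl
 geometric (suc J) = trans (sym (+-suc (2 ^ J) _)) (trans (cong (2 ^ J +_) (geometric J)) (cong (2 ^ J +_) (sym (+-identityʳ _))))

 -- The powers of two up to the largest one not above w add up to one less than the next power,
 -- hence to at least w.
 dyadic : ∀ J w → w < 2 ^ J → w ≤ ∑ (downFrom J) (λ j → 2 ^ j * 𝟙 (2 ^ j ≤ᵇ w))
 dyadic zero    w (s≤s z≤n) = z≤n
 dyadic (suc J) w lt with ≤-<-connex (2 ^ J) w
 ... | inj₂ small = ≤-trans (dyadic J w small) (m≤n+m _ _)
 ... | inj₁ large = ≤-trans (≤-pred (≤-trans lt (≤-reflexive (sym (geometric (suc J)))))) (all (suc J) ≤-refl)
   where
   all : ∀ i → i ≤ suc J → ∑ (downFrom i) (2 ^_) ≤ ∑ (downFrom i) (λ j → 2 ^ j * 𝟙 (2 ^ j ≤ᵇ w))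
   all zero    _        = z≤n
   all (suc i) (s≤s le) = +-mono-≤ (≤-reflexive (sym (trans (cong (λ b → 2 ^ i * 𝟙 b) (≤ᵇ-intro (≤-trans (^-monoʳ-≤ 2 le) large))) (*-identityʳ _)))) (all i (≤-trans le (n≤1+n J)))

 -- The scales are 3·2^i because the joints bound concerns points on at least 4·K lines with K at
 -- least 3. For the same reason multiplicities below 12 are treated apart, by `large-part`.
 dyadic-square : ∀ I r → 12 ≤ r → r < 12 * 2 ^ I → r * r ≤ ∑ (downFrom I) (λ i → 𝟙 (4 * (3 * 2 ^ i) ≤ᵇ r) * (64 * (3 * 2 ^ i * (3 * 2 ^ i))))
 dyadic-square zero    r lo hi = ⊥-elim (<-irrefl refl (≤-trans hi lo))
 dyadic-square (suc I) r lo hi with ≤-<-connex (4 * (3 * 2 ^ I)) r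
 ... | inj₁ large = ≤-trans (*-mono-≤ r≤ r≤) (≤-trans (≤-reflexive (trans (solveℕ 1 (λ k → # 8 ⊗ k ⊗ (# 8 ⊗ k) ⊜ # 64 ⊗ (k ⊗ k) ⊕ # 0) refl (3 * 2 ^ I))
       (cong (λ b → 𝟙 b * (64 * (3 * 2 ^ I * (3 * 2 ^ I)))) (sym (≤ᵇ-intro large))))) (m≤m+n _ _))
   where
   r≤ : r ≤ 8 * (3 * 2 ^ I)
   r≤ = ≤-trans (<⇒≤ hi) (≤-reflexive (solveℕ 1 (λ x → # 12 ⊗ (# 2 ⊗ x) ⊜ # 8 ⊗ (# 3 ⊗ x)) refl (2 ^ I)))
 ... | inj₂ small = ≤-trans (dyadic-square I r lo (≤-trans small (≤-reflexive (solveℕ 1 (λ x → # 4 ⊗ (# 3 ⊗ x) ⊜ # 12 ⊗ x) refl (2 ^ I))))) (m≤n+m _ _)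

 sum-constant : ∀ J c → ∑ (downFrom J) (λ _ → c) ≡ J * c
 sum-constant zero    c = refl
 sum-constant (suc J) c = cong (c +_) (sum-constant J c)

 -- An average over J terms; the successor in the comparison turns the weak inequality of the sums
 -- into a strict one.
 pick : ∀ J V (t : ℕ → ℕ) → 0 < V → V ≤ ∑ (downFrom J) t → ∃ λ j → V ≤ J * t j
 pick J V t pos le with ∑-exists (downFrom J) (λ j → suc (J * t j)) (λ _ → V) (≤-trans (≤-reflexive (cong suc (sum-constant J V))) (strict J le))
   where
   strict : ∀ J' → V ≤ ∑ (downFrom J') t → J' * V < ∑ (downFrom J') (λ j → suc (J' * t j))
   strict zero h = ⊥-elim (<-irrefl refl (≤-trans pos h))
   strict (suc J') h = ≤-trans (s≤s (≤-trans (*-monoʳ-≤ (suc J') h) (≤-reflexive (sym (∑-*ˡ (downFrom (suc J')) (suc J') t)))))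
     (≤-trans (+-monoˡ-≤ X one≤) (≤-reflexive (sym (∑-+ (downFrom (suc J')) (λ _ → 1) (λ j → suc J' * t j)))))
     where
     X = ∑ (downFrom (suc J')) (λ j → suc J' * t j)
     one≤ : 1 ≤ ∑ (downFrom (suc J')) (λ _ → 1)
     one≤ = s≤s z≤n
 ... | j , h = j , ≤-pred h

 -- The search returns the least admissible degree. The degree before it fails the condition, which
 -- bounds the chosen one by the square root of 6n; for degree zero n ≥ 1 suffices.
 degree : ∀ n b → 0 < n → 6 * n < (b + 2) * (b + 3) → ∃ λ a → a ≤ b × 6 * n < (a + 2) * (a + 3) × (2 * a + 2) * (2 * a + 2) ≤ 24 * n
 degree n zero    pos h = zero , z≤n , h , ≤-trans (≤ᵇ⇒≤ 4 24 _) (≤-trans (≤-reflexive (sym (*-identityʳ 24))) (*-monoʳ-≤ 24 pos))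
 degree n (suc b) pos h with ≤-<-connex ((b + 2) * (b + 3)) (6 * n)
 ... | inj₂ lt with degree n b pos lt
 ...   | a , le , r = a , ≤-trans le (n≤1+n b) , r
 degree n (suc b) pos h | inj₁ le = suc b , ≤-refl , h , (begin
   (2 * suc b + 2) * (2 * suc b + 2) ≡⟨ solveℕ 1 (λ b → (# 2 ⊗ (# 1 ⊕ b) ⊕ # 2) ⊗ (# 2 ⊗ (# 1 ⊕ b) ⊕ # 2) ⊜ # 4 ⊗ ((b ⊕ # 2) ⊗ (b ⊕ # 2))) refl b ⟩
   4 * ((b + 2) * (b + 2)) ≤⟨ *-monoʳ-≤ 4 (*-monoʳ-≤ (b + 2) (+-monoʳ-≤ b (n≤1+n 2))) ⟩
   4 * ((b + 2) * (b + 3)) ≤⟨ *-monoʳ-≤ 4 le ⟩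
   4 * (6 * n)             ≡⟨ *-assoc 4 6 n ⟨
   24 * n ∎)
   where open ≤-Reasoning

 -- With b = p - 3 this says that a degree below p is admissible: for n ≤ e² and e about p/3 the
 -- left side is about 2p²/3, and the remaining third of p² absorbs the lower terms once b is at
 -- least 9.
 conditions-bound : ∀ n e b → n ≤ e * e → 3 * e ≤ b + 5 → 9 ≤ b → 6 * n < (b + 2) * (b + 3)
 conditions-bound n e b n≤ hi lo = *-cancelˡ-< 3 _ _ (begin-strict
   3 * (6 * n)             ≤⟨ *-monoʳ-≤ 3 (*-monoʳ-≤ 6 n≤) ⟩
   3 * (6 * (e * e))       ≡⟨ solveℕ 1 (λ e → # 3 ⊗ (# 6 ⊗ (e ⊗ e)) ⊜ # 2 ⊗ (# 3 ⊗ e ⊗ (# 3 ⊗ e))) refl e ⟩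
   2 * (3 * e * (3 * e))   ≤⟨ *-monoʳ-≤ 2 (*-mono-≤ hi hi) ⟩
   2 * ((b + 5) * (b + 5)) ≡⟨ solveℕ 1 (λ b → # 2 ⊗ ((b ⊕ # 5) ⊗ (b ⊕ # 5)) ⊜ # 2 ⊗ (b ⊗ b) ⊕ # 15 ⊗ b ⊕ # 18 ⊕ (# 5 ⊗ b ⊕ # 32)) refl b ⟩
   2 * (b * b) + 15 * b + 18 + (5 * b + 32) <⟨ +-monoʳ-< (2 * (b * b) + 15 * b + 18) small ⟩
   2 * (b * b) + 15 * b + 18 + b * b ≡⟨ solveℕ 1 (λ b → # 2 ⊗ (b ⊗ b) ⊕ # 15 ⊗ b ⊕ # 18 ⊕ b ⊗ b ⊜ # 3 ⊗ ((b ⊕ # 2) ⊗ (b ⊕ # 3))) refl b ⟩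
   3 * ((b + 2) * (b + 3)) ∎)
   where
   open ≤-Reasoning
   small : 5 * b + 32 < b * b
   small = begin-strict
     5 * b + 32    <⟨ +-monoʳ-< (5 * b) (<-≤-trans (≤ᵇ⇒≤ 33 36 _) (*-monoʳ-≤ 4 lo)) ⟩
     5 * b + 4 * b ≡⟨ solveℕ 1 (λ b → # 5 ⊗ b ⊕ # 4 ⊗ b ⊜ # 9 ⊗ b) refl b ⟩
     9 * b         ≤⟨ *-monoˡ-≤ b lo ⟩
     b * b ∎

 large-part : ℕ → ℕ
 large-part r = r * 𝟙 (12 ≤ᵇ r)

 large-part-split : ∀ r → r ≤ 12 + large-part r
 large-part-split r with ≤-<-connex 12 r
 ... | inj₁ h = ≤-trans (≤-reflexive (sym (trans (cong (λ b → r * 𝟙 b) (≤ᵇ-intro h)) (*-identityʳ r)))) (m≤n+m _ 12)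
 ... | inj₂ h = ≤-trans (<⇒≤ h) (m≤m+n 12 _)

 large-part-square : ∀ I r → r < 12 * 2 ^ I → large-part r * large-part r ≤ ∑ (downFrom I) (λ i → 𝟙 (4 * (3 * 2 ^ i) ≤ᵇ r) * (64 * (3 * 2 ^ i * (3 * 2 ^ i))))
 large-part-square I r lt = go (12 ≤ᵇ r) refl
   where
   go : ∀ b → (12 ≤ᵇ r) ≡ b → r * 𝟙 b * (r * 𝟙 b) ≤ ∑ (downFrom I) (λ i → 𝟙 (4 * (3 * 2 ^ i) ≤ᵇ r) * (64 * (3 * 2 ^ i * (3 * 2 ^ i))))
   go true  h = ≤-trans (≤-reflexive (solveℕ 1 (λ r → r ⊗ # 1 ⊗ (r ⊗ # 1) ⊜ r ⊗ r) refl r)) (dyadic-square I r (≤ᵇ-true h) lt)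
   go false h = ≤-trans (≤-reflexive (solveℕ 1 (λ r → r ⊗ # 0 ⊗ (r ⊗ # 0) ⊜ # 0) refl r)) z≤n

 -- N, e and Y are the sizes of S, E and S(E), and `En` is the energy of S. c is the dyadic weight
 -- of the dominant class of n lines and a the degree of a form vanishing on them. B sums r against
 -- the number of lines through g, T sums the square of that number, both over the g on at least 12
 -- lines.
 module _ (N e J Y c n a k₁ k₂ B T En K : ℕ) (0<N : 0 < N) (0<e : 0 < e)
   (cn≤e² : c * n ≤ e * e) (c≤k₁ : c ≤ k₁) (a²≤n : (2 * a + 2) * (2 * a + 2) ≤ 24 * n)
   (class : (N * e) * (N * e) ≤ J * (Y * (c * (12 * (N * N) + B))))
   (B²≤ : B * B ≤ En * T) (T≤ : T ≤ J * (64 * (n * (2 * a + 2 + k₂)))) (K-En≤N³ : K * En ≤ N * N * N) where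
   private
     b = 2 * a + 2
     W = (N * e) * (N * e)
     cancel : ∀ {x y z} → 0 < x → x * y ≤ x * z → y ≤ z
     cancel {x} h le = *-cancelˡ-≤ x {{>-nonZero h}} le
     -- The bound for elements on fewer than 12 lines dominates; as the sum of r is N², the size of
     -- S cancels.
     few : B ≤ 12 * (N * N) → e * e ≤ 24 * J * k₁ * Y
     few h = cancel (*-mono-< 0<N 0<N) (begin
       N * N * (e * e) ≡⟨ solveℕ 2 (λ n e → n ⊗ n ⊗ (e ⊗ e) ⊜ n ⊗ e ⊗ (n ⊗ e)) refl N e ⟩
       W               ≤⟨ class ⟩
       J * (Y * (c * (12 * (N * N) + B))) ≤⟨ *-monoʳ-≤ J (*-monoʳ-≤ Y (*-mono-≤ c≤k₁ (+-monoʳ-≤ (12 * (N * N)) h))) ⟩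
       J * (Y * (k₁ * (12 * (N * N) + 12 * (N * N)))) ≡⟨ solveℕ 4 (λ j y k n → j ⊗ (y ⊗ (k ⊗ (# 12 ⊗ n ⊕ # 12 ⊗ n))) ⊜ n ⊗ (# 24 ⊗ j ⊗ k ⊗ y)) refl J Y k₁ (N * N) ⟩
       N * N * (24 * J * k₁ * Y) ∎)
       where open ≤-Reasoning
     square : 12 * (N * N) ≤ B → K * N * (e * e * (e * e)) ≤ 256 * (J * J * J) * (Y * Y) * (c * (c * n) * (b + k₂))
     square h = cancel (*-mono-< (*-mono-< 0<N 0<N) 0<N) (begin
       N * N * N * (K * N * (e * e * (e * e))) ≡⟨ solveℕ 3 (λ n k e → n ⊗ n ⊗ n ⊗ (k ⊗ n ⊗ (e ⊗ e ⊗ (e ⊗ e))) ⊜ k ⊗ (n ⊗ e ⊗ (n ⊗ e) ⊗ (n ⊗ e ⊗ (n ⊗ e)))) refl N K e ⟩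
       K * (W * W) ≤⟨ *-monoʳ-≤ K (*-mono-≤ W≤ W≤) ⟩
       K * (2 * J * Y * c * B * (2 * J * Y * c * B)) ≡⟨ solveℕ 3 (λ k x b → k ⊗ (x ⊗ b ⊗ (x ⊗ b)) ⊜ k ⊗ (x ⊗ x ⊗ (b ⊗ b))) refl K (2 * J * Y * c) B ⟩
       K * (2 * J * Y * c * (2 * J * Y * c) * (B * B)) ≤⟨ *-monoʳ-≤ K (*-monoʳ-≤ (2 * J * Y * c * (2 * J * Y * c)) (≤-trans B²≤ (*-monoʳ-≤ En T≤))) ⟩
       K * (2 * J * Y * c * (2 * J * Y * c) * (En * (J * (64 * (n * (b + k₂)))))) ≡⟨ solveℕ 4 (λ k x en t → k ⊗ (x ⊗ (en ⊗ t)) ⊜ k ⊗ en ⊗ (x ⊗ t)) refl K (2 * J * Y * c * (2 * J * Y * c)) En (J * (64 * (n * (b + k₂)))) ⟩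
       K * En * (2 * J * Y * c * (2 * J * Y * c) * (J * (64 * (n * (b + k₂))))) ≤⟨ *-monoˡ-≤ _ K-En≤N³ ⟩
       N * N * N * (2 * J * Y * c * (2 * J * Y * c) * (J * (64 * (n * (b + k₂))))) ≡⟨ cong (N * N * N *_) (solveℕ 5 (λ j y c n s →
          # 2 ⊗ j ⊗ y ⊗ c ⊗ (# 2 ⊗ j ⊗ y ⊗ c) ⊗ (j ⊗ (# 64 ⊗ (n ⊗ s))) ⊜ # 256 ⊗ (j ⊗ j ⊗ j) ⊗ (y ⊗ y) ⊗ (c ⊗ (c ⊗ n) ⊗ s)) refl J Y c n (b + k₂)) ⟩
       N * N * N * (256 * (J * J * J) * (Y * Y) * (c * (c * n) * (b + k₂))) ∎)
       where
       open ≤-Reasoning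
       W≤ : W ≤ 2 * J * Y * c * B
       W≤ = ≤-trans class (≤-trans (*-monoʳ-≤ J (*-monoʳ-≤ Y (*-monoʳ-≤ c (+-monoˡ-≤ B h))))
         (≤-reflexive (solveℕ 4 (λ j y c b → j ⊗ (y ⊗ (c ⊗ (b ⊕ b))) ⊜ # 2 ⊗ j ⊗ y ⊗ c ⊗ b) refl J Y c B)))
     D = 512 * (J * J * J) * (Y * Y)
     doubled : ∀ X s t → s ≤ t → 256 * (J * J * J) * (Y * Y) * (X * (s + t)) ≤ D * (X * t)
     doubled X s t le = ≤-trans (*-monoʳ-≤ (256 * (J * J * J) * (Y * Y)) (*-monoʳ-≤ X (+-monoˡ-≤ t le)))
       (≤-reflexive (solveℕ 4 (λ j y x t → # 256 ⊗ j ⊗ y ⊗ (x ⊗ (t ⊕ t)) ⊜ # 512 ⊗ j ⊗ y ⊗ (x ⊗ t)) refl (J * J * J) (Y * Y) X t))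
     e²>0 : 0 < e * e
     e²>0 = *-mono-< 0<e 0<e
     wide : 12 * (N * N) ≤ B → b ≤ k₂ → K * N * (e * e) ≤ D * (k₁ * k₂)
     wide h le = cancel e²>0 (begin
       e * e * (K * N * (e * e)) ≡⟨ solveℕ 2 (λ x y → x ⊗ (y ⊗ x) ⊜ y ⊗ (x ⊗ x)) refl (e * e) (K * N) ⟩
       K * N * (e * e * (e * e)) ≤⟨ ≤-trans (square h) (doubled (c * (c * n)) b k₂ le) ⟩
       D * (c * (c * n) * k₂)    ≤⟨ *-monoʳ-≤ D (*-monoˡ-≤ k₂ (*-mono-≤ c≤k₁ cn≤e²)) ⟩
       D * (k₁ * (e * e) * k₂)   ≡⟨ solveℕ 4 (λ d k x l → d ⊗ (k ⊗ x ⊗ l) ⊜ x ⊗ (d ⊗ (k ⊗ l))) refl D k₁ (e * e) k₂ ⟩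
       e * e * (D * (k₁ * k₂)) ∎)
       where open ≤-Reasoning
     -- The inequality is squared because b is known only through b² ≤ 24·n; then c²·(c·n)²·b²
     -- becomes 24·c·(c·n)³, and c·n ≤ e².
     narrow : 12 * (N * N) ≤ B → k₂ ≤ b → (K * N * e) * (K * N * e) ≤ D * D * (24 * k₁)
     narrow h le = cancel (*-mono-< (*-mono-< e²>0 e²>0) e²>0) (begin
       e * e * (e * e) * (e * e) * (K * N * e * (K * N * e)) ≡⟨ solveℕ 2 (λ e y → e ⊗ e ⊗ (e ⊗ e) ⊗ (e ⊗ e) ⊗ (y ⊗ e ⊗ (y ⊗ e)) ⊜ y ⊗ (e ⊗ e ⊗ (e ⊗ e)) ⊗ (y ⊗ (e ⊗ e ⊗ (e ⊗ e)))) refl e (K * N) ⟩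
       K * N * (e * e * (e * e)) * (K * N * (e * e * (e * e))) ≤⟨ *-mono-≤ step step ⟩
       D * (c * (c * n) * b) * (D * (c * (c * n) * b)) ≡⟨ solveℕ 4 (λ d c x b → d ⊗ (c ⊗ x ⊗ b) ⊗ (d ⊗ (c ⊗ x ⊗ b)) ⊜ d ⊗ d ⊗ (c ⊗ c ⊗ (x ⊗ x) ⊗ (b ⊗ b))) refl D c (c * n) b ⟩
       D * D * (c * c * (c * n * (c * n)) * (b * b)) ≤⟨ *-monoʳ-≤ (D * D) (*-monoʳ-≤ (c * c * (c * n * (c * n))) a²≤n) ⟩
       D * D * (c * c * (c * n * (c * n)) * (24 * n)) ≡⟨ cong (D * D *_) (solveℕ 2 (λ c n → c ⊗ c ⊗ (c ⊗ n ⊗ (c ⊗ n)) ⊗ (# 24 ⊗ n) ⊜ # 24 ⊗ c ⊗ (c ⊗ n ⊗ (c ⊗ n) ⊗ (c ⊗ n))) refl c n) ⟩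
       D * D * (24 * c * (c * n * (c * n) * (c * n))) ≤⟨ *-monoʳ-≤ (D * D) (*-mono-≤ (*-monoʳ-≤ 24 c≤k₁) (*-mono-≤ (*-mono-≤ cn≤e² cn≤e²) cn≤e²)) ⟩
       D * D * (24 * k₁ * (e * e * (e * e) * (e * e))) ≡⟨ solveℕ 3 (λ d k x → d ⊗ (k ⊗ x) ⊜ x ⊗ (d ⊗ k)) refl (D * D) (24 * k₁) (e * e * (e * e) * (e * e)) ⟩
       e * e * (e * e) * (e * e) * (D * D * (24 * k₁)) ∎)
       where
       open ≤-Reasoning
       step : K * N * (e * e * (e * e)) ≤ D * (c * (c * n) * b)
       step = ≤-trans (square h) (≤-trans (≤-reflexive (cong (λ s → 256 * (J * J * J) * (Y * Y) * (c * (c * n) * s)) (+-comm b k₂))) (doubled (c * (c * n)) k₂ b le))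
   trichotomy : (K * N * (e * e) ≤ D * (k₁ * k₂)) ⊎ ((K * N * e) * (K * N * e) ≤ D * D * (24 * k₁)) ⊎ (e * e ≤ 24 * J * k₁ * Y)
   trichotomy with ≤-total B (12 * (N * N))
   ... | inj₁ h = inj₂ (inj₂ (few h))
   ... | inj₂ h with ≤-total b k₂
   ...   | inj₁ le = inj₁ (wide h le)
   ...   | inj₂ le = inj₂ (inj₁ (narrow h le))

-- Powers of p and the absorption of logarithms

module Parameters where
 open import Data.Nat
 open import Data.Nat.DivMod using (_/_; m/n*n≤m; m≡m%n+[m/n]*n; m%n<n; m*n/n≡m; /-monoˡ-≤)
 open import Data.Nat.Logarithm using (⌈log₂_⌉; ⌈log₂⌉-mono-≤; ⌈log₂2^n⌉≡n)
 open import Data.Nat.Properties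
 open Arith

 n<2^n : ∀ n → n < 2 ^ n
 n<2^n zero    = s≤s z≤n
 n<2^n (suc n) = ≤-trans (s≤s (n<2^n n)) (≤-trans (+-monoˡ-≤ (2 ^ n) (m^n>0 2 n)) (≤-reflexive (cong (2 ^ n +_) (sym (+-identityʳ _)))))

 floor-log : ∀ p → 0 < p → ∃ λ k → 2 ^ k ≤ p × p < 2 ^ suc k
 floor-log (suc zero)    _ = 0 , ≤-refl , ≤-refl
 floor-log (suc (suc p)) _ with floor-log (suc p) (s≤s z≤n)
 ... | k , lo , hi with ≤-<-connex (2 ^ suc k) (suc (suc p))
 ...   | inj₂ lt = k , ≤-trans lo (n≤1+n _) , lt
 ...   | inj₁ le = suc k , le , ≤-trans (s≤s hi) (≤-trans (+-monoˡ-≤ (2 ^ suc k) (m^n>0 2 (suc k))) (≤-reflexive (cong (2 ^ suc k +_) (sym (+-identityʳ _)))))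

 ^-distribʳ-* : ∀ n x y → (x * y) ^ n ≡ x ^ n * y ^ n
 ^-distribʳ-* zero    x y = refl
 ^-distribʳ-* (suc n) x y = trans (cong (x * y *_) (^-distribʳ-* n x y)) (solveℕ 4 (λ x y a b → x ⊗ y ⊗ (a ⊗ b) ⊜ x ⊗ a ⊗ (y ⊗ b)) refl x y (x ^ n) (y ^ n))

 linear≤exponential : ∀ f s → 0 < f → 2 * f ≤ s → f * s ≤ 2 ^ s
 linear≤exponential f s pos h with m≤n⇒∃[o]m+o≡n h
 ... | i , refl = ≤-trans (*-mono-≤ (<⇒≤ (n<2^n f)) (large (f + i) (≤-trans pos (m≤m+n f i))))
   (≤-reflexive (trans (sym (^-distribˡ-+-* 2 f (f + i))) (cong (2 ^_) (solveℕ 2 (λ f i → f ⊕ (f ⊕ i) ⊜ # 2 ⊗ f ⊕ i) refl f i))))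
   where
   double : ∀ x → 0 < x → 2 * x ≤ 2 ^ x
   double (suc x) _ = *-monoʳ-≤ 2 (n<2^n x)
   large : ∀ x → 0 < x → 2 * f + i ≤ 2 ^ (f + i)
   large _ _ = ≤-trans (≤-trans (+-monoʳ-≤ (2 * f) (m≤m+n i (1 * i))) (≤-reflexive (sym (*-distribˡ-+ 2 f i)))) (double (f + i) (≤-trans pos (m≤m+n f i)))

 module _ (p : ℕ) (0<p : 0 < p) (g h : ℕ) (0<g : 0 < g) where
   private
     instance
       p≢0 : NonZero p
       p≢0 = >-nonZero 0<p
     p≤p^g : p ≤ p ^ g
     p≤p^g = ≤-trans (≤-reflexive (sym (*-identityʳ p))) (^-monoʳ-≤ p 0<g)
   not-below : ∀ N B → p ^ g < N ^ h → B ^ h ≤ p → N ≤ B → ⊥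
   not-below N B lower B≤ le = <-irrefl refl (<-≤-trans lower (≤-trans (^-monoˡ-≤ h le) (≤-trans B≤ p≤p^g)))
   sparse-below : ∀ N B c → c ^ (2 * h) * p ^ g < N ^ (2 * h) → B ^ (2 * h) ≤ p → B * c ≤ N
   sparse-below N B c few B≤ with ≤-<-connex (B * c) N
   ... | inj₁ le = le
   ... | inj₂ lt = ⊥-elim (<-irrefl refl (≤-<-trans (≤-trans (^-monoˡ-≤ (2 * h) (<⇒≤ lt)) (≤-trans (≤-reflexive (trans (^-distribʳ-* (2 * h) B c) (*-comm (B ^ (2 * h)) (c ^ (2 * h)))))
       (*-monoʳ-≤ (c ^ (2 * h)) (≤-trans B≤ p≤p^g)))) few))
   -- After raising to the power h, the upper bound on N leaves a factor p^(2g) below p^(3h), and B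
   -- uses up at most p^g of it.
   not-filling : ∀ N B → g < h → N ^ h < p ^ (3 * h ∸ 2 * g) → B ^ h ≤ p → p * (p * p) ≤ B * N → ⊥
   not-filling N B g<h upper B≤ le = <-irrefl refl (begin-strict
     p ^ (3 * h) ≡⟨ ^-*-assoc p 3 h ⟨
     (p ^ 3) ^ h ≡⟨ cong (_^ h) (cong (λ x → p * (p * x)) (*-identityʳ p)) ⟩
     (p * (p * p)) ^ h ≤⟨ ^-monoˡ-≤ h le ⟩
     (B * N) ^ h ≡⟨ ^-distribʳ-* h B N ⟩
     B ^ h * N ^ h ≤⟨ *-monoˡ-≤ (N ^ h) (≤-trans B≤ p≤p^g) ⟩
     p ^ g * N ^ h <⟨ *-monoʳ-< (p ^ g) {{m^n≢0 p g}} upper ⟩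
     p ^ g * p ^ (3 * h ∸ 2 * g) ≡⟨ ^-distribˡ-+-* p g (3 * h ∸ 2 * g) ⟨
     p ^ (g + (3 * h ∸ 2 * g)) ≤⟨ ^-monoʳ-≤ p (≤-trans (+-monoˡ-≤ (3 * h ∸ 2 * g) (m≤m+n g (1 * g))) (≤-reflexive (m+[n∸m]≡n (*-mono-≤ (n≤1+n 2) (<⇒≤ g<h))))) ⟩
     p ^ (3 * h) ∎)
     where open ≤-Reasoning

 power-absorbed : ∀ k M p c h → 0 < k → k ^ M ≤ p → (c + c) * h ≤ M → ((k * k) ^ c) ^ h ≤ p
 power-absorbed k M p c h 0<k k^M≤p le = begin
   ((k * k) ^ c) ^ h ≡⟨ ^-*-assoc (k * k) c h ⟩
   (k * k) ^ (c * h) ≡⟨ ^-distribʳ-* (c * h) k k ⟩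
   k ^ (c * h) * k ^ (c * h) ≡⟨ ^-distribˡ-+-* k (c * h) (c * h) ⟨
   k ^ (c * h + c * h) ≡⟨ cong (k ^_) (*-distribʳ-+ h c c) ⟨
   k ^ ((c + c) * h) ≤⟨ ^-monoʳ-≤ k {{>-nonZero 0<k}} le ⟩
   k ^ M ≤⟨ k^M≤p ⟩
   p ∎
   where open ≤-Reasoning

 -- `k₁` is a power of two whose M-th power is at most p and whose f-th power is at least p. Its
 -- exponent is about k/f rounded up; the rounding at most doubles it, and this is the gap between M
 -- and f = 2·M.
 module Scale (M : ℕ) (0<M : 0 < M) where
   f : ℕ
   f = 2 * M
   0<f : 0 < f
   0<f = ≤-trans 0<M (m≤m+n M _)
   -- The term 2·f·f makes s at least 2·f, so that s·f ≤ 2^s and `k₁` exceeds the number of dyadic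
   -- scales; the term f pays for the rounding in `k₁^M≤p`; the term 4 gives p ≥ 12.
   threshold : ℕ
   threshold = 2 * f * f + f + 4
   module _ (p : ℕ) (large : 2 ^ threshold ≤ p) where
     private
       instance
         f≢0 : NonZero f
         f≢0 = >-nonZero 0<f
     0<p : 0 < p
     0<p = ≤-trans (m^n>0 2 threshold) large
     opaque
       log : ∃ λ k → 2 ^ k ≤ p × p < 2 ^ suc k
       log = floor-log p 0<p
     k s k₁ : ℕ
     k = proj₁ log
     s = suc (k / f)
     k₁ = 2 ^ s
     p<2^J : p < 2 ^ suc k
     p<2^J = proj₂ (proj₂ log)
     threshold≤k : threshold ≤ k
     threshold≤k with ≤-<-connex threshold k
     ... | inj₁ h = h
     ... | inj₂ h = ⊥-elim (<-irrefl refl (<-≤-trans p<2^J (≤-trans (^-monoʳ-≤ 2 h) large)))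
     12≤p : 12 ≤ p
     12≤p = ≤-trans (≤ᵇ⇒≤ 12 16 _) (≤-trans (^-monoʳ-≤ 2 (m≤n+m 4 (2 * f * f + f))) large)
     J≤2L : suc k ≤ 2 * ⌈log₂ p ⌉
     J≤2L = ≤-trans (+-monoˡ-≤ k (≤-trans (≤-trans (s≤s z≤n) (m≤n+m 4 (2 * f * f + f))) threshold≤k))
       (≤-trans (≤-reflexive (cong (k +_) (sym (+-identityʳ k)))) (*-monoʳ-≤ 2 (≤-trans (≤-reflexive (sym (⌈log₂2^n⌉≡n k))) (⌈log₂⌉-mono-≤ (proj₁ (proj₂ log))))))
     J≤s*f : suc k ≤ s * f
     J≤s*f = ≤-trans (≤-reflexive (cong suc (m≡m%n+[m/n]*n k f))) (+-monoˡ-≤ (k / f * f) (m%n<n k f))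
     J≤k₁ : suc k ≤ k₁
     J≤k₁ = ≤-trans J≤s*f (≤-trans (≤-reflexive (*-comm s f)) (linear≤exponential f s 0<f (≤-trans (≤-reflexive (sym (m*n/n≡m (2 * f) f)))
       (≤-trans (/-monoˡ-≤ f (≤-trans (≤-trans (m≤m+n (2 * f * f) f) (m≤m+n _ 4)) threshold≤k)) (n≤1+n _)))))
     p≤k₁^f : p ≤ k₁ ^ f
     p≤k₁^f = ≤-trans (<⇒≤ p<2^J) (≤-trans (^-monoʳ-≤ 2 J≤s*f) (≤-reflexive (sym (^-*-assoc 2 s f))))
     k₁^M≤p : k₁ ^ M ≤ p
     k₁^M≤p = ≤-trans (≤-reflexive (^-*-assoc 2 s M)) (≤-trans (^-monoʳ-≤ 2 (*-cancelˡ-≤ {s * M} {k} 2 (begin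
       2 * (s * M) ≡⟨ solveℕ 2 (λ s m → # 2 ⊗ (s ⊗ m) ⊜ s ⊗ (# 2 ⊗ m)) refl s M ⟩
       f + k / f * f ≤⟨ +-mono-≤ (≤-trans (≤-trans (m≤n+m f (2 * f * f)) (m≤m+n _ 4)) threshold≤k) (m/n*n≤m k f) ⟩
       k + k ≡⟨ cong (k +_) (sym (+-identityʳ k)) ⟩
       2 * k ∎))) (proj₁ (proj₂ log)))
       where open ≤-Reasoning
     4≤k₁² : 4 ≤ k₁ * k₁
     4≤k₁² = *-mono-≤ {2} {k₁} {2} {k₁} two two
       where
       two : 2 ≤ k₁
       two = ^-monoʳ-≤ 2 {1} {s} (s≤s z≤n)

 -- Here `K` is the root of the energy parameter, which therefore appears as `K * K`.
 module _ (c K J L N e e' Y k₁ k₂ p f : ℕ) (432≤c : 432 ≤ c) (0<J : 0 < J) (J≤K : J ≤ K) (J≤2L : J ≤ 2 * L) (p≤ : p ≤ K ^ f) (e≤ : e ≤ 3 * e') where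
   private
     D X : ℕ
     D = c * (J * J * J) * (Y * Y)
     X = c * L * Y
     e²≤ : e * e ≤ 9 * (e' * e')
     e²≤ = ≤-trans (*-mono-≤ e≤ e≤) (≤-reflexive (solveℕ 1 (λ e → # 3 ⊗ e ⊗ (# 3 ⊗ e) ⊜ # 9 ⊗ (e ⊗ e)) refl e'))
     cancel : ∀ {x y} → J * x ≤ J * y → x ≤ y
     cancel = *-cancelˡ-≤ J {{>-nonZero 0<J}}
     J²≤ : J * J ≤ 4 * (L * L)
     J²≤ = ≤-trans (*-mono-≤ J≤2L J≤2L) (≤-reflexive (solveℕ 1 (λ l → # 2 ⊗ l ⊗ (# 2 ⊗ l) ⊜ # 4 ⊗ (l ⊗ l)) refl L))
   -- Three factors J face only the two logarithms in X·X. The third one is bounded by one factor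
   -- `K`, and the other factor `K` remains as the gain.
   first-alternative : K * K * N * (e' * e') ≤ D * (k₁ * k₂) → K * (N * (e * e)) ≤ X * X * (k₁ * k₂)
   first-alternative h = begin
     K * (N * (e * e)) ≤⟨ *-monoʳ-≤ K (*-monoʳ-≤ N e²≤) ⟩
     K * (N * (9 * (e' * e'))) ≡⟨ solveℕ 3 (λ k n e → k ⊗ (n ⊗ (# 9 ⊗ e)) ⊜ # 9 ⊗ (k ⊗ n ⊗ e)) refl K N (e' * e') ⟩
     9 * (K * N * (e' * e')) ≤⟨ *-monoʳ-≤ 9 (cancel step) ⟩
     9 * (c * (J * J) * (Y * Y) * (k₁ * k₂)) ≤⟨ *-monoʳ-≤ 9 (*-monoˡ-≤ (k₁ * k₂) (*-monoˡ-≤ (Y * Y) (*-monoʳ-≤ c J²≤))) ⟩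
     9 * (c * (4 * (L * L)) * (Y * Y) * (k₁ * k₂)) ≡⟨ solveℕ 4 (λ c l y k → # 9 ⊗ (c ⊗ (# 4 ⊗ l) ⊗ y ⊗ k) ⊜ # 36 ⊗ (c ⊗ l ⊗ y ⊗ k)) refl c (L * L) (Y * Y) (k₁ * k₂) ⟩
     36 * (c * (L * L) * (Y * Y) * (k₁ * k₂)) ≤⟨ *-monoˡ-≤ (c * (L * L) * (Y * Y) * (k₁ * k₂)) (≤-trans (≤ᵇ⇒≤ 36 432 _) 432≤c) ⟩
     c * (c * (L * L) * (Y * Y) * (k₁ * k₂)) ≡⟨ solveℕ 4 (λ c l y k → c ⊗ (c ⊗ (l ⊗ l) ⊗ (y ⊗ y) ⊗ k) ⊜ c ⊗ l ⊗ y ⊗ (c ⊗ l ⊗ y) ⊗ k) refl c L Y (k₁ * k₂) ⟩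
     X * X * (k₁ * k₂) ∎
     where
     open ≤-Reasoning
     step : J * (K * N * (e' * e')) ≤ J * (c * (J * J) * (Y * Y) * (k₁ * k₂))
     step = ≤-trans (*-monoˡ-≤ (K * N * (e' * e')) J≤K) (≤-trans (≤-reflexive (solveℕ 3 (λ k n e → k ⊗ (k ⊗ n ⊗ e) ⊜ k ⊗ k ⊗ n ⊗ e) refl K N (e' * e')))
       (≤-trans h (≤-reflexive (solveℕ 4 (λ c j y k → c ⊗ (j ⊗ j ⊗ j) ⊗ y ⊗ k ⊜ j ⊗ (c ⊗ (j ⊗ j) ⊗ y ⊗ k)) refl c J (Y * Y) (k₁ * k₂)))))
   second-alternative : (K * K * N * e') * (K * K * N * e') ≤ D * D * (24 * k₁) → (K * (N * e)) * (K * (N * e)) ≤ X * X * (X * X) * k₁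
   second-alternative h = begin
     K * (N * e) * (K * (N * e)) ≡⟨ solveℕ 3 (λ k n e → k ⊗ (n ⊗ e) ⊗ (k ⊗ (n ⊗ e)) ⊜ k ⊗ n ⊗ (k ⊗ n) ⊗ (e ⊗ e)) refl K N e ⟩
     K * N * (K * N) * (e * e) ≤⟨ *-monoʳ-≤ (K * N * (K * N)) e²≤ ⟩
     K * N * (K * N) * (9 * (e' * e')) ≡⟨ solveℕ 3 (λ k n e → k ⊗ n ⊗ (k ⊗ n) ⊗ (# 9 ⊗ (e ⊗ e)) ⊜ # 9 ⊗ (k ⊗ n ⊗ e ⊗ (k ⊗ n ⊗ e))) refl K N e' ⟩
     9 * (Z * Z) ≤⟨ *-monoʳ-≤ 9 (cancel (cancel step)) ⟩
     9 * (G * G * (24 * k₁)) ≤⟨ *-monoʳ-≤ 9 (*-monoˡ-≤ (24 * k₁) (*-mono-≤ G≤ G≤)) ⟩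
     9 * (H * H * (24 * k₁)) ≡⟨ solveℕ 2 (λ h k → # 9 ⊗ (h ⊗ h ⊗ (# 24 ⊗ k)) ⊜ # 216 ⊗ (h ⊗ h ⊗ k)) refl H k₁ ⟩
     216 * (H * H * k₁) ≡⟨ solveℕ 2 (λ g k → # 216 ⊗ (# 4 ⊗ g ⊗ (# 4 ⊗ g) ⊗ k) ⊜ # 3456 ⊗ (g ⊗ g ⊗ k)) refl G₀ k₁ ⟩
     3456 * (G₀ * G₀ * k₁) ≤⟨ *-monoˡ-≤ (G₀ * G₀ * k₁) (≤-trans (≤ᵇ⇒≤ 3456 (59 * 59) _) (*-mono-≤ 59≤c 59≤c)) ⟩
     c * c * (G₀ * G₀ * k₁) ≡⟨ solveℕ 3 (λ c g k → c ⊗ c ⊗ (g ⊗ g ⊗ k) ⊜ c ⊗ g ⊗ (c ⊗ g) ⊗ k) refl c G₀ k₁ ⟩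
     c * (c * (L * L) * (Y * Y)) * (c * (c * (L * L) * (Y * Y))) * k₁ ≡⟨ solveℕ 4 (λ c l y k → c ⊗ (c ⊗ (l ⊗ l) ⊗ (y ⊗ y)) ⊗ (c ⊗ (c ⊗ (l ⊗ l) ⊗ (y ⊗ y))) ⊗ k
          ⊜ c ⊗ l ⊗ y ⊗ (c ⊗ l ⊗ y) ⊗ (c ⊗ l ⊗ y ⊗ (c ⊗ l ⊗ y)) ⊗ k) refl c L Y k₁ ⟩
     X * X * (X * X) * k₁ ∎
     where
     open ≤-Reasoning
     Z = K * N * e'
     G = c * (J * J) * (Y * Y)
     G₀ = c * (L * L) * (Y * Y)
     H = 4 * G₀
     59≤c : 59 ≤ c
     59≤c = ≤-trans (≤ᵇ⇒≤ 59 432 _) 432≤c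
     G≤ : G ≤ H
     G≤ = ≤-trans (*-monoˡ-≤ (Y * Y) (*-monoʳ-≤ c J²≤)) (≤-reflexive (solveℕ 3 (λ c l y → c ⊗ (# 4 ⊗ l) ⊗ y ⊜ # 4 ⊗ (c ⊗ l ⊗ y)) refl c (L * L) (Y * Y)))
     step : J * (J * (Z * Z)) ≤ J * (J * (G * G * (24 * k₁)))
     step = ≤-trans (*-mono-≤ J≤K (*-monoˡ-≤ (Z * Z) J≤K)) (≤-trans (≤-reflexive (solveℕ 3 (λ k n e → k ⊗ (k ⊗ (k ⊗ n ⊗ e ⊗ (k ⊗ n ⊗ e))) ⊜ k ⊗ k ⊗ n ⊗ e ⊗ (k ⊗ k ⊗ n ⊗ e)) refl K N e'))
       (≤-trans h (≤-reflexive (solveℕ 4 (λ c j y k → c ⊗ (j ⊗ j ⊗ j) ⊗ y ⊗ (c ⊗ (j ⊗ j ⊗ j) ⊗ y) ⊗ k ⊜ j ⊗ (j ⊗ (c ⊗ (j ⊗ j) ⊗ y ⊗ (c ⊗ (j ⊗ j) ⊗ y) ⊗ k))) refl c J (Y * Y) (24 * k₁)))))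
   fourth-alternative : e' * e' ≤ 24 * J * k₁ * Y → e ^ 2 ≤ X * k₁
   fourth-alternative h = begin
     e ^ 2 ≡⟨ cong (e *_) (*-identityʳ e) ⟩
     e * e ≤⟨ e²≤ ⟩
     9 * (e' * e') ≤⟨ *-monoʳ-≤ 9 (≤-trans h (*-monoˡ-≤ Y (*-monoˡ-≤ k₁ (*-monoʳ-≤ 24 J≤2L)))) ⟩
     9 * (24 * (2 * L) * k₁ * Y) ≡⟨ solveℕ 3 (λ l k y → # 9 ⊗ (# 24 ⊗ (# 2 ⊗ l) ⊗ k ⊗ y) ⊜ # 432 ⊗ (l ⊗ y ⊗ k)) refl L k₁ Y ⟩
     432 * (L * Y * k₁) ≤⟨ *-monoˡ-≤ (L * Y * k₁) 432≤c ⟩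
     c * (L * Y * k₁) ≡⟨ solveℕ 4 (λ c l y k → c ⊗ (l ⊗ y ⊗ k) ⊜ c ⊗ l ⊗ y ⊗ k) refl c L Y k₁ ⟩
     X * k₁ ∎
     where open ≤-Reasoning
   private
     square-power : ∀ x → x ^ (2 * f) ≡ (x * x) ^ f
     square-power x = trans (sym (^-*-assoc x 2 f)) (cong (λ y → (x * y) ^ f) (*-identityʳ x))
     ^-distribˡ-* : ∀ x y → (x * y) ^ f ≡ x ^ f * y ^ f
     ^-distribˡ-* x y = ^-distribʳ-* f x y
   first-power : K * (N * (e * e)) ≤ X * X * (k₁ * k₂) → e ^ (2 * f) * N ^ f * p ^ 1 ≤ X ^ (2 * f) * k₁ ^ f * k₂ ^ f
   first-power h = begin
     e ^ (2 * f) * N ^ f * p ^ 1 ≡⟨ cong₂ _*_ (cong (_* N ^ f) (square-power e)) (*-identityʳ p) ⟩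
     (e * e) ^ f * N ^ f * p ≤⟨ *-monoʳ-≤ ((e * e) ^ f * N ^ f) p≤ ⟩
     (e * e) ^ f * N ^ f * K ^ f ≡⟨ solveℕ 3 (λ a b c → a ⊗ b ⊗ c ⊜ c ⊗ (b ⊗ a)) refl ((e * e) ^ f) (N ^ f) (K ^ f) ⟩
     K ^ f * (N ^ f * (e * e) ^ f) ≡⟨ trans (^-distribˡ-* K (N * (e * e))) (cong (K ^ f *_) (^-distribˡ-* N (e * e))) ⟨
     (K * (N * (e * e))) ^ f ≤⟨ ^-monoˡ-≤ f h ⟩
     (X * X * (k₁ * k₂)) ^ f ≡⟨ trans (^-distribˡ-* (X * X) (k₁ * k₂)) (cong₂ _*_ (sym (square-power X)) (^-distribˡ-* k₁ k₂)) ⟩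
     X ^ (2 * f) * (k₁ ^ f * k₂ ^ f) ≡⟨ *-assoc (X ^ (2 * f)) (k₁ ^ f) (k₂ ^ f) ⟨
     X ^ (2 * f) * k₁ ^ f * k₂ ^ f ∎
     where open ≤-Reasoning
   second-power : (K * (N * e)) * (K * (N * e)) ≤ X * X * (X * X) * k₁ → e ^ (2 * f) * N ^ (2 * f) * p ^ 2 ≤ X ^ (4 * f) * k₁ ^ f
   second-power h = begin
     e ^ (2 * f) * N ^ (2 * f) * p ^ 2 ≡⟨ cong₂ _*_ (cong₂ _*_ (square-power e) (square-power N)) (cong (p *_) (*-identityʳ p)) ⟩
     (e * e) ^ f * (N * N) ^ f * (p * p) ≤⟨ *-monoʳ-≤ ((e * e) ^ f * (N * N) ^ f) (*-mono-≤ p≤ p≤) ⟩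
     (e * e) ^ f * (N * N) ^ f * (K ^ f * K ^ f) ≡⟨ cong₂ _*_ (^-distribˡ-* (e * e) (N * N)) (^-distribˡ-* K K) ⟨
     (e * e * (N * N)) ^ f * (K * K) ^ f ≡⟨ ^-distribˡ-* (e * e * (N * N)) (K * K) ⟨
     (e * e * (N * N) * (K * K)) ^ f ≡⟨ cong (_^ f) (solveℕ 3 (λ e n k → e ⊗ e ⊗ (n ⊗ n) ⊗ (k ⊗ k) ⊜ k ⊗ (n ⊗ e) ⊗ (k ⊗ (n ⊗ e))) refl e N K) ⟩
     (K * (N * e) * (K * (N * e))) ^ f ≤⟨ ^-monoˡ-≤ f h ⟩
     (X * X * (X * X) * k₁) ^ f ≡⟨ trans (^-distribˡ-* (X * X * (X * X)) k₁) (cong (_* k₁ ^ f) fourth) ⟩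
     X ^ (4 * f) * k₁ ^ f ∎
     where
     open ≤-Reasoning
     fourth : (X * X * (X * X)) ^ f ≡ X ^ (4 * f)
     fourth = trans (cong (_^ f) (solveℕ 1 (λ x → x ⊗ x ⊗ (x ⊗ x) ⊜ x ⊗ (x ⊗ (x ⊗ (x ⊗ # 1)))) refl X)) (^-*-assoc X 4 f)

module OverField (𝔽 : FiniteField) where
 private
  module 𝓕 = FieldTheory 𝔽
  module 𝓢 = PowerSeries.Series 𝓕.commutativeRing
  module 𝓟 = Forms 𝔽
  module E₀ = 𝓟.Eval 𝓟.baseAlg

 -- Zeros of polynomials counted with multiplicity

 module Roots where
  open 𝓕
  open import Data.List using (List; []; _∷_; length)
  open PowerSeries
  open Sums

  open 𝓢

  +ˡ : ∀ {a b c} → b ≡ c → a + b ≡ a + c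
  +ˡ {a} = cong (a +_)

  -- The expansion at c, as a series in X, of the polynomial with coefficients q, by Horner's rule
  -- in c + X. Orders of vanishing are read off it without dividing by factorials.
  expand : F → List F → Seq
  expand c []      n = 0#
  expand c (a ∷ q) n = const a n + (c * expand c q n + shift (expand c q) n)

  rem : F → List F → F
  rem c q = expand c q 0

  quot : F → List F → List F
  quot c []            = []
  quot c (a ∷ [])      = []
  quot c (a ∷ b ∷ q)   = rem c (b ∷ q) ∷ quot c (b ∷ q)

  length-quot : ∀ c a q → length (quot c (a ∷ q)) ≡ length q
  length-quot c a []      = refl
  length-quot c a (b ∷ q) = cong suc (length-quot c b q)

  shift-lin : ∀ x y z (f g h : Seq) → (∀ n → f n ≡ x * g n + y * h n + const z n) →
              ∀ n → shift f n ≡ x * shift g n + y * shift h n + z * X n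
  shift-lin x y z f g h e zero = solve 3 (λ x y z → :0 := x :* :0 :+ y :* :0 :+ z :* :0) refl x y z
  shift-lin x y z f g h e (suc zero) = trans (e 0) (+ˡ (sym (*-identityʳ z)))
  shift-lin x y z f g h e (suc (suc n)) = trans (e (suc n)) (+ˡ (sym (zeroʳ z)))

  shift-const : ∀ z n → shift (const z) n ≡ z * X n
  shift-const z zero = sym (zeroʳ z)
  shift-const z (suc zero) = sym (*-identityʳ z)
  shift-const z (suc (suc n)) = sym (zeroʳ z)

  shift-+ : ∀ (f g : Seq) n → shift (λ k → f k + g k) n ≡ shift f n + shift g n
  shift-+ f g zero = sym (+-identityˡ 0#)
  shift-+ f g (suc n) = refl

  shift-* : ∀ x (f : Seq) n → shift (λ k → x * f k) n ≡ x * shift f n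
  shift-* x f zero = sym (zeroʳ x)
  shift-* x f (suc n) = refl

  division-step : ∀ a b c r (E D : Seq) → (∀ n → E n ≡ (b - c) * D n + shift D n + const r n) → ∀ n →
    let D' = λ k → const r k + (b * D k + shift D k) in
    const a n + (b * E n + shift E n) ≡ (b - c) * D' n + shift D' n + const (a + (c * r + 0#)) n
  division-step a b c r E D ih n = begin
    const a n + (b * E n + shift E n)
      ≡⟨ cong (const a n +_) (cong₂ _+_ (cong (b *_) (ih n)) (sh n)) ⟩
    const a n + (b * ((b - c) * D n + shift D n + const r n) + ((b - c) * shift D n + shift (shift D) n + r * X n))
      ≡⟨ cong₂ _+_ (const-split n) (refl {x = b * ((b - c) * D n + shift D n + const r n) + ((b - c) * shift D n + shift (shift D) n + r * X n)}) ⟩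
    (const (a + (c * r + 0#)) n - c * const r n) + (b * ((b - c) * D n + shift D n + const r n) + ((b - c) * shift D n + shift (shift D) n + r * X n))
      ≡⟨ solve 9 (λ A c R b D S SS r X → (A :- c :* R) :+ (b :* ((b :- c) :* D :+ S :+ R) :+ ((b :- c) :* S :+ SS :+ r :* X))
           := (b :- c) :* (R :+ (b :* D :+ S)) :+ ((b :* S :+ SS) :+ r :* X) :+ A) refl
           (const (a + (c * r + 0#)) n) c (const r n) b (D n) (shift D n) (shift (shift D) n) r (X n) ⟩
    (b - c) * (const r n + (b * D n + shift D n)) + ((b * shift D n + shift (shift D) n) + r * X n) + const (a + (c * r + 0#)) n
      ≡⟨ cong (λ z → (b - c) * (const r n + (b * D n + shift D n)) + z + const (a + (c * r + 0#)) n) (sym sh2) ⟩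
    (b - c) * D' n + shift D' n + const (a + (c * r + 0#)) n ∎
    where
    open ≡-Reasoning
    D' : Seq
    D' k = const r k + (b * D k + shift D k)
    sh : ∀ n → shift E n ≡ (b - c) * shift D n + shift (shift D) n + r * X n
    sh zero = trans (solve 2 (λ y r → :0 := y :* :0 :+ :0 :+ r :* :0) refl (b - c) r) refl
    sh (suc n) = trans (ih n) (+ˡ (shift-const r (suc n)))
    sh2 : shift D' n ≡ (b * shift D n + shift (shift D) n) + r * X n
    sh2 = trans (shift-+ (const r) (λ k → b * D k + shift D k) n)
      (trans (cong₂ _+_ (shift-const r n) (trans (shift-+ (λ k → b * D k) (shift D) n) (cong (_+ shift (shift D) n) (shift-* b D n))))
        (+-comm _ _))
    const-split : ∀ n → const a n ≡ const (a + (c * r + 0#)) n - c * const r n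
    const-split zero    = solve 3 (λ a c r → a := (a :+ (c :* r :+ :0)) :- c :* r) refl a c r
    const-split (suc n) = solve 1 (λ c → :0 := :0 :- c :* :0) refl c

  -- Division by the linear factor at c, expanded at a second point b, where that factor is (b - c)
  -- + X. At b = c it lowers the order of vanishing by one, elsewhere the order is preserved.
  division : ∀ b c q n → expand b q n ≡ (b - c) * expand b (quot c q) n + shift (expand b (quot c q)) n + const (rem c q) n
  division b c [] n = trans (solve 2 (λ b c → :0 := (b :- c) :* :0 :+ :0 :+ :0) refl b c) (cong₂ _+_ (cong ((b - c) * 0# +_) (h n)) (k n))
    where
    h : ∀ n → 0# ≡ shift (λ _ → 0#) n
    h zero = refl
    h (suc n) = refl
    k : ∀ n → 0# ≡ const 0# n
    k zero = refl
    k (suc n) = refl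
  division b c (a ∷ []) n = trans (cong (const a n +_) (cong₂ _+_ (zeroʳ b) (sym (z n))))
    (trans (e n) (cong₂ _+_ (cong₂ _+_ (sym (zeroʳ (b - c))) (z n)) (cong (λ x → const x n)
      (solve 2 (λ a c → a := a :+ (c :* :0 :+ :0)) refl a c))))
    where
    z : ∀ n → 0# ≡ shift (λ _ → 0#) n
    z zero = refl
    z (suc n) = refl
    e : ∀ n → const a n + (0# + 0#) ≡ 0# + 0# + const a n
    e n = solve 1 (λ a → a :+ (:0 :+ :0) := :0 :+ :0 :+ a) refl (const a n)
  division b c (a ∷ q@(x ∷ xs)) n =
    division-step a b c (rem c q) (expand b q) (expand b (quot c q)) (division b c (x ∷ xs)) n

  -- Each division by a linear factor uses up one unit of multiplicity and one coefficient.
  roots : ∀ q (m : F → ℕ) → length q ≤ Fᶠ.∑ᴬ m → (∀ c n → n < m c → expand c q n ≡ 0#) → ∀ c n → expand c q n ≡ 0#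
  roots q m = go (length q) q m refl
    where
    go : ∀ L q m → length q ≡ L → L ≤ Fᶠ.∑ᴬ m → (∀ c n → n < m c → expand c q n ≡ 0#) → ∀ c n → expand c q n ≡ 0#
    go zero    []      m e le h c n = refl
    go (suc L) (a ∷ q) m e le h b n
      with ∑-exists Fᶠ.elems m (λ _ → 0) (≤-trans (≤-reflexive (cong suc (∑-0 Fᶠ.elems))) (≤-trans (s≤s z≤n) le))
    ... | c , pos = trans (split b n) (trans (cong₂ _+_ (cong ((b - c) *_) (ih b n)) (shift-0 n)) (solve 2 (λ b c → (b :- c) :* :0 :+ :0 := :0) refl b c))
      where
      d = quot c (a ∷ q)
      r0 : rem c (a ∷ q) ≡ 0#
      r0 = h c 0 pos
      split : ∀ b n → expand b (a ∷ q) n ≡ (b - c) * expand b d n + shift (expand b d) n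
      split b n = trans (division b c (a ∷ q) n) (trans (+ˡ (trans (cong (λ z → const z n) r0) (k n))) (+-identityʳ _))
        where
        k : ∀ n → const 0# n ≡ 0#
        k zero = refl
        k (suc n) = refl
      m' : F → ℕ
      m' b = m b ℕ.∸ 𝟙 (c == b)
      m≡ : ∀ b → m b ≡ m' b ℕ.+ 𝟙 (c == b)
      m≡ b with c ≟ b
      ... | yes refl = sym (ℕ.m∸n+n≡m pos)
      ... | no _     = sym (trans (ℕ.+-identityʳ _) refl)
      le' : L ≤ Fᶠ.∑ᴬ m'
      le' = ℕ.≤-pred (≤-trans le (≤-reflexive (trans (∑-cong Fᶠ.elems m≡) (trans (∑-+ Fᶠ.elems m' _)
        (trans (cong (Fᶠ.∑ᴬ m' ℕ.+_) (Fᶠ.once c)) (ℕ.+-comm _ 1))))))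
      h' : ∀ b n → n < m' b → expand b d n ≡ 0#
      h' b n lt with c ≟ b
      ... | yes refl = trans (sym (trans (split c (suc n)) (trans (cong (_+ expand c d n) (trans (cong (_* expand c d (suc n)) (zero-sub refl)) (zeroˡ _))) (+-identityˡ _))))
                         (h c (suc n) (≤-trans (s≤s lt) (≤-reflexive (trans (ℕ.+-comm 1 _) (ℕ.m∸n+n≡m pos)))))
      ... | no ne = go' n lt
        where
        nz : ¬ (b - c ≡ 0#)
        nz z = ne (sym (sub-zero z))
        go' : ∀ n → n < m b → expand b d n ≡ 0#
        go' zero    lt = *-cancel0 nz (trans (sym (trans (split b 0) (+-identityʳ _))) (h b 0 lt))
        go' (suc n) lt = *-cancel0 nz (trans (sym (trans (split b (suc n)) (trans (+ˡ (go' n (≤-trans (ℕ.n≤1+n _) lt))) (+-identityʳ _)))) (h b (suc n) lt))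
      ih : ∀ b n → expand b d n ≡ 0#
      ih = go L d m' (trans (length-quot c a q) (ℕ.suc-injective e)) le' h'
      shift-0 : ∀ n → shift (expand b d) n ≡ 0#
      shift-0 zero = refl
      shift-0 (suc n) = ih b n

 -- Families of series that are expansions of one polynomial

 module Degree where
  open 𝓕
  open Roots
  open import Data.List using (List; []; _∷_; length)
  open PowerSeries hiding (multiple)
  open Sums
  open 𝓢

  -- φ c is the expansion at c of one polynomial of degree at most d, the same for all c. The class
  -- is closed under the ring operations and the derivative, and `deg-roots` turns vanishing to high
  -- order at enough points into vanishing everywhere.
  Deg : ℕ → (F → Seq) → Set
  Deg d φ = Σ (List F) λ q → (length q ≤ suc d) × (∀ c n → φ c n ≡ expand c q n)

  addL : List F → List F → List F
  addL []      r       = r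
  addL (a ∷ q) []      = a ∷ q
  addL (a ∷ q) (b ∷ r) = (a + b) ∷ addL q r

  scaleL : F → List F → List F
  scaleL a []      = []
  scaleL a (b ∷ q) = a * b ∷ scaleL a q

  mulL : List F → List F → List F
  mulL []      r = []
  mulL (a ∷ q) r = addL (scaleL a r) (0# ∷ mulL q r)

  derivL : List F → List F
  derivL []      = []
  derivL (a ∷ q) = addL q (0# ∷ derivL q)

  length-addL : ∀ q r {k} → length q ≤ k → length r ≤ k → length (addL q r) ≤ k
  length-addL []      r       h       h'       = h'
  length-addL (_ ∷ _) []      h       h'       = h
  length-addL (_ ∷ q) (_ ∷ r) (s≤s h) (s≤s h') = s≤s (length-addL q r h h')

  length-scaleL : ∀ a q → length (scaleL a q) ≡ length q
  length-scaleL a []      = refl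
  length-scaleL a (b ∷ q) = cong suc (length-scaleL a q)

  length-mulL : ∀ q r {d e} → length q ≤ suc d → length r ≤ suc e → length (mulL q r) ≤ suc (d ℕ.+ e)
  length-mulL []           r h h' = z≤n
  length-mulL (a ∷ [])     r {d} {e} h h' = length-addL (scaleL a r) (0# ∷ []) (≤-trans (≤-reflexive (length-scaleL a r)) (≤-trans h' (s≤s (ℕ.m≤n+m e d)))) (s≤s z≤n)
  length-mulL (a ∷ b ∷ q)  r {suc d} {e} (s≤s h) h' =
    length-addL (scaleL a r) (0# ∷ mulL (b ∷ q) r) (≤-trans (≤-reflexive (length-scaleL a r)) (≤-trans h' (s≤s (ℕ.m≤n+m e (suc d))))) (s≤s (length-mulL (b ∷ q) r h h'))

  length-derivL : ∀ q → length (derivL q) ≤ length q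
  length-derivL []      = z≤n
  length-derivL (a ∷ q) = length-addL q (0# ∷ derivL q) (ℕ.n≤1+n _) (s≤s (length-derivL q))

  const-+ : ∀ a b n → const (a + b) n ≡ const a n + const b n
  const-+ a b zero = refl
  const-+ a b (suc n) = sym (+-identityˡ 0#)

  const-* : ∀ a b n → const (a * b) n ≡ a * const b n
  const-* a b zero = refl
  const-* a b (suc n) = sym (zeroʳ a)

  const-0 : ∀ n → const 0# n ≡ 0#
  const-0 zero = refl
  const-0 (suc n) = refl

  expand-+ : ∀ c q r n → expand c (addL q r) n ≡ expand c q n + expand c r n
  expand-+ c []      r       n = sym (+-identityˡ _)
  expand-+ c (a ∷ q) []      n = sym (+-identityʳ _)
  expand-+ c (a ∷ q) (b ∷ r) n = trans
    (cong₂ _+_ (const-+ a b n) (cong₂ _+_ (cong (c *_) (expand-+ c q r n))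
      (trans (shift-cong (expand-+ c q r) n) (shift-+ (expand c q) (expand c r) n))))
    (solve 7 (λ a b c e e' s s' → (a :+ b) :+ (c :* (e :+ e') :+ (s :+ s')) := (a :+ (c :* e :+ s)) :+ (b :+ (c :* e' :+ s'))) refl
      (const a n) (const b n) c (expand c q n) (expand c r n) (shift (expand c q) n) (shift (expand c r) n))

  expand-scale : ∀ c a q n → expand c (scaleL a q) n ≡ a * expand c q n
  expand-scale c a []      n = sym (zeroʳ a)
  expand-scale c a (b ∷ q) n = trans
    (cong₂ _+_ (const-* a b n) (cong₂ _+_ (cong (c *_) (expand-scale c a q n))
      (trans (shift-cong (expand-scale c a q) n) (shift-* a (expand c q) n))))
    (solve 5 (λ a b c e s → a :* b :+ (c :* (a :* e) :+ a :* s) := a :* (b :+ (c :* e :+ s))) refl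
      a (const b n) c (expand c q n) (shift (expand c q) n))

  expand-* : ∀ c q r n → expand c (mulL q r) n ≡ mul (expand c q) (expand c r) n
  expand-* c []      r n = sym (mul-zeroˡ _ n)
  expand-* c (a ∷ q) r n = begin
    expand c (addL (scaleL a r) (0# ∷ mulL q r)) n
      ≡⟨ expand-+ c (scaleL a r) (0# ∷ mulL q r) n ⟩
    expand c (scaleL a r) n + (const 0# n + (c * expand c (mulL q r) n + shift (expand c (mulL q r)) n))
      ≡⟨ cong₂ _+_ (trans (expand-scale c a r n) (sym (mul-const a R n)))
           (trans (cong (_+ (c * expand c (mulL q r) n + shift (expand c (mulL q r)) n)) (const-0 n)) (trans (+-identityˡ _)
             (cong₂ _+_ (trans (cong (c *_) (expand-* c q r n)) (sym (mul-scale c E R n)))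
               (trans (shift-cong (expand-* c q r) n) (sym (mul-shift E R n)))))) ⟩
    mul (const a) R n + (mul (λ k → c * E k) R n + mul (shift E) R n)
      ≡⟨ cong (mul (const a) R n +_) (sym (mul-distribʳ R (λ k → c * E k) (shift E) n)) ⟩
    mul (const a) R n + mul (λ k → c * E k + shift E k) R n
      ≡⟨ sym (mul-distribʳ R (const a) (λ k → c * E k + shift E k) n) ⟩
    mul (expand c (a ∷ q)) R n ∎
    where
    open ≡-Reasoning
    E = expand c q
    R = expand c r

  dv : Seq → Seq
  dv = deriv commutativeRing

  dv-cong : ∀ {f g} → (∀ n → f n ≡ g n) → ∀ n → dv f n ≡ dv g n
  dv-cong e n = cong (multiple (suc n)) (e (suc n))

  expand-deriv : ∀ c q n → expand c (derivL q) n ≡ dv (expand c q) n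
  expand-deriv c []      n = sym (multiple-0 commutativeRing (suc n))
  expand-deriv c (a ∷ q) n = begin
    expand c (addL q (0# ∷ derivL q)) n
      ≡⟨ expand-+ c q (0# ∷ derivL q) n ⟩
    E n + (const 0# n + (c * expand c (derivL q) n + shift (expand c (derivL q)) n))
      ≡⟨ +ˡ (trans (cong (_+ (c * expand c (derivL q) n + shift (expand c (derivL q)) n)) (const-0 n)) (trans (+-identityˡ _)
           (cong₂ _+_ (cong (c *_) (expand-deriv c q n)) (shift-cong (expand-deriv c q) n)))) ⟩
    E n + (c * dv E n + shift (dv E) n)
      ≡⟨ solve 4 (λ e c d s → e :+ (c :* d :+ s) := c :* d :+ (e :+ s)) refl (E n) c (dv E n) (shift (dv E) n) ⟩
    c * dv E n + (E n + shift (dv E) n)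
      ≡⟨ cong₂ _+_ (sym (multiple-* commutativeRing (suc n) c (E (suc n)))) (lower n) ⟩
    multiple (suc n) (c * E (suc n)) + multiple (suc n) (E n)
      ≡⟨ sym (multiple-+ commutativeRing (suc n) (c * E (suc n)) (E n)) ⟩
    multiple (suc n) (c * E (suc n) + E n)
      ≡⟨ cong (multiple (suc n)) (sym (+-identityˡ _)) ⟩
    dv (expand c (a ∷ q)) n ∎
    where
    open ≡-Reasoning
    E = expand c q
    lower : ∀ n → E n + shift (dv E) n ≡ multiple (suc n) (E n)
    lower zero    = refl
    lower (suc n) = refl

  deg-resp : ∀ {d φ ψ} → (∀ c n → φ c n ≡ ψ c n) → Deg d φ → Deg d ψ
  deg-resp e (q , l , h) = q , l , λ c n → trans (sym (e c n)) (h c n)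

  deg-mono : ∀ {d e φ} → d ≤ e → Deg d φ → Deg e φ
  deg-mono le (q , l , h) = q , ≤-trans l (s≤s le) , h

  deg-0 : ∀ {d} → Deg d (λ _ _ → 0#)
  deg-0 = [] , z≤n , λ _ _ → refl

  deg-const : ∀ {d} a → Deg d (λ _ → const a)
  deg-const a = a ∷ [] , s≤s z≤n , λ c n → sym (trans (cong (const a n +_) (trans (cong₂ _+_ (zeroʳ c) (z n)) (+-identityʳ 0#))) (+-identityʳ _))
    where
    z : ∀ n → shift (λ _ → 0#) n ≡ 0#
    z zero = refl
    z (suc n) = refl

  deg-var : Deg 1 (λ c n → const c n + X n)
  deg-var = 0# ∷ 1# ∷ [] , s≤s (s≤s z≤n) , λ c n → sym (e c n)
    where
    q1 : ∀ c n → expand c (1# ∷ []) n ≡ unit n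
    q1 c n = trans (sym (proj₂ (proj₂ (deg-const {0} 1#)) c n)) (k n)
      where
      k : ∀ n → const 1# n ≡ unit n
      k zero = refl
      k (suc n) = refl
    cu : ∀ c n → c * unit n ≡ const c n
    cu c zero = *-identityʳ c
    cu c (suc n) = zeroʳ c
    e : ∀ c n → const 0# n + (c * expand c (1# ∷ []) n + shift (expand c (1# ∷ [])) n) ≡ const c n + X n
    e c n = trans (cong₂ _+_ (const-0 n) (cong₂ _+_ (trans (cong (c *_) (q1 c n)) (cu c n)) (shift-cong (q1 c) n))) (+-identityˡ _)

  deg-+ : ∀ {d φ ψ} → Deg d φ → Deg d ψ → Deg d (λ c n → φ c n + ψ c n)
  deg-+ (q , l , h) (r , l' , h') = addL q r , length-addL q r l l' ,
    λ c n → trans (cong₂ _+_ (h c n) (h' c n)) (sym (expand-+ c q r n))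

  deg-scale : ∀ {d φ} a → Deg d φ → Deg d (λ c n → a * φ c n)
  deg-scale a (q , l , h) = scaleL a q , ≤-trans (≤-reflexive (length-scaleL a q)) l ,
    λ c n → trans (cong (a *_) (h c n)) (sym (expand-scale c a q n))

  deg-neg : ∀ {d φ} → Deg d φ → Deg d (λ c n → - φ c n)
  deg-neg {φ = φ} D = deg-resp (λ c n → solve 1 (λ x → (:- :1) :* x := :- x) refl (φ c n)) (deg-scale (- 1#) D)

  deg-* : ∀ {d e φ ψ} → Deg d φ → Deg e ψ → Deg (d ℕ.+ e) (λ c → mul (φ c) (ψ c))
  deg-* (q , l , h) (r , l' , h') = mulL q r , length-mulL q r l l' ,
    λ c n → trans (mul-cong (h c) (h' c) n) (sym (expand-* c q r n))

  deg-deriv : ∀ {d φ} → Deg d φ → Deg d (λ c → dv (φ c))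
  deg-deriv (q , l , h) = derivL q , ≤-trans (length-derivL q) l ,
    λ c n → trans (dv-cong (h c) n) (sym (expand-deriv c q n))

  deg-roots : ∀ {d φ} → Deg d φ → (m : F → ℕ) → d < Fᶠ.∑ᴬ m → (∀ c n → n < m c → φ c n ≡ 0#) → ∀ c n → φ c n ≡ 0#
  deg-roots (q , l , h) m le z c n = trans (h c n) (roots q m (≤-trans l le) (λ c n lt → trans (sym (h c n)) (z c n lt)) c n)

 -- Wronskians, double series and restriction to lines

 module Tangency where
  open 𝓕
  open Roots
  open Degree
  open 𝓟 hiding (const; scale; sub-zero)
  open import Data.Fin as Fin using (Fin; zero; suc)
  open PowerSeries hiding (multiple)
  open Sums
  open 𝓢

  P₁ P₂ : Alg
  P₁ = PSAlg baseAlg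
  P₂ = PSAlg P₁

  module E₁ = Eval P₁
  module E₂ = Eval P₂
  module S₂ = Series (Alg.ring P₁)

  Seq² : Set
  Seq² = ℕ → Seq

  Vec₄ : Set → Set
  Vec₄ A = Fin 4 → A

  vec : {A : Set} → A → A → A → A → Vec₄ A
  vec a b c d zero                   = a
  vec a b c d (suc zero)             = b
  vec a b c d (suc (suc zero))       = c
  vec a b c d (suc (suc (suc zero))) = d

  lin : {A : Set} → A → Vec₄ A → Vec₄ A → Fin 4 → ℕ → A
  lin z x y i 0             = x i
  lin z x y i 1             = y i
  lin z x y i (suc (suc _)) = z

  _≡_[<_] : Seq → Seq → ℕ → Set
  a ≡ b [< k ] = ∀ j → j < k → a j ≡ b j

  mul-trunc : ∀ {k a a' b b'} → a ≡ a' [< k ] → b ≡ b' [< k ] → mul a b ≡ mul a' b' [< k ]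
  mul-trunc {k} e e' zero    lt = cong₂ _*_ (e 0 lt) (e' 0 lt)
  mul-trunc {suc k} {a} {a'} {b} {b'} e e' (suc j) (s≤s lt) = cong₂ _+_ (cong₂ _*_ (e 0 (s≤s z≤n)) (e' (suc j) (s≤s lt)))
    (mul-trunc {k} (λ i l → e (suc i) (s≤s l)) (λ i l → e' i (ℕ.m≤n⇒m≤1+n l)) j lt)

  mul-low : ∀ a b j → (∀ i → i < j → a i ≡ 0#) → mul a b j ≡ a j * b 0
  mul-low a b zero    h = refl
  mul-low a b (suc j) h = trans (cong₂ _+_ (trans (cong (_* b (suc j)) (h 0 (s≤s z≤n))) (zeroˡ _)) (mul-low (tail a) b j (λ i l → h (suc i) (s≤s l)))) (+-identityˡ _)

  X-lower : ∀ f {k} → (∀ j → j < suc k → mul X f j ≡ 0#) → ∀ j → j < k → f j ≡ 0#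
  X-lower f h j lt = trans (sym (mul-X f (suc j))) (h (suc j) (s≤s lt))

  wronskian : Seq → Seq → Seq
  wronskian a b n = mul a (dv b) n - mul (dv a) b n

  dv-scale : ∀ c a n → dv (λ k → c * a k) n ≡ c * dv a n
  dv-scale c a n = multiple-* commutativeRing (suc n) c (a (suc n))

  dv-trunc : ∀ {k a b} → a ≡ b [< suc k ] → dv a ≡ dv b [< k ]
  dv-trunc h j lt = cong (multiple (suc j)) (h (suc j) (s≤s lt))

  wronskian-scale : ∀ c a n → wronskian (λ k → c * a k) a n ≡ 0#
  wronskian-scale c a n = trans (cong₂ (λ x y → x - y) (mul-scale c a (dv a) n)
      (trans (mul-cong {f = dv (λ k → c * a k)} {g = a} (dv-scale c a) (λ _ → refl) n) (trans (mul-scale c (dv a) a n) (cong (c *_) (mul-comm (dv a) a n)))))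
    (zero-sub refl)

  -- A vanishing Wronskian is a first-order linear equation for a. Once the coefficients up to order
  -- j vanish, it reads (j + 1)·a (j + 1)·b 0 = 0, and j + 1 is invertible below p.
  wronskian-0 : ∀ a b → ¬ (b 0 ≡ 0#) → a 0 ≡ 0# → (∀ n → wronskian a b n ≡ 0#) → ∀ j → j < p → a j ≡ 0#
  wronskian-0 a b b0 a0 w j lt = low j lt j ≤-refl
    where
    step : ∀ j → suc j < p → (∀ i → i ≤ j → a i ≡ 0#) → a (suc j) ≡ 0#
    step j le ih = *-cancel0 (char (suc j) (s≤s z≤n) le) (trans (sym (multiple-≡ (suc j) (a (suc j)))) (*-cancel0 b0 (trans (*-comm _ _) top)))
      where
      m1 : mul a (dv b) j ≡ 0#
      m1 = trans (mul-low a (dv b) j (λ i l → ih i (ℕ.<⇒≤ l))) (trans (cong (_* dv b 0) (ih j ≤-refl)) (zeroˡ _))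
      m2 : mul (dv a) b j ≡ dv a j * b 0
      m2 = mul-low (dv a) b j (λ i l → trans (cong (multiple (suc i)) (ih (suc i) l)) (multiple-0 commutativeRing (suc i)))
      top : dv a j * b 0 ≡ 0#
      top = neg-zero (trans (sym (+-identityˡ _)) (trans (cong₂ _-_ (sym m1) (sym m2)) (w j)))
    low : ∀ j → j < p → ∀ i → i ≤ j → a i ≡ 0#
    low zero    lt zero z≤n = a0
    low (suc j) lt i l with ℕ.m≤n⇒m<n∨m≡n l
    ... | inj₁ (s≤s l') = low j (ℕ.<-trans (ℕ.n<1+n j) lt) i l'
    ... | inj₂ refl     = step j lt (low j (ℕ.<-trans (ℕ.n<1+n j) lt))

  -- The degree may grow with the order j in the outer variable; it is used with 2·j for a slope
  -- that enters a line quadratically.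
  Deg² : (ℕ → ℕ) → (F → Seq²) → Set
  Deg² d e = ∀ j → Deg (d j) (λ c → e c j)

  deg²-* : ∀ (d d' d'' : ℕ → ℕ) {e e' : F → Seq²} → (∀ i j → d i ℕ.+ d' j ≤ d'' (i ℕ.+ j)) →
    Deg² d e → Deg² d' e' → Deg² d'' (λ c → S₂.mul (e c) (e' c))
  deg²-* d d' d'' h D D' zero    = deg-mono (h 0 0) (deg-* (D 0) (D' 0))
  deg²-* d d' d'' {e} h D D' (suc j) = deg-+ (deg-mono (h 0 (suc j)) (deg-* (D 0) (D' (suc j))))
    (deg²-* (λ i → d (suc i)) d' (λ i → d'' (suc i)) {e = λ c → S₂.tail (e c)} (λ i j → h (suc i) j) (λ i → D (suc i)) D' j)

  deg²-const : ∀ (d : ℕ → ℕ) a → Deg² d (λ _ → S₂.const (const a))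
  deg²-const d a zero    = deg-const a
  deg²-const d a (suc j) = deg-0

  -- Forms are evaluated once in the algebra of all families c ↦ φ c, so that `eval-closed` can
  -- bound the degree of the result; `at` recovers the single members.
  family₁ family₂ : Alg
  family₁ = ΠAlg F P₁
  family₂ = ΠAlg F P₂

  at : ∀ A → F → Hom (ΠAlg F A) A
  at A c = record { fun = λ x → x c ; pres-≈ = λ e → e c ; pres-+ = λ _ _ → Alg.refl A ; pres-* = λ _ _ → Alg.refl A ; pres-ι = λ _ → Alg.refl A }

  deg-eval : ∀ {k a} (x : Fin k → F → Seq) → (∀ i → Deg 1 (x i)) → (f : Form k a) → Deg a (λ c → E₁.eval (λ i → x i c) f)
  deg-eval x h f = deg-resp (λ c n → eval-hom (at P₁ c) x f n)
    (Eval.eval-closed family₁ Deg deg-+ deg-* deg-const deg-0 {x = x} h f)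

  deg²-eval : ∀ {k a} (d : ℕ → ℕ → ℕ) → (∀ m m' i j → d m i ℕ.+ d m' j ≤ d (m ℕ.+ m') (i ℕ.+ j)) →
    (x : Fin k → F → Seq²) → (∀ i → Deg² (d 1) (x i)) → (f : Form k a) → Deg² (d a) (λ c → E₂.eval (λ i → x i c) f)
  deg²-eval {a = a} d h x hx f j = deg-resp (λ c n → eval-hom (at P₂ c) x f j n)
    (Eval.eval-closed family₂ (λ m → Deg² (d m)) (λ D D' j → deg-+ (D j) (D' j))
       (λ {m} {m'} → deg²-* (d m) (d m') (d (m ℕ.+ m')) (h m m')) (λ {m} c → deg²-const (d m) c) (λ j → deg-0) {x = x} hx f j)

  inner₀ : Hom P₂ P₁
  inner₀ = record { fun = λ e j → e j 0 ; pres-≈ = λ h j → h j 0 ; pres-+ = λ _ _ _ → refl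
    ; pres-* = λ a b j → inner-0 commutativeRing a b j ; pres-ι = λ { c zero → refl ; c (suc j) → refl } }

  swap : Hom P₂ P₂
  swap = record { fun = λ e k j → e j k ; pres-≈ = λ h k j → h j k ; pres-+ = λ _ _ _ _ → refl
    ; pres-* = λ a b k j → swap-* commutativeRing a b j k
    ; pres-ι = λ { c zero zero → refl ; c zero (suc j) → refl ; c (suc k) zero → refl ; c (suc k) (suc j) → refl } }

  rescale : Seq → Hom P₂ P₂
  rescale v = record { fun = λ e k → mul (pow (Alg.ring P₁) v k) (e k) ; pres-≈ = λ h k → mul-cong {f = pow (Alg.ring P₁) v k} (λ _ → refl) (h k)
    ; pres-+ = λ a b k → mul-distribˡ (pow (Alg.ring P₁) v k) (a k) (b k)
    ; pres-* = λ a b k → scale-* (Alg.ring P₁) v a b k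
    ; pres-ι = λ { c zero n → mul-unitˡ (const c) n ; c (suc k) n → Alg.zeroʳ P₁ (pow (Alg.ring P₁) v (suc k)) n } }

  -- The restriction of the form to the line is a polynomial of degree at most a, and `fam` is the
  -- family of expansions of the line at its points.
  line-vanishes : ∀ {a} (x y : Vec₄ F) (f : Form 4 a) (good : F → Bool) → a < Fᶠ.count good →
    (∀ c → good c ≡ true → E₀.eval (λ i → x i + c * y i) f ≡ 0#) → ∀ j → E₁.eval (lin 0# x y) f j ≡ 0#
  line-vanishes x y f good lt h j = trans (E₁.eval-cong at0 f j)
    (deg-roots (deg-eval fam degfam f) (λ c → 𝟙 (good c)) lt zeros 0# j)
    where
    fam : Fin 4 → F → Seq
    fam i c = lin 0# (λ i → x i + c * y i) y i
    at0 : ∀ i n → lin 0# x y i n ≡ fam i 0# n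
    at0 i 0 = solve 2 (λ x y → x := x :+ :0 :* y) refl (x i) (y i)
    at0 i 1 = refl
    at0 i (suc (suc n)) = refl
    degfam : ∀ i → Deg 1 (fam i)
    degfam i = deg-resp e (deg-+ (deg-const (x i)) (deg-scale (y i) deg-var))
      where
      e : ∀ c n → const (x i) n + y i * (const c n + X n) ≡ fam i c n
      e c 0 = solve 3 (λ x y c → x :+ y :* (c :+ :0) := x :+ c :* y) refl (x i) (y i) c
      e c 1 = solve 1 (λ y → :0 :+ y :* (:0 :+ :1) := y) refl (y i)
      e c (suc (suc n)) = solve 1 (λ y → :0 :+ y :* (:0 :+ :0) := :0) refl (y i)
    zeros : ∀ c n → n < 𝟙 (good c) → E₁.eval (λ i → fam i c) f n ≡ 0#
    zeros c n l with good c in e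
    zeros c zero l | true = trans (eval-hom (Taylor.coefficient-0 baseAlg) (λ i → fam i c) f) (h c e)
    zeros c (suc n) (s≤s ()) | true
    zeros c n () | false

 -- Second-order tangency: all derivatives vanish along a rich line

 module TangentLine where
  open 𝓕
  open Roots
  open Degree
  open 𝓟 hiding (const; scale; sub-zero)
  open Tangency
  open import Data.Fin as Fin using (Fin; zero; suc)
  open PowerSeries hiding (multiple)
  open Arith
  open Sums
  open 𝓢

  private
    module R₁ = RingTactic (Alg.ring P₁)

  -- The line of shears, which serves as the standard line of the quadric; matrices are listed row
  -- by row.
  L : F → Vec₄ F
  L u = vec 1# u 0# 1#

  -- The matrices that agree with `L u` on (1, τ) form a line through `L u` with a direction of rank
  -- one; `N u τ` is that direction minus τ·`L u`. The change only rescales points, which a form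
  -- does not notice, and it gives `N u τ` = e₁₂ - 2τ·e₁₁ - τ²·(u·e₁₁ + e₂₁). The determinant of
  -- `L u` + c·`N u τ` is (1 - τc)².
  N : F → F → Vec₄ F
  N u τ = vec (- (τ + τ) - u * (τ * τ)) 1# (- (τ * τ)) 0#

  e₁₁ e₁₂ e₂₁ e₂₂ : Vec₄ F
  e₁₁ = vec 1# 0# 0# 0#
  e₁₂ = vec 0# 1# 0# 0#
  e₂₁ = vec 0# 0# 1# 0#
  e₂₂ = vec 0# 0# 0# 1#

  wronskian-+ : ∀ a b c n → wronskian (λ k → a k + c * b k) b n ≡ wronskian a b n + wronskian (λ k → c * b k) b n
  wronskian-+ a b c n = trans (cong₂ _-_ (mul-distribʳ (dv b) a (λ k → c * b k) n)
      (trans (mul-cong {f = dv (λ k → a k + c * b k)} {g = b} (λ j → multiple-+ commutativeRing (suc j) _ _) (λ _ → refl) n)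
        (mul-distribʳ b (dv a) (dv (λ k → c * b k)) n)))
    (solve 4 (λ x y z w → (x :+ y) :- (z :+ w) := (x :- z) :+ (y :- w)) refl _ _ _ _)

  module _ {n} (κ : Fin 4 → Fin 4 → F) (f : Form 4 n) where
    -- A linear change of coordinates, later M ↦ A·M·C, which carries the line of shears to an
    -- arbitrary line.
    conj : Vec₄ F → Vec₄ F
    conj M i = κ i zero * M zero + κ i (suc zero) * M (suc zero) + κ i (suc (suc zero)) * M (suc (suc zero))
               + κ i (suc (suc (suc zero))) * M (suc (suc (suc zero)))
    conj-cong : ∀ {x y : Vec₄ F} → (∀ l → x l ≡ y l) → ∀ i → conj x i ≡ conj y i
    conj-cong h i = cong₂ _+_ (cong₂ _+_ (cong₂ _+_ (cong (_ *_) (h _)) (cong (_ *_) (h _))) (cong (_ *_) (h _))) (cong (_ *_) (h _))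
    conj-lin : ∀ x y c i → conj (λ l → x l + c * y l) i ≡ conj x i + c * conj y i
    conj-lin x y c i = solve 13 (λ c k₀ k₁ k₂ k₃ x₀ x₁ x₂ x₃ y₀ y₁ y₂ y₃ →
      k₀ :* (x₀ :+ c :* y₀) :+ k₁ :* (x₁ :+ c :* y₁) :+ k₂ :* (x₂ :+ c :* y₂) :+ k₃ :* (x₃ :+ c :* y₃)
      := (k₀ :* x₀ :+ k₁ :* x₁ :+ k₂ :* x₂ :+ k₃ :* x₃) :+ c :* (k₀ :* y₀ :+ k₁ :* y₁ :+ k₂ :* y₂ :+ k₃ :* y₃)) refl
      c _ _ _ _ _ _ _ _ _ _ _ _
    conj-scale : ∀ y c i → conj (λ l → c * y l) i ≡ c * conj y i
    conj-scale y c i = solve 9 (λ c k₀ k₁ k₂ k₃ y₀ y₁ y₂ y₃ →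
      k₀ :* (c :* y₀) :+ k₁ :* (c :* y₁) :+ k₂ :* (c :* y₂) :+ k₃ :* (c :* y₃)
      := c :* (k₀ :* y₀ :+ k₁ :* y₁ :+ k₂ :* y₂ :+ k₃ :* y₃)) refl
      c _ _ _ _ _ _ _ _
    deg-conj : ∀ {d} (x : Fin 4 → F → Seq) → (∀ l → Deg d (x l)) → ∀ i → Deg d (λ c k → conj (λ l → x l c k) i)
    deg-conj x h i = deg-+ (deg-+ (deg-+ (deg-scale _ (h _)) (deg-scale _ (h _))) (deg-scale _ (h _))) (deg-scale _ (h _))
    module _ (U : F → Bool) (T : F → F → Bool) (K : ℕ)
      (n+3≤p : n ℕ.+ 3 ≤ p)
      -- The Wronskian below has degree 2n + 1; the extra K pays for the one point whose coordinate
      -- may equal the constant ratio.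
      (many-points : 2 ℕ.* n ℕ.+ 2 ℕ.+ K ≤ Fᶠ.count U ℕ.* K)
      -- The coefficients of order up to K + 1 along a line have degree at most 2K + 2 in the slope.
      (many-lines : ∀ u → U u ≡ true → 2 ℕ.* K ℕ.+ 3 ≤ Fᶠ.count (T u))
      (on-line : ∀ u → E₀.eval (conj (L u)) f ≡ 0#)
      (on-lines : ∀ u τ c → U u ≡ true → T u τ ≡ true → ¬ (1# - τ * c ≡ 0#) → E₀.eval (conj (λ l → L u l + c * N u τ l)) f ≡ 0#)
      where
      private
        n<p : n < p
        n<p = ≤-trans (≤-trans (ℕ.n≤1+n _) (ℕ.n≤1+n _)) (≤-trans (≤-reflexive (ℕ.+-comm 3 n)) n+3≤p)
        2≢0 : ¬ (1# + (1# + 0#) ≡ 0#)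
        2≢0 = char 2 (s≤s z≤n) (≤-trans (ℕ.m≤n+m 3 n) n+3≤p)
        var+ : F → Seq
        var+ c k = const c k + X k
        Nˢ : F → Seq → Vec₄ Seq
        Nˢ u t = vec (λ k → - (t k + t k) - u * mul t t k) unit (λ k → - mul t t k) (λ _ → 0#)
        -- The line of slope τ through `L u`: the outer variable is the position on the line, the
        -- inner one an increment of τ.
        B : F → F → Fin 4 → Seq²
        B u τ = lin (λ _ → 0#) (λ i → const (conj (L u) i)) (λ i k → conj (λ l → Nˢ u (var+ τ) l k) i)
        deg-B : ∀ u i → Deg² (2 ℕ.*_) (λ τ → B u τ i)
        deg-B u i zero          = deg-const _
        deg-B u i (suc zero)    = deg-conj (λ l τ → Nˢ u (var+ τ) l) h i
          where
          t² : Deg 2 (λ τ → mul (var+ τ) (var+ τ))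
          t² = deg-* deg-var deg-var
          h : ∀ l → Deg 2 (λ τ → Nˢ u (var+ τ) l)
          h zero                   = deg-+ (deg-neg (deg-mono (s≤s z≤n) (deg-+ deg-var deg-var))) (deg-neg (deg-scale u t²))
          h (suc zero)             = deg-resp (λ { c zero → refl ; c (suc _) → refl }) (deg-const 1#)
          h (suc (suc zero))       = deg-neg t²
          h (suc (suc (suc zero))) = deg-0
        deg-B u i (suc (suc j)) = deg-0
        B-inner : ∀ u τ i j → B u τ i j 0 ≡ lin 0# (conj (L u)) (conj (N u τ)) i j
        B-inner u τ i zero          = refl
        B-inner u τ i (suc zero)    = conj-cong h i
          where
          h : ∀ l → Nˢ u (var+ τ) l 0 ≡ N u τ l
          h zero                   = solve 2 (λ u τ → (:- ((τ :+ :0) :+ (τ :+ :0))) :- u :* ((τ :+ :0) :* (τ :+ :0)) := (:- (τ :+ τ)) :- u :* (τ :* τ)) refl u τ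
          h (suc zero)             = refl
          h (suc (suc zero))       = solve 1 (λ τ → :- ((τ :+ :0) :* (τ :+ :0)) := :- (τ :* τ)) refl τ
          h (suc (suc (suc zero))) = refl
        B-inner u τ i (suc (suc j)) = refl
        bad : F → F → Bool
        bad τ c = (1# - τ * c) == 0#
        many-good : ∀ τ → n < Fᶠ.count (λ c → not (bad τ c))
        many-good τ = ℕ.+-cancelʳ-≤ 2 _ _ (≤-trans (≤-trans (≤-reflexive (trans (ℕ.+-comm (suc n) 2) (ℕ.+-comm 3 n))) n+3≤p)
          (≤-trans (≤-reflexive good+bad) (ℕ.+-monoʳ-≤ _ (Fᶠ.count-≤2 c₁ c₁ (λ c h → inj₁ (unique c (does-true (_ ≟ _) h)))))))
          where
          good+bad : p ≡ Fᶠ.count (λ c → not (bad τ c)) ℕ.+ Fᶠ.count (bad τ)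
          good+bad = trans (sym order) (trans (∑-cong Fᶠ.elems (λ c → e (bad τ c))) (∑-+ Fᶠ.elems _ _))
            where
            e : ∀ b → 1 ≡ 𝟙 (not b) ℕ.+ 𝟙 b
            e true  = refl
            e false = refl
          c₁ : F
          c₁ with τ ≟ 0#
          ... | yes _ = 0#
          ... | no h  = invert h
          unique : ∀ c → 1# - τ * c ≡ 0# → c₁ ≡ c
          unique c e with τ ≟ 0#
          ... | yes refl = ⊥-elim (1≢0 (trans (solve 1 (λ c → :1 := :1 :- :0 :* c) refl c) e))
          ... | no h     = *-cancelˡ h (trans (*-invert h) (sub-zero e))
        E : F → F → Seq²
        E u τ = E₂.eval (B u τ) f
        -- The coefficient of order j along the line is a polynomial of degree at most 2j in the
        -- slope, with a zero at each given slope; for j up to K + 1 these are too many. So f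
        -- vanishes to that order along the lines of all slopes, and one may differentiate in the
        -- slope.
        E-vanishes : ∀ u → U u ≡ true → ∀ j k → j < 2 ℕ.+ K → E u 0# j k ≡ 0#
        E-vanishes u hu j k lt = deg-roots (deg²-eval (λ _ → 2 ℕ.*_) (λ _ _ i j → ≤-reflexive (sym (ℕ.*-distribˡ-+ 2 i j))) (λ i τ → B u τ i) (deg-B u) f j)
            (λ τ → 𝟙 (T u τ)) enough zeros 0# k
          where
          enough : 2 ℕ.* j < Fᶠ.count (T u)
          enough = ≤-trans (s≤s (ℕ.*-monoʳ-≤ 2 (ℕ.≤-pred lt))) (≤-trans (≤-reflexive (arith K)) (many-lines u hu))
            where
            arith : ∀ K → suc (2 ℕ.* suc K) ≡ 2 ℕ.* K ℕ.+ 3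
            arith = solveℕ 1 (λ K → # 1 ⊕ # 2 ⊗ (# 1 ⊕ K) ⊜ # 2 ⊗ K ⊕ # 3) refl
          zeros : ∀ τ m → m < 𝟙 (T u τ) → E u τ j m ≡ 0#
          zeros τ m l with T u τ in e
          zeros τ zero l | true = trans (eval-hom inner₀ (B u τ) f j) (trans (E₁.eval-cong (B-inner u τ) f j)
            (line-vanishes (conj (L u)) (conj (N u τ)) f (λ c → not (bad τ c)) (many-good τ)
              (λ c h → trans (E₀.eval-cong (λ i → sym (conj-lin (L u) (N u τ) c i)) f)
                (on-lines u τ c hu e (λ z → true≢false (does-intro (_ ≟ _) z) (not-true h)))) j))
          zeros τ (suc m) (s≤s ()) | true
          zeros τ m () | false
        t : Seq
        t = var+ 0#
        t≡X : ∀ k → t k ≡ X k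
        t≡X zero    = +-identityˡ _
        t≡X (suc k) = +-identityˡ _
        t² : ∀ k → mul t t k ≡ shift X k
        t² k = trans (mul-cong t≡X t≡X k) (mul-X X k)
        -- The same double series at slope 0 with the variables exchanged. To order zero in the
        -- slope it is `L u` + s·e₁₂, that is, the standard line near u.
        x : F → Fin 4 → Seq²
        x u i k j = B u 0# i j k
        x-vanishes : ∀ u → U u ≡ true → ∀ k j → j < 2 ℕ.+ K → E₂.eval (x u) f k j ≡ 0#
        x-vanishes u hu k j lt = trans (sym (eval-hom swap (B u 0#) f k j)) (E-vanishes u hu j k lt)
        PL : F → Fin 4 → Seq
        PL c = lin 0# (conj (L c)) (conj e₁₂)
        v : Seq
        v k = - (X k + X k)
        x₀ : ∀ u i j → x u i 0 j ≡ PL u i j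
        x₀ u i zero          = refl
        x₀ u i (suc zero)    = conj-cong h i
          where
          h : ∀ l → Nˢ u t l 0 ≡ e₁₂ l
          h zero                   = solve 1 (λ u → (:- ((:0 :+ :0) :+ (:0 :+ :0))) :- u :* ((:0 :+ :0) :* (:0 :+ :0)) := :0) refl u
          h (suc zero)             = refl
          h (suc (suc zero))       = solve 0 (:- ((:0 :+ :0) :* (:0 :+ :0)) := :0) refl
          h (suc (suc (suc zero))) = refl
        x₀ u i (suc (suc j)) = refl
        mul-const′ : ∀ a c j → mul a (const c) j ≡ c * a j
        mul-const′ a c j = trans (mul-comm a (const c) j) (mul-const c a j)
        x₁ : ∀ u i j → x u i 1 j ≡ mul v (const (conj e₁₁ i)) j
        x₁ u i zero          = sym (trans (mul-const′ v (conj e₁₁ i) 0) (solve 1 (λ c → c :* (:- (:0 :+ :0)) := :0) refl (conj e₁₁ i)))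
        x₁ u i (suc zero)    = trans (trans (conj-cong {y = λ l → - (1# + 1#) * e₁₁ l} (λ l → trans (h l) (+-identityˡ _)) i) (conj-scale e₁₁ (- (1# + 1#)) i))
                                 (trans (*-comm _ _) (sym (mul-const′ v (conj e₁₁ i) 1)))
          where
          h : ∀ l → Nˢ u t l 1 ≡ 0# + - (1# + 1#) * e₁₁ l
          h zero                   = trans (cong (λ z → - ((0# + 1#) + (0# + 1#)) - u * z) (t² 1))
            (solve 1 (λ u → (:- ((:0 :+ :1) :+ (:0 :+ :1))) :- u :* :0 := :0 :+ (:- (:1 :+ :1)) :* :1) refl u)
          h (suc zero)             = solve 0 (:0 := :0 :+ (:- (:1 :+ :1)) :* :0) refl
          h (suc (suc zero))       = trans (cong -_ (t² 1)) (solve 0 (:- :0 := :0 :+ (:- (:1 :+ :1)) :* :0) refl)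
          h (suc (suc (suc zero))) = solve 0 (:0 := :0 :+ (:- (:1 :+ :1)) :* :0) refl
        x₁ u i (suc (suc j)) = sym (trans (mul-const′ v (conj e₁₁ i) (suc (suc j))) (solve 1 (λ c → c :* (:- (:0 :+ :0)) := :0) refl (conj e₁₁ i)))
        x₂ : ∀ u i j → x u i 2 j ≡ mul X (λ k → mul (const (- u)) (const (conj e₁₁ i)) k + mul (const (- 1#)) (const (conj e₂₁ i)) k) j
        x₂ u i zero          = sym (zeroˡ _)
        x₂ u i (suc zero)    = trans (conj-cong h i) (trans (conj-lin (λ l → - u * e₁₁ l) e₂₁ (- 1#) i)
            (trans (cong (_+ - 1# * conj e₂₁ i) (conj-scale e₁₁ (- u) i))
              (sym (mul-X (λ k → mul (const (- u)) (const (conj e₁₁ i)) k + mul (const (- 1#)) (const (conj e₂₁ i)) k) 1))))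
          where
          h : ∀ l → Nˢ u t l 2 ≡ - u * e₁₁ l + - 1# * e₂₁ l
          h zero                   = trans (cong (λ z → - ((0# + 0#) + (0# + 0#)) - u * z) (t² 2))
            (solve 1 (λ u → (:- ((:0 :+ :0) :+ (:0 :+ :0))) :- u :* :1 := (:- u) :* :1 :+ (:- :1) :* :0) refl u)
          h (suc zero)             = solve 1 (λ u → :0 := (:- u) :* :0 :+ (:- :1) :* :0) refl u
          h (suc (suc zero))       = trans (cong -_ (t² 2)) (solve 1 (λ u → :- :1 := (:- u) :* :0 :+ (:- :1) :* :1) refl u)
          h (suc (suc (suc zero))) = solve 1 (λ u → :0 := (:- u) :* :0 :+ (:- :1) :* :0) refl u
        x₂ u i (suc (suc j)) = sym (trans (mul-X (λ k → mul (const (- u)) (const (conj e₁₁ i)) k + mul (const (- 1#)) (const (conj e₂₁ i)) k) (suc (suc j)))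
          (trans (cong₂ _+_ (trans (mul-const (- u) (const (conj e₁₁ i)) (suc j)) (zeroʳ _)) (trans (mul-const (- 1#) (const (conj e₂₁ i)) (suc j)) (zeroʳ _))) (+-identityˡ 0#)))
        d : Vec₄ F → F → Seq
        d Z c = E₁.dir (PL c) (λ i → const (Z i)) f
        pencil : Vec₄ F → F → Fin 4 → Seq²
        pencil Z c = lin (λ _ → 0#) (PL c) (λ i → const (Z i))
        -- `h` is the coefficient of order 2 of f in the direction e₁₁ along the standard line, and
        -- the 4 in `h₄` is the square of the factor -2 of e₁₁ in `N`. `q` uses that c = u + s near
        -- u: it turns the condition s·h₄ = d₂₁ at u, where s is the distance from u, into q = u·h₄.
        h h₄ q : F → Seq
        h c = E₂.eval (pencil (conj e₁₁) c) f 2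
        h₄ c k = h c k + h c k + h c k + h c k
        q c k = mul (var+ c) (h₄ c) k - d (conj e₂₁) c k
        PL-lin : ∀ c i → conj (L c) i ≡ conj (L 0#) i + c * conj e₁₂ i
        PL-lin c i = trans (conj-cong e i) (conj-lin (L 0#) e₁₂ c i)
          where
          e : ∀ l → L c l ≡ L 0# l + c * e₁₂ l
          e zero                   = solve 1 (λ c → :1 := :1 :+ c :* :0) refl c
          e (suc zero)             = solve 1 (λ c → c := :0 :+ c :* :1) refl c
          e (suc (suc zero))       = solve 1 (λ c → :0 := :0 :+ c :* :0) refl c
          e (suc (suc (suc zero))) = solve 1 (λ c → :1 := :1 :+ c :* :0) refl c
        deg-PL : ∀ i → Deg 1 (λ c → PL c i)
        deg-PL i = deg-resp e (deg-+ (deg-const (conj (L 0#) i)) (deg-scale (conj e₁₂ i) deg-var))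
          where
          e : ∀ c k → const (conj (L 0#) i) k + conj e₁₂ i * (const c k + X k) ≡ PL c i k
          e c 0 = trans (solve 3 (λ x y c → x :+ y :* (c :+ :0) := x :+ c :* y) refl (conj (L 0#) i) (conj e₁₂ i) c) (sym (PL-lin c i))
          e c 1 = solve 1 (λ y → :0 :+ y :* (:0 :+ :1) := y) refl (conj e₁₂ i)
          e c (suc (suc k)) = solve 1 (λ y → :0 :+ y :* (:0 :+ :0) := :0) refl (conj e₁₂ i)
        deg-pencil : ∀ Z j → Deg n (λ c → E₂.eval (pencil Z c) f j)
        deg-pencil Z = deg²-eval (λ m _ → m) (λ _ _ _ _ → ≤-refl) (λ i c → pencil Z c i) g f
          where
          g : ∀ i → Deg² (λ _ → 1) (λ c → pencil Z c i)
          g i zero          = deg-PL i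
          g i (suc zero)    = deg-const (Z i)
          g i (suc (suc j)) = deg-0
        deg-d : ∀ Z → Deg n (d Z)
        deg-d Z = deg-resp (λ c k → Taylor.taylor₁ P₁ (pencil Z c) f k) (deg-pencil Z 1)
        deg-h₄ : Deg n h₄
        deg-h₄ = deg-+ (deg-+ (deg-+ D D) D) D
          where D = deg-pencil (conj e₁₁) 2
        deg-q : Deg (suc n) q
        deg-q = deg-+ (deg-* deg-var deg-h₄) (deg-neg (deg-mono (ℕ.n≤1+n n) (deg-d (conj e₂₁))))
        halve : ∀ {z} → - (z + z) ≡ 0# → z ≡ 0#
        halve {z} e = *-cancel0 2≢0 (trans (solve 1 (λ z → (:1 :+ (:1 :+ :0)) :* z := z :+ z) refl z) (neg-zero e))
        -- First order in the slope: -2·s times this derivative vanishes up to order K + 1, and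
        -- dividing by s costs one order.
        d₁₁-local : ∀ u → U u ≡ true → ∀ j → j < suc K → d (conj e₁₁) u j ≡ 0#
        d₁₁-local u hu = X-lower (d (conj e₁₁) u) λ j lt → halve (trans (e j) (eq j lt))
          where
          D = d (conj e₁₁) u
          e : ∀ j → - (mul X D j + mul X D j) ≡ mul v D j
          e = R₁.solve 2 (λ X D → R₁.:- (X R₁.:* D R₁.:+ X R₁.:* D) R₁.:= (R₁.:- (X R₁.:+ X)) R₁.:* D) refl X D
          eq : ∀ j → j < 2 ℕ.+ K → mul v D j ≡ 0#
          eq j lt = trans (sym (trans (Taylor.taylor₁ P₁ (x u) f j) (trans (E₁.dir-cong (x₀ u) (x₁ u) f j) (E₁.dir-* (PL u) (λ i → const (conj e₁₁ i)) v f j))))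
                      (x-vanishes u hu 1 j lt)
        ∑U : ∀ m → Fᶠ.∑ᴬ (λ c → 𝟙 (U c) ℕ.* m) ≡ Fᶠ.count U ℕ.* m
        ∑U m = ∑-*ʳ Fᶠ.elems m _
        with-U : ∀ {φ : F → Seq} m → (∀ u → U u ≡ true → ∀ j → j < m → φ u j ≡ 0#) → ∀ c j → j < 𝟙 (U c) ℕ.* m → φ c j ≡ 0#
        with-U m H c j lt with U c in e
        ... | true = H c e j (≤-trans lt (≤-reflexive (ℕ.+-identityʳ m)))
        bound₁ : n < Fᶠ.count U ℕ.* suc K
        bound₁ = ≤-trans (≤-trans (s≤s (ℕ.m≤m+n n _)) (≤-trans (ℕ.n≤1+n _) (≤-trans (≤-reflexive (ℕ.+-comm 2 (2 ℕ.* n))) (ℕ.m≤m+n _ K)))) (≤-trans many-points (ℕ.*-monoʳ-≤ (Fᶠ.count U) (ℕ.n≤1+n K)))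
        bound₂ : suc n ℕ.+ n < Fᶠ.count U ℕ.* K
        bound₂ = ≤-trans (≤-trans (≤-reflexive (arith n)) (ℕ.m≤m+n _ K)) many-points
            where
            arith : ∀ n → suc (suc n ℕ.+ n) ≡ 2 ℕ.* n ℕ.+ 2
            arith = solveℕ 1 (λ n → # 1 ⊕ (# 1 ⊕ n ⊕ n) ⊜ # 2 ⊗ n ⊕ # 2) refl
        d₁₁-0 : ∀ c j → d (conj e₁₁) c j ≡ 0#
        d₁₁-0 = deg-roots (deg-d (conj e₁₁)) (λ c → 𝟙 (U c) ℕ.* suc K) (≤-trans bound₁ (≤-reflexive (sym (∑U (suc K))))) (with-U (suc K) d₁₁-local)
        -- Second order in the slope. The first-order motion -2·s·e₁₁ contributes 4·s²·h, and the
        -- second-order motion -s·(u·e₁₁ + e₂₁) contributes linearly; of the latter only the part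
        -- towards e₂₁ survives `d₁₁-0`. Again one factor s is divided out.
        second : ∀ u → U u ≡ true → ∀ j → j < suc K → mul X (h₄ u) j - d (conj e₂₁) u j ≡ 0#
        second u hu = X-lower (λ k → mul X (h₄ u) k - d (conj e₂₁) u k) λ j lt → trans (e j) (eq j lt)
          where
          D = d (conj e₂₁) u
          lx : ∀ i k j → Taylor.linear P₁ (x u) i k j ≡ Hom.fun (rescale v) (pencil (conj e₁₁) u i) k j
          lx i zero          j = trans (x₀ u i j) (sym (mul-unitˡ (PL u i) j))
          lx i (suc zero)    j = trans (x₁ u i j) (mul-cong {g = const (conj e₁₁ i)} (λ k → sym (trans (mul-comm v unit k) (mul-unitˡ v k))) (λ _ → refl) j)
          lx i (suc (suc k)) j = sym (Alg.zeroʳ P₁ (pow (Alg.ring P₁) v (suc (suc k))) j)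
          quad : ∀ j → E₂.eval (Taylor.linear P₁ (x u)) f 2 j ≡ mul (mul v (mul v unit)) (h u) j
          quad j = trans (E₂.eval-cong lx f 2 j) (sym (eval-hom (rescale v) (pencil (conj e₁₁) u) f 2 j))
          lin-part : ∀ j → E₁.dir (λ i → x u i 0) (λ i → x u i 2) f j ≡ mul X (λ k → - D k) j
          lin-part j = trans (E₁.dir-cong (x₀ u) (x₂ u) f j) (trans (E₁.dir-* (PL u) _ X f j) (mul-cong {f = X} (λ _ → refl) inner j))
            where
            inner : ∀ k → E₁.dir (PL u) (λ i k → mul (const (- u)) (const (conj e₁₁ i)) k + mul (const (- 1#)) (const (conj e₂₁ i)) k) f k ≡ - D k
            inner k = trans (E₁.dir-+ (PL u) (λ i → mul (const (- u)) (const (conj e₁₁ i))) (λ i → mul (const (- 1#)) (const (conj e₂₁ i))) f k)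
              (trans (cong₂ _+_ (trans (E₁.dir-* (PL u) (λ i → const (conj e₁₁ i)) (const (- u)) f k) (trans (mul-const (- u) (d (conj e₁₁) u) k) (trans (cong (- u *_) (d₁₁-0 u k)) (zeroʳ _))))
                  (trans (E₁.dir-* (PL u) (λ i → const (conj e₂₁ i)) (const (- 1#)) f k) (mul-const (- 1#) D k)))
                (solve 1 (λ D → :0 :+ (:- :1) :* D := :- D) refl (D k)))
          e : ∀ j → mul X (λ k → mul X (h₄ u) k - D k) j ≡ mul (mul v (mul v unit)) (h u) j + mul X (λ k → - D k) j
          e = R₁.solve 3 (λ X H D → X R₁.:* (X R₁.:* (H R₁.:+ H R₁.:+ H R₁.:+ H) R₁.:- D)
              R₁.:= ((R₁.:- (X R₁.:+ X)) R₁.:* ((R₁.:- (X R₁.:+ X)) R₁.:* R₁.:1)) R₁.:* H R₁.:+ X R₁.:* (R₁.:- D)) refl X (h u) D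
          eq : ∀ j → j < 2 ℕ.+ K → mul (mul v (mul v unit)) (h u) j + mul X (λ k → - D k) j ≡ 0#
          eq j lt = trans (sym (trans (Taylor.taylor₂ P₁ (x u) f j) (cong₂ _+_ (quad j) (lin-part j)))) (x-vanishes u hu 2 j lt)
        q-local : ∀ u → U u ≡ true → q u ≡ (λ k → u * h₄ u k) [< suc K ]
        q-local u hu j lt = trans (cong (_- d (conj e₂₁) u j) (trans (mul-distribʳ (h₄ u) (const u) X j) (cong (_+ mul X (h₄ u) j) (mul-const u (h₄ u) j))))
          (trans (solve 3 (λ a b c → (a :+ b) :- c := a :+ (b :- c)) refl _ _ _) (trans (cong (u * h₄ u j +_) (second u hu j lt)) (+-identityʳ _)))
        w-local : ∀ u → U u ≡ true → ∀ j → j < K → wronskian (q u) (h₄ u) j ≡ 0#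
        w-local u hu j lt = trans (cong₂ _-_
            (mul-trunc {K} {q u} {λ k → u * h₄ u k} {dv (h₄ u)} {dv (h₄ u)} (λ i l → q-local u hu i (ℕ.m≤n⇒m≤1+n l)) (λ _ _ → refl) j lt)
            (mul-trunc {K} {dv (q u)} {dv (λ k → u * h₄ u k)} {h₄ u} {h₄ u} (dv-trunc {K} {q u} {λ k → u * h₄ u k} (q-local u hu)) (λ _ _ → refl) j lt))
          (wronskian-scale u (h₄ u) j)
        -- Near a rich point u the series of q and of u·h₄ agree up to order K, so the Wronskian of
        -- q and h₄ vanishes to order K there; its degree is only 2n + 1.
        w-0 : ∀ c j → wronskian (q c) (h₄ c) j ≡ 0#
        w-0 = deg-roots (deg-+ (deg-* deg-q (deg-deriv deg-h₄)) (deg-neg (deg-* (deg-deriv deg-q) deg-h₄)))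
                (λ c → 𝟙 (U c) ℕ.* K) (≤-trans bound₂ (≤-reflexive (sym (∑U K)))) (with-U {λ c → wronskian (q c) (h₄ c)} K w-local)
        -- Were h₄ nonzero at c₀, the vanishing Wronskian would make q a constant multiple of h₄
        -- near c₀ up to order p, hence everywhere, as the degrees are smaller. But q is also u·h₄
        -- near u, so h₄ vanishes to order K + 1 at every rich point other than that constant, too
        -- often for its degree.
        h₄-0 : ∀ c j → h₄ c j ≡ 0#
        h₄-0 with Fᶠ.search (λ c → not (h₄ c 0 == 0#))
        ... | inj₂ none = deg-roots deg-h₄ (λ _ → 1) (≤-trans n<p (≤-reflexive (sym order)))
                (λ { c zero _ → decide c (none c) ; c (suc _) (s≤s ()) })
          where
          decide : ∀ c → not (h₄ c 0 == 0#) ≡ false → h₄ c 0 ≡ 0#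
          decide c e with h₄ c 0 ≟ 0#
          ... | yes z = z
        ... | inj₁ (c₀ , found) = λ c j → ⊥-elim (nz (vanish c₀ 0))
          where
          nz : ¬ (h₄ c₀ 0 ≡ 0#)
          nz z = true≢false (does-intro (_ ≟ _) z) (not-true found)
          ratio : F
          ratio = q c₀ 0 * invert nz
          φ : F → Seq
          φ c k = q c k + - ratio * h₄ c k
          φ-c₀ : ∀ j → j < p → φ c₀ j ≡ 0#
          φ-c₀ = wronskian-0 (φ c₀) (h₄ c₀) nz
            (trans (solve 3 (λ q i h → q :+ (:- (q :* i)) :* h := q :* (:1 :- h :* i)) refl (q c₀ 0) (invert nz) (h₄ c₀ 0))
              (trans (cong (q c₀ 0 *_) (zero-sub (sym (*-invert nz)))) (zeroʳ _)))
            (λ k → trans (wronskian-+ (q c₀) (h₄ c₀) (- ratio) k) (trans (cong₂ _+_ (w-0 c₀ k) (wronskian-scale (- ratio) (h₄ c₀) k)) (+-identityˡ 0#)))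
          φ-0 : ∀ c j → φ c j ≡ 0#
          φ-0 = deg-roots (deg-+ deg-q (deg-mono (ℕ.n≤1+n n) (deg-scale (- ratio) deg-h₄))) (λ c → 𝟙 (c₀ == c) ℕ.* (2 ℕ.+ n))
                  (≤-reflexive (sym (Fᶠ.∑-δ c₀ (λ _ → 2 ℕ.+ n)))) zeros
            where
            zeros : ∀ c j → j < 𝟙 (c₀ == c) ℕ.* (2 ℕ.+ n) → φ c j ≡ 0#
            zeros c j lt with c₀ ≟ c
            ... | yes refl = φ-c₀ j (≤-trans lt (≤-trans (≤-reflexive (ℕ.+-identityʳ _)) (≤-trans (ℕ.n≤1+n _) (≤-trans (≤-reflexive (ℕ.+-comm 3 n)) n+3≤p))))
          vanish : ∀ c j → h₄ c j ≡ 0#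
          vanish = deg-roots deg-h₄ (λ c → (𝟙 (U c) ℕ.∸ 𝟙 (ratio == c)) ℕ.* suc K)
              (ℕ.+-cancelʳ-< K n _ (≤-trans (≤-trans (s≤s (ℕ.+-monoˡ-≤ K (ℕ.m≤m+n n _))) (≤-trans (ℕ.n≤1+n _) (≤-reflexive (arith n K))))
                (≤-trans many-points bound))) zeros
            where
            arith : ∀ n K → suc (suc (2 ℕ.* n ℕ.+ K)) ≡ 2 ℕ.* n ℕ.+ 2 ℕ.+ K
            arith = solveℕ 2 (λ n K → # 2 ⊕ (# 2 ⊗ n ⊕ K) ⊜ # 2 ⊗ n ⊕ # 2 ⊕ K) refl
            Σ' = Fᶠ.∑ᴬ (λ c → 𝟙 (U c) ℕ.∸ 𝟙 (ratio == c))
            count-split : Fᶠ.count U ≤ Σ' ℕ.+ 1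
            count-split = ≤-trans (∑-mono Fᶠ.elems (λ c → ≤-trans (ℕ.m≤n+m∸n (𝟙 (U c)) (𝟙 (ratio == c))) (≤-reflexive (ℕ.+-comm _ (𝟙 (U c) ℕ.∸ 𝟙 (ratio == c))))))
              (≤-reflexive (trans (∑-+ Fᶠ.elems _ _) (cong (Σ' ℕ.+_) (Fᶠ.once ratio))))
            bound : Fᶠ.count U ℕ.* K ≤ Fᶠ.∑ᴬ (λ c → (𝟙 (U c) ℕ.∸ 𝟙 (ratio == c)) ℕ.* suc K) ℕ.+ K
            bound = ≤-trans (ℕ.*-monoˡ-≤ K count-split) (≤-trans (≤-reflexive (trans (ℕ.*-distribʳ-+ K Σ' 1) (cong (Σ' ℕ.* K ℕ.+_) (ℕ.*-identityˡ K))))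
              (ℕ.+-monoˡ-≤ K (≤-trans (ℕ.*-monoʳ-≤ Σ' (ℕ.n≤1+n K)) (≤-reflexive (sym (∑-*ʳ Fᶠ.elems (suc K) _))))))
            zeros : ∀ c j → j < (𝟙 (U c) ℕ.∸ 𝟙 (ratio == c)) ℕ.* suc K → h₄ c j ≡ 0#
            zeros c j lt with U c in e | ratio ≟ c
            zeros c j () | true  | yes _
            zeros c j () | false | yes _
            zeros c j () | false | no _
            zeros c j lt | true | no ne = *-cancel0 (λ z → ne (sym (sub-zero z)))
              (trans (solve 3 (λ c r h → (c :- r) :* h := c :* h :+ (:- r) :* h) refl c ratio (h₄ c j))
                (trans (cong (_+ - ratio * h₄ c j) (sym (q-local c e j (≤-trans lt (≤-reflexive (ℕ.+-identityʳ _)))))) (φ-0 c j)))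
        d₂₁-0 : ∀ c j → d (conj e₂₁) c j ≡ 0#
        d₂₁-0 = deg-roots (deg-d (conj e₂₁)) (λ c → 𝟙 (U c) ℕ.* suc K) (≤-trans bound₁ (≤-reflexive (sym (∑U (suc K))))) (with-U (suc K) local)
          where
          local : ∀ u → U u ≡ true → ∀ j → j < suc K → d (conj e₂₁) u j ≡ 0#
          local u hu j lt = neg-zero (trans (sym (trans (cong (_- d (conj e₂₁) u j) (trans (mul-cong {f = X} (λ _ → refl) (h₄-0 u) j) (Alg.zeroʳ P₁ X j))) (+-identityˡ _))) (second u hu j lt))
        numeric : ∀ Z c → (∀ j → d Z c j ≡ 0#) → E₀.dir (conj (L c)) Z f ≡ 0#
        numeric Z c z = trans (sym (dir-hom (Taylor.coefficient-0 baseAlg) (PL c) (λ i → const (Z i)) f)) (z 0)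
        d₁₂-0 : ∀ c → E₀.dir (conj (L c)) (conj e₁₂) f ≡ 0#
        d₁₂-0 c = trans (sym (Taylor.taylor₁ baseAlg (lin 0# (conj (L c)) (conj e₁₂)) f))
          (line-vanishes (conj (L c)) (conj e₁₂) f (λ _ → true) (≤-trans n<p (≤-reflexive (sym order)))
            (λ c' _ → trans (E₀.eval-cong (λ i → trans (cong (_+ c' * conj e₁₂ i) (PL-lin c i)) (trans (solve 4 (λ a b c c' → a :+ c :* b :+ c' :* b := a :+ (c :+ c') :* b) refl _ _ c c') (sym (PL-lin (c + c') i)))) f) (on-line (c + c'))) 1)
        -- Euler's identity at the point e₁₁ + c·e₁₂ + e₂₂, where f vanishes, yields this direction
        -- from those towards e₁₁ and e₁₂.
        d₂₂-0 : ∀ c → E₀.dir (conj (L c)) (conj e₂₂) f ≡ 0#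
        d₂₂-0 c = trans (sym (trans (trans (E₀.dir-cong (λ _ → refl) dec f) (trans (E₀.dir-+ P (λ i → conj e₁₁ i + c * conj e₁₂ i) (conj e₂₂) f)
                    (cong (_+ E₀.dir P (conj e₂₂) f) (trans (E₀.dir-+ P (conj e₁₁) (λ i → c * conj e₁₂ i) f)
                      (cong₂ _+_ (numeric _ c (d₁₁-0 c)) (trans (E₀.dir-* P (conj e₁₂) c f) (trans (cong (c *_) (d₁₂-0 c)) (zeroʳ c)))))))) (solve 1 (λ x → :0 :+ :0 :+ x := x) refl _)))
            (E₀.dir-euler P f (on-line c))
          where
          P = conj (L c)
          dec : ∀ i → P i ≡ (conj e₁₁ i + c * conj e₁₂ i) + conj e₂₂ i
          dec i = solve 5 (λ k₀ k₁ k₂ k₃ c → k₀ :* :1 :+ k₁ :* c :+ k₂ :* :0 :+ k₃ :* :1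
            := ((k₀ :* :1 :+ k₁ :* :0 :+ k₂ :* :0 :+ k₃ :* :0) :+ c :* (k₀ :* :0 :+ k₁ :* :1 :+ k₂ :* :0 :+ k₃ :* :0)) :+ (k₀ :* :0 :+ k₁ :* :0 :+ k₂ :* :0 :+ k₃ :* :1)) refl
            (κ i zero) (κ i (suc zero)) (κ i (suc (suc zero))) (κ i (suc (suc (suc zero)))) c
      derivatives-vanish : ∀ c M → E₀.dir (conj (L c)) (conj M) f ≡ 0#
      derivatives-vanish c M = trans (E₀.dir-cong (λ _ → refl) dec f) (trans (E₀.dir-+ P _ _ f) (trans (cong₂ _+_
          (trans (E₀.dir-+ P _ _ f) (cong₂ _+_ (part e₁₁ _ (numeric _ c (d₁₁-0 c))) (part e₁₂ _ (d₁₂-0 c))))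
          (trans (E₀.dir-+ P _ _ f) (cong₂ _+_ (part e₂₁ _ (numeric _ c (d₂₁-0 c))) (part e₂₂ _ (d₂₂-0 c)))))
        (solve 0 ((:0 :+ :0) :+ (:0 :+ :0) := :0) refl)))
        where
        P = conj (L c)
        part : ∀ Z s → E₀.dir P (conj Z) f ≡ 0# → E₀.dir P (λ i → s * conj Z i) f ≡ 0#
        part Z s z = trans (E₀.dir-* P (conj Z) s f) (trans (cong (s *_) z) (zeroʳ s))
        dec : ∀ i → conj M i ≡ (M zero * conj e₁₁ i + M (suc zero) * conj e₁₂ i) + (M (suc (suc zero)) * conj e₂₁ i + M (suc (suc (suc zero))) * conj e₂₂ i)
        dec i = solve 8 (λ k₀ k₁ k₂ k₃ a b c d → k₀ :* a :+ k₁ :* b :+ k₂ :* c :+ k₃ :* d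
          := (a :* (k₀ :* :1 :+ k₁ :* :0 :+ k₂ :* :0 :+ k₃ :* :0) :+ b :* (k₀ :* :0 :+ k₁ :* :1 :+ k₂ :* :0 :+ k₃ :* :0))
             :+ (c :* (k₀ :* :0 :+ k₁ :* :0 :+ k₂ :* :1 :+ k₃ :* :0) :+ d :* (k₀ :* :0 :+ k₁ :* :0 :+ k₂ :* :0 :+ k₃ :* :1))) refl
          (κ i zero) (κ i (suc zero)) (κ i (suc (suc zero))) (κ i (suc (suc (suc zero)))) (M zero) (M (suc zero)) (M (suc (suc zero))) (M (suc (suc (suc zero))))

 -- SL₂ over the field: commutation, eigendirections, the projective line

 module SL2 where
  open 𝓕
  open import Data.Maybe using (Maybe; just; nothing)
  open Sums

  Mat : Set
  Mat = F × F × F × F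

  _·_ : Mat → Mat → Mat
  (a , b , c , d) · (a' , b' , c' , d') =
    ( (a * a') + (b * c') , (a * b') + (b * d')
    , (c * a') + (d * c') , (c * b') + (d * d') )

  inv : Mat → Mat
  inv (a , b , c , d) = (d , - b , - c , a)

  inSL₂ : Mat → Bool
  inSL₂ (a , b , c , d) = does ((a * d) ≟ (1# + (b * c)))

  finite-Pt : Finite (F × F)
  finite-Pt = finite-× finite finite

  finite-Mat : Finite Mat
  finite-Mat = finite-× finite (finite-× finite (finite-× finite finite))

  SL : Set
  SL = Σ Mat λ M → inSL₂ M ≡ true

  det≡1 : ∀ {a b c d} → inSL₂ (a , b , c , d) ≡ true → a * d ≡ 1# + b * c
  det≡1 h = does-true (_ ≟ _) h

  sl-intro : ∀ {a b c d} → a * d - b * c ≡ 1# → inSL₂ (a , b , c , d) ≡ true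
  sl-intro {a} {b} {c} {d} e = does-intro (_ ≟ _) (trans (solve 4 (λ a b c d → a :* d := (a :* d :- b :* c) :+ b :* c) refl a b c d) (cong (_+ b * c) e))

  det-1 : ∀ {a b c d} → inSL₂ (a , b , c , d) ≡ true → a * d - b * c ≡ 1#
  det-1 {a} {b} {c} {d} h = trans (cong (_- b * c) (det≡1 h)) (solve 2 (λ b c → (:1 :+ b :* c) :- b :* c := :1) refl b c)

  SL-ext : ∀ {x y : SL} → proj₁ x ≡ proj₁ y → x ≡ y
  SL-ext {M , e} {.M , e'} refl = cong (M ,_) (uip e e')
    where
    uip : ∀ {b c : Bool} (e e' : b ≡ c) → e ≡ e'
    uip refl refl = refl

  mat-ext : ∀ {a b c d a' b' c' d' : F} → a ≡ a' → b ≡ b' → c ≡ c' → d ≡ d' → (a , b , c , d) ≡ (a' , b' , c' , d')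
  mat-ext refl refl refl refl = refl

  ·-assoc : ∀ x y z → (x · y) · z ≡ x · (y · z)
  ·-assoc (a , b , c , d) (e , f , g , h) (i , j , k , l) = mat-ext (en a b i k) (en a b j l) (en c d i k) (en c d j l)
    where
    en : ∀ p q r s → (p * e + q * g) * r + (p * f + q * h) * s ≡ p * (e * r + f * s) + q * (g * r + h * s)
    en p q r s = solve 8 (λ p q r s e f g h → (p :* e :+ q :* g) :* r :+ (p :* f :+ q :* h) :* s := p :* (e :* r :+ f :* s) :+ q :* (g :* r :+ h :* s)) refl p q r s e f g h

  opaque
   ·-det : ∀ x y → inSL₂ x ≡ true → inSL₂ y ≡ true → inSL₂ (x · y) ≡ true
   ·-det (a , b , c , d) (e , f , g , h) p q = sl-intro (trans
    (solve 8 (λ a b c d e f g h → (a :* e :+ b :* g) :* (c :* f :+ d :* h) :- (a :* f :+ b :* h) :* (c :* e :+ d :* g)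
      := (a :* d :- b :* c) :* (e :* h :- f :* g)) refl a b c d e f g h) (trans (cong₂ _*_ (det-1 p) (det-1 q)) (*-identityˡ 1#)))
   inv-det : ∀ x → inSL₂ x ≡ true → inSL₂ (inv x) ≡ true
   inv-det (a , b , c , d) p = sl-intro (trans (solve 4 (λ a b c d → d :* a :- (:- b) :* (:- c) := a :* d :- b :* c) refl a b c d) (det-1 p))

  one : Mat
  one = (1# , 0# , 0# , 1#)

  opaque
   one-det : inSL₂ one ≡ true
   one-det = sl-intro (solve 0 (:1 :* :1 :- :0 :* :0 := :1) refl)

  SL₂ : FiniteGroup
  SL₂ = record
    { G = SL
    ; _∙_ = λ { (x , p) (y , q) → x · y , ·-det x y p q }
    ; ε = one , one-det
    ; _⁻¹ = λ { (x , p) → inv x , inv-det x p }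
    ; assoc = λ { (x , _) (y , _) (z , _) → SL-ext (·-assoc x y z) }
    ; idˡ = λ { ((a , b , c , d) , _) → SL-ext (mat-ext (l a c) (l b d) (l′ a c) (l′ b d)) }
    ; idʳ = λ { ((a , b , c , d) , _) → SL-ext (mat-ext (r a b) (r′ a b) (r c d) (r′ c d)) }
    ; invˡ = λ { ((a , b , c , d) , p) → SL-ext (mat-ext
        (trans (solve 4 (λ a b c d → d :* a :+ (:- b) :* c := a :* d :- b :* c) refl a b c d) (det-1 p))
        (solve 2 (λ b d → d :* b :+ (:- b) :* d := :0) refl b d)
        (solve 2 (λ a c → (:- c) :* a :+ a :* c := :0) refl a c)
        (trans (solve 4 (λ a b c d → (:- c) :* b :+ a :* d := a :* d :- b :* c) refl a b c d) (det-1 p))) }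
    ; invʳ = λ { ((a , b , c , d) , p) → SL-ext (mat-ext
        (trans (solve 4 (λ a b c d → a :* d :+ b :* (:- c) := a :* d :- b :* c) refl a b c d) (det-1 p))
        (solve 2 (λ a b → a :* (:- b) :+ b :* a := :0) refl a b)
        (solve 2 (λ c d → c :* d :+ d :* (:- c) := :0) refl c d)
        (trans (solve 4 (λ a b c d → c :* (:- b) :+ d :* a := a :* d :- b :* c) refl a b c d) (det-1 p))) }
    ; finite = finite-Σ finite-Mat inSL₂ }
    where
    l : ∀ x y → 1# * x + 0# * y ≡ x
    l = solve 2 (λ x y → :1 :* x :+ :0 :* y := x) refl
    l′ : ∀ x y → 0# * x + 1# * y ≡ y
    l′ = solve 2 (λ x y → :0 :* x :+ :1 :* y := y) refl
    r : ∀ x y → x * 1# + y * 0# ≡ x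
    r = solve 2 (λ x y → x :* :1 :+ y :* :0 := x) refl
    r′ : ∀ x y → x * 0# + y * 1# ≡ y
    r′ = solve 2 (λ x y → x :* :0 :+ y :* :1 := y) refl

  open FiniteGroup SL₂ using (_∙_; ε; _⁻¹; count)

  F³ : Set
  F³ = F × F × F

  -- Coordinates of the matrix modulo scalars. The entries of a commutator are, up to sign, those of
  -- the cross product of these vectors, so commuting means being parallel.
  vec : SL → F³
  vec ((a , b , c , d) , _) = (a - d , b , c)

  tr : SL → F
  tr ((a , b , c , d) , _) = a + d

  Par : F³ → F³ → Set
  Par (x , y , z) (x' , y' , z') = (x * y' ≡ x' * y) × (x * z' ≡ x' * z) × (y * z' ≡ y' * z)

  Zero : F³ → Set
  Zero (x , y , z) = (x ≡ 0#) × (y ≡ 0#) × (z ≡ 0#)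

  zero? : ∀ u → Dec (Zero u)
  zero? (x , y , z) with x ≟ 0# | y ≟ 0# | z ≟ 0#
  ... | yes p | yes q | yes r = yes (p , q , r)
  ... | no ¬p | _     | _     = no λ { (p , _) → ¬p p }
  ... | yes _ | no ¬q | _     = no λ { (_ , q , _) → ¬q q }
  ... | yes _ | yes _ | no ¬r = no λ { (_ , _ , r) → ¬r r }

  infix 4 _∝_·_
  _∝_·_ : F³ → F → F³ → Set
  (x' , y' , z') ∝ β · (x , y , z) = (x' ≡ β * x) × (y' ≡ β * y) × (z' ≡ β * z)

  proportional : ∀ u v → ¬ Zero u → Par u v → ∃ λ β → v ∝ β · u
  proportional (x , y , z) (x' , y' , z') nz (e₁ , e₂ , e₃) with x ≟ 0# | y ≟ 0# | z ≟ 0#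
  ... | no h | _ | _ = x' * invert h , pivot x x' (trans (*-comm x x') refl) , pivot y y' e₁ , pivot z z' e₂
    where
    pivot : ∀ w w' → x * w' ≡ x' * w → w' ≡ x' * invert h * w
    pivot w w' e = *-cancelˡ h (trans e (trans (cong (_* w) (trans (sym (*-identityʳ x')) (cong (x' *_) (sym (*-invert h)))))
      (solve 4 (λ x x' i w → (x' :* (x :* i)) :* w := x :* (x' :* i :* w)) refl x x' (invert h) w)))
  ... | yes _ | no h | _ = y' * invert h , pivot x x' (trans (*-comm y x') (trans (sym e₁) (*-comm x y'))) , pivot y y' (*-comm y y') , pivot z z' e₃
    where
    pivot : ∀ w w' → y * w' ≡ y' * w → w' ≡ y' * invert h * w
    pivot w w' e = *-cancelˡ h (trans e (trans (cong (_* w) (trans (sym (*-identityʳ y')) (cong (y' *_) (sym (*-invert h)))))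
      (solve 4 (λ x x' i w → (x' :* (x :* i)) :* w := x :* (x' :* i :* w)) refl y y' (invert h) w)))
  ... | yes _ | yes _ | no h = z' * invert h , pivot x x' (trans (*-comm z x') (trans (sym e₂) (*-comm x z'))) , pivot y y' (trans (*-comm z y') (trans (sym e₃) (*-comm y z'))) , pivot z z' (*-comm z z')
    where
    pivot : ∀ w w' → z * w' ≡ z' * w → w' ≡ z' * invert h * w
    pivot w w' e = *-cancelˡ h (trans e (trans (cong (_* w) (trans (sym (*-identityʳ z')) (cong (z' *_) (sym (*-invert h)))))
      (solve 4 (λ x x' i w → (x' :* (x :* i)) :* w := x :* (x' :* i :* w)) refl z z' (invert h) w)))
  ... | yes p | yes q | yes r = ⊥-elim (nz (p , q , r))

  par-sym : ∀ u v → Par u v → Par v u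
  par-sym (x , y , z) (x' , y' , z') (e₁ , e₂ , e₃) = sym e₁ , sym e₂ , sym e₃

  par-trans : ∀ u v w → ¬ Zero u → Par u v → Par u w → Par v w
  par-trans u v w nz p q with proportional u v nz p | proportional u w nz q
  ... | β , refl , refl , refl | β' , refl , refl , refl = e _ _ , e _ _ , e _ _
    where
    e : ∀ x y → β * x * (β' * y) ≡ β' * x * (β * y)
    e x y = solve 4 (λ b b' x y → b :* x :* (b' :* y) := b' :* x :* (b :* y)) refl β β' x y

  Commute : SL → SL → Set
  Commute g h = g ∙ h ≡ h ∙ g

  commute⇒par : ∀ g h → Commute g h → Par (vec g) (vec h)
  commute⇒par ((a , b , c , d) , _) ((a' , b' , c' , d') , _) e =
    sub-zero (trans (solve 6 (λ a b d a' b' d' → (a :- d) :* b' :- (a' :- d') :* b := (a :* b' :+ b :* d') :- (a' :* b :+ b' :* d)) refl a b d a' b' d')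
      (zero-sub (cong (λ g → proj₁ (proj₂ (proj₁ g))) e))) ,
    sub-zero (trans (solve 6 (λ a c d a' c' d' → (a :- d) :* c' :- (a' :- d') :* c := (c' :* a :+ d' :* c) :- (c :* a' :+ d :* c')) refl a c d a' c' d')
      (zero-sub (sym (cong (λ g → proj₁ (proj₂ (proj₂ (proj₁ g)))) e)))) ,
    sub-zero (trans (solve 6 (λ a b c a' b' c' → b :* c' :- b' :* c := (a :* a' :+ b :* c') :- (a' :* a :+ b' :* c)) refl a b c a' b' c')
      (zero-sub (cong (λ g → proj₁ (proj₁ g)) e)))

  par⇒commute : ∀ g h → Par (vec g) (vec h) → Commute g h
  par⇒commute ((a , b , c , d) , _) ((a' , b' , c' , d') , _) (e₁ , e₂ , e₃) = SL-ext (mat-ext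
    (sub-zero (trans (solve 6 (λ a b c a' b' c' → (a :* a' :+ b :* c') :- (a' :* a :+ b' :* c) := b :* c' :- b' :* c) refl a b c a' b' c') (zero-sub e₃)))
    (sub-zero (trans (solve 6 (λ a b d a' b' d' → (a :* b' :+ b :* d') :- (a' :* b :+ b' :* d) := (a :- d) :* b' :- (a' :- d') :* b) refl a b d a' b' d') (zero-sub e₁)))
    (sub-zero (trans (solve 6 (λ a c d a' c' d' → (c :* a' :+ d :* c') :- (c' :* a :+ d' :* c) := (a' :- d') :* c :- (a :- d) :* c') refl a c d a' c' d') (zero-sub (sym e₂))))
    (sub-zero (trans (solve 6 (λ b c d b' c' d' → (c :* b' :+ d :* d') :- (c' :* b :+ d' :* d) := b' :* c :- b :* c') refl b c d b' c' d') (zero-sub (sym e₃)))))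

  Central : SL → Set
  Central g = Zero (vec g)

  commute-trans : ∀ y z w → ¬ Central y → Commute y z → Commute y w → Commute z w
  commute-trans y z w nc p q = par⇒commute z w (par-trans (vec y) (vec z) (vec w) nc (commute⇒par y z p) (commute⇒par y w q))

  central-commutes : ∀ g h → Central g → Commute g h
  central-commutes g@((a , b , c , d) , _) h@((a' , b' , c' , d') , _) (e₁ , e₂ , e₃) = par⇒commute g h
    (z e₁ e₂ , z e₁ e₃ , z e₂ e₃)
    where
    z : ∀ {x y x' y'} → x ≡ 0# → y ≡ 0# → x * y' ≡ x' * y
    z {x' = x'} {y'} refl refl = trans (zeroˡ y') (sym (zeroʳ x'))

  conjugate : SL → SL → SL
  conjugate a z = a ∙ z ∙ a ⁻¹

  opaque
    U-det : inSL₂ (1# , 1# , 0# , 1#) ≡ true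
    U-det = sl-intro (solve 0 (:1 :* :1 :- :1 :* :0 := :1) refl)
    V-det : inSL₂ (1# , 0# , 1# , 1#) ≡ true
    V-det = sl-intro (solve 0 (:1 :* :1 :- :0 :* :1 := :1) refl)

  U V : SL
  U = (1# , 1# , 0# , 1#) , U-det
  V = (1# , 0# , 1# , 1#) , V-det

  -- The area spanned by x and g x: a quadratic form in x that vanishes exactly on eigenvectors of g
  -- and on zero.
  q : SL → F × F → F
  q ((a , b , c , d) , _) (x , y) = x * (c * x + d * y) - y * (a * x + b * y)

  act : SL → F × F → F × F
  act ((a , b , c , d) , _) (x , y) = ((a * x) + (b * y) , (c * x) + (d * y))

  area : F × F → F × F → F
  area (x , y) (x' , y') = x * y' - y * x'

  act-∙ : ∀ g h x → act (g ∙ h) x ≡ act g (act h x)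
  act-∙ ((a , b , c , d) , _) ((a' , b' , c' , d') , _) (x , y) = cong₂ _,_ (en a b) (en c d)
    where
    en : ∀ p r → (p * a' + r * c') * x + (p * b' + r * d') * y ≡ p * (a' * x + b' * y) + r * (c' * x + d' * y)
    en p r = solve 8 (λ p r a b c d x y → (p :* a :+ r :* c) :* x :+ (p :* b :+ r :* d) :* y := p :* (a :* x :+ b :* y) :+ r :* (c :* x :+ d :* y)) refl p r a' b' c' d' x y

  area-act : ∀ g x y → area (act g x) (act g y) ≡ area x y
  area-act ((a , b , c , d) , p) (x , y) (x' , y') = trans
    (solve 8 (λ a b c d x y x' y' → (a :* x :+ b :* y) :* (c :* x' :+ d :* y') :- (c :* x :+ d :* y) :* (a :* x' :+ b :* y')
      := (a :* d :- b :* c) :* (x :* y' :- y :* x')) refl a b c d x y x' y') (trans (cong (_* (x * y' - y * x')) (det-1 p)) (*-identityˡ _))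

  q-conj : ∀ a m x → q (a ⁻¹ ∙ m ∙ a) x ≡ q m (act a x)
  q-conj a m x = trans (cong (area x) (trans (act-∙ (a ⁻¹ ∙ m) a x) (act-∙ (a ⁻¹) m (act a x))))
    (trans (sym (area-act a x _)) (cong (area (act a x)) (trans (sym (act-∙ a (a ⁻¹) _)) (trans (cong (λ g → act g (act m (act a x))) (FiniteGroup.invʳ SL₂ a)) (act-ε _)))))
    where
    act-ε : ∀ v → act ε v ≡ v
    act-ε (x , y) = cong₂ _,_ (solve 2 (λ x y → :1 :* x :+ :0 :* y := x) refl x y) (solve 2 (λ x y → :0 :* x :+ :1 :* y := y) refl x y)

  q-inv : ∀ g x → q (g ⁻¹) x ≡ - q g x
  q-inv ((a , b , c , d) , _) (x , y) = solve 6 (λ a b c d x y → x :* ((:- c) :* x :+ a :* y) :- y :* (d :* x :+ (:- b) :* y) := :- (x :* (c :* x :+ d :* y) :- y :* (a :* x :+ b :* y))) refl a b c d x y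

  nonzero : F × F → Set
  nonzero (x , y) = ¬ ((x ≡ 0#) × (y ≡ 0#))

  area-proportional : ∀ x y → nonzero x → area x y ≡ 0# → ∃ λ l → y ≡ (l * proj₁ x , l * proj₂ x)
  area-proportional (x , y) (x' , y') nz e with x ≟ 0# | y ≟ 0#
  ... | no h | _ = x' * invert h , cong₂ _,_ (pivot x x' (*-comm x x')) (pivot y y' (trans (sub-zero e) (*-comm y x')))
    where
    pivot : ∀ w w' → x * w' ≡ x' * w → w' ≡ x' * invert h * w
    pivot w w' e = *-cancelˡ h (trans e (trans (cong (_* w) (trans (sym (*-identityʳ x')) (cong (x' *_) (sym (*-invert h)))))
      (solve 4 (λ x x' i w → (x' :* (x :* i)) :* w := x :* (x' :* i :* w)) refl x x' (invert h) w)))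
  ... | yes _ | no h = y' * invert h , cong₂ _,_ (pivot x x' (trans (sym (sub-zero e)) (*-comm x y'))) (pivot y y' (*-comm y y'))
    where
    pivot : ∀ w w' → y * w' ≡ y' * w → w' ≡ y' * invert h * w
    pivot w w' e = *-cancelˡ h (trans e (trans (cong (_* w) (trans (sym (*-identityʳ y')) (cong (y' *_) (sym (*-invert h)))))
      (solve 4 (λ x x' i w → (x' :* (x :* i)) :* w := x :* (x' :* i :* w)) refl y y' (invert h) w)))
  ... | yes p | yes r = ⊥-elim (nz (p , r))

  q-∙ : ∀ g h x → nonzero x → q g x ≡ 0# → q h x ≡ 0# → q (g ∙ h) x ≡ 0#
  q-∙ g@((a , b , c , d) , _) h v@(x , y) nz eg eh with area-proportional v (act h v) nz eh
  ... | l , e = trans (cong (area v) (trans (act-∙ g h v) (cong (act g) e)))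
    (trans (solve 7 (λ a b c d x y l → x :* (c :* (l :* x) :+ d :* (l :* y)) :- y :* (a :* (l :* x) :+ b :* (l :* y)) := l :* (x :* (c :* x :+ d :* y) :- y :* (a :* x :+ b :* y))) refl a b c d x y l)
      (trans (cong (l *_) eg) (zeroʳ l)))

  area-swap : ∀ x y → area x y ≡ - area y x
  area-swap (x , y) (x' , y') = solve 4 (λ x y x' y' → x :* y' :- y :* x' := :- (x' :* y :- y' :* x)) refl x y x' y'

  -- A binary quadratic form with three zeros on the projective line is zero: in the basis x, y only
  -- the mixed term is left, and z removes it.
  three-eigendirections : ∀ m x y z → ¬ (area x y ≡ 0#) → ¬ (area x z ≡ 0#) → ¬ (area y z ≡ 0#) →
    q m x ≡ 0# → q m y ≡ 0# → q m z ≡ 0# → Central m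
  three-eigendirections m@((a , b , c , d) , _) (x₁ , x₂) (y₁ , y₂) (z₁ , z₂) xy xz yz qx qy qz = δ0 , b0 , c0
    where
    Q : F → F → F
    Q u v = u * (c * u + d * v) - v * (a * u + b * v)
    B : F
    B = (x₁ * (c * y₁ + d * y₂) - x₂ * (a * y₁ + b * y₂)) + (y₁ * (c * x₁ + d * x₂) - y₂ * (a * x₁ + b * x₂))
    D = x₁ * y₂ - x₂ * y₁
    expand : ∀ u v → let α = u * y₂ - v * y₁ ; β = x₁ * v - x₂ * u in
      D * D * Q u v ≡ α * α * Q x₁ x₂ + α * β * B + β * β * Q y₁ y₂
    expand u v = solve 10 (λ a b c d x₁ x₂ y₁ y₂ u v →
        let D = x₁ :* y₂ :- x₂ :* y₁
            α = u :* y₂ :- v :* y₁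
            β = x₁ :* v :- x₂ :* u
            Q = λ u v → u :* (c :* u :+ d :* v) :- v :* (a :* u :+ b :* v)
            B = (x₁ :* (c :* y₁ :+ d :* y₂) :- x₂ :* (a :* y₁ :+ b :* y₂)) :+ (y₁ :* (c :* x₁ :+ d :* x₂) :- y₂ :* (a :* x₁ :+ b :* x₂))
        in D :* D :* Q u v := α :* α :* Q x₁ x₂ :+ α :* β :* B :+ β :* β :* Q y₁ y₂) refl a b c d x₁ x₂ y₁ y₂ u v
    middle : ∀ A m C {s t} → s ≡ 0# → t ≡ 0# → A * s + m + C * t ≡ 0# → m ≡ 0#
    middle A m C refl refl e = trans (solve 3 (λ A m C → m := A :* :0 :+ m :+ C :* :0) refl A m C) e
    combine : ∀ A B C {s t r} → s ≡ 0# → t ≡ 0# → r ≡ 0# → A * s + B * t + C * r ≡ 0#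
    combine A B C refl refl refl = solve 3 (λ A B C → A :* :0 :+ B :* :0 :+ C :* :0 := :0) refl A B C
    B0 : B ≡ 0#
    B0 = *-cancel0 (*-nonzero nzα xz) (middle _ _ _ qx qy (trans (sym (expand z₁ z₂)) (trans (cong (D * D *_) qz) (zeroʳ _))))
      where
      nzα : ¬ (z₁ * y₂ - z₂ * y₁ ≡ 0#)
      nzα e = yz (trans (area-swap (y₁ , y₂) (z₁ , z₂)) (trans (cong -_ e) (solve 0 (:- :0 := :0) refl)))
    Q0 : ∀ u v → Q u v ≡ 0#
    Q0 u v = *-cancel0 (*-nonzero xy xy) (trans (expand u v) (combine _ _ _ qx B0 qy))
    c0 : c ≡ 0#
    c0 = trans (solve 4 (λ a b c d → c := :1 :* (c :* :1 :+ d :* :0) :- :0 :* (a :* :1 :+ b :* :0)) refl a b c d) (Q0 1# 0#)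
    b0 : b ≡ 0#
    b0 = neg-zero (trans (solve 4 (λ a b c d → :- b := :0 :* (c :* :0 :+ d :* :1) :- :1 :* (a :* :0 :+ b :* :1)) refl a b c d) (Q0 0# 1#))
    δ0 : a - d ≡ 0#
    δ0 = trans (solve 4 (λ a b c d → a :- d := (c :- b) :- (:1 :* (c :* :1 :+ d :* :1) :- :1 :* (a :* :1 :+ b :* :1))) refl a b c d)
      (trans (cong₂ _-_ (cong₂ _-_ c0 b0) (Q0 1# 1#)) (solve 0 ((:0 :- :0) :- :0 := :0) refl))

  -- The projective line: `just s` is the direction of slope s and `nothing` the vertical one.
  Dir : Set
  Dir = Maybe F

  finite-Dir : Finite Dir
  finite-Dir = finite-Maybe finite

  ⟨_⟩ : Dir → F × F
  ⟨ nothing ⟩ = 0# , 1#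
  ⟨ just s ⟩  = 1# , s

  dir-nonzero : ∀ s → nonzero ⟨ s ⟩
  dir-nonzero nothing  (_ , e) = 1≢0 e
  dir-nonzero (just s) (e , _) = 1≢0 e

  dir-area : ∀ s t → ¬ (s ≡ t) → ¬ (area ⟨ s ⟩ ⟨ t ⟩ ≡ 0#)
  dir-area nothing  nothing  ne e = ne refl
  dir-area nothing  (just t) ne e = 1≢0 (neg-zero (trans (solve 1 (λ t → :- :1 := :0 :* t :- :1 :* :1) refl t) e))
  dir-area (just s) nothing  ne e = 1≢0 (trans (solve 1 (λ s → :1 := :1 :* :1 :- s :* :0) refl s) e)
  dir-area (just s) (just t) ne e = ne (cong just (sym (sub-zero (trans (solve 2 (λ s t → t :- s := :1 :* t :- s :* :1) refl s t) e))))

  fixes : SL → Dir → Bool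
  fixes g s = q g ⟨ s ⟩ == 0#

  few-fixed : ∀ g → ¬ Central g → Finite.count finite-Dir (fixes g) ℕ.≤ 2
  few-fixed g nc = count-≤2′ finite-Dir λ x y z px py pz xy xz → decide x y z px py pz xy xz
    where
    decide : ∀ x y z → fixes g x ≡ true → fixes g y ≡ true → fixes g z ≡ true → ¬ (x ≡ y) → ¬ (x ≡ z) → y ≡ z
    decide x y z px py pz xy xz with Finite._≟_ finite-Dir y z
    ... | yes e = e
    ... | no ne = ⊥-elim (nc (three-eigendirections g ⟨ x ⟩ ⟨ y ⟩ ⟨ z ⟩ (dir-area x y xy) (dir-area x z xz) (dir-area y z ne)
      (does-true (_ ≟ _) px) (does-true (_ ≟ _) py) (does-true (_ ≟ _) pz)))

  find-direction : ∀ v → nonzero v → ∃ λ s → ∃ λ l → ¬ (l ≡ 0#) × v ≡ (l * proj₁ ⟨ s ⟩ , l * proj₂ ⟨ s ⟩)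
  find-direction (x , y) nz with x ≟ 0#
  ... | no h = just (y * invert h) , x , h , cong₂ _,_ (sym (*-identityʳ x)) (sym (trans (solve 3 (λ x y i → x :* (y :* i) := y :* (x :* i)) refl x y (invert h)) (trans (cong (y *_) (*-invert h)) (*-identityʳ y))))
  ... | yes refl = nothing , y , (λ e → nz (refl , e)) , cong₂ _,_ (sym (zeroʳ y)) (sym (*-identityʳ y))

  fixes-scaled : ∀ g s l v → ¬ (l ≡ 0#) → v ≡ (l * proj₁ ⟨ s ⟩ , l * proj₂ ⟨ s ⟩) → q g v ≡ 0# → fixes g s ≡ true
  fixes-scaled g@((a , b , c , d) , _) s l v nl refl e = does-intro (_ ≟ _) (*-cancel0 (*-nonzero nl nl)
    (trans (solve 7 (λ a b c d x y l → l :* l :* (x :* (c :* x :+ d :* y) :- y :* (a :* x :+ b :* y)) := l :* x :* (c :* (l :* x) :+ d :* (l :* y)) :- l :* y :* (a :* (l :* x) :+ b :* (l :* y))) refl a b c d _ _ l) e))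

 private module 𝓖 = FiniteGroup SL2.SL₂

 -- Coordinates on the lines of the quadric

 module Charts where
  open 𝓕
  open SL2 hiding (vec)
  open 𝓟 hiding (const; scale; sub-zero)
  open Tangency using (Vec₄; vec)
  open TangentLine
  open 𝓖 using (_∙_; ε; _⁻¹; count; assoc; cancelˡ; cancelˡ′; cancelʳ; cancelʳ′; invˡ; invʳ; idˡ; idʳ) renaming (finite to finite-SL)
  open import Data.Fin using (Fin; zero; suc)
  open import Data.Maybe using (just; nothing)
  open Sums
  module Dirᶠ = Finite finite-Dir
  module Ptᶠ = Finite finite-Pt

  entries : Mat → Vec₄ F
  entries (a , b , c , d) = vec a b c d

  point : SL → Vec₄ F
  point g = entries (proj₁ g)

  act-ε : ∀ v → act ε v ≡ v
  act-ε (x , y) = cong₂ _,_ (solve 2 (λ x y → :1 :* x :+ :0 :* y := x) refl x y) (solve 2 (λ x y → :0 :* x :+ :1 :* y := y) refl x y)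

  act-inv : ∀ g v → act (g ⁻¹) (act g v) ≡ v
  act-inv g v = trans (sym (act-∙ (g ⁻¹) g v)) (trans (cong (λ h → act h v) (invˡ g)) (act-ε v))

  act-inv′ : ∀ g v → act g (act (g ⁻¹) v) ≡ v
  act-inv′ g v = trans (sym (act-∙ g (g ⁻¹) v)) (trans (cong (λ h → act h v) (invʳ g)) (act-ε v))

  act-0 : ∀ g → act g (0# , 0#) ≡ (0# , 0#)
  act-0 ((a , b , c , d) , _) = cong₂ _,_ (solve 2 (λ a b → a :* :0 :+ b :* :0 := :0) refl a b) (solve 2 (λ a b → a :* :0 :+ b :* :0 := :0) refl c d)

  act-nonzero : ∀ g v → nonzero v → nonzero (act g v)
  act-nonzero g v nz (e₁ , e₂) = nz (cong proj₁ v≡0 , cong proj₂ v≡0)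
    where
    v≡0 : v ≡ (0# , 0#)
    v≡0 = trans (sym (act-inv g v)) (trans (cong (act (g ⁻¹)) (cong₂ _,_ e₁ e₂)) (act-0 (g ⁻¹)))

  frame-mat : Dir → Mat
  frame-mat (just s) = 1# , 0# , - s , 1#
  frame-mat nothing  = 0# , 1# , - 1# , 0#

  opaque
    frame-det : ∀ x → inSL₂ (frame-mat x) ≡ true
    frame-det (just s) = sl-intro (solve 1 (λ s → :1 :* :1 :- :0 :* (:- s) := :1) refl s)
    frame-det nothing  = sl-intro (solve 0 (:0 :* :0 :- :1 :* (:- :1) := :1) refl)
    shear-det : ∀ u → inSL₂ (1# , u , 0# , 1#) ≡ true
    shear-det u = sl-intro (solve 1 (λ u → :1 :* :1 :- u :* :0 := :1) refl u)

  frame : Dir → SL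
  frame x = frame-mat x , frame-det x

  frame-act : ∀ x → act (frame x) ⟨ x ⟩ ≡ (1# , 0#)
  frame-act (just s) = cong₂ _,_ (solve 1 (λ s → :1 :* :1 :+ :0 :* s := :1) refl s) (solve 1 (λ s → (:- s) :* :1 :+ :1 :* s := :0) refl s)
  frame-act nothing  = cong₂ _,_ (solve 0 (:0 :* :0 :+ :1 :* :1 := :1) refl) (solve 0 ((:- :1) :* :0 :+ :0 :* :1 := :0) refl)

  shear : F → SL
  shear u = (1# , u , 0# , 1#) , shear-det u

  corner : SL → F
  corner ((_ , b , _ , _) , _) = b

  shear-act : ∀ u → act (shear u) (1# , 0#) ≡ (1# , 0#)
  shear-act u = cong₂ _,_ (solve 1 (λ u → :1 :* :1 :+ u :* :0 := :1) refl u) (solve 0 (:0 :* :1 :+ :1 :* :0 := :0) refl)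

  shear-unique : ∀ g → act g (1# , 0#) ≡ (1# , 0#) → g ≡ shear (corner g)
  shear-unique ((a , b , c , d) , e) h = SL-ext (mat-ext a1 refl c0 d1)
    where
    a1 : a ≡ 1#
    a1 = trans (solve 2 (λ a b → a := a :* :1 :+ b :* :0) refl a b) (cong proj₁ h)
    c0 : c ≡ 0#
    c0 = trans (solve 2 (λ c d → c := c :* :1 :+ d :* :0) refl c d) (cong proj₂ h)
    d1 : d ≡ 1#
    d1 = trans (sym (trans (cong₂ _-_ (trans (cong (_* d) a1) (*-identityˡ d)) (trans (cong (b *_) c0) (zeroʳ b))) (solve 1 (λ d → d :- :0 := d) refl d))) (det-1 e)

  -- The matrix, in four coordinates, of the linear map M ↦ A·M·C.
  sandwich : Mat → Mat → Fin 4 → Fin 4 → F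
  sandwich (a , b , c , d) (e , f , g , h) zero                   = vec (a * e) (a * g) (b * e) (b * g)
  sandwich (a , b , c , d) (e , f , g , h) (suc zero)             = vec (a * f) (a * h) (b * f) (b * h)
  sandwich (a , b , c , d) (e , f , g , h) (suc (suc zero))       = vec (c * e) (c * g) (d * e) (d * g)
  sandwich (a , b , c , d) (e , f , g , h) (suc (suc (suc zero))) = vec (c * f) (c * h) (d * f) (d * h)

  sandwich-entries : ∀ {n} (φ : Form 4 n) A C M i → conj (sandwich A C) φ (entries M) i ≡ entries ((A · M) · C) i
  sandwich-entries φ (a , b , c , d) (e , f , g , h) (m , o , q , r) = λ
    { zero → en a b e g ; (suc zero) → en a b f h ; (suc (suc zero)) → en c d e g ; (suc (suc (suc zero))) → en c d f h }
    where
    en : ∀ a b e g → a * e * m + a * g * o + b * e * q + b * g * r ≡ (a * m + b * q) * e + (a * o + b * r) * g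
    en a b e g = solve 8 (λ a b e g m o q r → a :* e :* m :+ a :* g :* o :+ b :* e :* q :+ b :* g :* r := (a :* m :+ b :* q) :* e :+ (a :* o :+ b :* r) :* g) refl a b e g m o q r

  -- Elements that agree with g₀ on x form a left coset of the stabiliser of ⟨ x ⟩, and the frame
  -- conjugates that stabiliser to the group of shears.
  module Chart (x : Dir) (g₀ : SL) where
    C A : SL
    C = frame x
    A = g₀ ∙ C ⁻¹
    chart : F → SL
    chart u = A ∙ shear u ∙ C
    coordinate : SL → F
    coordinate g = corner (A ⁻¹ ∙ g ∙ C ⁻¹)
    chart-act : ∀ u → act (chart u) ⟨ x ⟩ ≡ act g₀ ⟨ x ⟩
    chart-act u = trans (act-∙ (A ∙ shear u) C ⟨ x ⟩) (trans (cong (act (A ∙ shear u)) (frame-act x)) (trans (act-∙ A (shear u) _)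
      (trans (cong (act A) (trans (shear-act u) (sym (frame-act x)))) (trans (sym (act-∙ A C ⟨ x ⟩)) (cong (λ g → act g ⟨ x ⟩) (cancelʳ′ g₀ C))))))
    chart-coordinate : ∀ g → act g ⟨ x ⟩ ≡ act g₀ ⟨ x ⟩ → g ≡ chart (coordinate g)
    chart-coordinate g e = sym (trans (cong (λ h → A ∙ h ∙ C) (sym (shear-unique k fixed)))
      (trans (cong (_∙ C) (trans (cong (A ∙_) (assoc _ _ _)) (cancelˡ′ A (g ∙ C ⁻¹)))) (cancelʳ′ g C)))
      where
      k = A ⁻¹ ∙ g ∙ C ⁻¹
      C⁻¹e₁ : act (C ⁻¹) (1# , 0#) ≡ ⟨ x ⟩
      C⁻¹e₁ = trans (cong (act (C ⁻¹)) (sym (frame-act x))) (act-inv C ⟨ x ⟩)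
      fixed : act k (1# , 0#) ≡ (1# , 0#)
      fixed = trans (act-∙ (A ⁻¹ ∙ g) (C ⁻¹) _) (trans (cong (act (A ⁻¹ ∙ g)) C⁻¹e₁) (trans (act-∙ (A ⁻¹) g _) (trans (cong (act (A ⁻¹)) (trans e
        (sym (trans (act-∙ g₀ (C ⁻¹) _) (cong (act g₀) C⁻¹e₁))))) (act-inv A _))))
    κ : Fin 4 → Fin 4 → F
    κ = sandwich (proj₁ A) (proj₁ C)

 -- The number of forms of given degree

 module FormCount where
  open 𝓕 using (F; p; finite; order)
  open 𝓟
  open import Data.Nat using (_+_; _*_; _^_)
  open import Data.Nat.Properties
  open import Data.Unit using (⊤; tt)
  open import Data.List using ([]; _∷_)
  open Arith
  open Sums
  open Pigeonhole

  private
    finite-⊤ : Finite ⊤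
    finite-⊤ = record { elems = tt ∷ [] ; _≟_ = λ _ _ → yes refl ; once = λ _ → refl }
    node-parts : ∀ {k a} → Form (suc k) (suc a) → Form k (suc a) × Form (suc k) a
    node-parts (node G H) = G , H
    constant : ∀ {k} → Form k zero → F
    constant (const c) = c

  finite-Form : ∀ k a → Finite (Form k a)
  finite-Form k       zero    = transport-finite finite constant const (λ { (const c) → refl }) (λ _ → refl)
  finite-Form zero    (suc a) = transport-finite finite-⊤ (λ _ → tt) (λ _ → void) (λ { void → refl }) (λ _ → refl)
  finite-Form (suc k) (suc a) = transport-finite (finite-× (finite-Form k (suc a)) (finite-Form (suc k) a)) node-parts (λ { (G , H) → node G H })
    (λ { (node G H) → refl }) (λ _ → refl)

  dimension : ℕ → ℕ → ℕ
  dimension k       zero    = 1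
  dimension zero    (suc a) = 0
  dimension (suc k) (suc a) = dimension k (suc a) + dimension (suc k) a

  count-forms : ∀ k a → ∑ (Finite.elems (finite-Form k a)) (λ _ → 1) ≡ p ^ dimension k a
  count-forms k       zero    = trans (∑-map const (Finite.elems finite) _) (trans order (sym (*-identityʳ p)))
  count-forms zero    (suc a) = refl
  count-forms (suc k) (suc a) = trans (∑-map _ (Finite.elems 𝓟) _) (trans (∑-product (Finite.elems (finite-Form k (suc a))) (Finite.elems (finite-Form (suc k) a)) _)
    (trans (sym (∑-* (Finite.elems (finite-Form k (suc a))) (Finite.elems (finite-Form (suc k) a)) (λ _ → 1) (λ _ → 1)))
      (trans (cong₂ _*_ (count-forms k (suc a)) (count-forms (suc k) a)) (sym (^-distribˡ-+-* p (dimension k (suc a)) (dimension (suc k) a))))))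
    where
    𝓟 = finite-× (finite-Form k (suc a)) (finite-Form (suc k) a)

  private
    dimension₁ : ∀ a → dimension 1 a ≡ 1
    dimension₁ zero    = refl
    dimension₁ (suc a) = dimension₁ a
    dimension₂ : ∀ a → dimension 2 a ≡ suc a
    dimension₂ zero    = refl
    dimension₂ (suc a) = cong₂ _+_ (dimension₁ (suc a)) (dimension₂ a)
    dimension₃ : ∀ a → 2 * dimension 3 a ≡ (a + 1) * (a + 2)
    dimension₃ zero    = refl
    dimension₃ (suc a) = trans (*-distribˡ-+ 2 (dimension 2 (suc a)) (dimension 3 a)) (trans (cong₂ _+_ (cong (2 *_) (dimension₂ (suc a))) (dimension₃ a))
      (solveℕ 1 (λ a → # 2 ⊗ (# 2 ⊕ a) ⊕ (a ⊕ # 1) ⊗ (a ⊕ # 2) ⊜ (# 1 ⊕ a ⊕ # 1) ⊗ (# 1 ⊕ a ⊕ # 2)) refl a))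

  dimension₄ : ∀ a → 6 * dimension 4 a ≡ (a + 1) * (a + 2) * (a + 3)
  dimension₄ zero    = refl
  dimension₄ (suc a) = trans (*-distribˡ-+ 6 (dimension 3 (suc a)) (dimension 4 a)) (trans (cong₂ _+_
      (trans (*-assoc 3 2 (dimension 3 (suc a))) (cong (3 *_) (dimension₃ (suc a)))) (dimension₄ a))
    (solveℕ 1 (λ a → # 3 ⊗ ((# 1 ⊕ a ⊕ # 1) ⊗ (# 1 ⊕ a ⊕ # 2)) ⊕ (a ⊕ # 1) ⊗ (a ⊕ # 2) ⊗ (a ⊕ # 3) ⊜ (# 1 ⊕ a ⊕ # 1) ⊗ (# 1 ⊕ a ⊕ # 2) ⊗ (# 1 ⊕ a ⊕ # 3)) refl a))

 -- Forms vanishing on the lines of a rich configuration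

 module JointForms where
  open 𝓕
  open SL2 hiding (vec)
  open 𝓟 hiding (const; scale; sub-zero)
  open 𝓟 using () renaming (const to constant)
  open Tangency using (vec)
  open TangentLine
  open Charts
  open 𝓖 using (_∙_; ε; _⁻¹; count; count-mono; assoc; cancelˡ; cancelˡ′; cancelʳ; cancelʳ′; invˡ; invʳ; idˡ; idʳ) renaming (finite to finite-SL)
  open import Data.Fin using (Fin; zero; suc)
  open import Data.Maybe using (just; nothing)
  open Arith
  open Sums
  open Pigeonhole

  opaque
    tangent-det : ∀ u τ c (d≢0 : ¬ (1# - τ * c ≡ 0#)) → let i = invert d≢0 in
      inSL₂ (i * (1# + c * (- (τ + τ) - u * (τ * τ))) , i * (u + c * 1#) , i * (0# + c * - (τ * τ)) , i * (1# + c * 0#)) ≡ true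
    tangent-det u τ c d≢0 = sl-intro (trans
      (solve 4 (λ u τ c i → i :* (:1 :+ c :* (:- (τ :+ τ) :- u :* (τ :* τ))) :* (i :* (:1 :+ c :* :0)) :- i :* (u :+ c :* :1) :* (i :* (:0 :+ c :* :- (τ :* τ)))
        := ((:1 :- τ :* c) :* i) :* ((:1 :- τ :* c) :* i)) refl u τ c (invert d≢0))
      (trans (cong₂ _*_ (*-invert d≢0) (*-invert d≢0)) (*-identityˡ 1#)))

  -- The matrix `L u` + c·`N u τ` divided by 1 - τc, a square root of its determinant. The result
  -- lies in SL₂ and agrees with `shear u` on (1, τ).
  tangent : ∀ u τ c → ¬ (1# - τ * c ≡ 0#) → SL
  tangent u τ c d≢0 = _ , tangent-det u τ c d≢0

  tangent-act : ∀ u τ c d≢0 v → area v (1# , τ) ≡ 0# → act (tangent u τ c d≢0) v ≡ act (shear u) v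
  tangent-act u τ c d≢0 (v , w) e = cong₂ _,_
    (trans (cong (λ w → i * (1# + c * (- (τ + τ) - u * (τ * τ))) * v + i * (u + c * 1#) * w) w≡)
      (trans (solve 5 (λ u τ c i v → i :* (:1 :+ c :* (:- (τ :+ τ) :- u :* (τ :* τ))) :* v :+ i :* (u :+ c :* :1) :* (v :* τ)
          := ((:1 :- τ :* c) :* i) :* (:1 :* v :+ u :* (v :* τ))) refl u τ c i v)
        (trans (cong₂ (λ x w → x * (1# * v + u * w)) (*-invert d≢0) (sym w≡)) (*-identityˡ _))))
    (trans (cong (λ w → i * (0# + c * - (τ * τ)) * v + i * (1# + c * 0#) * w) w≡)
      (trans (solve 4 (λ τ c i v → i :* (:0 :+ c :* :- (τ :* τ)) :* v :+ i :* (:1 :+ c :* :0) :* (v :* τ)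
          := ((:1 :- τ :* c) :* i) :* (:0 :* v :+ :1 :* (v :* τ))) refl τ c i v)
        (trans (cong₂ (λ x w → x * (0# * v + 1# * w)) (*-invert d≢0) (sym w≡)) (*-identityˡ _))))
    where
    i = invert d≢0
    w≡ : w ≡ v * τ
    w≡ = sym (trans (sub-zero e) (*-identityʳ w))

  Vanishes : ∀ {n} → Form 4 n → Dir → F × F → Set
  Vanishes f x y = ∀ θ → act θ ⟨ x ⟩ ≡ y → E₀.eval (point θ) f ≡ 0#

  module RichJoints (J : SL → Bool) (𝓛 : Dir → F × F → Bool) (β K a₀ : ℕ)
    (rich-lines : ∀ x y → 𝓛 x y ≡ true → β ≤ count (λ g → J g ∧ (act g ⟨ x ⟩ Ptᶠ.== y)))
    (rich-points : ∀ g → J g ≡ true → 2 ℕ.* K ℕ.+ 4 ≤ Dirᶠ.count (λ x → 𝓛 x (act g ⟨ x ⟩)))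
    (degree : 2 ℕ.* a₀ ℕ.+ 2 ℕ.+ K ≤ β ℕ.* K) (small : a₀ ℕ.+ 3 ≤ p) where
    module _ (x : Dir) (y : F × F) (xy : 𝓛 x y ≡ true) where
      0<β : 0 < β
      0<β = positive β (≤-trans (≤-trans (ℕ.m≤n+m 1 (2 ℕ.* a₀ ℕ.+ 1)) (≤-trans (≤-reflexive (ℕ.+-assoc (2 ℕ.* a₀) 1 1)) (ℕ.m≤m+n _ K))) degree)
        where
        positive : ∀ β → 1 ≤ β ℕ.* K → 0 < β
        positive (suc β) _ = s≤s z≤n
      opaque
        base : ∃ λ g → (J g ∧ (act g ⟨ x ⟩ Ptᶠ.== y)) ≡ true
        base = count-∃ finite-SL (≤-trans 0<β (rich-lines x y xy))
      g₀ : SL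
      g₀ = proj₁ base
      g₀-on : act g₀ ⟨ x ⟩ ≡ y
      g₀-on = does-true (act g₀ ⟨ x ⟩ Ptᶠ.≟ y) (proj₂ (∧-true {J g₀} (proj₂ base)))
      open Chart x g₀
      points : F → Bool
      points u = J (chart u)
      meets : F → F → Dir → Bool
      meets u τ x' = 𝓛 x' (act (chart u) ⟨ x' ⟩) ∧ (area (act C ⟨ x' ⟩) (1# , τ) == 0#)
      opaque
        lines : F → F → Bool
        lines u τ = any (meets u τ) Dirᶠ.elems
        lines-true : ∀ u τ → lines u τ ≡ true → ∃ λ x' → meets u τ x' ≡ true
        lines-true u τ h = any-true (meets u τ) Dirᶠ.elems h
        lines-intro : ∀ u τ x' → meets u τ x' ≡ true → lines u τ ≡ true
        lines-intro u τ x' h = Dirᶠ.any-intro (meets u τ) x' h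
      many-points : β ≤ Fᶠ.count points
      many-points = ≤-trans (rich-lines x y xy) (count-injective finite-SL finite coordinate (λ g → J g ∧ (act g ⟨ x ⟩ Ptᶠ.== y)) points
        (λ g e → trans (sym (cong J (at g e))) (proj₁ (∧-true e)))
        (λ g g' e e' same → trans (at g e) (trans (cong chart same) (sym (at g' e')))))
        where
        at : ∀ g → (J g ∧ (act g ⟨ x ⟩ Ptᶠ.== y)) ≡ true → g ≡ chart (coordinate g)
        at g e = chart-coordinate g (trans (does-true (act g ⟨ x ⟩ Ptᶠ.≟ y) (proj₂ (∧-true {J g} e))) (sym g₀-on))
      -- Of the 2K + 4 lines through the point one may have infinite slope in the chart; the others
      -- have distinct finite slopes, because the frame preserves areas.
      many-lines : ∀ u → points u ≡ true → 2 ℕ.* K ℕ.+ 3 ≤ Fᶠ.count (lines u)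
      many-lines u hu = ℕ.≤-pred (≤-trans (≤-reflexive (sym (ℕ.+-suc (2 ℕ.* K) 3))) (≤-trans (rich-points (chart u) hu)
        (≤-trans (count-injective finite-Dir finite-Dir slope (λ x' → 𝓛 x' (act (chart u) ⟨ x' ⟩)) target hits inj)
          (≤-reflexive (cong suc (∑-map just Fᶠ.elems (λ d → 𝟙 (target d))))))))
        where
        target : Dir → Bool
        target nothing  = true
        target (just τ) = lines u τ
        found : ∀ x' → ∃ λ s → ∃ λ l → ¬ (l ≡ 0#) × act C ⟨ x' ⟩ ≡ (l * proj₁ ⟨ s ⟩ , l * proj₂ ⟨ s ⟩)
        found x' = find-direction (act C ⟨ x' ⟩) (act-nonzero C ⟨ x' ⟩ (dir-nonzero x'))
        slope : Dir → Dir
        slope x' = proj₁ (found x')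
        hits : ∀ x' → 𝓛 x' (act (chart u) ⟨ x' ⟩) ≡ true → target (slope x') ≡ true
        hits x' h = go (found x')
          where
          go : ∀ (r : ∃ λ s → ∃ λ l → ¬ (l ≡ 0#) × act C ⟨ x' ⟩ ≡ (l * proj₁ ⟨ s ⟩ , l * proj₂ ⟨ s ⟩)) → target (proj₁ r) ≡ true
          go (nothing , _) = refl
          go (just τ , l , _ , e) = lines-intro u τ x' (∧-intro h (does-intro (_ ≟ 0#)
            (trans (cong (λ v → area v (1# , τ)) e) (solve 2 (λ l t → l :* :1 :* t :- l :* t :* :1 := :0) refl l τ))))
        inj : ∀ x₁ x₂ → 𝓛 x₁ (act (chart u) ⟨ x₁ ⟩) ≡ true → 𝓛 x₂ (act (chart u) ⟨ x₂ ⟩) ≡ true → slope x₁ ≡ slope x₂ → x₁ ≡ x₂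
        inj x₁ x₂ _ _ same = go (found x₁) (found x₂) same
          where
          go : ∀ (r : ∃ λ s → ∃ λ l → ¬ (l ≡ 0#) × act C ⟨ x₁ ⟩ ≡ (l * proj₁ ⟨ s ⟩ , l * proj₂ ⟨ s ⟩))
                 (r' : ∃ λ s → ∃ λ l → ¬ (l ≡ 0#) × act C ⟨ x₂ ⟩ ≡ (l * proj₁ ⟨ s ⟩ , l * proj₂ ⟨ s ⟩)) → proj₁ r ≡ proj₁ r' → x₁ ≡ x₂
          go (s , l , _ , e) (.s , l' , _ , e') refl with Dirᶠ._≟_ x₁ x₂
          ... | yes q = q
          ... | no ne = ⊥-elim (dir-area x₁ x₂ ne (trans (sym (area-act C ⟨ x₁ ⟩ ⟨ x₂ ⟩)) (trans (cong₂ area e e')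
                  (solve 4 (λ l l' a b → l :* a :* (l' :* b) :- l :* b :* (l' :* a) := :0) refl l l' (proj₁ ⟨ s ⟩) (proj₂ ⟨ s ⟩)))))
      module _ {n} (n≤a₀ : n ≤ a₀) (f : Form 4 n) (vanishes : ∀ x y → 𝓛 x y ≡ true → Vanishes f x y) where
        chart-point : ∀ h i → conj κ f (point h) i ≡ point (A ∙ h ∙ C) i
        chart-point h i = sandwich-entries f (proj₁ A) (proj₁ C) (proj₁ h) i
        shear-point : ∀ u i → L u i ≡ point (shear u) i
        shear-point u zero                   = refl
        shear-point u (suc zero)             = refl
        shear-point u (suc (suc zero))       = refl
        shear-point u (suc (suc (suc zero))) = refl
        on-line : ∀ u → E₀.eval (conj κ f (L u)) f ≡ 0#
        on-line u = trans (E₀.eval-cong (λ i → trans (conj-cong κ f (shear-point u) i) (chart-point (shear u) i)) f)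
          (vanishes x y xy (chart u) (trans (chart-act u) g₀-on))
        on-lines : ∀ u τ c → points u ≡ true → lines u τ ≡ true → ¬ (1# - τ * c ≡ 0#) → E₀.eval (conj κ f (λ l → L u l + c * N u τ l)) f ≡ 0#
        on-lines u τ c hu hl d≢0 = go (lines-true u τ hl)
          where
          d = 1# - τ * c
          θ = A ∙ tangent u τ c d≢0 ∙ C
          unscale : ∀ z → z ≡ d * (invert d≢0 * z)
          unscale z = sym (trans (sym (*-assoc d _ z)) (trans (cong (_* z) (*-invert d≢0)) (*-identityˡ z)))
          scaled : ∀ l → L u l + c * N u τ l ≡ d * point (tangent u τ c d≢0) l
          scaled zero                   = unscale _
          scaled (suc zero)             = unscale _
          scaled (suc (suc zero))       = unscale _
          scaled (suc (suc (suc zero))) = unscale _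
          go : (∃ λ x' → meets u τ x' ≡ true) → E₀.eval (conj κ f (λ l → L u l + c * N u τ l)) f ≡ 0#
          go (x' , m) = trans (E₀.eval-cong (λ i → trans (conj-cong κ f scaled i) (trans (conj-scale κ f (point (tangent u τ c d≢0)) d i)
                (cong (d *_) (chart-point (tangent u τ c d≢0) i)))) f)
              (trans (E₀.eval-scale d (point θ) f) (trans (cong (E₀.power d n *_) (vanishes x' (act (chart u) ⟨ x' ⟩) (proj₁ (∧-true m)) θ same)) (zeroʳ _)))
            where
            v = act C ⟨ x' ⟩
            same : act θ ⟨ x' ⟩ ≡ act (chart u) ⟨ x' ⟩
            same = trans (act-∙ (A ∙ tangent u τ c d≢0) C ⟨ x' ⟩) (trans (act-∙ A (tangent u τ c d≢0) v)
              (trans (cong (act A) (tangent-act u τ c d≢0 v (does-true (_ ≟ 0#) (proj₂ (∧-true {𝓛 x' (act (chart u) ⟨ x' ⟩)} m)))))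
                (trans (sym (act-∙ A (shear u) v)) (sym (act-∙ (A ∙ shear u) C ⟨ x' ⟩)))))
        all-derivatives : ∀ c M → E₀.dir (conj κ f (L c)) (conj κ f M) f ≡ 0#
        all-derivatives = derivatives-vanish κ f points lines K (≤-trans (ℕ.+-monoˡ-≤ 3 n≤a₀) small)
          (≤-trans (ℕ.+-monoˡ-≤ K (ℕ.+-monoˡ-≤ 2 (ℕ.*-monoʳ-≤ 2 n≤a₀))) (≤-trans degree (ℕ.*-monoˡ-≤ K many-points)))
          many-lines on-line on-lines
        -- The direction B is pulled back through the chart: M is chosen such that A·M·C = B.
        directional : ∀ B θ → act θ ⟨ x ⟩ ≡ y → E₀.dir (point θ) (entries B) f ≡ 0#
        directional B θ on = trans (sym (E₀.dir-cong at (λ i → trans (sandwich-entries f (proj₁ A) (proj₁ C) M i) (cong (λ X → entries X i) undo)) f)) (all-derivatives (coordinate θ) (entries M))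
          where
          M = (proj₁ (A ⁻¹) · B) · proj₁ (C ⁻¹)
          one-· : ∀ X → one · X ≡ X
          one-· (a , b , c , d) = mat-ext (l a c) (l b d) (l′ a c) (l′ b d)
            where
            l = solve 2 (λ x y → :1 :* x :+ :0 :* y := x) refl
            l′ = solve 2 (λ x y → :0 :* x :+ :1 :* y := y) refl
          ·-one : ∀ X → X · one ≡ X
          ·-one (a , b , c , d) = mat-ext (l a b) (l′ a b) (l c d) (l′ c d)
            where
            l = solve 2 (λ x y → x :* :1 :+ y :* :0 := x) refl
            l′ = solve 2 (λ x y → x :* :0 :+ y :* :1 := y) refl
          undo : (proj₁ A · M) · proj₁ C ≡ B
          undo = trans (cong (_· proj₁ C) (trans (sym (·-assoc (proj₁ A) (proj₁ (A ⁻¹) · B) (proj₁ (C ⁻¹))))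
              (cong (_· proj₁ (C ⁻¹)) (trans (sym (·-assoc (proj₁ A) (proj₁ (A ⁻¹)) B)) (trans (cong (_· B) (cong proj₁ (invʳ A))) (one-· B))))))
            (trans (·-assoc B (proj₁ (C ⁻¹)) (proj₁ C)) (trans (cong (B ·_) (cong proj₁ (invˡ C))) (·-one B)))
          at : ∀ i → conj κ f (L (coordinate θ)) i ≡ point θ i
          at i = trans (conj-cong κ f (shear-point (coordinate θ)) i) (trans (chart-point (shear (coordinate θ)) i)
            (cong (λ g → point g i) (sym (chart-coordinate θ (trans on (sym g₀-on))))))
    ∂-vanishes : ∀ {n} → suc n ≤ a₀ → (f : Form 4 (suc n)) → (∀ x y → 𝓛 x y ≡ true → Vanishes f x y) →
      ∀ i x y → 𝓛 x y ≡ true → Vanishes (∂ i f) x y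
    ∂-vanishes n≤a₀ f vanishes i x y xy θ on = trans (E₀.eval-∂ (point θ) i f)
      (trans (E₀.dir-cong (λ _ → refl) (basis-entries i) f) (directional x y xy n≤a₀ f vanishes (unit-matrix i) θ on))
      where
      unit-matrix : Fin 4 → Mat
      unit-matrix i = E₀.basis i zero , E₀.basis i (suc zero) , E₀.basis i (suc (suc zero)) , E₀.basis i (suc (suc (suc zero)))
      basis-entries : ∀ i l → E₀.basis i l ≡ entries (unit-matrix i) l
      basis-entries i zero                   = refl
      basis-entries i (suc zero)             = refl
      basis-entries i (suc (suc zero))       = refl
      basis-entries i (suc (suc (suc zero))) = refl
    -- The partial derivatives vanish on the same lines, so f can be differentiated down to a
    -- constant, which vanishes at a point of J. The way back from derivatives to f works because
    -- the degree is below p.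
    vanishing-form : ∀ {n} → n ≤ a₀ → (f : Form 4 n) → (∀ x y → 𝓛 x y ≡ true → Vanishes f x y) → ∀ g → J g ≡ true → IsZero f
    vanishing-form {zero} _ (constant c) vanishes g jg = go (count-∃ finite-Dir (≤-trans (≤-trans (s≤s z≤n) (ℕ.m≤n+m 4 (2 ℕ.* K))) (rich-points g jg)))
      where
      go : (∃ λ x → 𝓛 x (act g ⟨ x ⟩) ≡ true) → IsZero (constant c)
      go (x , h) = subst (λ c → IsZero (constant c)) (sym (vanishes x (act g ⟨ x ⟩) h g refl)) constant
    vanishing-form {suc n} n≤a₀ f vanishes g jg = ∂-zero f (≤-trans (s≤s n≤a₀) (≤-trans (≤-trans (ℕ.m≤n+m (suc a₀) 2) (≤-reflexive (ℕ.+-comm 3 a₀))) small))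
      (λ i → vanishing-form (≤-trans (ℕ.n≤1+n n) n≤a₀) (∂ i f) (∂-vanishes n≤a₀ f vanishes i) g jg)

 -- The joints bound for lines in SL₂

 module Joints where
  open 𝓕 hiding (sub-zero)
  open SL2 hiding (vec)
  open 𝓟 hiding (const; scale)
  open Tangency using (line-vanishes; lin)
  open TangentLine
  open Charts
  open JointForms
  open FormCount
  open 𝓖 using (_∙_; ε; _⁻¹; elems; ∑ᴬ; count; count-mono) renaming (finite to finite-SL)
  open import Data.Nat using (_≤ᵇ_; >-nonZero)
  open import Data.Nat.DivMod using (_/_; _%_; m≡m%n+[m/n]*n; m%n<n)
  open Arith
  open Sums
  open Pigeonhole

  Line : Set
  Line = Dir × (F × F)

  finite-Line : Finite Line
  finite-Line = finite-× finite-Dir finite-Pt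

  module Lineᶠ = Finite finite-Line

  _∈_ : SL → Line → Bool
  g ∈ (x , y) = act g ⟨ x ⟩ Ptᶠ.== y

  open Prune finite-SL finite-Line

  lines-at : (Line → Bool) → SL → ℕ
  lines-at L g = Dirᶠ.count (λ x → L (x , act g ⟨ x ⟩))

  lines-at-deg : ∀ L g → degᴬ _∈_ L g ≡ lines-at L g
  lines-at-deg L g = trans (∑-product Dirᶠ.elems Ptᶠ.elems _) (∑-cong Dirᶠ.elems λ x →
    trans (∑-cong Ptᶠ.elems λ y → trans (𝟙-∧ (L (x , y)) _) (ℕ.*-comm (𝟙 (L (x , y))) _)) (Ptᶠ.∑-δ (act g ⟨ x ⟩) (λ y → 𝟙 (L (x , y)))))

  opaque
    -- A pair (x, y) with y = 0 is a line without points. The default `ε` is harmless there, since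
    -- vanishing on an empty line demands nothing.
    base-point : Line → SL
    base-point l with FiniteGroup.search SL₂ (λ g → g ∈ l)
    ... | inj₁ (g , _) = g
    ... | inj₂ _       = ε
    base-point-on : ∀ l g → g ∈ l ≡ true → base-point l ∈ l ≡ true
    base-point-on l g h with FiniteGroup.search SL₂ (λ g → g ∈ l)
    ... | inj₁ (g' , e) = e
    ... | inj₂ none     = ⊥-elim (true≢false h (none g))

  line-point : Line → F → SL
  line-point l u = Chart.chart (proj₁ l) (base-point l) u

  module _ {n} (f : Form 4 n) (l : Line) (good : F → Bool) (enough : n < Fᶠ.count good)
    (zeros : ∀ u → good u ≡ true → E₀.eval (point (line-point l u)) f ≡ 0#) where
    vanishes-on-line : Vanishes f (proj₁ l) (proj₂ l)
    vanishes-on-line θ on = trans (E₀.eval-cong (λ i → cong (λ g → point g i) at) f) (everywhere (coordinate θ))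
      where
      open Chart (proj₁ l) (base-point l)
      x = proj₁ l
      at : θ ≡ chart (coordinate θ)
      at = chart-coordinate θ (trans on (sym (does-true (act (base-point l) ⟨ x ⟩ Ptᶠ.≟ proj₂ l) (base-point-on l θ (does-intro (act θ ⟨ x ⟩ Ptᶠ.≟ proj₂ l) on)))))
      shear-point : ∀ u i → L u i ≡ point (shear u) i
      shear-point u i = refl-cases i
        where
        open import Data.Fin using (zero; suc)
        refl-cases : ∀ i → L u i ≡ point (shear u) i
        refl-cases zero                   = refl
        refl-cases (suc zero)             = refl
        refl-cases (suc (suc zero))       = refl
        refl-cases (suc (suc (suc zero))) = refl
      translate : ∀ c u l → L c l + u * e₁₂ l ≡ L (c + u) l
      translate c u = cases
        where
        open import Data.Fin using (Fin; zero; suc)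
        cases : ∀ (l : Fin 4) → L c l + u * e₁₂ l ≡ L (c + u) l
        cases zero                   = solve 1 (λ u → :1 :+ u :* :0 := :1) refl u
        cases (suc zero)             = solve 2 (λ c u → c :+ u :* :1 := c :+ u) refl c u
        cases (suc (suc zero))       = solve 1 (λ u → :0 :+ u :* :0 := :0) refl u
        cases (suc (suc (suc zero))) = solve 1 (λ u → :1 :+ u :* :0 := :1) refl u
      chart-point : ∀ u i → conj κ f (L u) i ≡ point (chart u) i
      chart-point u i = trans (conj-cong κ f (shear-point u) i) (sandwich-entries f (proj₁ A) (proj₁ C) (proj₁ (shear u)) i)
      everywhere : ∀ c → E₀.eval (point (chart c)) f ≡ 0#
      everywhere c = trans (E₀.eval-cong (λ i → sym (chart-point c i)) f) (trans (sym (eval-hom (Taylor.coefficient-0 baseAlg) (lin 0# (conj κ f (L c)) (conj κ f e₁₂)) f))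
        (line-vanishes (conj κ f (L c)) (conj κ f e₁₂) f (λ u → good (c + u))
          (≤-trans enough (≤-reflexive (sym (∑-reindex finite finite (c +_) (λ u → u - c) (λ u → solve 2 (λ c u → (c :+ u) :- c := u) refl c u) (λ u → solve 2 (λ c u → c :+ (u :- c) := u) refl c u) (λ u → 𝟙 (good u))))))
          (λ u h → trans (E₀.eval-cong (λ i → trans (sym (conj-lin κ f (L c) e₁₂ u i)) (trans (conj-cong κ f (translate c u) i) (chart-point (c + u) i))) f) (zeros (c + u) h)) 0))

  -- Vanishing at a + 1 points of a line implies vanishing on it, so there are |L|·(a + 1)
  -- conditions against (a + 1)(a + 2)(a + 3)/6 coefficients, and the factor a + 1 cancels.
  nonzero-form : ∀ (L : Line → Bool) a → a < p → 6 ℕ.* Lineᶠ.count L < (a ℕ.+ 2) ℕ.* (a ℕ.+ 3) →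
    ∃ λ (f : Form 4 a) → ¬ IsZero f × (∀ l → L l ≡ true → Vanishes f (proj₁ l) (proj₂ l))
  nonzero-form L a a<p few = sub f g , (λ z → f≢g (sub-zero f g z)) , λ l hl → vanishes-on-line (sub f g) l good (≤-reflexive (sym size)) λ u hu → E₀.eval-sub (point (line-point l u)) f g (same l u hl hu)
    where
    opaque
      sampled : ∃ λ Q → (∀ u → Q u ≡ true → true ≡ true) × Fᶠ.count Q ≡ suc a
      sampled = subset-of-size finite (p ℕ.∸ suc a) (suc a) (λ _ → true) (trans order (sym (ℕ.m∸n+n≡m a<p)))
    good = proj₁ sampled
    size = proj₂ (proj₂ sampled)
    I = Line × F
    finite-I = finite-× finite-Line finite
    W : I → Bool
    W (l , u) = L l ∧ good u
    value : I → Form 4 a → F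
    value (l , u) f = E₀.eval (point (line-point l u)) f
    conditions : ∑ (Finite.elems finite-I) (λ i → 𝟙 (W i)) ≡ Lineᶠ.count L ℕ.* suc a
    conditions = trans (∑-product Lineᶠ.elems Fᶠ.elems _) (trans (∑-cong Lineᶠ.elems λ l → trans (∑-cong Fᶠ.elems λ u → 𝟙-∧ (L l) (good u)) (∑-*ˡ Fᶠ.elems (𝟙 (L l)) _))
      (trans (∑-*ʳ Lineᶠ.elems (Fᶠ.count good) _) (cong (Lineᶠ.count L ℕ.*_) size)))
    fewer : Lineᶠ.count L ℕ.* suc a < dimension 4 a
    fewer = ℕ.*-cancelˡ-< 6 _ _ (≤-trans (≤-trans (s≤s (≤-reflexive (solveℕ 2 (λ n a → # 6 ⊗ (n ⊗ a) ⊜ a ⊗ (# 6 ⊗ n)) refl (Lineᶠ.count L) (suc a)))) (ℕ.*-monoʳ-< (suc a) few)) (≤-reflexive (sym (trans (dimension₄ a) (solveℕ 1 (λ a → (a ⊕ # 1) ⊗ (a ⊕ # 2) ⊗ (a ⊕ # 3) ⊜ (# 1 ⊕ a) ⊗ ((a ⊕ # 2) ⊗ (a ⊕ # 3))) refl a)))))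
    opaque
      pair : ∃ λ f → ∃ λ g → (true ≡ true × true ≡ true) × ¬ (f ≡ g) × disagreements (finite-Form 4 a) finite value W (Finite.elems finite-I) f g ≡ 0
      pair = agreeing-pair (finite-Form 4 a) finite value W (Finite.elems finite-I) (λ _ → true)
        (≤-trans (s≤s (≤-reflexive (cong₂ ℕ._^_ order conditions))) (≤-trans (ℕ.^-monoʳ-< p 1<p fewer) (≤-reflexive (sym (count-forms 4 a)))))
    f = proj₁ pair
    g = proj₁ (proj₂ pair)
    f≢g = proj₁ (proj₂ (proj₂ (proj₂ pair)))
    same : ∀ l u → L l ≡ true → good u ≡ true → E₀.eval (point (line-point l u)) f ≡ E₀.eval (point (line-point l u)) g
    same l u hl hu with value (l , u) f Fᶠ.≟ value (l , u) g in eq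
    ... | yes e = e
    ... | no _ with () ← ≤-trans (≤-reflexive (sym (cong₂ (λ w d → 𝟙 w ℕ.* 𝟙 (not d)) (∧-intro hl hu) (cong does eq))))
         (≤-trans (Finite.≤∑ finite-I (l , u) (λ i → 𝟙 (W i) ℕ.* 𝟙 (not (value i f Fᶠ.== value i g)))) (≤-reflexive (proj₂ (proj₂ (proj₂ (proj₂ pair))))))

  module _ (L : Line → Bool) (K a : ℕ) (3≤K : 3 ≤ K) (a+3≤p : a ℕ.+ 3 ≤ p) (few : 6 ℕ.* Lineᶠ.count L < (a ℕ.+ 2) ℕ.* (a ℕ.+ 3)) where
    private
      n = Lineᶠ.count L
      rich : SL → Bool
      rich g = 4 ℕ.* K ≤ᵇ lines-at L g
      instance
        K≢0 : ℕ.NonZero K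
        K≢0 = >-nonZero (≤-trans (s≤s z≤n) 3≤K)
      -- β is m/K rounded up or slightly more: lines that keep more than β points satisfy (β + 1)·K
      -- ≥ m + K, the condition on the degree in `RichJoints`.
      m β : ℕ
      m = 2 ℕ.* a ℕ.+ 2
      β = suc (m / K)
      β≤ : β ℕ.* K ≤ K ℕ.+ m
      β≤ = ℕ.+-monoʳ-≤ K (≤-trans (ℕ.m≤n+m (m / K ℕ.* K) (m % K)) (≤-reflexive (sym (m≡m%n+[m/n]*n m K))))
      ≤β : m ≤ β ℕ.* K
      ≤β = ≤-trans (≤-reflexive (m≡m%n+[m/n]*n m K)) (ℕ.+-monoˡ-≤ (m / K ℕ.* K) (ℕ.<⇒≤ (m%n<n m K)))
      -- A stable remainder would be a rich configuration, on whose lines a nonzero form of degree a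
      -- vanishes.
      unstable : ∀ J' L' → (∃ λ g → J' g ≡ true) → (∀ l → L' l ≡ true → L l ≡ true) → ¬ Stable _∈_ (2 ℕ.* K ℕ.+ 3) β J' L'
      unstable J' L' (g , jg) sub (rich-points , rich-lines) = go (nonzero-form L a (≤-trans (≤-reflexive (ℕ.+-comm 1 a)) (≤-trans (ℕ.+-monoʳ-≤ a (s≤s z≤n)) a+3≤p)) few)
        where
        go : ¬ (∃ λ (f : Form 4 a) → ¬ IsZero f × (∀ l → L l ≡ true → Vanishes f (proj₁ l) (proj₂ l)))
        go (f , f≢0 , vanishes) = f≢0 (RichJoints.vanishing-form J' (λ x y → L' (x , y)) (suc β) K a
          (λ x y h → rich-lines (x , y) h)
          (λ g h → ≤-trans (≤-reflexive (ℕ.+-suc (2 ℕ.* K) 3)) (≤-trans (rich-points g h) (≤-reflexive (lines-at-deg L' g))))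
          (≤-trans (≤-trans (≤-reflexive (ℕ.+-comm m K)) (ℕ.+-monoʳ-≤ K ≤β)) ≤-refl) a+3≤p ≤-refl f (λ x y h → vanishes (x , y) (sub (x , y) h)) g jg)
      few-edges : edges _∈_ rich L ≤ (2 ℕ.* K ℕ.+ 3) ℕ.* count rich ℕ.+ β ℕ.* n
      few-edges = go (prune _∈_ (2 ℕ.* K ℕ.+ 3) β (suc (count rich ℕ.+ n)) rich L ≤-refl)
        where
        go : _ → _
        go (inj₁ (J' , L' , r , sub , st)) = ⊥-elim (unstable J' L' r sub st)
        go (inj₂ e) = e
      many-edges : count rich ℕ.* (4 ℕ.* K) ≤ edges _∈_ rich L
      many-edges = ≤-trans (≤-reflexive (sym (∑-*ʳ elems (4 ℕ.* K) _))) (∑-mono elems λ g → 𝟙*-≤ (rich g) λ h → ≤-trans (≤ᵇ-true h) (≤-reflexive (sym (lines-at-deg L g))))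
      count-rich : count rich ℕ.* K ≤ β ℕ.* n
      count-rich = ℕ.+-cancelˡ-≤ ((2 ℕ.* K ℕ.+ 3) ℕ.* count rich) _ _ (≤-trans (≤-trans (≤-reflexive (solveℕ 2 (λ k j → (# 2 ⊗ k ⊕ # 3) ⊗ j ⊕ j ⊗ k ⊜ j ⊗ (# 3 ⊗ k ⊕ # 3)) refl K (count rich)))
        (ℕ.*-monoʳ-≤ (count rich) (≤-trans (ℕ.+-monoʳ-≤ (3 ℕ.* K) 3≤K) (≤-reflexive (solveℕ 1 (λ k → # 3 ⊗ k ⊕ k ⊜ # 4 ⊗ k) refl K))))) (≤-trans many-edges few-edges))
    -- Of the 4K incidences at each rich point, deleted points account for 2K + 3. The other 2K - 3,
    -- at least K as K is at least 3, are paid for by deleted lines, at most β for each line.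
    joints : count (λ g → 4 ℕ.* K ≤ᵇ lines-at L g) ℕ.* (K ℕ.* K) ≤ Lineᶠ.count L ℕ.* (2 ℕ.* a ℕ.+ 2 ℕ.+ K)
    joints = ≤-trans (≤-reflexive (sym (ℕ.*-assoc (count rich) K K))) (≤-trans (ℕ.*-monoˡ-≤ K count-rich)
      (≤-trans (≤-reflexive (solveℕ 3 (λ b n k → b ⊗ n ⊗ k ⊜ n ⊗ (b ⊗ k)) refl β n K)) (ℕ.*-monoʳ-≤ n (≤-trans β≤ (≤-reflexive (ℕ.+-comm K m))))))

 -- From the image of E to weighted incidences

 module Incidences where
  open 𝓕
  open SL2 hiding (vec)
  open Charts using (module Dirᶠ; module Ptᶠ; act-inv; act-inv′)
  open Joints using (Line; module Lineᶠ)
  open 𝓖 using (_∙_; _⁻¹; elems; ∑ᴬ; count; count-mono; quotients; ∑-quotients)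
  open import Data.Maybe using (just; nothing)
  open Sums
  open Pigeonhole

  origin : F × F
  origin = 0# , 0#

  infixr 8 _⋆_
  _⋆_ : F → F × F → F × F
  t ⋆ (x , y) = t * x , t * y

  ⋆-injective : ∀ {t} → ¬ (t ≡ 0#) → ∀ {v w} → t ⋆ v ≡ t ⋆ w → v ≡ w
  ⋆-injective t≢0 e = cong₂ _,_ (*-cancelˡ t≢0 (cong proj₁ e)) (*-cancelˡ t≢0 (cong proj₂ e))

  0⋆ : ∀ v → 0# ⋆ v ≡ origin
  0⋆ (x , y) = cong₂ _,_ (zeroˡ x) (zeroˡ y)

  act-⋆ : ∀ g t v → act g (t ⋆ v) ≡ t ⋆ act g v
  act-⋆ ((a , b , c , d) , _) t (x , y) = cong₂ _,_ (en a b) (en c d)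
    where
    en : ∀ a b → a * (t * x) + b * (t * y) ≡ t * (a * x + b * y)
    en a b = solve 5 (λ a b t x y → a :* (t :* x) :+ b :* (t :* y) := t :* (a :* x :+ b :* y)) refl a b t x y

  unit-coordinate : ∀ x t t' → t ⋆ ⟨ x ⟩ ≡ t' ⋆ ⟨ x ⟩ → t ≡ t'
  unit-coordinate nothing t t' e = trans (sym (*-identityʳ t)) (trans (cong proj₂ e) (*-identityʳ t'))
  unit-coordinate (just s) t t' e = trans (sym (*-identityʳ t)) (trans (cong proj₁ e) (*-identityʳ t'))

  private
    nonzero-intro : ∀ {z} → ¬ (z ≡ origin) → nonzero z
    nonzero-intro h (e₁ , e₂) = h (cong₂ _,_ e₁ e₂)

  polar : ∀ z → Dec (z ≡ origin) → Dir × F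
  polar z (yes _) = nothing , 0#
  polar z (no h)  = let s , l , _ = find-direction z (nonzero-intro h) in s , l

  polar-≡ : ∀ z d → ¬ (z ≡ origin) → z ≡ proj₂ (polar z d) ⋆ ⟨ proj₁ (polar z d) ⟩
  polar-≡ z (yes e) h = ⊥-elim (h e)
  polar-≡ z (no h) _  = proj₂ (proj₂ (proj₂ (find-direction z (nonzero-intro h))))

  module _ (P : F × F → Bool) (P0 : P origin ≡ false) where
    private
      member≢0 : ∀ {z} → P z ≡ true → ¬ (z ≡ origin)
      member≢0 h refl = true≢false h P0
      scalar≢0 : ∀ {t v} → P (t ⋆ v) ≡ true → ¬ (t ≡ 0#)
      scalar≢0 {v = v} h refl = member≢0 h (0⋆ v)
    count-polar-≤ : Ptᶠ.count P ≤ Dirᶠ.∑ᴬ (λ x → Fᶠ.count (λ t → P (t ⋆ ⟨ x ⟩)))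
    count-polar-≤ = ≤-trans (count-injective finite-Pt (finite-× finite-Dir finite) φ P (λ { (x , t) → P (t ⋆ ⟨ x ⟩) })
        (λ z h → trans (cong P (sym (φ-≡ z h))) h) (λ z z' h h' e → trans (φ-≡ z h) (trans (cong (λ { (x , t) → t ⋆ ⟨ x ⟩ }) e) (sym (φ-≡ z' h')))))
      (≤-reflexive (∑-product Dirᶠ.elems Fᶠ.elems _))
      where
      φ : F × F → Dir × F
      φ z = polar z (z Ptᶠ.≟ origin)
      φ-≡ : ∀ z → P z ≡ true → z ≡ proj₂ (φ z) ⋆ ⟨ proj₁ (φ z) ⟩
      φ-≡ z h = polar-≡ z (z Ptᶠ.≟ origin) (member≢0 h)
    count-polar-≥ : Dirᶠ.∑ᴬ (λ x → Fᶠ.count (λ t → P (t ⋆ ⟨ x ⟩))) ≤ Ptᶠ.count P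
    count-polar-≥ = ≤-trans (≤-reflexive (sym (∑-product Dirᶠ.elems Fᶠ.elems _)))
      (count-injective (finite-× finite-Dir finite) finite-Pt (λ { (x , t) → t ⋆ ⟨ x ⟩ }) (λ { (x , t) → P (t ⋆ ⟨ x ⟩) }) P (λ _ h → h)
        λ { (x , t) (x' , t') h h' e → unique x x' t t' (scalar≢0 h) (scalar≢0 h') e })
      where
      direction : ∀ x x' t t' → ¬ (t ≡ 0#) → ¬ (t' ≡ 0#) → t ⋆ ⟨ x ⟩ ≡ t' ⋆ ⟨ x' ⟩ → x ≡ x'
      direction x x' t t' ht ht' e with Dirᶠ._≟_ x x'
      ... | yes q = q
      ... | no ne = ⊥-elim (dir-area x x' ne (*-cancel0 (*-nonzero ht ht')
            (trans (trans (rearrange t t' ⟨ x ⟩ ⟨ x' ⟩) (cong (λ v → area v (t' ⋆ ⟨ x' ⟩)) e)) (self (t' ⋆ ⟨ x' ⟩)))))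
        where
        rearrange : ∀ t t' v w → t * t' * area v w ≡ area (t ⋆ v) (t' ⋆ w)
        rearrange t t' (a , b) (c , d) = solve 6 (λ t t' a b c d → t :* t' :* (a :* d :- b :* c) := t :* a :* (t' :* d) :- t :* b :* (t' :* c)) refl t t' a b c d
        self : ∀ v → area v v ≡ 0#
        self (a , b) = solve 2 (λ a b → a :* b :- b :* a := :0) refl a b
      unique : ∀ x x' t t' → ¬ (t ≡ 0#) → ¬ (t' ≡ 0#) → t ⋆ ⟨ x ⟩ ≡ t' ⋆ ⟨ x' ⟩ → (x , t) ≡ (x' , t')
      unique x x' t t' ht ht' e with direction x x' t t' ht ht' e
      ... | refl = cong (x ,_) (unit-coordinate x t t' e)

  module Weights (E : F × F → Bool) (E0 : E origin ≡ false) where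
    radius : Dir → ℕ
    radius x = Fᶠ.count (λ t → E (t ⋆ ⟨ x ⟩))
    -- The number of points of E in direction x that are sent into E by an element with g ⟨ x ⟩ = y.
    -- It depends on g only through y, and so belongs to the line (x, y).
    weight : Line → ℕ
    weight (x , y) = Fᶠ.count (λ t → E (t ⋆ ⟨ x ⟩) ∧ E (t ⋆ y))
    weight≤radius : ∀ x y → weight (x , y) ≤ radius x
    weight≤radius x y = Fᶠ.count-mono λ t h → proj₁ (∧-true h)
    stays : SL → ℕ
    stays g = Ptᶠ.count (λ z → E z ∧ E (act g z))
    stays≤ : ∀ g → stays g ≤ Dirᶠ.∑ᴬ (λ x → weight (x , act g ⟨ x ⟩))
    stays≤ g = ≤-trans (count-polar-≤ (λ z → E z ∧ E (act g z)) (cong (_∧ E (act g origin)) E0))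
      (≤-reflexive (∑-cong Dirᶠ.elems λ x → Fᶠ.count-cong λ t → cong (λ v → E (t ⋆ ⟨ x ⟩) ∧ E v) (act-⋆ g t ⟨ x ⟩)))
    -- A contribution to a weight is a pair of points t·x and t·y of E. The first determines x and
    -- t, and then y is determined by the second, because t is not zero.
    total-weight : Lineᶠ.∑ᴬ weight ≤ Ptᶠ.count E ℕ.* Ptᶠ.count E
    total-weight = begin
      Lineᶠ.∑ᴬ weight ≡⟨ ∑-product Dirᶠ.elems Ptᶠ.elems _ ⟩
      Dirᶠ.∑ᴬ (λ x → Ptᶠ.∑ᴬ (λ y → weight (x , y))) ≡⟨ ∑-cong Dirᶠ.elems (λ x → trans (∑-swap Ptᶠ.elems Fᶠ.elems _)
           (∑-cong Fᶠ.elems λ t → trans (∑-cong Ptᶠ.elems λ y → 𝟙-∧ (E (t ⋆ ⟨ x ⟩)) (E (t ⋆ y))) (∑-*ˡ Ptᶠ.elems (𝟙 (E (t ⋆ ⟨ x ⟩))) _))) ⟩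
      Dirᶠ.∑ᴬ (λ x → Fᶠ.∑ᴬ (λ t → 𝟙 (E (t ⋆ ⟨ x ⟩)) ℕ.* Ptᶠ.count (λ y → E (t ⋆ y)))) ≤⟨ ∑-mono Dirᶠ.elems (λ x → ∑-mono Fᶠ.elems λ t → bound x t (E (t ⋆ ⟨ x ⟩)) refl) ⟩
      Dirᶠ.∑ᴬ (λ x → Fᶠ.∑ᴬ (λ t → 𝟙 (E (t ⋆ ⟨ x ⟩)) ℕ.* Ptᶠ.count E)) ≡⟨ trans (∑-cong Dirᶠ.elems λ x → ∑-*ʳ Fᶠ.elems (Ptᶠ.count E) _) (∑-*ʳ Dirᶠ.elems (Ptᶠ.count E) radius) ⟩
      Dirᶠ.∑ᴬ radius ℕ.* Ptᶠ.count E ≤⟨ ℕ.*-monoˡ-≤ (Ptᶠ.count E) (count-polar-≥ E E0) ⟩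
      Ptᶠ.count E ℕ.* Ptᶠ.count E ∎
      where
      open ℕ.≤-Reasoning
      bound : ∀ x t b → E (t ⋆ ⟨ x ⟩) ≡ b → 𝟙 b ℕ.* Ptᶠ.count (λ y → E (t ⋆ y)) ≤ 𝟙 b ℕ.* Ptᶠ.count E
      bound x t false _ = z≤n
      bound x t true  h = ℕ.+-monoˡ-≤ 0 (count-injective finite-Pt finite-Pt (t ⋆_) (λ y → E (t ⋆ y)) E (λ _ h → h)
        λ _ _ _ _ e → ⋆-injective (λ { refl → true≢false h (trans (cong E (0⋆ ⟨ x ⟩)) E0) }) e)
    module _ (S : SL → Bool) (I : F × F → Bool) (image : ∀ g x → S g ≡ true → E x ≡ true → I (act g x) ≡ true) where
      private
        hits : F × F → ℕ
        hits y = ∑ᴬ (λ g → 𝟙 (S g) ℕ.* 𝟙 (E (act (g ⁻¹) y)))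
        reindex : ∀ g (f : F × F → ℕ) → Ptᶠ.∑ᴬ (λ y → f (act (g ⁻¹) y)) ≡ Ptᶠ.∑ᴬ f
        reindex g = ∑-reindex finite-Pt finite-Pt (act (g ⁻¹)) (act g) (act-inv′ g) (act-inv g)
        total-hits : Ptᶠ.∑ᴬ hits ≡ count S ℕ.* Ptᶠ.count E
        total-hits = trans (∑-swap Ptᶠ.elems elems _) (trans (∑-cong elems λ g → trans (∑-*ˡ Ptᶠ.elems (𝟙 (S g)) _) (cong (𝟙 (S g) ℕ.*_) (reindex g (λ y → 𝟙 (E y))))) (∑-*ʳ elems (Ptᶠ.count E) _))
        supported : ∀ y → hits y ≡ 𝟙 (I y) ℕ.* hits y
        supported y = trans (∑-cong elems λ g → cell g (S g) refl (E (act (g ⁻¹) y)) refl) (∑-*ˡ elems (𝟙 (I y)) _)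
          where
          cell : ∀ g s → S g ≡ s → ∀ e → E (act (g ⁻¹) y) ≡ e → 𝟙 s ℕ.* 𝟙 e ≡ 𝟙 (I y) ℕ.* (𝟙 s ℕ.* 𝟙 e)
          cell g false _ e     _ = sym (ℕ.*-zeroʳ (𝟙 (I y)))
          cell g true  _ false _ = sym (ℕ.*-zeroʳ (𝟙 (I y)))
          cell g true  hs true he = cong (λ b → 𝟙 b ℕ.* 1) (sym (trans (cong I (sym (act-inv′ g y))) (image g _ hs he)))
        square-hits : Ptᶠ.∑ᴬ (λ y → hits y ℕ.* hits y) ≡ ∑ᴬ (λ g → quotients S g ℕ.* stays g)
        square-hits = begin
          Ptᶠ.∑ᴬ (λ y → hits y ℕ.* hits y) ≡⟨ ∑-cong Ptᶠ.elems (λ y → ∑-* elems elems _ _) ⟩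
          Ptᶠ.∑ᴬ (λ y → ∑ᴬ (λ h → ∑ᴬ (λ g → 𝟙 (S h) ℕ.* 𝟙 (E (act (h ⁻¹) y)) ℕ.* (𝟙 (S g) ℕ.* 𝟙 (E (act (g ⁻¹) y)))))) ≡⟨ trans (∑-swap Ptᶠ.elems elems _) (∑-cong elems λ h → ∑-swap Ptᶠ.elems elems _) ⟩
          ∑ᴬ (λ h → ∑ᴬ (λ g → Ptᶠ.∑ᴬ (λ y → 𝟙 (S h) ℕ.* 𝟙 (E (act (h ⁻¹) y)) ℕ.* (𝟙 (S g) ℕ.* 𝟙 (E (act (g ⁻¹) y)))))) ≡⟨ ∑-cong elems (λ h → ∑-cong elems λ g → pair h g) ⟩
          ∑ᴬ (λ h → ∑ᴬ (λ g → 𝟙 (S h) ℕ.* 𝟙 (S g) ℕ.* stays (h ⁻¹ ∙ g))) ≡⟨ ∑-quotients S stays ⟩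
          ∑ᴬ (λ g → quotients S g ℕ.* stays g) ∎
          where
          open ≡-Reasoning
          open import Data.Nat.Solver using (module +-*-Solver)
          pair : ∀ h g → Ptᶠ.∑ᴬ (λ y → 𝟙 (S h) ℕ.* 𝟙 (E (act (h ⁻¹) y)) ℕ.* (𝟙 (S g) ℕ.* 𝟙 (E (act (g ⁻¹) y)))) ≡ 𝟙 (S h) ℕ.* 𝟙 (S g) ℕ.* stays (h ⁻¹ ∙ g)
          pair h g = trans (∑-cong Ptᶠ.elems λ y → shuffle (𝟙 (S h)) (𝟙 (E (act (h ⁻¹) y))) (𝟙 (S g)) (𝟙 (E (act (g ⁻¹) y))))
            (trans (∑-*ˡ Ptᶠ.elems (𝟙 (S h) ℕ.* 𝟙 (S g)) _) (cong (𝟙 (S h) ℕ.* 𝟙 (S g) ℕ.*_)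
              (trans (sym (∑-reindex finite-Pt finite-Pt (act g) (act (g ⁻¹)) (act-inv g) (act-inv′ g) _))
                (∑-cong Ptᶠ.elems λ z → trans (cong₂ (λ v w → 𝟙 (E v) ℕ.* 𝟙 (E w)) (act-inv g z) (sym (act-∙ (h ⁻¹) g z))) (sym (𝟙-∧ (E z) _))))))
            where
            shuffle : ∀ a b c d → a ℕ.* b ℕ.* (c ℕ.* d) ≡ a ℕ.* c ℕ.* (d ℕ.* b)
            shuffle = +-*-Solver.solve 4 (λ a b c d → a +-*-Solver.:* b +-*-Solver.:* (c +-*-Solver.:* d) +-*-Solver.:= a +-*-Solver.:* c +-*-Solver.:* (d +-*-Solver.:* b)) refl
      image-bound : (count S ℕ.* Ptᶠ.count E) ℕ.* (count S ℕ.* Ptᶠ.count E) ≤ Ptᶠ.count I ℕ.* ∑ᴬ (λ g → quotients S g ℕ.* stays g)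
      image-bound = ≤-trans (≤-reflexive (cong (λ n → n ℕ.* n) (trans (sym total-hits) (∑-cong Ptᶠ.elems supported))))
        (≤-trans (cauchy-schwarz Ptᶠ.elems (λ y → 𝟙 (I y)) hits) (≤-reflexive (cong₂ ℕ._*_ (∑-cong Ptᶠ.elems λ y → 𝟙² (I y)) square-hits)))

 -- Combining low energy with the joints bound

 module Core where
  open 𝓕 hiding (sub-zero)
  open SL2 hiding (vec; q)
  open Charts using (module Dirᶠ; module Ptᶠ)
  open Joints using (Line; module Lineᶠ; lines-at; joints)
  open Incidences
  open 𝓖 using (elems; ∑ᴬ; count; count-0; quotients; energy; ∑-quotients-total)
  open import Data.List using (downFrom)
  open import Data.Nat using (_≤ᵇ_; _^_)
  open Arith
  open Sums
  open Pigeonhole using (count-∃)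
  open Dyadic

  count-Dir : ∑ Dirᶠ.elems (λ _ → 1) ≡ suc p
  count-Dir = cong suc (trans (∑-map _ Fᶠ.elems _) order)

  module _ (E : F × F → Bool) (E0 : E origin ≡ false) (S : SL → Bool) (I : F × F → Bool)
    (image : ∀ g x → S g ≡ true → E x ≡ true → I (act g x) ≡ true) (k₁ k₂ J K : ℕ)
    (lines-contain : ∀ x → Weights.radius E E0 x ≤ k₁)
    (directions : Dirᶠ.count (λ x → 1 ≤ᵇ Weights.radius E E0 x) ≤ k₂)
    (p<2^J : p < 2 ^ J) (12≤p : 12 ≤ p) (size : 3 ℕ.* Ptᶠ.count E ≤ p ℕ.+ 2)
    (0<N : 0 < count S) (0<e : 0 < Ptᶠ.count E) (low-energy : K ℕ.* energy S ≤ count S ℕ.* count S ℕ.* count S) where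
    open Weights E E0
    private
      N = count S
      e = Ptᶠ.count E
      Y = Ptᶠ.count I
      q = quotients S
      -- Classes are cumulative: only the lower bound on the weight is used, both in 2^j·n ≤ e² and
      -- in 2^j ≤ k₁.
      heavy : ℕ → Line → Bool
      heavy j l = 2 ^ j ≤ᵇ weight l
      weight<2^J : ∀ l → weight l < 2 ^ J
      weight<2^J l = ≤-trans (s≤s (≤-trans (∑-mono Fᶠ.elems λ t → 𝟙≤1 _) (≤-reflexive order))) p<2^J
      stays≤classes : ∀ g → stays g ≤ ∑ (downFrom J) (λ j → 2 ^ j ℕ.* lines-at (heavy j) g)
      stays≤classes g = ≤-trans (stays≤ g) (≤-trans (∑-mono Dirᶠ.elems λ x → dyadic J (weight (x , act g ⟨ x ⟩)) (weight<2^J (x , act g ⟨ x ⟩)))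
        (≤-reflexive (trans (∑-swap Dirᶠ.elems (downFrom J) _) (∑-cong (downFrom J) λ j → ∑-*ˡ Dirᶠ.elems (2 ^ j) _))))
      class-sum : ℕ → ℕ
      class-sum j = ∑ᴬ (λ g → q g ℕ.* lines-at (heavy j) g)
      classes : (N ℕ.* e) ℕ.* (N ℕ.* e) ≤ ∑ (downFrom J) (λ j → Y ℕ.* (2 ^ j ℕ.* class-sum j))
      classes = begin
        (N ℕ.* e) ℕ.* (N ℕ.* e) ≤⟨ image-bound S I image ⟩
        Y ℕ.* ∑ᴬ (λ g → q g ℕ.* stays g) ≤⟨ ℕ.*-monoʳ-≤ Y (∑-mono elems λ g → ℕ.*-monoʳ-≤ (q g) (stays≤classes g)) ⟩
        Y ℕ.* ∑ᴬ (λ g → q g ℕ.* ∑ (downFrom J) (λ j → 2 ^ j ℕ.* lines-at (heavy j) g)) ≡⟨ cong (Y ℕ.*_) (trans (∑-cong elems λ g → sym (∑-*ˡ (downFrom J) (q g) _)) (∑-swap elems (downFrom J) _)) ⟩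
        Y ℕ.* ∑ (downFrom J) (λ j → ∑ᴬ (λ g → q g ℕ.* (2 ^ j ℕ.* lines-at (heavy j) g))) ≡⟨ cong (Y ℕ.*_) (∑-cong (downFrom J) λ j →
            trans (∑-cong elems λ g → solveℕ 3 (λ a b c → a ⊗ (b ⊗ c) ⊜ b ⊗ (a ⊗ c)) refl (q g) (2 ^ j) (lines-at (heavy j) g)) (∑-*ˡ elems (2 ^ j) _)) ⟩
        Y ℕ.* ∑ (downFrom J) (λ j → 2 ^ j ℕ.* class-sum j) ≡⟨ ∑-*ˡ (downFrom J) Y _ ⟨
        ∑ (downFrom J) (λ j → Y ℕ.* (2 ^ j ℕ.* class-sum j)) ∎
        where open ℕ.≤-Reasoning
      Ne²>0 : 0 < (N ℕ.* e) ℕ.* (N ℕ.* e)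
      Ne²>0 = ℕ.*-mono-< (ℕ.*-mono-< 0<N 0<e) (ℕ.*-mono-< 0<N 0<e)
      module Class (j : ℕ) (dominant : (N ℕ.* e) ℕ.* (N ℕ.* e) ≤ J ℕ.* (Y ℕ.* (2 ^ j ℕ.* class-sum j))) where
        L : Line → Bool
        L = heavy j
        ρ : SL → ℕ
        ρ = lines-at L
        n = Lineᶠ.count L
        2^j>0 : 0 < 2 ^ j
        2^j>0 = ℕ.m^n>0 2 j
        member : ∀ l → L l ≡ true → 2 ^ j ≤ weight l
        member l h = ≤ᵇ-true h
        2^j*n≤ : 2 ^ j ℕ.* n ≤ e ℕ.* e
        2^j*n≤ = ≤-trans (≤-trans (≤-reflexive (trans (ℕ.*-comm (2 ^ j) n) (sym (∑-*ʳ Lineᶠ.elems (2 ^ j) _)))) (∑-mono Lineᶠ.elems λ l → ≤-trans (𝟙*-≤ (L l) (member l)) (𝟙*≤ (L l) (weight l)))) total-weight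
        n≤e² : n ≤ e ℕ.* e
        n≤e² = ≤-trans (≤-trans (≤-reflexive (sym (ℕ.*-identityˡ n))) (ℕ.*-monoˡ-≤ n 2^j>0)) 2^j*n≤
        ρ≤k₂ : ∀ g → ρ g ≤ k₂
        ρ≤k₂ g = ≤-trans (Dirᶠ.count-mono λ x h → ≤ᵇ-intro (≤-trans 2^j>0 (≤-trans (member (x , act g ⟨ x ⟩) h) (weight≤radius x (act g ⟨ x ⟩))))) directions
        class-sum>0 : 0 < class-sum j
        class-sum>0 = positive J Y (2 ^ j) (class-sum j) (≤-trans Ne²>0 dominant)
          where
          positive : ∀ a b c d → 0 < a ℕ.* (b ℕ.* (c ℕ.* d)) → 0 < d
          positive a b c (suc d) _ = s≤s z≤n
          positive a b c zero h = ⊥-elim (ℕ.<-irrefl refl (≤-trans h (≤-reflexive (solveℕ 3 (λ a b c → a ⊗ (b ⊗ (c ⊗ # 0)) ⊜ # 0) refl a b c))))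
        opaque
          line : ∃ λ l → L l ≡ true
          line with ∑-exists elems (λ g → q g ℕ.* ρ g) (λ _ → 0) (≤-trans (s≤s (≤-reflexive (∑-0 elems))) class-sum>0)
          ... | g , lt with count-∃ finite-Dir (factor (q g) (ρ g) lt)
            where
            factor : ∀ a b → 0 < a ℕ.* b → 0 < b
            factor a (suc b) _ = s≤s z≤n
            factor a zero h = ⊥-elim (ℕ.<-irrefl refl (≤-trans h (≤-reflexive (ℕ.*-zeroʳ a))))
          ...   | x , h = (x , act g ⟨ x ⟩) , h
        2^j≤k₁ : 2 ^ j ≤ k₁
        2^j≤k₁ = ≤-trans (member (proj₁ line) (proj₂ line)) (≤-trans (weight≤radius (proj₁ (proj₁ line)) (proj₂ (proj₁ line))) (lines-contain (proj₁ (proj₁ line))))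
        0<n : 0 < n
        0<n = ≤-trans (1≤𝟙 (proj₂ line)) (Lineᶠ.≤∑ (proj₁ line) (λ l → 𝟙 (L l)))
        p-3+3 : p ℕ.∸ 3 ℕ.+ 3 ≡ p
        p-3+3 = ℕ.m∸n+n≡m (≤-trans (s≤s (s≤s (s≤s z≤n))) 12≤p)
        few-lines : 6 ℕ.* n < (p ℕ.∸ 3 ℕ.+ 2) ℕ.* (p ℕ.∸ 3 ℕ.+ 3)
        few-lines = conditions-bound n e (p ℕ.∸ 3) n≤e² (≤-trans size (≤-reflexive (trans (cong (ℕ._+ 2) (sym p-3+3)) (ℕ.+-assoc (p ℕ.∸ 3) 3 2))))
          (ℕ.+-cancelʳ-≤ 3 9 (p ℕ.∸ 3) (≤-trans 12≤p (≤-reflexive (sym p-3+3))))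
        opaque
          chosen : ∃ λ a → a ≤ p ℕ.∸ 3 × 6 ℕ.* n < (a ℕ.+ 2) ℕ.* (a ℕ.+ 3) × (2 ℕ.* a ℕ.+ 2) ℕ.* (2 ℕ.* a ℕ.+ 2) ≤ 24 ℕ.* n
          chosen = degree n (p ℕ.∸ 3) 0<n few-lines
        a = proj₁ chosen
        a+3≤p : a ℕ.+ 3 ≤ p
        a+3≤p = ≤-trans (ℕ.+-monoˡ-≤ 3 (proj₁ (proj₂ chosen))) (≤-reflexive p-3+3)
        rich : SL → ℕ
        rich g = large-part (ρ g)
        B T : ℕ
        B = ∑ᴬ (λ g → q g ℕ.* rich g)
        T = ∑ᴬ (λ g → rich g ℕ.* rich g)
        B²≤ : B ℕ.* B ≤ energy S ℕ.* T
        B²≤ = cauchy-schwarz elems q rich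
        class-sum≤ : class-sum j ≤ 12 ℕ.* (N ℕ.* N) ℕ.+ B
        class-sum≤ = ≤-trans (∑-mono elems λ g → ≤-trans (ℕ.*-monoʳ-≤ (q g) (large-part-split (ρ g))) (≤-reflexive (ℕ.*-distribˡ-+ (q g) 12 (rich g))))
          (≤-reflexive (trans (∑-+ elems _ _) (cong (ℕ._+ B) (trans (∑-*ʳ elems 12 q) (trans (ℕ.*-comm (∑ᴬ q) 12) (cong (12 ℕ.*_) (∑-quotients-total S)))))))
        ρ<12·2^J : ∀ g → ρ g < 12 ℕ.* 2 ^ J
        ρ<12·2^J g = ≤-trans (s≤s (≤-trans (∑-mono Dirᶠ.elems λ x → 𝟙≤1 _) (≤-reflexive count-Dir))) (≤-trans (s≤s p<2^J)
          (≤-trans (ℕ.+-monoˡ-≤ (2 ^ J) (ℕ.m^n>0 2 J)) (≤-trans (ℕ.m≤m+n (2 ^ J ℕ.+ 2 ^ J) (10 ℕ.* 2 ^ J)) (≤-reflexive (solveℕ 1 (λ x → x ⊕ x ⊕ # 10 ⊗ x ⊜ # 12 ⊗ x) refl (2 ^ J))))))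
        scale-of : ℕ → ℕ
        scale-of i = 3 ℕ.* 2 ^ i
        -- If no g lies on 4·K lines the class is empty. Otherwise such a g shows that K is at most
        -- k₂, since g lies on at most one line for each direction of E; this brings k₂ into the
        -- bound.
        scale-bound : ∀ i → count (λ g → 4 ℕ.* scale-of i ≤ᵇ ρ g) ℕ.* (64 ℕ.* (scale-of i ℕ.* scale-of i)) ≤ 64 ℕ.* (n ℕ.* (2 ℕ.* a ℕ.+ 2 ℕ.+ k₂))
        scale-bound i with FiniteGroup.search SL₂ (λ g → 4 ℕ.* scale-of i ≤ᵇ ρ g)
        ... | inj₂ none = ≤-trans (≤-reflexive (cong (ℕ._* (64 ℕ.* (scale-of i ℕ.* scale-of i))) (count-0 none))) z≤n
        ... | inj₁ (g , h) = ≤-trans (≤-reflexive (solveℕ 2 (λ c s → c ⊗ (# 64 ⊗ s) ⊜ # 64 ⊗ (c ⊗ s)) refl (count (λ g → 4 ℕ.* scale-of i ≤ᵇ ρ g)) (scale-of i ℕ.* scale-of i)))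
            (ℕ.*-monoʳ-≤ 64 (≤-trans (joints L (scale-of i) a (ℕ.*-monoʳ-≤ 3 (ℕ.m^n>0 2 i)) a+3≤p (proj₁ (proj₂ (proj₂ chosen))))
              (ℕ.*-monoʳ-≤ n (ℕ.+-monoʳ-≤ (2 ℕ.* a ℕ.+ 2) (≤-trans (ℕ.m≤m+n (scale-of i) _) (≤-trans (≤ᵇ-true h) (ρ≤k₂ g)))))))
        T≤ : T ≤ J ℕ.* (64 ℕ.* (n ℕ.* (2 ℕ.* a ℕ.+ 2 ℕ.+ k₂)))
        T≤ = begin
          T ≤⟨ ∑-mono elems (λ g → large-part-square J (ρ g) (ρ<12·2^J g)) ⟩
          ∑ᴬ (λ g → ∑ (downFrom J) (λ i → 𝟙 (4 ℕ.* scale-of i ≤ᵇ ρ g) ℕ.* (64 ℕ.* (scale-of i ℕ.* scale-of i)))) ≡⟨ ∑-swap elems (downFrom J) _ ⟩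
          ∑ (downFrom J) (λ i → ∑ᴬ (λ g → 𝟙 (4 ℕ.* scale-of i ≤ᵇ ρ g) ℕ.* (64 ℕ.* (scale-of i ℕ.* scale-of i)))) ≡⟨ ∑-cong (downFrom J) (λ i → ∑-*ʳ elems (64 ℕ.* (scale-of i ℕ.* scale-of i)) _) ⟩
          ∑ (downFrom J) (λ i → count (λ g → 4 ℕ.* scale-of i ≤ᵇ ρ g) ℕ.* (64 ℕ.* (scale-of i ℕ.* scale-of i))) ≤⟨ ∑-mono (downFrom J) scale-bound ⟩
          ∑ (downFrom J) (λ i → 64 ℕ.* (n ℕ.* (2 ℕ.* a ℕ.+ 2 ℕ.+ k₂))) ≡⟨ sum-constant J _ ⟩
          J ℕ.* (64 ℕ.* (n ℕ.* (2 ℕ.* a ℕ.+ 2 ℕ.+ k₂))) ∎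
          where
          open ℕ.≤-Reasoning
        conclusion : _
        conclusion = trichotomy N e J Y (2 ^ j) n a k₁ k₂ B T (energy S) K 0<N 0<e 2^j*n≤ 2^j≤k₁ (proj₂ (proj₂ (proj₂ chosen)))
          (≤-trans dominant (ℕ.*-monoʳ-≤ J (ℕ.*-monoʳ-≤ Y (ℕ.*-monoʳ-≤ (2 ^ j) class-sum≤)))) B²≤ T≤ low-energy
    image-trichotomy : let D = 512 ℕ.* (J ℕ.* J ℕ.* J) ℕ.* (Ptᶠ.count I ℕ.* Ptᶠ.count I) in
      (K ℕ.* count S ℕ.* (Ptᶠ.count E ℕ.* Ptᶠ.count E) ≤ D ℕ.* (k₁ ℕ.* k₂))
      ⊎ ((K ℕ.* count S ℕ.* Ptᶠ.count E) ℕ.* (K ℕ.* count S ℕ.* Ptᶠ.count E) ≤ D ℕ.* D ℕ.* (24 ℕ.* k₁))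
      ⊎ (Ptᶠ.count E ℕ.* Ptᶠ.count E ≤ 24 ℕ.* J ℕ.* k₁ ℕ.* Ptᶠ.count I)
    image-trichotomy = go (pick J ((N ℕ.* e) ℕ.* (N ℕ.* e)) (λ j → Y ℕ.* (2 ^ j ℕ.* class-sum j)) Ne²>0 classes)
      where
      go : _ → _
      go (j , h) = Class.conclusion j h

 module WithScale (2<p : 2 < FiniteField.p 𝔽) (K : ℕ) (4≤K : 4 ≤ K) where
  private
   module 𝓒 = Calculus K 4≤K
   module 𝓑 = BSG SL2.SL₂ K 4≤K
   module 𝓠 = Popular SL2.SL₂ K 4≤K

  -- Counting in SL₂: centralisers, traces and the group order

  module SL2Count where
   open 𝓕 hiding (_==_; _≟_)
   open SL2
   open Arith
   open Sums
   open 𝓖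
   2≢0 : ¬ (1# + 1# ≡ 0#)
   2≢0 e = char 2 (s≤s z≤n) 2<p (trans (cong (1# +_) (+-identityʳ 1#)) e)
   halve : ∀ {x} → x + x ≡ 0# → x ≡ 0#
   halve {x} e = *-cancel0 2≢0 (trans (solve 1 (λ x → (:1 :+ :1) :* x := x :+ x) refl x) e)
   square-zero : ∀ {x} → x * x ≡ 0# → x ≡ 0#
   square-zero e with *-zero e
   ... | inj₁ z = z
   ... | inj₂ z = z
   vec-conj-U : ∀ g → let (δ , b , c) = vec g in vec (conjugate U g) ≡ (δ + (c + c) , (b - δ) - c , c)
   vec-conj-U ((a , b , c , d) , _) = cong₂ _,_
     (solve 4 (λ a b c d → ((:1 :* a :+ :1 :* c) :* :1 :+ (:1 :* b :+ :1 :* d) :* (:- :0)) :- ((:0 :* a :+ :1 :* c) :* (:- :1) :+ (:0 :* b :+ :1 :* d) :* :1) := (a :- d) :+ (c :+ c)) refl a b c d)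
     (cong₂ _,_ (solve 4 (λ a b c d → (:1 :* a :+ :1 :* c) :* (:- :1) :+ (:1 :* b :+ :1 :* d) :* :1 := (b :- (a :- d)) :- c) refl a b c d)
       (solve 4 (λ a b c d → (:0 :* a :+ :1 :* c) :* :1 :+ (:0 :* b :+ :1 :* d) :* (:- :0) := c) refl a b c d))
   vec-conj-V : ∀ g → let (δ , b , c) = vec g in vec (conjugate V g) ≡ (δ - (b + b) , b , (c + δ) - b)
   vec-conj-V ((a , b , c , d) , _) = cong₂ _,_
     (solve 4 (λ a b c d → ((:1 :* a :+ :0 :* c) :* :1 :+ (:1 :* b :+ :0 :* d) :* (:- :1)) :- ((:1 :* a :+ :1 :* c) :* (:- :0) :+ (:1 :* b :+ :1 :* d) :* :1) := (a :- d) :- (b :+ b)) refl a b c d)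
     (cong₂ _,_ (solve 4 (λ a b c d → (:1 :* a :+ :0 :* c) :* (:- :0) :+ (:1 :* b :+ :0 :* d) :* :1 := b) refl a b c d)
       (solve 4 (λ a b c d → (:1 :* a :+ :1 :* c) :* :1 :+ (:1 :* b :+ :1 :* d) :* (:- :1) := (c :+ (a :- d)) :- b) refl a b c d))
   not-parallel : ∀ δ b c → Par (δ + (c + c) , (b - δ) - c , c) (δ , b , c) → Par (δ - (b + b) , b , (c + δ) - b) (δ , b , c) → Zero (δ , b , c)
   not-parallel δ b c u v = δ0 δ b c b0 c0 (proj₁ u) , b0 , c0
     where
     c0 : c ≡ 0#
     c0 = square-zero (halve (trans (solve 2 (λ c δ → c :* c :+ c :* c := (δ :+ (c :+ c)) :* c :- δ :* c) refl c δ) (zero-sub (proj₁ (proj₂ u)))))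
     b0 : b ≡ 0#
     b0 = square-zero (halve (trans (solve 2 (λ b δ → b :* b :+ b :* b := δ :* b :- (δ :- (b :+ b)) :* b) refl b δ) (zero-sub (sym (proj₁ v)))))
     δ0 : ∀ δ b c → b ≡ 0# → c ≡ 0# → (δ + (c + c)) * b ≡ δ * ((b - δ) - c) → δ ≡ 0#
     δ0 δ b c refl refl e = square-zero (trans (solve 1 (λ δ → δ :* δ := (δ :+ (:0 :+ :0)) :* :0 :- δ :* ((:0 :- δ) :- :0)) refl δ) (zero-sub e))
   -- No noncentral y has a centraliser that is preserved under conjugation by both unipotents `U`
   -- and `V`, so the stabiliser of a centraliser is a proper subgroup, from which `D` can escape.
   moved : ∀ y → ¬ Central y → Commute (conjugate U y) y → Commute (conjugate V y) y → ⊥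
   moved y nc eU eV = nc (not-parallel _ _ _ (subst (λ v → Par v (vec y)) (vec-conj-U y) (commute⇒par (conjugate U y) y eU))
     (subst (λ v → Par v (vec y)) (vec-conj-V y) (commute⇒par (conjugate V y) y eV)))
   four : F
   four = 1# + 1# + 1# + 1#
   -- The discriminant tr² - 4 of the characteristic polynomial, written in terms of `vec`; it
   -- vanishes exactly for trace 2 or -2.
   disc : F³ → F
   disc (x , y , z) = x * x + four * (y * z)
   disc-tr : ∀ g → disc (vec g) ≡ tr g * tr g - four
   disc-tr ((a , b , c , d) , p) = trans (solve 4 (λ a b c d → (a :- d) :* (a :- d) :+ (:1 :+ :1 :+ :1 :+ :1) :* (b :* c)
       := (a :+ d) :* (a :+ d) :- (:1 :+ :1 :+ :1 :+ :1) :* (a :* d :- b :* c)) refl a b c d)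
     (trans (cong (λ z → (a + d) * (a + d) - four * z) (det-1 p)) (cong (λ z → (a + d) * (a + d) - z) (*-identityʳ four)))
   vec-tr-ext : ∀ g h → vec g ≡ vec h → tr g ≡ tr h → g ≡ h
   vec-tr-ext g@((a , b , c , d) , _) h@((a' , b' , c' , d') , _) ev et = SL-ext (mat-ext
     (sub-zero (halve (trans (solve 4 (λ a d a' d' → (a :- a') :+ (a :- a') := ((a :- d) :- (a' :- d')) :+ ((a :+ d) :- (a' :+ d'))) refl a d a' d') both)))
     (cong (λ v → proj₁ (proj₂ v)) ev) (cong (λ v → proj₂ (proj₂ v)) ev)
     (sub-zero (halve (trans (solve 4 (λ a d a' d' → (d :- d') :+ (d :- d') := ((a :+ d) :- (a' :+ d')) :- ((a :- d) :- (a' :- d'))) refl a d a' d') both′))))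
     where
     both : ((a - d) - (a' - d')) + ((a + d) - (a' + d')) ≡ 0#
     both = trans (cong₂ _+_ (zero-sub (cong proj₁ ev)) (zero-sub et)) (+-identityˡ 0#)
     both′ : ((a + d) - (a' + d')) - ((a - d) - (a' - d')) ≡ 0#
     both′ = trans (cong₂ _-_ (zero-sub et) (zero-sub (cong proj₁ ev))) (solve 0 (:0 :- :0 := :0) refl)
   opaque
     comm : SL → SL → Bool
     comm g h = (g ∙ h) == (h ∙ g)
     comm-true : ∀ g h → comm g h ≡ true → Commute g h
     comm-true g h e = does-true (_ ≟ _) e
     comm-intro : ∀ g h → Commute g h → comm g h ≡ true
     comm-intro g h e = does-intro (_ ≟ _) e
   disc-scaled : ∀ u v β → v ∝ β · u → disc v ≡ β * β * disc u
   disc-scaled (x , y , z) v β (refl , refl , refl) = solve 4 (λ b x y z → b :* x :* (b :* x) :+ (:1 :+ :1 :+ :1 :+ :1) :* (b :* y :* (b :* z)) := b :* b :* (x :* x :+ (:1 :+ :1 :+ :1 :+ :1) :* (y :* z))) refl β x y z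
   square-roots : ∀ {D s} β β' → ¬ (D ≡ 0#) → β * β * D ≡ s → β' * β' * D ≡ s → ¬ (β ≡ β') → β' ≡ - β
   square-roots {D} β β' D≢0 e e' ne = pick (*-zero (*-cancel0 D≢0 (trans (solve 3 (λ D a b → D :* ((a :- b) :* (a :+ b)) := a :* a :* D :- b :* b :* D) refl D β β') (zero-sub (trans e (sym e'))))))
     where
     pick : (β - β' ≡ 0#) ⊎ (β + β' ≡ 0#) → β' ≡ - β
     pick (inj₁ z) = ⊥-elim (ne (sub-zero z))
     pick (inj₂ z) = sub-zero (trans (solve 2 (λ a b → b :- (:- a) := a :+ b) refl β β') z)
   ∝-unique : ∀ u v w {β β'} → v ∝ β · u → w ∝ β' · u → β ≡ β' → v ≡ w
   ∝-unique u v w (refl , refl , refl) (refl , refl , refl) refl = refl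
   module _ (d : SL) (t : F) (nc : ¬ Central d) (disc≢0 : ¬ (disc (vec d) ≡ 0#)) where
     private
       Good : SL → Set
       Good k = (tr k ≡ t) × ∃ λ β → vec k ∝ β · vec d
       good : ∀ k → comm d k ∧ Fᶠ._==_ (tr k) t ≡ true → Good k
       good k pk = does-true (_ Fᶠ.≟ _) (proj₂ (∧-true {comm d k} pk)) ,
         proportional (vec d) (vec k) nc (commute⇒par d k (comm-true d k (proj₁ (∧-true {comm d k} pk))))
       disc-eq : ∀ k (g : Good k) → let β = proj₁ (proj₂ g) in β * β * disc (vec d) ≡ t * t - four
       disc-eq k (e , β , pr) = trans (sym (disc-scaled (vec d) (vec k) β pr)) (trans (disc-tr k) (cong (λ s → s * s - four) e))
       same : ∀ x y (g : Good x) (h : Good y) → proj₁ (proj₂ g) ≡ proj₁ (proj₂ h) → x ≡ y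
       same x y (e , β , pr) (e' , β' , pr') eq = vec-tr-ext x y (∝-unique (vec d) (vec x) (vec y) pr pr' eq) (trans e (sym e'))
       unique : ∀ x y z → Good x → Good y → Good z → ¬ (x ≡ y) → ¬ (x ≡ z) → y ≡ z
       unique x y z gx gy gz x≢y x≢z = same y z gy gz (trans (opposite y gy x≢y) (sym (opposite z gz x≢z)))
         where
         opposite : ∀ k (g : Good k) → ¬ (x ≡ k) → proj₁ (proj₂ g) ≡ - proj₁ (proj₂ gx)
         opposite k g ne = square-roots _ _ disc≢0 (disc-eq x gx) (disc-eq k g) (λ e → ne (same x k gx g e))
     -- An element of the centraliser has β·`vec d` as its vector. The trace fixes β² through the
     -- discriminant, and vector and trace together determine the element.
     few-in-centraliser : count (λ k → comm d k ∧ Fᶠ._==_ (tr k) t) ℕ.≤ 2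
     few-in-centraliser = count-≤2′ (FiniteGroup.finite SL₂) λ x y z px py pz → unique x y z (good x px) (good y py) (good z pz)
   central-scalar : ∀ g → Central g → ∃ λ a → proj₁ g ≡ (a , 0# , 0# , a) × a * a ≡ 1#
   central-scalar ((a , b , c , d) , p) (δ0 , refl , refl) with sub-zero δ0
   ... | refl = a , refl , trans (det≡1 p) (solve 0 (:1 :+ :0 :* :0 := :1) refl)
   central : SL → Bool
   central g = does (zero? (vec g))
   count-central : count central ℕ.≤ 2
   count-central = count-≤2′ (FiniteGroup.finite SL₂) λ x y z px py pz xy xz →
     go x y z (central-scalar x (does-true (zero? _) px)) (central-scalar y (does-true (zero? _) py)) (central-scalar z (does-true (zero? _) pz)) xy xz
     where
     go : ∀ (x y z : SL) → (∃ λ a → proj₁ x ≡ (a , 0# , 0# , a) × a * a ≡ 1#) → (∃ λ a → proj₁ y ≡ (a , 0# , 0# , a) × a * a ≡ 1#) →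
       (∃ λ a → proj₁ z ≡ (a , 0# , 0# , a) × a * a ≡ 1#) → ¬ (x ≡ y) → ¬ (x ≡ z) → y ≡ z
     go x y z (a , ex , a²) (b , ey , b²) (c , ez , c²) xy xz = SL-ext (trans ey (trans (cong (λ t → (t , 0# , 0# , t)) (trans (neg b b² y ey xy) (sym (neg c c² z ez xz)))) (sym ez)))
       where
       neg : ∀ b → b * b ≡ 1# → ∀ y → proj₁ y ≡ (b , 0# , 0# , b) → ¬ (x ≡ y) → b ≡ - a
       neg b b² y ey ne with *-zero (trans (solve 2 (λ a b → (a :- b) :* (a :+ b) := a :* a :- b :* b) refl a b) (zero-sub (trans a² (sym b²))))
       ... | inj₁ e = ⊥-elim (ne (SL-ext (trans ex (trans (cong (λ t → (t , 0# , 0# , t)) (sub-zero e)) (sym ey)))))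
       ... | inj₂ e = sub-zero (trans (solve 2 (λ a b → b :- (:- a) := a :+ b) refl a b) e)
   central-quotients : ∀ (P : SL → Bool) → (∀ u v → P u ≡ true → P v ≡ true → Central (v ⁻¹ ∙ u)) → count P ℕ.≤ 2
   central-quotients P h with search P
   ... | inj₂ none    = ≤-trans (≤-reflexive (count-0 none)) z≤n
   ... | inj₁ (v , pv) = ≤-trans (count-mono λ u pu → does-intro (zero? _) (h u v pu pv)) (≤-trans (≤-reflexive (∑-left (v ⁻¹) (λ g → 𝟙 (central g)))) count-central)
   -- Along the line x + l·M the determinant is quadratic in l. Equality with its value at l = 0
   -- leaves a factor l and an equation linear in l.
   det-shift : ∀ x₁ x₂ x₃ x₄ m₁ m₂ m₃ l → (x₁ + l * m₁) * (x₄ - l * m₁) - (x₂ + l * m₂) * (x₃ + l * m₃) ≡ 1# → x₁ * x₄ - x₂ * x₃ ≡ 1# →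
     l * ((x₄ * m₁ - x₁ * m₁ - x₂ * m₃ - x₃ * m₂) - l * (m₁ * m₁ + m₂ * m₃)) ≡ 0#
   det-shift x₁ x₂ x₃ x₄ m₁ m₂ m₃ l e e' = trans
     (solve 8 (λ x₁ x₂ x₃ x₄ l m₁ m₂ m₃ → l :* ((x₄ :* m₁ :- x₁ :* m₁ :- x₂ :* m₃ :- x₃ :* m₂) :- l :* (m₁ :* m₁ :+ m₂ :* m₃))
       := ((x₁ :+ l :* m₁) :* (x₄ :- l :* m₁) :- (x₂ :+ l :* m₂) :* (x₃ :+ l :* m₃)) :- (x₁ :* x₄ :- x₂ :* x₃)) refl x₁ x₂ x₃ x₄ l m₁ m₂ m₃)
     (zero-sub (trans e (sym e')))
   unshift : ∀ x₁ x₂ x₃ x₄ m₁ m₂ m₃ l → l ≡ 0# → (x₁ + l * m₁ , x₂ + l * m₂ , x₃ + l * m₃ , x₄ - l * m₁) ≡ (x₁ , x₂ , x₃ , x₄)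
   unshift x₁ x₂ x₃ x₄ m₁ m₂ m₃ l refl = mat-ext (stay x₁ m₁) (stay x₂ m₂) (stay x₃ m₃) (solve 2 (λ x m → x :- :0 :* m := x) refl x₄ m₁)
     where
     stay : ∀ x m → x + 0# * m ≡ x
     stay = solve 2 (λ x m → x :+ :0 :* m := x) refl
   -- The three traces are linear conditions and leave a line of matrices with direction M = hg -
   -- gh, on which det = 1 is a quadratic equation. Its leading coefficient is minus the determinant
   -- of M; were it zero, the kernel of M would be a direction fixed by g and by h.
   trace-fibre : ∀ g h τ → ¬ Commute g h → (∀ s → fixes g s ≡ true → fixes h s ≡ true → ⊥) →
     count (λ y → Fᶠ._==_ (tr y) τ ∧ (Fᶠ._==_ (tr (g ∙ y)) τ ∧ Fᶠ._==_ (tr (h ∙ y)) τ)) ℕ.≤ 2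
   trace-fibre g@((a , b , c , d) , _) h@((a' , b' , c' , d') , _) τ ncomm ncommon = count-≤2′ (FiniteGroup.finite SL₂)
       λ x y z px py pz xy xz → unique x y z (traces x px) (traces y py) (traces z pz) xy xz
     where
     Sol : SL → Set
     Sol y = (tr y ≡ τ) × (tr (g ∙ y) ≡ τ) × (tr (h ∙ y) ≡ τ)
     traces : ∀ y → Fᶠ._==_ (tr y) τ ∧ (Fᶠ._==_ (tr (g ∙ y)) τ ∧ Fᶠ._==_ (tr (h ∙ y)) τ) ≡ true → Sol y
     traces y p with ∧-true {Fᶠ._==_ (tr y) τ} p
     ... | p₁ , p' with ∧-true {Fᶠ._==_ (tr (g ∙ y)) τ} p'
     ...   | p₂ , p₃ = does-true (_ Fᶠ.≟ _) p₁ , does-true (_ Fᶠ.≟ _) p₂ , does-true (_ Fᶠ.≟ _) p₃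
     δ δ' m₁ m₂ m₃ : F
     δ = a - d
     δ' = a' - d'
     m₁ = c * b' - b * c'
     m₂ = b * δ' - δ * b'
     m₃ = δ * c' - c * δ'
     M : F³
     M = m₁ , m₂ , m₃
     M≢0 : ¬ Zero M
     M≢0 (z₁ , z₂ , z₃) = ncomm (par⇒commute g h (trans (sym (sub-zero z₂)) (*-comm b δ') , trans (sub-zero z₃) (*-comm c δ') , trans (sym (sub-zero z₁)) (*-comm c b')))
     gm : δ * m₁ + c * m₂ + b * m₃ ≡ 0#
     gm = solve 6 (λ δ b c δ' b' c' → δ :* (c :* b' :- b :* c') :+ c :* (b :* δ' :- δ :* b') :+ b :* (δ :* c' :- c :* δ') := :0) refl δ b c δ' b' c'
     hm : δ' * m₁ + c' * m₂ + b' * m₃ ≡ 0#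
     hm = solve 6 (λ δ b c δ' b' c' → δ' :* (c :* b' :- b :* c') :+ c' :* (b :* δ' :- δ :* b') :+ b' :* (δ :* c' :- c :* δ') := :0) refl δ b c δ' b' c'
     eigen : ∀ {p r} → m₁ * m₁ + m₂ * m₃ ≡ 0# → ∀ k → vec k ≡ (p , proj₁ r , proj₂ r) → p * m₁ + proj₂ r * m₂ + proj₁ r * m₃ ≡ 0# →
       ∀ w → (w ≡ (m₂ , - m₁)) ⊎ ((w ≡ (0# , 1#)) × (m₁ ≡ 0#) × (m₂ ≡ 0#)) → q k w ≡ 0#
     eigen e k@((ka , kb , kc , kd) , _) refl o w (inj₁ refl) = trans
       (solve 7 (λ a b c d m₁ m₂ m₃ → m₂ :* (c :* m₂ :+ d :* (:- m₁)) :- (:- m₁) :* (a :* m₂ :+ b :* (:- m₁))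
         := m₂ :* ((a :- d) :* m₁ :+ c :* m₂ :+ b :* m₃) :- b :* (m₁ :* m₁ :+ m₂ :* m₃)) refl ka kb kc kd m₁ m₂ m₃)
       (trans (cong₂ (λ s t → m₂ * s - kb * t) o e) (solve 2 (λ m b → m :* :0 :- b :* :0 := :0) refl m₂ kb))
     eigen e k@((ka , kb , kc , kd) , _) refl o w (inj₂ (refl , z₁ , z₂)) = trans
       (solve 4 (λ a b c d → :0 :* (c :* :0 :+ d :* :1) :- :1 :* (a :* :0 :+ b :* :1) := :- b) refl ka kb kc kd) (trans (cong -_ kb0) (solve 0 (:- :0 := :0) refl))
       where
       m₃≢0 : ¬ (m₃ ≡ 0#)
       m₃≢0 z₃ = M≢0 (z₁ , z₂ , z₃)
       kb0 : kb ≡ 0#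
       kb0 = *-cancel0 m₃≢0 (trans (solve 3 (λ D C y → y := D :* :0 :+ C :* :0 :+ y) refl (ka - kd) kc (m₃ * kb))
         (trans (cong₂ _+_ (cong₂ _+_ (cong ((ka - kd) *_) (sym z₁)) (cong (kc *_) (sym z₂))) (*-comm m₃ kb)) o))
     detM≢0 : ¬ (m₁ * m₁ + m₂ * m₃ ≡ 0#)
     detM≢0 e with pick
       where
       pick : ∃ λ w → nonzero w × ((w ≡ (m₂ , - m₁)) ⊎ ((w ≡ (0# , 1#)) × (m₁ ≡ 0#) × (m₂ ≡ 0#)))
       pick with m₁ Fᶠ.≟ 0# | m₂ Fᶠ.≟ 0#
       ... | yes z₁ | yes z₂ = (0# , 1#) , (λ { (_ , o) → 1≢0 o }) , inj₂ (refl , z₁ , z₂)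
       ... | no n   | _      = (m₂ , - m₁) , (λ { (_ , o) → n (neg-zero o) }) , inj₁ refl
       ... | yes _  | no n   = (m₂ , - m₁) , (λ { (o , _) → n o }) , inj₁ refl
     ... | w , nz , ew with find-direction w nz
     ...   | s , l , nl , es = ncommon s (fixes-scaled g s l w nl es (eigen e g refl gm w ew)) (fixes-scaled h s l w nl es (eigen e h refl hm w ew))
     unique : ∀ x y z → Sol x → Sol y → Sol z → ¬ (x ≡ y) → ¬ (x ≡ z) → y ≡ z
     unique x@((x₁ , x₂ , x₃ , x₄) , px) y z sx sy sz x≢y x≢z = same y z (multiple-of y sy) (multiple-of z sz) (λ e → x≢y e) (λ e → x≢z e)
       where
       Shift : SL → F → Set
       Shift k l = proj₁ k ≡ (x₁ + l * m₁ , x₂ + l * m₂ , x₃ + l * m₃ , x₄ - l * m₁)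
       multiple-of : ∀ k → Sol k → ∃ (Shift k)
       multiple-of ((y₁ , y₂ , y₃ , y₄) , _) (t₁ , t₂ , t₃) = l , mat-ext (move e₁) (move e₂) (move e₃)
           (sub-zero (trans (solve 6 (λ y₁ y₄ x₁ x₄ l m → y₄ :- (x₄ :- l :* m) := ((y₁ :+ y₄) :- (x₁ :+ x₄)) :- ((y₁ :- x₁) :- l :* m)) refl y₁ y₄ x₁ x₄ l m₁)
             (trans (cong₂ _-_ n₄ (zero-sub e₁)) (solve 0 (:0 :- :0 := :0) refl))))
         where
         n₁ = y₁ - x₁
         n₂ = y₂ - x₂
         n₃ = y₃ - x₃
         n₄ : (y₁ + y₄) - (x₁ + x₄) ≡ 0#
         n₄ = zero-sub (trans t₁ (sym (proj₁ sx)))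
         gn : δ * n₁ + c * n₂ + b * n₃ ≡ 0#
         gn = trans (solve 12 (λ a b c d x₁ x₂ x₃ x₄ y₁ y₂ y₃ y₄ → (a :- d) :* (y₁ :- x₁) :+ c :* (y₂ :- x₂) :+ b :* (y₃ :- x₃)
             := (((a :* y₁ :+ b :* y₃) :+ (c :* y₂ :+ d :* y₄)) :- ((a :* x₁ :+ b :* x₃) :+ (c :* x₂ :+ d :* x₄))) :- d :* ((y₁ :+ y₄) :- (x₁ :+ x₄))) refl a b c d x₁ x₂ x₃ x₄ y₁ y₂ y₃ y₄)
           (trans (cong₂ (λ s t → s - d * t) (zero-sub (trans t₂ (sym (proj₁ (proj₂ sx))))) n₄) (solve 1 (λ d → :0 :- d :* :0 := :0) refl d))
         hn : δ' * n₁ + c' * n₂ + b' * n₃ ≡ 0#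
         hn = trans (solve 12 (λ a b c d x₁ x₂ x₃ x₄ y₁ y₂ y₃ y₄ → (a :- d) :* (y₁ :- x₁) :+ c :* (y₂ :- x₂) :+ b :* (y₃ :- x₃)
             := (((a :* y₁ :+ b :* y₃) :+ (c :* y₂ :+ d :* y₄)) :- ((a :* x₁ :+ b :* x₃) :+ (c :* x₂ :+ d :* x₄))) :- d :* ((y₁ :+ y₄) :- (x₁ :+ x₄))) refl a' b' c' d' x₁ x₂ x₃ x₄ y₁ y₂ y₃ y₄)
           (trans (cong₂ (λ s t → s - d' * t) (zero-sub (trans t₃ (sym (proj₂ (proj₂ sx))))) n₄) (solve 1 (λ d → :0 :- d :* :0 := :0) refl d'))
         zero₂ : ∀ A B → A * (δ' * n₁ + c' * n₂ + b' * n₃) - B * (δ * n₁ + c * n₂ + b * n₃) ≡ 0#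
         zero₂ A B = trans (cong₂ (λ s t → A * s - B * t) hn gn) (solve 2 (λ A B → A :* :0 :- B :* :0 := :0) refl A B)
         par : Par M (n₁ , n₂ , n₃)
         par = sub-zero (trans (solve 9 (λ δ c b δ' c' b' n₁ n₂ n₃ → (c :* b' :- b :* c') :* n₂ :- n₁ :* (b :* δ' :- δ :* b') := (:- b) :* (δ' :* n₁ :+ c' :* n₂ :+ b' :* n₃) :- (:- b') :* (δ :* n₁ :+ c :* n₂ :+ b :* n₃)) refl δ c b δ' c' b' n₁ n₂ n₃) (zero₂ (- b) (- b')))
             , sub-zero (trans (solve 9 (λ δ c b δ' c' b' n₁ n₂ n₃ → (c :* b' :- b :* c') :* n₃ :- n₁ :* (δ :* c' :- c :* δ') := c :* (δ' :* n₁ :+ c' :* n₂ :+ b' :* n₃) :- c' :* (δ :* n₁ :+ c :* n₂ :+ b :* n₃)) refl δ c b δ' c' b' n₁ n₂ n₃) (zero₂ c c'))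
             , sub-zero (trans (solve 9 (λ δ c b δ' c' b' n₁ n₂ n₃ → (b :* δ' :- δ :* b') :* n₃ :- n₂ :* (δ :* c' :- c :* δ') := (:- δ) :* (δ' :* n₁ :+ c' :* n₂ :+ b' :* n₃) :- (:- δ') :* (δ :* n₁ :+ c :* n₂ :+ b :* n₃)) refl δ c b δ' c' b' n₁ n₂ n₃) (zero₂ (- δ) (- δ')))
         ratio = proportional M (n₁ , n₂ , n₃) M≢0 par
         l = proj₁ ratio
         e₁ = proj₁ (proj₂ ratio)
         e₂ = proj₁ (proj₂ (proj₂ ratio))
         e₃ = proj₂ (proj₂ (proj₂ ratio))
         move : ∀ {y x t} → y - x ≡ t → y ≡ x + t
         move {y} {x} refl = solve 2 (λ y x → y := x :+ (y :- x)) refl y x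
       B₀ : F
       B₀ = x₄ * m₁ - x₁ * m₁ - x₂ * m₃ - x₃ * m₂
       slope : ∀ k → ¬ (x ≡ k) → (s : ∃ (Shift k)) → B₀ - proj₁ s * (m₁ * m₁ + m₂ * m₃) ≡ 0#
       slope k ne (l , e) = *-cancel0 (λ l0 → ne (SL-ext (sym (trans e (unshift x₁ x₂ x₃ x₄ m₁ m₂ m₃ l l0)))))
         (det-shift x₁ x₂ x₃ x₄ m₁ m₂ m₃ l (det-1 (subst (λ M → inSL₂ M ≡ true) e (proj₂ k))) (det-1 px))
       same : ∀ y z → ∃ (Shift y) → ∃ (Shift z) → ¬ (x ≡ y) → ¬ (x ≡ z) → y ≡ z
       same y z (l , sy) (l' , sz) ny nz = SL-ext (trans sy (trans (cong (λ l → (x₁ + l * m₁ , x₂ + l * m₂ , x₃ + l * m₃ , x₄ - l * m₁)) l≡l') (sym sz)))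
         where
         l≡l' : l ≡ l'
         l≡l' = sub-zero (*-cancel0 detM≢0 (trans (solve 4 (λ D B l l' → D :* (l :- l') := (B :- l' :* D) :- (B :- l :* D)) refl (m₁ * m₁ + m₂ * m₃) B₀ l l')
           (trans (cong₂ _-_ (slope z nz (l' , sz)) (slope y ny (l , sy))) (solve 0 (:0 :- :0 := :0) refl))))
   -- Only matrices with a nonzero upper left entry are counted; the last entry is determined by the
   -- others, and (p - 1)·p² is at least half of p³.
   order-SL₂ : p ℕ.* (p ℕ.* p) ℕ.≤ 2 ℕ.* ∑ elems (λ _ → 1)
   order-SL₂ = ≤-trans (ℕ.*-monoˡ-≤ (p ℕ.* p) p≤) (≤-trans (≤-reflexive (ℕ.*-assoc 2 nz (p ℕ.* p))) (ℕ.*-monoʳ-≤ 2 bound))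
     where
     N : F → Bool
     N a = not (Fᶠ._==_ a 0#)
     nz = Fᶠ.count N
     split : p ≡ nz ℕ.+ 1
     split = trans (sym order) (trans (∑-cong Fᶠ.elems e) (trans (∑-+ Fᶠ.elems _ _) (cong (nz ℕ.+_) (Fᶠ.once 0#))))
       where
       e : ∀ a → 1 ≡ 𝟙 (N a) ℕ.+ 𝟙 (Fᶠ._==_ 0# a)
       e a with a Fᶠ.≟ 0# | 0# Fᶠ.≟ a
       ... | yes _  | yes _ = refl
       ... | no _   | no _  = refl
       ... | yes h  | no n  = ⊥-elim (n (sym h))
       ... | no n   | yes h = ⊥-elim (n (sym h))
     p≤ : p ℕ.≤ 2 ℕ.* nz
     p≤ = ≤-trans (≤-reflexive split) (≤-trans (ℕ.+-monoʳ-≤ nz (ℕ.+-cancelʳ-≤ 1 1 nz (≤-trans (ℕ.<⇒≤ 2<p) (≤-reflexive split)))) (≤-reflexive (cong (nz ℕ.+_) (sym (ℕ.+-identityʳ nz)))))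
     bound : nz ℕ.* (p ℕ.* p) ℕ.≤ ∑ elems (λ _ → 1)
     bound = ≤-trans (≤-reflexive (trans (sym (∑-*ʳ Fᶠ.elems (p ℕ.* p) _)) refl)) (≤-trans (∑-mono Fᶠ.elems row)
       (≤-reflexive (sym (trans (∑-restrict inSL₂ (Finite.elems finite-Mat) (λ _ → 1))
         (trans (∑-product Fᶠ.elems _ _) (∑-cong Fᶠ.elems λ a → trans (∑-product Fᶠ.elems _ _) (∑-cong Fᶠ.elems λ b → ∑-product Fᶠ.elems Fᶠ.elems _)))))))
       where
       cell : F → F → F → F → ℕ
       cell a b c d = 𝟙 (inSL₂ (a , b , c , d)) ℕ.* 1
       row : ∀ a → 𝟙 (N a) ℕ.* (p ℕ.* p) ℕ.≤ Fᶠ.∑ᴬ (λ b → Fᶠ.∑ᴬ (λ c → Fᶠ.∑ᴬ (λ d → cell a b c d)))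
       row a with a Fᶠ.≟ 0#
       ... | yes _ = z≤n
       ... | no h  = ≤-trans (≤-reflexive (trans (ℕ.+-identityʳ _) square)) (∑-mono Fᶠ.elems λ b → ∑-mono Fᶠ.elems λ c →
           ≤-trans (≤-reflexive (sym (trans (ℕ.*-identityʳ _) (cong 𝟙 (does-intro (_ Fᶠ.≟ _) (inverse-entry b c)))))) (Fᶠ.≤∑ ((1# + b * c) * invert h) (cell a b c)))
         where
         inverse-entry : ∀ b c → a * ((1# + b * c) * invert h) ≡ 1# + b * c
         inverse-entry b c = trans (solve 3 (λ a x i → a :* (x :* i) := x :* (a :* i)) refl a (1# + b * c) (invert h)) (trans (cong ((1# + b * c) *_) (*-invert h)) (*-identityʳ _))
         square : p ℕ.* p ≡ Fᶠ.∑ᴬ (λ _ → Fᶠ.∑ᴬ (λ _ → 1))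
         square = trans (cong (ℕ._* p) (sym order)) (trans (sym (∑-*ʳ Fᶠ.elems p (λ _ → 1))) (∑-cong Fᶠ.elems λ _ → trans (ℕ.+-identityʳ p) (sym order)))

  -- Bounds for Borel subgroups, centralisers and trace classes

  module Helfgott where
   open 𝓕 using (F; 0#; neg-zero; 1≢0; solve; _:=_; _:+_; _:*_; _:-_; :-_; :0; :1; module Fᶠ)
   open SL2
   open SL2Count
   open 𝓖
   open import Data.Bool using (_xor_)
   open import Data.Maybe using (just; nothing)
   open import Data.Nat using (_+_; _*_; _≤ᵇ_)
   open import Data.Nat.Properties hiding (_≟_)
   open Arith
   open Sums hiding (interchange)
   open 𝓒
   open 𝓑 using (quotientSet)
   open 𝓠
   record IsSubgroup (H : SL → Bool) : Set where
     field
       has-ε : H ε ≡ true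
       has-∙ : ∀ g h → H g ≡ true → H h ≡ true → H (g ∙ h) ≡ true
       has-⁻¹ : ∀ g → H g ≡ true → H (g ⁻¹) ≡ true
   conj-∙ : ∀ g h z → conjugate (g ∙ h) z ≡ conjugate g (conjugate h z)
   conj-∙ g h z = trans (cong (g ∙ h ∙ z ∙_) (inv-∙ g h)) (trans (sym (assoc _ _ _)) (cong (_∙ g ⁻¹)
     (trans (cong (_∙ h ⁻¹) (assoc g h z)) (trans (assoc g (h ∙ z) (h ⁻¹)) refl))))
   inv-ε : ε ⁻¹ ≡ ε
   inv-ε = sym (inv-unique (idˡ ε))
   conj-ε : ∀ z → conjugate ε z ≡ z
   conj-ε z = trans (cong (ε ∙ z ∙_) inv-ε) (trans (idʳ _) (idˡ z))
   conj-inv : ∀ g z → conjugate (g ⁻¹) (conjugate g z) ≡ z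
   conj-inv g z = trans (sym (conj-∙ (g ⁻¹) g z)) (trans (cong (λ x → conjugate x z) (invˡ g)) (conj-ε z))
   conj-commute : ∀ a {x y} → Commute x y → Commute (conjugate a x) (conjugate a y)
   conj-commute a {x} {y} e = trans (merge x y) (trans (cong (conjugate a) e) (sym (merge y x)))
     where
     merge : ∀ x y → conjugate a x ∙ conjugate a y ≡ conjugate a (x ∙ y)
     merge x y = trans (assoc (a ∙ x) (a ⁻¹) _) (trans (cong (a ∙ x ∙_) (trans (cong (a ⁻¹ ∙_) (assoc a y (a ⁻¹))) (cancelˡ a _)))
       (trans (sym (assoc (a ∙ x) y (a ⁻¹))) (cong (_∙ a ⁻¹) (assoc a x y))))
   central-conj : ∀ a z → Central z → conjugate a z ≡ z
   central-conj a z c = trans (cong (_∙ a ⁻¹) (sym (central-commutes z a c))) (cancelʳ z a)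
   noncentral-conj : ∀ a z → ¬ Central z → ¬ Central (conjugate a z)
   noncentral-conj a z nc c = nc (subst Central (trans (sym (central-conj (a ⁻¹) (conjugate a z) c)) (conj-inv a z)) c)
   tr-conj : ∀ a z → tr (conjugate a z) ≡ tr z
   tr-conj ((a , b , c , d) , pf) ((x , y , z , w) , _) = trans
     (solve 8 (λ a b c d x y z w → ((a :* x :+ b :* z) :* d :+ (a :* y :+ b :* w) :* (:- c)) :+ ((c :* x :+ d :* z) :* (:- b) :+ (c :* y :+ d :* w) :* a)
       := (a :* d :- b :* c) :* (x :+ w)) refl a b c d x y z w) (trans (cong (𝓕._* (x 𝓕.+ w)) (det-1 pf)) (𝓕.*-identityˡ _))
   opaque
     -- The stabiliser of a set under conjugation. It supplies the subgroups to escape from, for Φ a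
     -- centraliser and for Φ the set of involved elements.
     Stab : (SL → Bool) → SL → Bool
     Stab Φ h = not (any (λ z → Φ z xor Φ (conjugate h z)) elems)
     Stab-intro : ∀ Φ h → (∀ z → Φ z ≡ Φ (conjugate h z)) → Stab Φ h ≡ true
     Stab-intro Φ h e = not-intro (≢true λ t → absurd (any-true (λ z → Φ z xor Φ (conjugate h z)) elems t))
       where
       xor-same : ∀ b → b xor b ≡ false
       xor-same true  = refl
       xor-same false = refl
       absurd : ∃ (λ z → Φ z xor Φ (conjugate h z) ≡ true) → ⊥
       absurd (z , t) = true≢false t (trans (cong (Φ z xor_) (sym (e z))) (xor-same (Φ z)))
     Stab-elim : ∀ Φ h → Stab Φ h ≡ true → ∀ z → Φ z ≡ Φ (conjugate h z)
     Stab-elim Φ h s z = xor-false (Φ z) (Φ (conjugate h z)) (≢true λ t → true≢false (any-intro (λ z → Φ z xor Φ (conjugate h z)) z t) (not-true s))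
       where
       xor-false : ∀ a b → a xor b ≡ false → a ≡ b
       xor-false true  true  _ = refl
       xor-false false false _ = refl
   Stab-subgroup : ∀ Φ → IsSubgroup (Stab Φ)
   Stab-subgroup Φ = record
     { has-ε  = Stab-intro Φ ε λ z → cong Φ (sym (conj-ε z))
     ; has-∙  = λ g h sg sh → Stab-intro Φ (g ∙ h) λ z → trans (Stab-elim Φ h sh z) (trans (Stab-elim Φ g sg (conjugate h z)) (cong Φ (sym (conj-∙ g h z))))
     ; has-⁻¹ = λ g sg → Stab-intro Φ (g ⁻¹) λ z → sym (trans (Stab-elim Φ g sg (conjugate (g ⁻¹) z))
         (cong Φ (trans (cong (λ x → conjugate x (conjugate (g ⁻¹) z)) (sym (inv-inv g))) (conj-inv (g ⁻¹) z)))) }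
   fixes-true : ∀ g s → fixes g s ≡ true → q g ⟨ s ⟩ ≡ 0#
   fixes-true g s e = does-true (_ Fᶠ.≟ _) e
   fixes-intro : ∀ g s → q g ⟨ s ⟩ ≡ 0# → fixes g s ≡ true
   fixes-intro g s e = does-intro (_ Fᶠ.≟ _) e
   Borel-subgroup : ∀ s → IsSubgroup (λ g → fixes g s)
   Borel-subgroup s = record
     { has-ε  = fixes-intro ε s (solve 2 (λ x y → x :* (:0 :* x :+ :1 :* y) :- y :* (:1 :* x :+ :0 :* y) := :0) refl _ _)
     ; has-∙  = λ g h eg eh → fixes-intro (g ∙ h) s (q-∙ g h ⟨ s ⟩ (dir-nonzero s) (fixes-true g s eg) (fixes-true h s eh))
     ; has-⁻¹ = λ g eg → fixes-intro (g ⁻¹) s (trans (q-inv g ⟨ s ⟩) (trans (cong 𝓕.-_ (fixes-true g s eg)) (solve 0 (:- :0 := :0) refl))) }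
   Borel-proper : ∀ s → ∃ λ g → fixes g s ≡ false
   Borel-proper nothing  = U , ≢true λ e → 1≢0 (neg-zero (trans (solve 0 (:- :1 := :0 :* (:0 :* :0 :+ :1 :* :1) :- :1 :* (:1 :* :0 :+ :1 :* :1)) refl) (fixes-true U nothing e)))
   Borel-proper (just s) = V , ≢true λ e → 1≢0 (trans (solve 1 (λ s → :1 := :1 :* (:1 :* :1 :+ :1 :* s) :- s :* (:1 :* :1 :+ :0 :* s)) refl s) (fixes-true V (just s) e))
   cube-root : ∀ N → ∃ λ r → r * r * r ≤ N × N < suc r * suc r * suc r
   cube-root zero    = 0 , z≤n , s≤s z≤n
   cube-root (suc N) with cube-root N
   ... | r , lo , hi with ≤-<-connex (suc r * suc r * suc r) (suc N)
   ...   | inj₂ lt = r , m≤n⇒m≤1+n lo , lt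
   ...   | inj₁ le = suc r , le , ≤-<-trans hi (*-mono-< (*-mono-< (n<1+n (suc r)) (n<1+n (suc r))) (n<1+n (suc r)))
   cubes-< : ∀ {a b} → a * a * a < b * b * b → a < b
   cubes-< {a} {b} h = ≰⇒> λ le → <-irrefl refl (<-≤-trans h (*-mono-≤ (*-mono-≤ le le) le))
   minimiser : ∀ (f : SL → ℕ) → ∃ λ m → ∀ y → f m ≤ f y
   minimiser f = go (f ε) ε ≤-refl
     where
     go : ∀ n x → f x ≤ n → ∃ λ m → ∀ y → f m ≤ f y
     go n x le with search (λ y → suc (f y) ≤ᵇ f x)
     ... | inj₂ none = x , λ y → ≮⇒≥ λ lt → true≢false (≤ᵇ-intro lt) (none y)
     go zero    x le | inj₁ (y , e) = ⊥-elim (<-irrefl refl (≤-trans (≤ᵇ-true e) (≤-trans le z≤n)))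
     go (suc n) x le | inj₁ (y , e) = go n y (≤-pred (≤-trans (≤ᵇ-true e) le))
   -- Two cosets are avoided at once because the argument for Borel subgroups needs a second element
   -- outside the subgroup and outside the coset of the first one.
   Escapes : ∀ A (0<α : 0 < count A) → count (quotientSet A) ≲[ 32 ] count A → Set
   Escapes A 0<α few-quotients = ∀ H → IsSubgroup H → (∃ λ g → H g ≡ false) →
     ∀ g₁ g₂ → (∀ d → PopularQuotients.D A 0<α few-quotients d ≡ true → H (g₁ ⁻¹ ∙ d) ≡ true ⊎ H (g₂ ⁻¹ ∙ d) ≡ true) → ⊥
   module Growth (A : SL → Bool) (0<α : 0 < count A) (few-quotients : count (quotientSet A) ≲[ 32 ] count A)
     (escape′ : Escapes A 0<α few-quotients) where
     open PopularQuotients A 0<α few-quotients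
     M : ℕ
     M = count (P 25)
     opaque
       outside : ∀ H → IsSubgroup H → (∃ λ g → H g ≡ false) → ∀ g₁ g₂ → ∃ λ d → D d ≡ true × H (g₁ ⁻¹ ∙ d) ≡ false × H (g₂ ⁻¹ ∙ d) ≡ false
       outside H sub proper g₁ g₂ with search (λ d → D d ∧ (not (H (g₁ ⁻¹ ∙ d)) ∧ not (H (g₂ ⁻¹ ∙ d))))
       ... | inj₁ (d , e) = d , proj₁ (∧-true e) , not-true (proj₁ (∧-true (proj₂ (∧-true {D d} e)))) , not-true (proj₂ (∧-true {not (H (g₁ ⁻¹ ∙ d))} (proj₂ (∧-true {D d} e))))
       ... | inj₂ none = ⊥-elim (escape′ H sub proper g₁ g₂ λ d dd → cases (H (g₁ ⁻¹ ∙ d)) (H (g₂ ⁻¹ ∙ d)) (trans (cong (_∧ _) (sym dd)) (none d)))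
         where
         cases : ∀ x y → not x ∧ not y ≡ false → x ≡ true ⊎ y ≡ true
         cases true  y     _ = inj₁ refl
         cases false true  _ = inj₂ refl
     pairs-bound : ∀ (R : SL → SL → SL → Bool) (X Y : SL → Bool) → (∀ g h z → R g h z ≡ true → X g ≡ true × Y h ≡ true) →
       (∀ g h → count (R g h) ≤ 2) → ∑ᴬ (λ g → ∑ᴬ (λ h → count (R g h))) ≤ 2 * (count X * count Y)
     pairs-bound R X Y supp two = begin
       ∑ᴬ (λ g → ∑ᴬ (λ h → count (R g h))) ≤⟨ ∑-mono elems (λ g → ∑-mono elems λ h → bound g h (X g) (Y h) refl refl) ⟩
       ∑ᴬ (λ g → ∑ᴬ (λ h → 2 * (𝟙 (X g) * 𝟙 (Y h)))) ≡⟨ trans (∑-cong elems λ g → ∑-*ˡ elems 2 _) (∑-*ˡ elems 2 _) ⟩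
       2 * ∑ᴬ (λ g → ∑ᴬ (λ h → 𝟙 (X g) * 𝟙 (Y h))) ≡⟨ cong (2 *_) (sym (∑-* elems elems _ _)) ⟩
       2 * (count X * count Y) ∎
       where
       open ≤-Reasoning
       none : ∀ g h {n} → (∀ z → R g h z ≡ true → ⊥) → count (R g h) ≤ n
       none g h e = ≤-trans (≤-reflexive (count-0 λ z → ≢true (e z))) z≤n
       bound : ∀ g h x y → X g ≡ x → Y h ≡ y → count (R g h) ≤ 2 * (𝟙 x * 𝟙 y)
       bound g h true  true  _ _ = two g h
       bound g h true  false _ e = none g h λ z r → true≢false (proj₂ (supp g h z r)) e
       bound g h false y     e _ = none g h λ z r → true≢false (proj₁ (supp g h z r)) e
     module _ (s : Dir) where
       private
         x = ⟨ s ⟩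
         first = outside (λ g → fixes g s) (Borel-subgroup s) (Borel-proper s) ε ε
         a₀ = proj₁ first
         second = outside (λ g → fixes g s) (Borel-subgroup s) (Borel-proper s) ε a₀
         a₁ = proj₁ second
         moves : ∀ g → fixes g s ≡ false → ¬ (q g x ≡ 0#)
         moves g e z = true≢false (fixes-intro g s z) e
         unit : ∀ g → ε ⁻¹ ∙ g ≡ g
         unit g = trans (cong (_∙ g) inv-ε) (idˡ g)
         d₀ : ¬ (area x (act a₀ x) ≡ 0#)
         d₀ = moves a₀ (trans (cong (λ g → fixes g s) (sym (unit a₀))) (proj₁ (proj₂ (proj₂ first))))
         d₁ : ¬ (area x (act a₁ x) ≡ 0#)
         d₁ = moves a₁ (trans (cong (λ g → fixes g s) (sym (unit a₁))) (proj₁ (proj₂ (proj₂ second))))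
         d₂ : ¬ (area (act a₀ x) (act a₁ x) ≡ 0#)
         d₂ e = moves (a₀ ⁻¹ ∙ a₁) (proj₂ (proj₂ (proj₂ second))) (trans (sym (area-act a₀ x (act (a₀ ⁻¹ ∙ a₁) x)))
           (trans (cong (area (act a₀ x)) (trans (sym (act-∙ a₀ (a₀ ⁻¹ ∙ a₁) x)) (cong (λ g → act g x) (cancelˡ′ a₀ a₁)))) e))
         opaque
           𝔅 : SL → Bool
           𝔅 z = P 12 z ∧ fixes z s
           𝔅-def : ∀ z → P 12 z ∧ fixes z s ≡ 𝔅 z
           𝔅-def z = refl
         -- A triple (z, z₁, z₂) of elements of D¹² that fix x is sent to g = z₁·(z·a₀) ⁻¹ and h =
         -- z·a₁·z₂ ⁻¹, both in D²⁵. Two values of z over the same (g, h) have a quotient that fixes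
         -- the three distinct directions x, a₀ x and a₁ x, hence is central.
         R : SL → SL → SL → Bool
         R g h z = 𝔅 z ∧ (𝔅 (g ∙ (z ∙ a₀)) ∧ 𝔅 (h ⁻¹ ∙ (z ∙ a₁)))
         parts : ∀ g h z → R g h z ≡ true → 𝔅 z ≡ true × 𝔅 (g ∙ (z ∙ a₀)) ≡ true × 𝔅 (h ⁻¹ ∙ (z ∙ a₁)) ≡ true
         parts g h z e = proj₁ (∧-true {𝔅 z} e) , ∧-true {𝔅 (g ∙ (z ∙ a₀))} (proj₂ (∧-true {𝔅 z} e))
         inP : ∀ z → 𝔅 z ≡ true → P 12 z ≡ true
         inP z e = proj₁ (∧-true {P 12 z} (trans (𝔅-def z) e))
         inB : ∀ z → 𝔅 z ≡ true → fixes z s ≡ true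
         inB z e = proj₂ (∧-true {P 12 z} (trans (𝔅-def z) e))
         supp : ∀ g h z → R g h z ≡ true → P 25 g ≡ true × P 25 h ≡ true
         supp g h z e with parts g h z e
         ... | bz , bg , bh =
           trans (cong (P 25) (sym (cancelʳ g (z ∙ a₀)))) (P-∙ 12 13 (inP _ bg) (trans (cong (P 13) (inv-∙ z a₀)) (P-∙ 1 12 (P-inv 1 (D⇒P₁ (proj₁ (proj₂ first)))) (P-inv 12 (inP z bz))))) ,
           trans (cong (P 25) (sym (trans (cong (z ∙ a₁ ∙_) (inv-div h (z ∙ a₁))) (cancelˡ′ (z ∙ a₁) h)))) (P-∙ 13 12 (P-∙ 12 1 (inP z bz) (D⇒P₁ (proj₁ (proj₂ second)))) (P-inv 12 (inP _ bh)))
         open IsSubgroup (Borel-subgroup s)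
         two : ∀ g h → count (R g h) ≤ 2
         two g h = central-quotients (R g h) λ u v ru rv → eig u v (parts g h u ru) (parts g h v rv)
           where
           eig : ∀ u v → 𝔅 u ≡ true × 𝔅 (g ∙ (u ∙ a₀)) ≡ true × 𝔅 (h ⁻¹ ∙ (u ∙ a₁)) ≡ true →
                 𝔅 v ≡ true × 𝔅 (g ∙ (v ∙ a₀)) ≡ true × 𝔅 (h ⁻¹ ∙ (v ∙ a₁)) ≡ true → Central (v ⁻¹ ∙ u)
           eig u v (bu , bgu , bhu) (bv , bgv , bhv) = three-eigendirections (v ⁻¹ ∙ u) x (act a₀ x) (act a₁ x) d₀ d₁ d₂
             (fixes-true (v ⁻¹ ∙ u) s (has-∙ (v ⁻¹) u (has-⁻¹ v (inB v bv)) (inB u bu)))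
             (trans (sym (q-conj a₀ (v ⁻¹ ∙ u) x)) (fixed g a₀ bgv bgu))
             (trans (sym (q-conj a₁ (v ⁻¹ ∙ u) x)) (fixed (h ⁻¹) a₁ bhv bhu))
             where
             slide : ∀ g a → a ⁻¹ ∙ (v ⁻¹ ∙ u) ∙ a ≡ (g ∙ (v ∙ a)) ⁻¹ ∙ (g ∙ (u ∙ a))
             slide g a = sym (trans (cong (_∙ (g ∙ (u ∙ a))) (inv-∙ g (v ∙ a))) (trans (assoc _ (g ⁻¹) _) (trans (cong ((v ∙ a) ⁻¹ ∙_) (cancelˡ g (u ∙ a)))
               (trans (cong (_∙ (u ∙ a)) (inv-∙ v a)) (trans (assoc (a ⁻¹) (v ⁻¹) _) (trans (cong (a ⁻¹ ∙_) (sym (assoc (v ⁻¹) u a))) (sym (assoc (a ⁻¹) _ a))))))))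
             fixed : ∀ g a → 𝔅 (g ∙ (v ∙ a)) ≡ true → 𝔅 (g ∙ (u ∙ a)) ≡ true → q (a ⁻¹ ∙ (v ⁻¹ ∙ u) ∙ a) x ≡ 0#
             fixed g a ev eu = fixes-true (a ⁻¹ ∙ (v ⁻¹ ∙ u) ∙ a) s (trans (cong (λ y → fixes y s) (slide g a))
               (has-∙ ((g ∙ (v ∙ a)) ⁻¹) (g ∙ (u ∙ a)) (has-⁻¹ (g ∙ (v ∙ a)) (inB _ ev)) (inB _ eu)))
       borel-count : ℕ
       borel-count = count 𝔅
       borel-count-def : count (λ z → P 12 z ∧ fixes z s) ≡ borel-count
       borel-count-def = count-cong 𝔅-def
       borel-bound : borel-count * borel-count * borel-count ≤ 2 * (M * M)
       borel-bound = begin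
         b * b * b ≡⟨ *-assoc b b b ⟩
         b * (b * b) ≡⟨ ∑-*ʳ elems (b * b) _ ⟨
         ∑ᴬ (λ z → 𝟙 (𝔅 z) * (b * b)) ≡⟨ ∑-cong elems (λ z → cong (𝟙 (𝔅 z) *_) (trans (cong₂ _*_ (sym (∑-right (z ∙ a₀) (λ g → 𝟙 (𝔅 g)))) (sym (trans (∑-inv (λ h → 𝟙 (𝔅 (h ∙ (z ∙ a₁))))) (∑-right (z ∙ a₁) (λ g → 𝟙 (𝔅 g)))))) (∑-* elems elems _ _))) ⟩
         ∑ᴬ (λ z → 𝟙 (𝔅 z) * ∑ᴬ (λ g → ∑ᴬ (λ h → 𝟙 (𝔅 (g ∙ (z ∙ a₀))) * 𝟙 (𝔅 (h ⁻¹ ∙ (z ∙ a₁)))))) ≡⟨ ∑-cong elems (λ z → trans (sym (∑-*ˡ elems (𝟙 (𝔅 z)) _)) (∑-cong elems λ g → sym (∑-*ˡ elems (𝟙 (𝔅 z)) _))) ⟩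
         ∑ᴬ (λ z → ∑ᴬ (λ g → ∑ᴬ (λ h → 𝟙 (𝔅 z) * (𝟙 (𝔅 (g ∙ (z ∙ a₀))) * 𝟙 (𝔅 (h ⁻¹ ∙ (z ∙ a₁))))))) ≡⟨ trans (∑-swap elems elems _) (∑-cong elems λ g → ∑-swap elems elems _) ⟩
         ∑ᴬ (λ g → ∑ᴬ (λ h → ∑ᴬ (λ z → 𝟙 (𝔅 z) * (𝟙 (𝔅 (g ∙ (z ∙ a₀))) * 𝟙 (𝔅 (h ⁻¹ ∙ (z ∙ a₁))))))) ≡⟨ ∑-cong elems (λ g → ∑-cong elems λ h → ∑-cong elems λ z → sym (trans (𝟙-∧ (𝔅 z) _) (cong (𝟙 (𝔅 z) *_) (𝟙-∧ (𝔅 (g ∙ (z ∙ a₀))) _)))) ⟩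
         ∑ᴬ (λ g → ∑ᴬ (λ h → count (R g h))) ≤⟨ pairs-bound R (P 25) (P 25) supp two ⟩
         2 * (M * M) ∎
         where
         open ≤-Reasoning
         b = borel-count
     module _ (y : SL) (nc : ¬ Central y) where
       private
         Φ : SL → Bool
         Φ = comm y
         opaque
           proper : ∃ λ g → Stab Φ g ≡ false
           proper with Stab Φ U in eU | Stab Φ V in eV
           ... | false | _     = U , eU
           ... | true  | false = V , eV
           ... | true  | true  = ⊥-elim (moved y nc (sym (comm-true y _ (trans (sym (Stab-elim Φ U eU y)) (comm-intro y y refl))))
                                   (sym (comm-true y _ (trans (sym (Stab-elim Φ V eV y)) (comm-intro y y refl)))))
         mover = outside (Stab Φ) (Stab-subgroup Φ) proper ε ε
         a = proj₁ mover
         a-moves : ¬ Commute y (conjugate a y)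
         a-moves e = true≢false (Stab-intro Φ a λ z → ≡-iff
             (λ h → comm-intro y _ (commute-trans (conjugate a y) y (conjugate a z) (noncentral-conj a y nc) (sym e) (conj-commute a (comm-true y z h))))
             (λ h → comm-intro y z (subst₂ Commute (conj-inv a y) (conj-inv a z) (conj-commute (a ⁻¹) (commute-trans y (conjugate a y) (conjugate a z) nc e (comm-true y _ h))))))
           (trans (cong (Stab Φ) (sym (trans (cong (_∙ a) inv-ε) (idˡ a)))) (proj₁ (proj₂ (proj₂ mover))))
         opaque
           ℭ : SL → Bool
           ℭ z = P 12 z ∧ comm y z
           ℭ-def : ∀ z → P 12 z ∧ comm y z ≡ ℭ z
           ℭ-def z = refl
         inC : ∀ z → ℭ z ≡ true → Commute y z
         inC z e = comm-true y z (proj₂ (∧-true {P 12 z} (trans (ℭ-def z) e)))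
         inP : ∀ z → ℭ z ≡ true → P 12 z ≡ true
         inP z e = proj₁ (∧-true {P 12 z} (trans (ℭ-def z) e))
         two : ∀ g → count (λ z → ℭ z ∧ ℭ (a ⁻¹ ∙ (z ⁻¹ ∙ g))) ≤ 2
         two g = central-quotients (λ z → ℭ z ∧ ℭ (a ⁻¹ ∙ (z ⁻¹ ∙ g))) λ u v eu ev → quotient u v (∧-true {ℭ u} eu) (∧-true {ℭ v} ev)
           where
           commute-∙ : ∀ {x z w} → Commute x z → Commute x w → Commute x (z ∙ w)
           commute-∙ {x} {z} {w} e e' = trans (sym (assoc x z w)) (trans (cong (_∙ w) e) (trans (assoc z x w) (trans (cong (z ∙_) e') (sym (assoc z w x)))))
           commute-inv : ∀ {x z} → Commute x z → Commute x (z ⁻¹)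
           commute-inv {x} {z} e = trans (sym (cancelˡ z _)) (trans (cong (z ⁻¹ ∙_) (trans (sym (assoc z x (z ⁻¹))) (trans (cong (_∙ z ⁻¹) (sym e)) (cancelʳ x z)))) refl)
           quotient : ∀ u v → ℭ u ≡ true × ℭ (a ⁻¹ ∙ (u ⁻¹ ∙ g)) ≡ true → ℭ v ≡ true × ℭ (a ⁻¹ ∙ (v ⁻¹ ∙ g)) ≡ true → Central (v ⁻¹ ∙ u)
           quotient u v (cu , cu') (cv , cv') with zero? (vec (v ⁻¹ ∙ u))
           ... | yes z = z
           ... | no n  = ⊥-elim (a-moves (commute-trans (v ⁻¹ ∙ u) y (conjugate a y) n (sym cm) (sym cm')))
             where
             cm : Commute y (v ⁻¹ ∙ u)
             cm = commute-∙ (commute-inv (inC v cv)) (inC u cu)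
             c₂ = a ⁻¹ ∙ (v ⁻¹ ∙ g)
             c₂' = a ⁻¹ ∙ (u ⁻¹ ∙ g)
             e : conjugate a (c₂ ∙ c₂' ⁻¹) ≡ v ⁻¹ ∙ u
             e = trans (cong (_∙ a ⁻¹) (trans (cong (a ∙_) (trans (cong (c₂ ∙_) (trans (inv-∙ (a ⁻¹) _) (cong₂ _∙_ (inv-div u g) (inv-inv a)))) (sym (assoc c₂ (g ⁻¹ ∙ u) a))))
                   (trans (sym (assoc a _ a)) (cong (_∙ a) (trans (sym (assoc a c₂ _)) (cong (_∙ (g ⁻¹ ∙ u)) (cancelˡ′ a (v ⁻¹ ∙ g))))))))
                 (trans (cancelʳ _ a) (trans (assoc (v ⁻¹) g _) (cong (v ⁻¹ ∙_) (cancelˡ′ g u))))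
             cm' : Commute (conjugate a y) (v ⁻¹ ∙ u)
             cm' = subst (Commute (conjugate a y)) e (conj-commute a {y} {c₂ ∙ c₂' ⁻¹} (commute-∙ {y} {c₂} {c₂' ⁻¹} (inC c₂ cv') (commute-inv {y} {c₂'} (inC c₂' cu'))))
       centraliser-count : ℕ
       centraliser-count = count ℭ
       centraliser-count-def : count (λ z → P 12 z ∧ comm y z) ≡ centraliser-count
       centraliser-count-def = count-cong ℭ-def
       -- The map (z, c) ↦ z·a·c on pairs from the centraliser of y is at most two-to-one, because a
       -- moves this centraliser to one that meets it only in the centre.
       centraliser-bound : centraliser-count * centraliser-count ≤ 2 * M
       centraliser-bound = begin
         t * t ≡⟨ ∑-*ʳ elems t _ ⟨
         ∑ᴬ (λ z → 𝟙 (ℭ z) * t) ≡⟨ ∑-cong elems (λ z → trans (cong (𝟙 (ℭ z) *_) (sym (trans (∑-left (z ⁻¹) (λ g → 𝟙 (ℭ (a ⁻¹ ∙ g)))) (∑-left (a ⁻¹) (λ g → 𝟙 (ℭ g)))))) (sym (∑-*ˡ elems (𝟙 (ℭ z)) _))) ⟩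
         ∑ᴬ (λ z → ∑ᴬ (λ g → 𝟙 (ℭ z) * 𝟙 (ℭ (a ⁻¹ ∙ (z ⁻¹ ∙ g))))) ≡⟨ ∑-swap elems elems _ ⟩
         ∑ᴬ (λ g → ∑ᴬ (λ z → 𝟙 (ℭ z) * 𝟙 (ℭ (a ⁻¹ ∙ (z ⁻¹ ∙ g))))) ≤⟨ ∑-mono elems (λ g → ≤-trans (≤-reflexive (∑-cong elems λ z → sym (𝟙-∧ (ℭ z) _))) (bound g (P 25 g) refl)) ⟩
         ∑ᴬ (λ g → 2 * 𝟙 (P 25 g)) ≡⟨ ∑-*ˡ elems 2 _ ⟩
         2 * M ∎
         where
         open ≤-Reasoning
         t = centraliser-count
         supp : ∀ g z → ℭ z ∧ ℭ (a ⁻¹ ∙ (z ⁻¹ ∙ g)) ≡ true → P 25 g ≡ true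
         supp g z e with ∧-true {ℭ z} e
         ... | cz , cz' = trans (cong (P 25) (sym (trans (assoc z a _) (trans (cong (z ∙_) (cancelˡ′ a (z ⁻¹ ∙ g))) (cancelˡ′ z g))))) (P-∙ 13 12 (P-∙ 12 1 (inP z cz) (D⇒P₁ (proj₁ (proj₂ mover)))) (inP _ cz'))
         bound : ∀ g x → P 25 g ≡ x → count (λ z → ℭ z ∧ ℭ (a ⁻¹ ∙ (z ⁻¹ ∙ g))) ≤ 2 * 𝟙 x
         bound g true  _ = two g
         bound g false e = ≤-trans (≤-reflexive (count-0 λ z → ≢true λ h → true≢false (supp g z h) e)) z≤n
     private
       root = cube-root (4 * (M * M))
     -- An upper cube root of 4·M² serves for both kinds of subgroups: t² ≤ 2·M for centralisers
     -- gives t³ ≤ t⁴ ≤ 4·M².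
     β : ℕ
     β = suc (proj₁ root)
     0<M : 0 < M
     0<M = ≤-trans (1≤𝟙 ε∈P) (≤∑ ε (λ g → 𝟙 (P 25 g)))
       where
       up : ∀ n → P n ε ≡ true
       up zero    = P-ε
       up (suc n) = P-mono n (up n)
       ε∈P = up 25
     β³≤ : β * β * β ≤ 8 * (4 * (M * M))
     β³≤ = ≤-trans (*-mono-≤ (*-mono-≤ suc≤ suc≤) suc≤) (≤-trans (≤-reflexive (solveℕ 1 (λ r → # 2 ⊗ r ⊗ (# 2 ⊗ r) ⊗ (# 2 ⊗ r) ⊜ # 8 ⊗ (r ⊗ r ⊗ r)) refl r)) (*-monoʳ-≤ 8 (proj₁ (proj₂ root))))
       where
       r = proj₁ root
       positive : ∀ r → 4 * (M * M) < suc r * suc r * suc r → 1 ≤ r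
       positive zero    lt = ⊥-elim (<-irrefl refl (<-≤-trans lt (≤-trans (*-mono-≤ 0<M 0<M) (m≤m+n _ _))))
       positive (suc _) _  = s≤s z≤n
       suc≤ : suc r ≤ 2 * r
       suc≤ = ≤-trans (≤-reflexive (+-comm 1 r)) (≤-trans (+-monoʳ-≤ r (positive r (proj₂ (proj₂ root)))) (≤-reflexive (cong (r +_) (sym (+-identityʳ r)))))
     borel≤β : ∀ s → count (λ z → P 12 z ∧ fixes z s) ≤ β
     borel≤β s = ≤-trans (≤-reflexive (borel-count-def s)) (<⇒≤ (cubes-< (≤-<-trans (≤-trans (borel-bound s) (*-monoˡ-≤ (M * M) {2} {4} (s≤s (s≤s z≤n)))) (proj₂ (proj₂ root)))))
     centraliser≤β : ∀ y → ¬ Central y → count (λ z → P 12 z ∧ comm y z) ≤ β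
     centraliser≤β y nc = ≤-trans (≤-reflexive (centraliser-count-def y nc)) (<⇒≤ (cubes-< (≤-<-trans (≤-trans (cube≤ t) (≤-trans (*-mono-≤ (centraliser-bound y nc) (centraliser-bound y nc)) (≤-reflexive (solveℕ 1 (λ m → # 2 ⊗ m ⊗ (# 2 ⊗ m) ⊜ # 4 ⊗ (m ⊗ m)) refl M)))) (proj₂ (proj₂ root)))))
       where
       t = centraliser-count y nc
       cube≤ : ∀ t → t * t * t ≤ t * t * (t * t)
       cube≤ zero    = z≤n
       cube≤ (suc t) = *-monoʳ-≤ (suc t * suc t) (m≤m*n (suc t) (suc t))
     module _ (τ : F) where
       private
         opaque
           X : SL → Bool
           X z = P 6 z ∧ Fᶠ._==_ (tr z) τ
           X-def : ∀ z → X z ≡ P 6 z ∧ Fᶠ._==_ (tr z) τ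
           X-def z = refl
         X-P : ∀ z → X z ≡ true → P 6 z ≡ true
         X-P z e = proj₁ (∧-true {P 6 z} (trans (sym (X-def z)) e))
         X-tr : ∀ z → X z ≡ true → Fᶠ._==_ (tr z) τ ≡ true
         X-tr z e = proj₂ (∧-true {P 6 z} (trans (sym (X-def z)) e))
         -- Triples (y, g ∙ y, h ∙ y) from the trace class. There are ξ³ of them, and they are
         -- counted through the pairs (g, h), which lie in D¹².
         W : SL → SL → SL → Bool
         W g h y = X y ∧ (X (g ∙ y) ∧ X (h ∙ y))
         W-parts : ∀ g h y → W g h y ≡ true → X y ≡ true × X (g ∙ y) ≡ true × X (h ∙ y) ≡ true
         W-parts g h y e = proj₁ (∧-true {X y} e) , ∧-true {X (g ∙ y)} (proj₂ (∧-true {X y} e))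
         opaque
           good : SL → SL → Bool
           good g h = count (W g h) ≤ᵇ 2
           good-def : ∀ g h → good g h ≡ (count (W g h) ≤ᵇ 2)
           good-def g h = refl
         quotient-P : ∀ g y → X y ≡ true → X (g ∙ y) ≡ true → P 12 g ≡ true
         quotient-P g y ey eg = trans (cong (P 12) (sym (cancelʳ g y))) (P-∙ 6 6 (X-P (g ∙ y) eg) (P-inv 6 (X-P y ey)))
         not-good : ∀ g h → good g h ≡ false → Commute g h ⊎ ∃ λ s → fixes g s ≡ true × fixes h s ≡ true
         not-good g h e with comm g h in ec | Finite.search finite-Dir (λ s → fixes g s ∧ fixes h s)
         ... | true  | _             = inj₁ (comm-true g h ec)
         ... | false | inj₁ (s , es) = inj₂ (s , ∧-true es)
         ... | false | inj₂ none     = ⊥-elim (<-irrefl refl (<-≤-trans (≤ᵇ-false (trans (sym (good-def g h)) e)) (≤-trans (count-mono traces)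
             (trace-fibre g h τ (λ c → true≢false (comm-intro g h c) ec) (λ s a b → true≢false (∧-intro a b) (none s))))))
           where
           traces : ∀ y → W g h y ≡ true → Fᶠ._==_ (tr y) τ ∧ (Fᶠ._==_ (tr (g ∙ y)) τ ∧ Fᶠ._==_ (tr (h ∙ y)) τ) ≡ true
           traces y w with W-parts g h y w
           ... | a , b , c = ∧-intro (X-tr y a) (∧-intro (X-tr (g ∙ y) b) (X-tr (h ∙ y) c))
       class-count : ℕ
       class-count = count X
       private
         ξ = class-count
         -- A noncentral g fixes at most two directions, so its bad partners lie in one centraliser
         -- and at most two Borel subgroups.
         few-bad : ∀ g → ¬ Central g → ∑ᴬ (λ h → 𝟙 (P 12 h) * 𝟙 (not (good g h))) ≤ 3 * β
         few-bad g nc = begin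
           ∑ᴬ (λ h → 𝟙 (P 12 h) * 𝟙 (not (good g h)))
             ≤⟨ ∑-mono elems (λ h → bound h (P 12 h) (good g h) refl refl) ⟩
           ∑ᴬ (λ h → 𝟙 (P 12 h ∧ comm g h) + ∑ Dirs (λ s → 𝟙 (fixes g s) * 𝟙 (P 12 h ∧ fixes h s)))
             ≡⟨ trans (∑-+ elems _ _) (cong (count (λ h → P 12 h ∧ comm g h) +_) (trans (∑-swap elems Dirs _) (∑-cong Dirs λ s → ∑-*ˡ elems (𝟙 (fixes g s)) _))) ⟩
           count (λ h → P 12 h ∧ comm g h) + ∑ Dirs (λ s → 𝟙 (fixes g s) * count (λ h → P 12 h ∧ fixes h s))
             ≤⟨ +-mono-≤ (centraliser≤β g nc) (≤-trans (∑-mono Dirs λ s → *-monoʳ-≤ (𝟙 (fixes g s)) (borel≤β s)) (≤-reflexive (∑-*ʳ Dirs β (λ s → 𝟙 (fixes g s))))) ⟩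
           β + Finite.count finite-Dir (fixes g) * β ≤⟨ +-monoʳ-≤ β (*-monoˡ-≤ β (few-fixed g nc)) ⟩
           3 * β ∎
           where
           open ≤-Reasoning
           Dirs = Finite.elems finite-Dir
           direction-part : SL → ℕ
           direction-part h = ∑ Dirs (λ s → 𝟙 (fixes g s) * 𝟙 (P 12 h ∧ fixes h s))
           bound : ∀ h x y → P 12 h ≡ x → good g h ≡ y → 𝟙 x * 𝟙 (not y) ≤ 𝟙 (P 12 h ∧ comm g h) + direction-part h
           bound h false y     _  _ = z≤n
           bound h true  true  _  _ = z≤n
           bound h true  false eP e with not-good g h e
           ... | inj₁ c = ≤-trans (1≤𝟙 (∧-intro eP (comm-intro g h c))) (m≤m+n (𝟙 (P 12 h ∧ comm g h)) (direction-part h))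
           ... | inj₂ (s , a , b) = ≤-trans (≤-trans (≤-reflexive (sym (cong₂ (λ x y → 𝟙 x * 𝟙 y) a (∧-intro eP b)))) (Finite.≤∑ finite-Dir s (λ s → 𝟙 (fixes g s) * 𝟙 (P 12 h ∧ fixes h s))))
                                  (m≤n+m (direction-part h) (𝟙 (P 12 h ∧ comm g h)))
         good-part : ∑ᴬ (λ g → ∑ᴬ (λ h → 𝟙 (good g h) * count (W g h))) ≤ 2 * (count (P 12) * count (P 12))
         good-part = ≤-trans (≤-reflexive (∑-cong elems λ g → ∑-cong elems λ h → trans (sym (∑-*ˡ elems (𝟙 (good g h)) _)) (∑-cong elems λ y → sym (𝟙-∧ (good g h) _))))
           (pairs-bound (λ g h y → good g h ∧ W g h y) (P 12) (P 12) supp two)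
           where
           supp : ∀ g h y → good g h ∧ W g h y ≡ true → P 12 g ≡ true × P 12 h ≡ true
           supp g h y e with W-parts g h y (proj₂ (∧-true {good g h} e))
           ... | a , b , c = quotient-P g y a b , quotient-P h y a c
           two : ∀ g h → count (λ y → good g h ∧ W g h y) ≤ 2
           two g h = go (good g h) refl
             where
             go : ∀ b → good g h ≡ b → count (λ y → b ∧ W g h y) ≤ 2
             go true  e = ≤ᵇ-true (trans (sym (good-def g h)) e)
             go false e = ≤-trans (≤-reflexive (∑-0 elems)) z≤n
         -- The at most two central g are charged with the whole trace class, every other g with
         -- 3·β.
         bad-part : ∑ᴬ (λ g → ∑ᴬ (λ h → 𝟙 (not (good g h)) * count (W g h))) ≤ ξ * (ξ * (2 + 3 * β))
         bad-part = begin
           ∑ᴬ (λ g → ∑ᴬ (λ h → 𝟙 (not (good g h)) * count (W g h)))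
             ≡⟨ ∑-cong elems (λ g → ∑-cong elems λ h → trans (sym (∑-*ˡ elems (𝟙 (not (good g h))) _)) (∑-cong elems λ y → split g h y)) ⟩
           ∑ᴬ (λ g → ∑ᴬ (λ h → ∑ᴬ (λ y → 𝟙 (X y) * (𝟙 (X (g ∙ y)) * (𝟙 (X (h ∙ y)) * 𝟙 (not (good g h)))))))
             ≡⟨ trans (∑-cong elems λ g → ∑-swap elems elems _) (∑-swap elems elems _) ⟩
           ∑ᴬ (λ y → ∑ᴬ (λ g → ∑ᴬ (λ h → 𝟙 (X y) * (𝟙 (X (g ∙ y)) * (𝟙 (X (h ∙ y)) * 𝟙 (not (good g h)))))))
             ≡⟨ ∑-cong elems (λ y → trans (∑-cong elems λ g → trans (∑-*ˡ elems (𝟙 (X y)) _) (cong (𝟙 (X y) *_) (∑-*ˡ elems (𝟙 (X (g ∙ y))) _))) (∑-*ˡ elems (𝟙 (X y)) _)) ⟩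
           ∑ᴬ (λ y → 𝟙 (X y) * ∑ᴬ (λ g → 𝟙 (X (g ∙ y)) * ∑ᴬ (λ h → 𝟙 (X (h ∙ y)) * 𝟙 (not (good g h)))))
             ≤⟨ ∑-mono elems (λ y → 𝟙*-≤ (X y) (λ ey → row y ey)) ⟩
           ∑ᴬ (λ y → 𝟙 (X y) * (ξ * (2 + 3 * β)))
             ≡⟨ ∑-*ʳ elems (ξ * (2 + 3 * β)) _ ⟩
           ξ * (ξ * (2 + 3 * β)) ∎
           where
           open ≤-Reasoning
           split : ∀ g h y → 𝟙 (not (good g h)) * 𝟙 (W g h y) ≡ 𝟙 (X y) * (𝟙 (X (g ∙ y)) * (𝟙 (X (h ∙ y)) * 𝟙 (not (good g h))))
           split g h y = trans (cong (𝟙 (not (good g h)) *_) (trans (𝟙-∧ (X y) _) (cong (𝟙 (X y) *_) (𝟙-∧ (X (g ∙ y)) _))))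
             (solveℕ 4 (λ n a b c → n ⊗ (a ⊗ (b ⊗ c)) ⊜ a ⊗ (b ⊗ (c ⊗ n))) refl (𝟙 (not (good g h))) (𝟙 (X y)) (𝟙 (X (g ∙ y))) (𝟙 (X (h ∙ y))))
           cell : ∀ y → X y ≡ true → ∀ g → ∑ᴬ (λ h → 𝟙 (X (h ∙ y)) * 𝟙 (not (good g h))) ≤ 𝟙 (central g) * ξ + 3 * β
           cell y ey g = go (zero? (vec g))
             where
             go : (d : Dec (Central g)) → ∑ᴬ (λ h → 𝟙 (X (h ∙ y)) * 𝟙 (not (good g h))) ≤ 𝟙 (does d) * ξ + 3 * β
             go (yes _) = ≤-trans (∑-mono elems λ h → ≤-trans (*-monoʳ-≤ (𝟙 (X (h ∙ y))) (𝟙≤1 (not (good g h)))) (≤-reflexive (*-identityʳ _)))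
               (≤-trans (≤-reflexive (trans (∑-right y (λ z → 𝟙 (X z))) (sym (+-identityʳ ξ)))) (m≤m+n _ _))
             go (no nc) = ≤-trans (∑-mono elems λ h → *-monoˡ-≤ (𝟙 (not (good g h))) (𝟙-mono {X (h ∙ y)} {P 12 h} (quotient-P h y ey))) (few-bad g nc)
           row : ∀ y → X y ≡ true → ∑ᴬ (λ g → 𝟙 (X (g ∙ y)) * ∑ᴬ (λ h → 𝟙 (X (h ∙ y)) * 𝟙 (not (good g h)))) ≤ ξ * (2 + 3 * β)
           row y ey = begin
             ∑ᴬ (λ g → 𝟙 (X (g ∙ y)) * ∑ᴬ (λ h → 𝟙 (X (h ∙ y)) * 𝟙 (not (good g h))))
               ≤⟨ ∑-mono elems (λ g → *-monoʳ-≤ (𝟙 (X (g ∙ y))) (cell y ey g)) ⟩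
             ∑ᴬ (λ g → 𝟙 (X (g ∙ y)) * (𝟙 (central g) * ξ + 3 * β))
               ≤⟨ ∑-mono elems (λ g → ≤-trans (≤-reflexive (*-distribˡ-+ (𝟙 (X (g ∙ y))) _ _)) (+-monoˡ-≤ _ (𝟙*≤ (X (g ∙ y)) _))) ⟩
             ∑ᴬ (λ g → 𝟙 (central g) * ξ + 𝟙 (X (g ∙ y)) * (3 * β))
               ≡⟨ trans (∑-+ elems _ _) (cong₂ _+_ (∑-*ʳ elems ξ _) (trans (∑-*ʳ elems (3 * β) _) (cong (_* (3 * β)) (∑-right y (λ z → 𝟙 (X z)))))) ⟩
             count central * ξ + ξ * (3 * β) ≤⟨ +-monoˡ-≤ _ (*-monoˡ-≤ ξ count-central) ⟩
             2 * ξ + ξ * (3 * β) ≡⟨ solveℕ 2 (λ x b → # 2 ⊗ x ⊕ x ⊗ (# 3 ⊗ b) ⊜ x ⊗ (# 2 ⊕ # 3 ⊗ b)) refl ξ β ⟩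
             ξ * (2 + 3 * β) ∎
         P12≤M : count (P 12) ≤ M
         P12≤M = count-mono λ g → up 13 g
           where
           up : ∀ k g → P 12 g ≡ true → P (k + 12) g ≡ true
           up zero    g h = h
           up (suc k) g h = P-mono (k + 12) (up k g h)
         cube : ξ * ξ * ξ ≤ 2 * (M * M) + ξ * (ξ * (2 + 3 * β))
         cube = begin
           ξ * ξ * ξ ≡⟨ trans (*-assoc ξ ξ ξ) (trans (sym (∑-*ʳ elems (ξ * ξ) _)) (∑-cong elems λ y → cong (𝟙 (X y) *_)
                (trans (cong₂ _*_ (sym (∑-right y (λ z → 𝟙 (X z)))) (sym (∑-right y (λ z → 𝟙 (X z))))) (∑-* elems elems _ _)))) ⟩
           ∑ᴬ (λ y → 𝟙 (X y) * ∑ᴬ (λ g → ∑ᴬ (λ h → 𝟙 (X (g ∙ y)) * 𝟙 (X (h ∙ y)))))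
             ≡⟨ ∑-cong elems (λ y → trans (sym (∑-*ˡ elems (𝟙 (X y)) _)) (∑-cong elems λ g → trans (sym (∑-*ˡ elems (𝟙 (X y)) _))
                  (∑-cong elems λ h → sym (trans (𝟙-∧ (X y) _) (cong (𝟙 (X y) *_) (𝟙-∧ (X (g ∙ y)) _)))))) ⟩
           ∑ᴬ (λ y → ∑ᴬ (λ g → ∑ᴬ (λ h → 𝟙 (W g h y)))) ≡⟨ trans (∑-swap elems elems _) (∑-cong elems λ g → ∑-swap elems elems _) ⟩
           ∑ᴬ (λ g → ∑ᴬ (λ h → count (W g h)))
             ≡⟨ trans (∑-cong elems λ g → trans (∑-cong elems λ h → halves (good g h) (count (W g h))) (∑-+ elems _ _)) (∑-+ elems _ _) ⟩
           ∑ᴬ (λ g → ∑ᴬ (λ h → 𝟙 (good g h) * count (W g h))) + ∑ᴬ (λ g → ∑ᴬ (λ h → 𝟙 (not (good g h)) * count (W g h)))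
             ≤⟨ +-mono-≤ (≤-trans good-part (*-monoʳ-≤ 2 (*-mono-≤ P12≤M P12≤M))) bad-part ⟩
           2 * (M * M) + ξ * (ξ * (2 + 3 * β)) ∎
           where
           open ≤-Reasoning
           halves : ∀ b n → n ≡ 𝟙 b * n + 𝟙 (not b) * n
           halves true  n = sym (trans (+-identityʳ _) (+-identityʳ _))
           halves false n = sym (+-identityʳ _)
       M≲ : M * M ≲[ 3250 ] α * α
       M≲ = ≲-* (P-size 25) (P-size 25)
       -- Either ξ is so large against β that half of ξ³ comes from good pairs, and ξ³ ≤ 4·M²; or ξ
       -- ≤ 10·β, and β³ is again of the order of M². The exponent 3250 is twice the 25·65 in the
       -- size of D²⁵.
       class-bound : class-count * class-count * class-count ≲[ 3260 ] α * α
       class-bound with ≤-<-connex (2 * (2 + 3 * β)) ξ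
       ... | inj₁ le = ≲-weaken (≤ᵇ⇒≤ 3252 3260 _) (≤-≲ large (≲-4 (≲-weaken (n≤1+n 3250) M≲)))
         where
         large : ξ * ξ * ξ ≤ 4 * (M * M)
         large = +-cancelʳ-≤ (ξ * ξ * ξ) _ _ (begin
           ξ * ξ * ξ + ξ * ξ * ξ ≡⟨ cong (ξ * ξ * ξ +_) (+-identityʳ _) ⟨
           2 * (ξ * ξ * ξ) ≤⟨ *-monoʳ-≤ 2 cube ⟩
           2 * (2 * (M * M) + ξ * (ξ * (2 + 3 * β))) ≡⟨ solveℕ 3 (λ m x b → # 2 ⊗ (# 2 ⊗ m ⊕ x ⊗ (x ⊗ b)) ⊜ # 4 ⊗ m ⊕ x ⊗ x ⊗ (# 2 ⊗ b)) refl (M * M) ξ (2 + 3 * β) ⟩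
           4 * (M * M) + ξ * ξ * (2 * (2 + 3 * β)) ≤⟨ +-monoʳ-≤ (4 * (M * M)) (*-monoʳ-≤ (ξ * ξ) le) ⟩
           4 * (M * M) + ξ * ξ * ξ ∎)
           where open ≤-Reasoning
       ... | inj₂ lt = ≲-weaken (≤ᵇ⇒≤ 3259 3260 _) (≤-≲ small (≲-4 (≲-4 (≲-4 (≲-4 (≲-4 (≲-4 (≲-4 (≲-4 (≲-weaken (n≤1+n 3250) M≲))))))))))
         where
         ξ≤ : ξ ≤ 10 * β
         ξ≤ = ≤-trans (<⇒≤ lt) (≤-trans (≤-reflexive (solveℕ 1 (λ b → # 2 ⊗ (# 2 ⊕ # 3 ⊗ b) ⊜ # 4 ⊕ # 6 ⊗ b) refl β)) (≤-trans (+-monoˡ-≤ (6 * β) (*-monoʳ-≤ 4 {1} {β} (s≤s z≤n))) (≤-reflexive (solveℕ 1 (λ b → # 4 ⊗ b ⊕ # 6 ⊗ b ⊜ # 10 ⊗ b) refl β))))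
         small : ξ * ξ * ξ ≤ 4 * (4 * (4 * (4 * (4 * (4 * (4 * (4 * (M * M))))))))
         small = ≤-trans (*-mono-≤ (*-mono-≤ ξ≤ ξ≤) ξ≤) (≤-trans (≤-reflexive (solveℕ 1 (λ b → # 10 ⊗ b ⊗ (# 10 ⊗ b) ⊗ (# 10 ⊗ b) ⊜ # 1000 ⊗ (b ⊗ b ⊗ b)) refl β))
           (≤-trans (*-monoʳ-≤ 1000 β³≤) (≤-trans (≤-reflexive (solveℕ 1 (λ m → # 1000 ⊗ (# 8 ⊗ (# 4 ⊗ m)) ⊜ # 32000 ⊗ m) refl (M * M)))
             (≤-trans (*-monoˡ-≤ (M * M) (≤ᵇ⇒≤ 32000 65536 _)) (≤-reflexive (solveℕ 1 (λ m → # 65536 ⊗ m ⊜ # 4 ⊗ (# 4 ⊗ (# 4 ⊗ (# 4 ⊗ (# 4 ⊗ (# 4 ⊗ (# 4 ⊗ (# 4 ⊗ m)))))))) refl (M * M)))))))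
       class-count-def : class-count ≡ count (λ z → P 6 z ∧ Fᶠ._==_ (tr z) τ)
       class-count-def = count-cong X-def

  -- The pivot argument: a set without growth fills the group

  module Pivot where
   open 𝓕 using (F; p; 0#; 1#; *-zero; sub-zero; zero-sub; solve; _:=_; _:+_; _:*_; _:-_; :-_; :0; :1; module Fᶠ)
   open SL2
   open SL2Count
   open 𝓖
   open import Data.Nat using (_+_; _*_; _^_; >-nonZero)
   open import Data.Nat.Properties hiding (_≟_; *-zero)
   open Arith
   open Sums hiding (interchange)
   open 𝓒
   open 𝓑 using (quotientSet)
   open 𝓠
   open Helfgott
   module Filling (A : SL → Bool) (0<α : 0 < count A) (few-quotients : count (quotientSet A) ≲[ 32 ] count A)
     (escape′ : Escapes A 0<α few-quotients) where
     open PopularQuotients A 0<α few-quotients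
     open Growth A 0<α few-quotients escape′
     torus-count : SL → ℕ
     torus-count z = count (λ d → P 2 d ∧ comm z d)
     -- Conjugating z by `D` gives elements of D⁶ with the trace of z, and conjugators with the same
     -- result have a quotient in D² that commutes with z.
     orbit-stabiliser : ∀ z → P 4 z ≡ true → count D ≤ torus-count z * class-count (tr z)
     orbit-stabiliser z pz = ≤-trans (count-fibre-≤ (FiniteGroup.finite SL₂) (FiniteGroup.finite SL₂) (λ a → conjugate a z) D (λ y → P 6 y ∧ Fᶠ._==_ (tr y) (tr z)) (torus-count z)
         (λ a da → ∧-intro (P-∙ 5 1 (P-∙ 1 4 (D⇒P₁ da) pz) (P-inv 1 (D⇒P₁ da))) (does-intro (_ Fᶠ.≟ _) (tr-conj a z)))
         (λ y _ → fibre y))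
       (≤-reflexive (cong (torus-count z *_) (sym (class-count-def (tr z)))))
       where
       fibre : ∀ y → count (λ a → D a ∧ (conjugate a z == y)) ≤ torus-count z
       fibre y with search (λ a → D a ∧ (conjugate a z == y))
       ... | inj₂ none = ≤-trans (≤-reflexive (count-0 none)) z≤n
       ... | inj₁ (b , eb) = ≤-trans (count-mono λ a ea → ∧-intro (P-∙ 1 1 (P-inv 1 (D⇒P₁ (proj₁ (∧-true {D b} eb)))) (D⇒P₁ (proj₁ (∧-true {D a} ea))))
             (comm-intro z (b ⁻¹ ∙ a) (quotient a (trans (does-true (conjugate a z ≟ y) (proj₂ (∧-true {D a} ea))) (sym (does-true (conjugate b z ≟ y) (proj₂ (∧-true {D b} eb))))))))
           (≤-reflexive (∑-left (b ⁻¹) (λ d → 𝟙 (P 2 d ∧ comm z d))))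
         where
         quotient : ∀ a → conjugate a z ≡ conjugate b z → Commute z (b ⁻¹ ∙ a)
         quotient a e = sym (trans (sym (cancelʳ′ (b ⁻¹ ∙ a ∙ z) (b ⁻¹ ∙ a))) (cong (_∙ (b ⁻¹ ∙ a)) (trans (conj-∙ (b ⁻¹) a z) (trans (cong (conjugate (b ⁻¹)) e) (conj-inv b z)))))
     cubes : ∀ {a b c} → a ≲[ c ] b → a * a * a ≲[ c + c + c ] b * b * b
     cubes h = ≲-* (≲-* h h) h
     α²>0 : 0 < α * α
     α²>0 = *-mono-< 0<α 0<α
     -- `D` has about α elements at least and a trace class about the power 2/3 of α at most, which
     -- leaves the power 1/3 of α for the centraliser.
     torus-large : ∀ z → P 4 z ≡ true → α ≲[ 3359 ] torus-count z * torus-count z * torus-count z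
     torus-large z pz = ≲-cancel α²>0 (≤-≲ (≤-reflexive (trans (*-comm α (α * α)) refl)) (≲-trans {b = count D * count D * count D} {c = 99} {c' = 3260} (cubes α≲D)
       (≤-≲ (≤-trans (*-mono-≤ (*-mono-≤ os os) os) (≤-reflexive (solveℕ 2 (λ t x → t ⊗ x ⊗ (t ⊗ x) ⊗ (t ⊗ x) ⊜ t ⊗ t ⊗ t ⊗ (x ⊗ x ⊗ x)) refl t ξ)))
         (≲-* (≲-≤ {t * t * t} ≤-refl) (class-bound (tr z))))))
       where
       os = orbit-stabiliser z pz
       t = torus-count z
       ξ = class-count (tr z)
     module _ (large : ¬ (α ≲[ 3400 ] 1)) where
       many : ∀ z → P 4 z ≡ true → 3 ≤ torus-count z
       many z pz with ≤-<-connex (torus-count z) 2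
       ... | inj₂ lt = lt
       ... | inj₁ le = ⊥-elim (large (≲-weaken (≤ᵇ⇒≤ 3361 3400 _) (≲-trans {c = 3359} {c' = 2} (≲-≤ʳ (torus-large z pz) (*-mono-≤ (*-mono-≤ le le) le)) (≤-≲ (≤ᵇ⇒≤ 8 16 _) (≲-4 (≲-4 (≲-≤ {1} ≤-refl)))))))
       noncentral-in-torus : ∀ z → P 4 z ≡ true → ∃ λ d → P 2 d ≡ true × Commute z d × ¬ Central d
       noncentral-in-torus z pz = go (count-<∃ {λ d → P 2 d ∧ comm z d} {central} (≤-trans (s≤s count-central) (many z pz)))
         where
         go : ∃ (λ d → (P 2 d ∧ comm z d) ≡ true × central d ≡ false) → ∃ λ d → P 2 d ≡ true × Commute z d × ¬ Central d
         go (d , e , c) = d , proj₁ (∧-true {P 2 d} e) , comm-true z d (proj₂ (∧-true {P 2 d} e)) , λ h → true≢false (does-intro (zero? (vec d)) h) c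
       opaque
         -- The pivot condition: the centraliser of z contains a noncentral element of D².
         involved : SL → Bool
         involved z = any (λ d → P 2 d ∧ (not (central d) ∧ comm z d)) elems
         involved-intro : ∀ z d → P 2 d ≡ true → ¬ Central d → Commute z d → involved z ≡ true
         involved-intro z d p nc c = any-intro (λ d → P 2 d ∧ (not (central d) ∧ comm z d)) d (∧-intro p (∧-intro (not-intro (does-elim (zero? (vec d)) nc)) (comm-intro z d c)))
         involved-elim : ∀ z → involved z ≡ true → ∃ λ d → P 2 d ≡ true × ¬ Central d × Commute z d
         involved-elim z h = go (any-true (λ d → P 2 d ∧ (not (central d) ∧ comm z d)) elems h)
           where
           go : ∃ (λ d → (P 2 d ∧ (not (central d) ∧ comm z d)) ≡ true) → ∃ λ d → P 2 d ≡ true × ¬ Central d × Commute z d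
           go (d , e) = d , proj₁ (∧-true {P 2 d} e) , (λ z → true≢false (does-intro (zero? (vec d)) z) (not-true (proj₁ (∧-true {not (central d)} (proj₂ (∧-true {P 2 d} e)))))) ,
             comm-true z d (proj₂ (∧-true {not (central d)} (proj₂ (∧-true {P 2 d} e))))
       -- If z commutes with a noncentral d of D², the conjugate of d lies in D⁴, and
       -- `noncentral-in-torus` finds in its centraliser a noncentral element of D² again. The
       -- exponent returns to 2, so the set of involved elements is invariant under `D`; its
       -- stabiliser is a subgroup containing `D` and hence is all of SL₂.
       involved-conj : ∀ a z → D a ≡ true → involved z ≡ true → involved (conjugate a z) ≡ true
       involved-conj a z da h = go (involved-elim z h)
         where
         go : ∃ (λ d → P 2 d ≡ true × ¬ Central d × Commute z d) → involved (conjugate a z) ≡ true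
         go (d , p , nc , c) = go′ (noncentral-in-torus (conjugate a d) (P-∙ 3 1 (P-∙ 1 2 (D⇒P₁ da) p) (P-inv 1 (D⇒P₁ da))))
           where
           go′ : ∃ (λ d' → P 2 d' ≡ true × Commute (conjugate a d) d' × ¬ Central d') → involved (conjugate a z) ≡ true
           go′ (d' , p' , c' , nc') = involved-intro (conjugate a z) d' p' nc' (commute-trans (conjugate a d) (conjugate a z) d' (noncentral-conj a d nc) (sym (conj-commute a c)) c')
       D-stabilises : ∀ a → D a ≡ true → Stab involved a ≡ true
       D-stabilises a da = Stab-intro involved a λ z → ≡-iff (involved-conj a z da)
         (λ h → trans (cong involved (sym (conj-inv a z))) (involved-conj (a ⁻¹) (conjugate a z) (trans (D-inv a) da) h))
       opaque
         all-stabilise : ∀ h → Stab involved h ≡ true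
         all-stabilise h with Stab involved h in e
         ... | true  = refl
         ... | false = ⊥-elim (escape′ (Stab involved) (Stab-subgroup involved) (h , e) ε ε λ d dd →
                         inj₁ (trans (cong (Stab involved) (trans (cong (_∙ d) inv-ε) (idˡ d))) (D-stabilises d dd)))
       regular : SL → Bool
       regular g = not (Fᶠ._==_ (tr g 𝓕.* tr g) four)
       -- Otherwise `D` consists of elements of trace 2 or -2 and lies in two trace classes, each of
       -- about the power 2/3 of α.
       irregular⇒small : (∀ g → D g ∧ regular g ≡ false) → α ≲[ 3361 ] 1
       irregular⇒small none = cancel-α² (≤-≲ (≤-reflexive (*-comm α (α * α))) (≲-trans {b = count D * count D * count D} {c = 99} {c' = 3262} (cubes α≲D) cube-D))
         where
         two : F
         two = 1# 𝓕.+ 1#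
         ξ₁ = class-count two
         ξ₂ = class-count (𝓕.- two)
         cancel-α² : α * (α * α) ≲[ 3361 ] α * α → α ≲[ 3361 ] 1
         cancel-α² h = ≲-cancel α²>0 (≲-≤ʳ h (≤-reflexive (sym (*-identityˡ (α * α)))))
         trace±2 : ∀ g → D g ≡ true → (tr g ≡ two) ⊎ (tr g ≡ 𝓕.- two)
         trace±2 g dg with *-zero (trans (solve 1 (λ t → (t :- (:1 :+ :1)) :* (t :+ (:1 :+ :1)) := t :* t :- (:1 :+ :1 :+ :1 :+ :1)) refl (tr g))
             (zero-sub (square (trans (cong (_∧ regular g) (sym dg)) (none g)))))
           where
           square : regular g ≡ false → tr g 𝓕.* tr g ≡ four
           square e = does-true ((tr g 𝓕.* tr g) Fᶠ.≟ four) (not-false e)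
             where
             not-false : ∀ {b} → not b ≡ false → b ≡ true
             not-false {true} _ = refl
         ... | inj₁ e = inj₁ (sub-zero e)
         ... | inj₂ e = inj₂ (sub-zero (trans (solve 1 (λ t → t :- (:- (:1 :+ :1)) := t :+ (:1 :+ :1)) refl (tr g)) e))
         lift : ∀ g → D g ≡ true → P 6 g ≡ true
         lift g dg = P-mono 5 (P-mono 4 (P-mono 3 (P-mono 2 (P-mono 1 (D⇒P₁ dg)))))
         D≤ : count D ≤ ξ₁ + ξ₂
         D≤ = ≤-trans (∑-mono elems λ g → pointwise g (D g) refl) (≤-reflexive (trans (∑-+ elems _ _) (cong₂ _+_ (sym (class-count-def two)) (sym (class-count-def (𝓕.- two))))))
           where
           pointwise : ∀ g b → D g ≡ b → 𝟙 b ≤ 𝟙 (P 6 g ∧ Fᶠ._==_ (tr g) two) + 𝟙 (P 6 g ∧ Fᶠ._==_ (tr g) (𝓕.- two))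
           pointwise g false _ = z≤n
           pointwise g true dg with trace±2 g dg
           ... | inj₁ e = ≤-trans (1≤𝟙 (∧-intro (lift g dg) (does-intro (_ Fᶠ.≟ _) e))) (m≤m+n _ _)
           ... | inj₂ e = ≤-trans (1≤𝟙 (∧-intro (lift g dg) (does-intro (_ Fᶠ.≟ _) e))) (m≤n+m _ _)
         cube-max : ∀ x y → (x + y) * (x + y) * (x + y) ≤ 4 * (x * x * x + y * y * y)
         cube-max x y with ≤-total x y
         ... | inj₁ le with m≤n⇒∃[o]m+o≡n le
         ...   | k , refl = ≤-trans (m≤m+n _ (6 * x * k * k + 3 * k * k * k)) (≤-reflexive (solveℕ 2 (λ x k →
                 (x ⊕ (x ⊕ k)) ⊗ (x ⊕ (x ⊕ k)) ⊗ (x ⊕ (x ⊕ k)) ⊕ (# 6 ⊗ x ⊗ k ⊗ k ⊕ # 3 ⊗ k ⊗ k ⊗ k) ⊜ # 4 ⊗ (x ⊗ x ⊗ x ⊕ (x ⊕ k) ⊗ (x ⊕ k) ⊗ (x ⊕ k))) refl x k))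
         cube-max x y | inj₂ le with m≤n⇒∃[o]m+o≡n le
         ...   | k , refl = ≤-trans (m≤m+n _ (6 * y * k * k + 3 * k * k * k)) (≤-reflexive (solveℕ 2 (λ x k →
                 ((x ⊕ k) ⊕ x) ⊗ ((x ⊕ k) ⊕ x) ⊗ ((x ⊕ k) ⊕ x) ⊕ (# 6 ⊗ x ⊗ k ⊗ k ⊕ # 3 ⊗ k ⊗ k ⊗ k) ⊜ # 4 ⊗ ((x ⊕ k) ⊗ (x ⊕ k) ⊗ (x ⊕ k) ⊕ x ⊗ x ⊗ x)) refl y k))
         sum-≲ : ∀ {x y c b} → x ≲[ c ] b → y ≲[ c ] b → x + y ≲[ suc c ] b
         sum-≲ {x} {y} {c} {b} (mk h) (mk h') = ≤-≲ (+-mono-≤ h h') (≤-≲ (≤-reflexive (cong (K ^ c * b +_) (sym (+-identityʳ _)))) (≲-2 (mk ≤-refl)))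
         cube-D : count D * count D * count D ≲[ 3262 ] α * α
         cube-D = ≤-≲ (≤-trans (*-mono-≤ (*-mono-≤ D≤ D≤) D≤) (cube-max ξ₁ ξ₂)) (≲-4 (sum-≲ (class-bound two) (class-bound (𝓕.- two))))
       opaque
         regular-element : ∃ λ g → D g ≡ true × regular g ≡ true
         regular-element = go (search (λ g → D g ∧ regular g))
           where
           go : ∃ (λ g → D g ∧ regular g ≡ true) ⊎ (∀ g → D g ∧ regular g ≡ false) → ∃ λ g → D g ≡ true × regular g ≡ true
           go (inj₁ (g , e)) = g , ∧-true e
           go (inj₂ none) = ⊥-elim (large (≲-weaken (≤ᵇ⇒≤ 3361 3400 _) (irregular⇒small none)))
       g₀ : SL
       g₀ = proj₁ regular-element
       disc-g₀ : ∀ k → tr k ≡ tr g₀ → ¬ (disc (vec k) ≡ 0#)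
       disc-g₀ k e z = true≢false (does-intro (_ Fᶠ.≟ _) (sub-zero (trans (sym (trans (disc-tr k) (cong (λ t → t 𝓕.* t 𝓕.- four) e))) z))) (not-true (proj₂ (proj₂ regular-element)))
       regular-noncentral : ∀ k → tr k ≡ tr g₀ → ¬ Central k
       regular-noncentral k e (x , y , z) = disc-g₀ k e (vanish (vec k) (x , y , z))
         where
         vanish : ∀ v → Zero v → disc v ≡ 0#
         vanish v (refl , refl , refl) = solve 0 (:0 :* :0 :+ (:1 :+ :1 :+ :1 :+ :1) :* (:0 :* :0) := :0) refl
       conjugates-involved : ∀ h → involved (conjugate h g₀) ≡ true
       conjugates-involved h = trans (sym (Stab-elim involved h (all-stabilise h) g₀))
         (involved-intro g₀ g₀ (P-mono 1 (D⇒P₁ (proj₁ (proj₂ regular-element)))) (regular-noncentral g₀ refl) refl)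
       conjugate-torus : ∀ h → ∃ λ d → P 4 d ≡ true × torus-count d ≤ torus-count (conjugate h g₀)
       conjugate-torus h = go (involved-elim (conjugate h g₀) (conjugates-involved h))
         where
         go : ∃ (λ d → P 2 d ≡ true × ¬ Central d × Commute (conjugate h g₀) d) → ∃ λ d → P 4 d ≡ true × torus-count d ≤ torus-count (conjugate h g₀)
         go (d , p , nc , c) = d , P-mono 3 (P-mono 2 p) , count-mono λ x e → ∧-intro (proj₁ (∧-true {P 2 x} e))
             (comm-intro (conjugate h g₀) x (commute-trans d (conjugate h g₀) x nc (sym c) (comm-true d x (proj₂ (∧-true {P 2 x} e)))))
       private
         k₀ : SL → SL
         k₀ h = conjugate h g₀
         tr-k₀ : ∀ h → tr (k₀ h) ≡ tr g₀
         tr-k₀ h = tr-conj h g₀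
         -- The minimum over all conjugates is a single lower bound for all of their tori, and being
         -- attained it is itself bounded below by `torus-large`.
         smallest = minimiser (λ h → torus-count (k₀ h))
         q₀ = torus-count (k₀ (proj₁ smallest))
         C : SL → SL → Bool
         C h d = P 2 d ∧ (not (central d) ∧ comm (k₀ h) d)
         α≲q₀³ : α ≲[ 3359 ] q₀ * q₀ * q₀
         α≲q₀³ = go (conjugate-torus (proj₁ smallest))
           where
           go : ∃ (λ d → P 4 d ≡ true × torus-count d ≤ q₀) → α ≲[ 3359 ] q₀ * q₀ * q₀
           go (d , p , le) = ≲-≤ʳ (torus-large d p) (*-mono-≤ (*-mono-≤ le le) le)
         -- The torus has at least three elements of D², of which at most two are central, so at
         -- least a third of them are noncentral.
         q₀≤ : ∀ h → q₀ ≤ 3 * count (C h)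
         q₀≤ h = go (conjugate-torus h)
           where
           triple : ∀ {m n} → 3 ≤ m → m ≤ n + count central → m ≤ 3 * n
           triple {m} {zero}  lo hi = ⊥-elim (<-irrefl refl (≤-trans lo (≤-trans hi count-central)))
           triple {m} {suc n} lo hi = ≤-trans hi (≤-trans (+-monoʳ-≤ (suc n) count-central) (≤-trans (m≤m+n (suc n + 2) (n + n)) (≤-reflexive (solveℕ 1 (λ n → # 1 ⊕ n ⊕ # 2 ⊕ (n ⊕ n) ⊜ # 3 ⊗ (# 1 ⊕ n)) refl n))))
           split : ∀ x → 𝟙 (P 2 x ∧ comm (k₀ h) x) ≤ 𝟙 (C h x) + 𝟙 (central x)
           split x = cases (P 2 x) (comm (k₀ h) x) (central x)
             where
             cases : ∀ a b c → 𝟙 (a ∧ b) ≤ 𝟙 (a ∧ (not c ∧ b)) + 𝟙 c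
             cases false b     c     = z≤n
             cases true  false c     = z≤n
             cases true  true  true  = s≤s z≤n
             cases true  true  false = s≤s z≤n
           go : ∃ (λ d → P 4 d ≡ true × torus-count d ≤ torus-count (k₀ h)) → q₀ ≤ 3 * count (C h)
           go (d , p , le) = ≤-trans (proj₂ smallest h) (triple (≤-trans (many d p) le) (≤-trans (∑-mono elems split) (≤-reflexive (∑-+ elems _ _))))
         centraliser-size : count (comm g₀) ≤ 2 * p
         centraliser-size = ≤-trans (count-fibre-≤ (FiniteGroup.finite SL₂) 𝓕.finite tr (comm g₀) (λ _ → true) 2 (λ _ _ → refl)
           (λ t _ → few-in-centraliser g₀ t (regular-noncentral g₀ refl) (disc-g₀ g₀ refl))) (≤-reflexive (cong (2 *_) 𝓕.order))
         conjugators : ∀ k → count (λ h → k₀ h == k) ≤ 2 * p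
         conjugators k with search (λ h → k₀ h == k)
         ... | inj₂ none = ≤-trans (≤-reflexive (count-0 none)) z≤n
         ... | inj₁ (b , eb) = ≤-trans (count-mono λ a ea → comm-intro g₀ (b ⁻¹ ∙ a) (quotient a (trans (does-true (k₀ a ≟ k) ea) (sym (does-true (k₀ b ≟ k) eb)))))
             (≤-trans (≤-reflexive (∑-left (b ⁻¹) (λ d → 𝟙 (comm g₀ d)))) centraliser-size)
           where
           quotient : ∀ a → k₀ a ≡ k₀ b → Commute g₀ (b ⁻¹ ∙ a)
           quotient a e = sym (trans (sym (cancelʳ′ (b ⁻¹ ∙ a ∙ g₀) (b ⁻¹ ∙ a))) (cong (_∙ (b ⁻¹ ∙ a)) (trans (conj-∙ (b ⁻¹) a g₀) (trans (cong (conjugate (b ⁻¹)) e) (conj-inv b g₀)))))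
         -- d commutes with at most two elements with the trace of g₀, and each of them comes from
         -- at most 2·p conjugators.
         commuting-conjugates : ∀ d → ¬ Central d → count (λ h → comm (k₀ h) d) ≤ 2 * p * 2
         commuting-conjugates d nc with search (λ h → comm (k₀ h) d)
         ... | inj₂ none = ≤-trans (≤-reflexive (count-0 none)) z≤n
         ... | inj₁ (b , eb) = ≤-trans (count-fibre-≤ (FiniteGroup.finite SL₂) (FiniteGroup.finite SL₂) k₀ (λ h → comm (k₀ h) d) (λ k → comm d k ∧ Fᶠ._==_ (tr k) (tr g₀)) (2 * p)
               (λ h e → ∧-intro (comm-intro d (k₀ h) (sym (comm-true (k₀ h) d e))) (does-intro (_ Fᶠ.≟ _) (tr-k₀ h)))
               (λ k _ → ≤-trans (count-mono λ h e → proj₂ (∧-true {comm (k₀ h) d} e)) (conjugators k)))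
             (*-monoʳ-≤ (2 * p) (few-in-centraliser d (tr g₀) nc (disc-d (proportional (vec d) (vec (k₀ b)) nc (par-sym _ _ (commute⇒par (k₀ b) d (comm-true (k₀ b) d eb)))))))
           where
           disc-d : ∃ (λ β → vec (k₀ b) ∝ β · vec d) → ¬ (disc (vec d) ≡ 0#)
           disc-d (l , pr) z = disc-g₀ (k₀ b) (tr-k₀ b) (trans (disc-scaled (vec d) (vec (k₀ b)) l pr) (trans (cong (l 𝓕.* l 𝓕.*_) z) (𝓕.zeroʳ _)))
         order = ∑ elems (λ _ → 1)
         -- Pairs (h, d) with d a noncentral element of D² that commutes with the conjugate of g₀ by
         -- h: each h has at least q₀/3 of them, each d at most 4·p.
         double-count : order * q₀ ≤ 12 * (p * count (P 2))
         double-count = begin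
           order * q₀ ≡⟨ trans (sym (∑-*ʳ elems q₀ _)) (∑-cong elems λ _ → +-identityʳ q₀) ⟩
           ∑ᴬ (λ h → q₀) ≤⟨ ∑-mono elems q₀≤ ⟩
           ∑ᴬ (λ h → 3 * count (C h)) ≡⟨ ∑-*ˡ elems 3 _ ⟩
           3 * ∑ᴬ (λ h → count (C h)) ≡⟨ cong (3 *_) (trans (∑-swap elems elems _) (∑-cong elems λ d → trans (∑-cong elems λ h → trans (𝟙-∧ (P 2 d) _) (cong (𝟙 (P 2 d) *_) (𝟙-∧ (not (central d)) _))) (trans (∑-*ˡ elems (𝟙 (P 2 d)) _) (cong (𝟙 (P 2 d) *_) (∑-*ˡ elems (𝟙 (not (central d))) _))))) ⟩
           3 * ∑ᴬ (λ d → 𝟙 (P 2 d) * (𝟙 (not (central d)) * count (λ h → comm (k₀ h) d))) ≤⟨ *-monoʳ-≤ 3 (∑-mono elems λ d → *-monoʳ-≤ (𝟙 (P 2 d)) (cell d (zero? (vec d)))) ⟩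
           3 * ∑ᴬ (λ d → 𝟙 (P 2 d) * (2 * p * 2)) ≡⟨ cong (3 *_) (∑-*ʳ elems (2 * p * 2) _) ⟩
           3 * (count (P 2) * (2 * p * 2)) ≡⟨ solveℕ 2 (λ c p → # 3 ⊗ (c ⊗ (# 2 ⊗ p ⊗ # 2)) ⊜ # 12 ⊗ (p ⊗ c)) refl (count (P 2)) p ⟩
           12 * (p * count (P 2)) ∎
           where
           open ≤-Reasoning
           cell : ∀ d (c : Dec (Central d)) → 𝟙 (not (does c)) * count (λ h → comm (k₀ h) d) ≤ 2 * p * 2
           cell d (yes _) = z≤n
           cell d (no nc) = ≤-trans (≤-reflexive (+-identityʳ _)) (commuting-conjugates d nc)
         p>0 : 0 < p
         p>0 = ≤-trans (s≤s z≤n) 2<p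
         p²q₀≤ : p * p * q₀ ≤ 24 * count (P 2)
         p²q₀≤ = *-cancelˡ-≤ p {{>-nonZero p>0}} (begin
           p * (p * p * q₀)             ≡⟨ *-assoc p (p * p) q₀ ⟨
           p * (p * p) * q₀             ≤⟨ *-monoˡ-≤ q₀ order-SL₂ ⟩
           2 * order * q₀               ≡⟨ *-assoc 2 order q₀ ⟩
           2 * (order * q₀)             ≤⟨ *-monoʳ-≤ 2 double-count ⟩
           2 * (12 * (p * count (P 2))) ≡⟨ solveℕ 2 (λ p c → # 2 ⊗ (# 12 ⊗ (p ⊗ c)) ⊜ p ⊗ (# 24 ⊗ c)) refl p (count (P 2)) ⟩
           p * (24 * count (P 2))       ∎)
           where open ≤-Reasoning
         24P≲ : 24 * count (P 2) ≲[ 133 ] α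
         24P≲ = ≤-≲ (≤-trans (*-monoˡ-≤ (count (P 2)) (≤ᵇ⇒≤ 24 64 _)) (≤-reflexive (solveℕ 1 (λ c → # 64 ⊗ c ⊜ # 4 ⊗ (# 4 ⊗ (# 4 ⊗ c))) refl (count (P 2))))) (≲-4 (≲-4 (≲-4 (P-size 2))))
       -- Up to powers of `K`, p²·q₀ is at most α and q₀³ is at least α; cubing the first gives p⁶·α
       -- below α³. The exponent 3758 = 3359 + 399 is rounded up to 3800 and halved by the square
       -- root.
       fills : p * (p * p) ≲[ 1900 ] α
       fills = ≲-sqrt 1900 (≲-weaken (≤ᵇ⇒≤ 3758 3800 _) (≲-cancel 0<α (≤-≲ (≤-reflexive (*-comm (p * (p * p) * (p * (p * p))) α))
         (≲-≤ʳ (≲-trans {b = q₀ * q₀ * q₀ * (p * (p * p) * (p * (p * p)))} {c = 3359} {c' = 399} (≲-* α≲q₀³ (≲-≤ {p * (p * p) * (p * (p * p))} ≤-refl))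
           (≤-≲ (≤-reflexive (solveℕ 2 (λ q p → q ⊗ q ⊗ q ⊗ (p ⊗ (p ⊗ p) ⊗ (p ⊗ (p ⊗ p))) ⊜ p ⊗ p ⊗ q ⊗ (p ⊗ p ⊗ q) ⊗ (p ⊗ p ⊗ q)) refl q₀ p))
             (≤-≲ (*-mono-≤ (*-mono-≤ p²q₀≤ p²q₀≤) p²q₀≤) (cubes 24P≲))))
           ≤-refl))))

  -- Large energy forces S to fill SL₂

  module Flattening where
   open 𝓕 using (p)
   open SL2
   open 𝓖
   open import Data.Nat using (_*_; _^_; >-nonZero)
   open import Data.Nat.Properties hiding (_≟_)
   open 𝓒
   open 𝓑
   open 𝓠
   open Helfgott
   open Pivot
   -- The exponent 39 is one more than the 38 needed in `escape`, to make the inequality there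
   -- strict; 3404 is the 3400 demanded of the dense part of S plus the 4 lost in passing to it.
   module _ (S : SL → Bool) (S-sym : ∀ g → S g ≡ S (g ⁻¹))
     (sparse : ∀ H → IsSubgroup H → (∃ λ g → H g ≡ false) → ∀ x → K ^ 39 * count (λ y → S y ∧ H (x ⁻¹ ∙ y)) ≤ count S)
     (big : ¬ (count S ≲[ 3404 ] 1)) (energetic : count S * count S * count S ≤ K * energy S) where
     private
       N = count S
       0<N : 0 < N
       0<N = ≮0⇒ λ z → big (≤-≲ (≤-trans (≤-reflexive z) z≤n) (mk ≤-refl))
         where
         ≮0⇒ : ∀ {n} → ¬ (n ≡ 0) → 0 < n
         ≮0⇒ {zero} h with () ← h refl
         ≮0⇒ {suc n} h = s≤s z≤n
       from-dense-part : (A : SL → Bool) → (∀ g → A g ≡ true → S g ≡ true) → N ≲[ 4 ] count A → count (quotientSet A) ≲[ 32 ] count A → p * (p * p) ≲[ 1900 ] N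
       from-dense-part A A⊂S N≲A few = ≲-≤ʳ (fills (λ h → big (≲-trans N≲A h))) (count-mono A⊂S)
         where
         0<α : 0 < count A
         0<α = positive (count A) refl
           where
           positive : ∀ a → count A ≡ a → 0 < a
           positive zero e with () ← <⇒≱ 0<N (≤-trans (le N≲A) (≤-reflexive (trans (cong (K ^ 4 *_) e) (*-zeroʳ (K ^ 4)))))
           positive (suc a) e = s≤s z≤n
         open PopularQuotients A 0<α few
         large : ∀ {a b} → a ≲[ 38 ] b → 0 < b → a < K ^ 39 * b
         large {a} {b} h 0<b = <-≤-trans (≤-<-trans (le h) (strict (K ^ 38 * b) (*-mono-≤ (m^n>0 K {{>-nonZero (≤-trans (s≤s z≤n) 4≤K)}} 38) 0<b)))
           (≤-reflexive (sym (*-assoc K (K ^ 38) b)))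
           where
           strict : ∀ m → 0 < m → m < K * m
           strict m 0<m = <-≤-trans (≤-<-trans (≤-reflexive (sym (+-identityʳ m))) (+-monoʳ-< m (≤-trans 0<m (m≤m+n m (m ℕ.+ (m ℕ.+ 0)))))) (*-monoˡ-≤ m 4≤K)
         escape′ : Escapes A 0<α few
         escape′ H sub proper g₁ g₂ cover = escape S A⊂S S-sym N≲A (K ^ 39) large H (sparse H sub proper) g₁ g₂ cover
         open Filling A 0<α few escape′
     flattening : p * (p * p) ≲[ 1900 ] N
     flattening = go (balog-szemerédi-gowers S 0<N energetic)
       where
       go : ∃ (λ A → (∀ g → A g ≡ true → S g ≡ true) × (N ≲[ 4 ] count A) × (count (quotientSet A) ≲[ 32 ] count A)) → p * (p * p) ≲[ 1900 ] N
       go (A , A⊂S , N≲A , few) = from-dense-part A A⊂S N≲A few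

  -- Cutting E to a third and applying the trichotomy

  module Assembly (12≤p : 12 ≤ FiniteField.p 𝔽) where
   open 𝓕 using (F; p; finite)
   open SL2 hiding (vec; q)
   open Charts using (module Dirᶠ; module Ptᶠ)
   open Incidences
   open Core
   open Helfgott using (IsSubgroup)
   open Flattening
   open 𝓒
   open 𝓖 using (_∙_; _⁻¹; count; energy)
   open import Data.Nat using (_+_; _*_; _^_; _≤ᵇ_)
   open import Data.Nat.DivMod using (_/_; m/n*n≤m; m≡m%n+[m/n]*n; m%n<n)
   open import Data.Nat.Properties hiding (_≟_)
   open Arith
   open Sums
   open Pigeonhole using (subset-of-size)
   Alternatives : ℕ → ℕ → ℕ → ℕ → ℕ → ℕ → Set
   Alternatives J N e Y k₁ k₂ = let D = 512 * (J * J * J) * (Y * Y) in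
     (K * N * (e * e) ≤ D * (k₁ * k₂)) ⊎ ((K * N * e) * (K * N * e) ≤ D * D * (24 * k₁)) ⊎ (e * e ≤ 24 * J * k₁ * Y)
   -- 3·m ≤ e + 2 is what the bound on the degree requires of the smaller set when e ≤ p; e ≤ 3·m
   -- returns to E at the cost of a constant.
   third : ∀ e → 0 < e → ∃ λ m → e ≤ 3 * m × 3 * m ≤ e + 2 × m ≤ e
   third e pos = m , e≤ , ≤-trans (≤-reflexive (*-comm 3 m)) (m/n*n≤m (e + 2) 3) , m≤e e pos (≤-trans (≤-reflexive (*-comm 3 m)) (m/n*n≤m (e + 2) 3))
     where
     m = (e + 2) / 3
     e≤ : e ≤ 3 * m
     e≤ = +-cancelʳ-≤ 2 e (3 * m) (≤-trans (≤-reflexive (m≡m%n+[m/n]*n (e + 2) 3)) (≤-trans (+-monoˡ-≤ (m * 3) (≤-pred (m%n<n (e + 2) 3)))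
       (≤-reflexive (trans (+-comm 2 (m * 3)) (cong (_+ 2) (*-comm m 3))))))
     m≤e : ∀ e {m} → 0 < e → 3 * m ≤ e + 2 → m ≤ e
     m≤e e {m} pos h = *-cancelˡ-≤ 3 (≤-trans h (≤-trans (+-monoʳ-≤ e (*-monoʳ-≤ 2 pos)) (≤-reflexive (solveℕ 1 (λ e → e ⊕ # 2 ⊗ e ⊜ # 3 ⊗ e) refl e))))
   module _ (S : SL → Bool) (S-sym : ∀ g → S g ≡ S (g ⁻¹))
     (sparse : ∀ H → IsSubgroup H → (∃ λ g → H g ≡ false) → ∀ x → K ^ 39 * count (λ y → S y ∧ H (x ⁻¹ ∙ y)) ≤ count S)
     (big : ¬ (count S ≲[ 3404 ] 1)) (0<N : 0 < count S) (small : ¬ (p * (p * p) ≲[ 1900 ] count S)) where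
     low-energy : K * energy S ≤ count S * count S * count S
     low-energy with ≤-total (K * energy S) (count S * count S * count S)
     ... | inj₁ h = h
     ... | inj₂ h = ⊥-elim (small (flattening S S-sym sparse big h))
     -- The bounds on lines and directions pass to the subset of E, and its image stays within I, so
     -- the conclusion for the subset speaks of the same I.
     alternatives : ∀ (E : F × F → Bool) (E0 : E origin ≡ false) (I : F × F → Bool) →
       (∀ g x → S g ≡ true → E x ≡ true → I (act g x) ≡ true) → ∀ k₁ k₂ J →
       (∀ x → Weights.radius E E0 x ≤ k₁) → Dirᶠ.count (λ x → 1 ≤ᵇ Weights.radius E E0 x) ≤ k₂ →
       p < 2 ^ J → Ptᶠ.count E ≤ p → 0 < Ptᶠ.count E →
       ∃ λ e → Ptᶠ.count E ≤ 3 * e × Alternatives J (count S) e (Ptᶠ.count I) k₁ k₂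
     alternatives E E0 I image k₁ k₂ J lines dirs p<2^J E≤p 0<E = m , proj₁ (proj₂ chosen) ,
       subst (λ e → Alternatives J (count S) e (Ptᶠ.count I) k₁ k₂) (proj₂ (proj₂ smaller))
         (image-trichotomy E' E'0 S I (λ g x sg ex → image g x sg (E'⊂E x ex)) k₁ k₂ J K
           (λ x → ≤-trans (radius≤ x) (lines x)) (≤-trans (Dirᶠ.count-mono λ x h → ≤ᵇ-intro (≤-trans (≤ᵇ-true {1} h) (radius≤ x))) dirs)
           p<2^J 12≤p (≤-trans (≤-reflexive (cong (3 *_) (proj₂ (proj₂ smaller)))) (≤-trans (proj₁ (proj₂ (proj₂ chosen))) (+-monoˡ-≤ 2 E≤p))) 0<N 0<E' low-energy)
       where
       chosen = third (Ptᶠ.count E) 0<E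
       m = proj₁ chosen
       opaque
         smaller : ∃ λ Q → (∀ x → Q x ≡ true → E x ≡ true) × Ptᶠ.count Q ≡ m
         smaller = subset-of-size finite-Pt (Ptᶠ.count E ℕ.∸ m) m E (sym (m∸n+n≡m (proj₂ (proj₂ (proj₂ chosen)))))
       E' = proj₁ smaller
       E'⊂E = proj₁ (proj₂ smaller)
       E'0 : E' origin ≡ false
       E'0 = ≢true λ h → true≢false (E'⊂E origin h) E0
       radius≤ : ∀ x → Weights.radius E' E'0 x ≤ Weights.radius E E0 x
       radius≤ x = Finite.count-mono finite λ t h → E'⊂E (t ⋆ ⟨ x ⟩) h
       0<E' : 0 < Ptᶠ.count E'
       0<E' = positive m (≤-trans 0<E (proj₁ (proj₂ chosen))) (proj₂ (proj₂ smaller))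
         where
         positive : ∀ m {c} → 0 < 3 * m → c ≡ m → 0 < c
         positive (suc m) _ refl = s≤s z≤n

open import Data.Nat using (NonZero)
open import Data.Nat.Primality using (Prime)

-- Residues modulo a prime as an instance of the abstract field

module PrimeField (p : ℕ) .{{_ : NonZero p}} (prime : Prime p) where
 open import Defs using (res; _+F_; _*F_; negF; allF)
 open import Data.Nat.Primality using (prime⇒nonTrivial)
 open import Data.Nat.DivMod
 open import Data.Nat.Coprimality using (coprime-Bézout; prime⇒coprime)
 open import Data.Nat.GCD using (module Bézout)
 open import Data.Fin as Fin using (Fin; toℕ)
 open import Data.Fin.Properties as Fin using (toℕ-fromℕ<; toℕ<n; toℕ-injective)
 open import Data.List using (tabulate)
 open import Algebra.Structures
 open PowerSeries using (nfold)
 open Sums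

 private
   F = Fin p
   infixl 6 _⊞_
   infixl 7 _⊠_
   _⊞_ _⊠_ : F → F → F
   _⊞_ = _+F_ p
   _⊠_ = _*F_ p
   r : ℕ → F
   r = res p
   toℕ-r : ∀ n → toℕ (r n) ≡ n % p
   toℕ-r n = toℕ-fromℕ< (m%n<n n p)
   r-cong : ∀ {m n} → m % p ≡ n % p → r m ≡ r n
   r-cong {m} {n} e = toℕ-injective (trans (toℕ-r m) (trans e (sym (toℕ-r n))))
   r-toℕ : ∀ a → r (toℕ a) ≡ a
   r-toℕ a = toℕ-injective (trans (toℕ-r (toℕ a)) (m<n⇒m%n≡m (toℕ<n a)))
   r-+ : ∀ m n → r m ⊞ r n ≡ r (m ℕ.+ n)
   r-+ m n = r-cong (trans (cong₂ (λ x y → (x ℕ.+ y) % p) (toℕ-r m) (toℕ-r n)) (sym (%-distribˡ-+ m n p)))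
   r-* : ∀ m n → r m ⊠ r n ≡ r (m ℕ.* n)
   r-* m n = r-cong (trans (cong₂ (λ x y → (x ℕ.* y) % p) (toℕ-r m) (toℕ-r n)) (sym (%-distribˡ-* m n p)))
   -- Every element is the residue of a natural number and `r` respects both operations, so the ring
   -- laws are inherited from the naturals.
   lift₁ : (P : F → Set) → (∀ n → P (r n)) → ∀ a → P a
   lift₁ P h a = subst P (r-toℕ a) (h (toℕ a))
   r0 : ∀ n → r (n ℕ.* p) ≡ r 0
   r0 n = r-cong (trans (m*n%n≡0 n p) (sym (m<n⇒m%n≡m (≤-trans (s≤s z≤n) (≤-reflexive refl-p)))))
     where
     refl-p : suc (ℕ.pred p) ≡ p
     refl-p = ℕ.suc-pred p
   ⊞-assoc : ∀ a b c → (a ⊞ b) ⊞ c ≡ a ⊞ (b ⊞ c)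
   ⊞-assoc = lift₁ _ λ x → lift₁ _ λ y → lift₁ _ λ z → trans (cong (_⊞ r z) (r-+ x y)) (trans (r-+ _ z) (trans (cong r (ℕ.+-assoc x y z))
     (trans (sym (r-+ x _)) (cong (r x ⊞_) (sym (r-+ y z))))))
   ⊞-comm : ∀ a b → a ⊞ b ≡ b ⊞ a
   ⊞-comm a b = cong r (ℕ.+-comm (toℕ a) (toℕ b))
   ⊞-identityˡ : ∀ a → r 0 ⊞ a ≡ a
   ⊞-identityˡ = lift₁ _ λ x → r-+ 0 x
   ⊠-assoc : ∀ a b c → (a ⊠ b) ⊠ c ≡ a ⊠ (b ⊠ c)
   ⊠-assoc = lift₁ _ λ x → lift₁ _ λ y → lift₁ _ λ z → trans (cong (_⊠ r z) (r-* x y)) (trans (r-* _ z) (trans (cong r (ℕ.*-assoc x y z))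
     (trans (sym (r-* x _)) (cong (r x ⊠_) (sym (r-* y z))))))
   ⊠-comm : ∀ a b → a ⊠ b ≡ b ⊠ a
   ⊠-comm a b = cong r (ℕ.*-comm (toℕ a) (toℕ b))
   ⊠-identityˡ : ∀ a → r 1 ⊠ a ≡ a
   ⊠-identityˡ = lift₁ _ λ x → trans (r-* 1 x) (cong r (ℕ.*-identityˡ x))
   distribˡ : ∀ a b c → a ⊠ (b ⊞ c) ≡ a ⊠ b ⊞ a ⊠ c
   distribˡ = lift₁ _ λ x → lift₁ _ λ y → lift₁ _ λ z → trans (cong (r x ⊠_) (r-+ y z)) (trans (r-* x _) (trans (cong r (ℕ.*-distribˡ-+ x y z))
     (trans (sym (r-+ _ _)) (sym (cong₂ _⊞_ (r-* x y) (r-* x z))))))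
   neg-inverseˡ : ∀ a → negF p a ⊞ a ≡ r 0
   neg-inverseˡ a = trans (cong (negF p a ⊞_) (sym (r-toℕ a))) (trans (r-+ _ (toℕ a)) (trans (cong r (trans (ℕ.m∸n+n≡m (ℕ.<⇒≤ (toℕ<n a))) (sym (ℕ.*-identityˡ p)))) (r0 1)))
   isRing : IsCommutativeRing _≡_ _⊞_ _⊠_ (negF p) (r 0) (r 1)
   isRing = record
     { isRing = record
       { +-isAbelianGroup = record
         { isGroup = record
           { isMonoid = record
             { isSemigroup = record { isMagma = isMagma _⊞_ ; assoc = ⊞-assoc }
             ; identity = ⊞-identityˡ , λ a → trans (⊞-comm a (r 0)) (⊞-identityˡ a) }
           ; inverse = neg-inverseˡ , λ a → trans (⊞-comm a (negF p a)) (neg-inverseˡ a)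
           ; ⁻¹-cong = cong (negF p) }
         ; comm = ⊞-comm }
       ; *-cong = cong₂ _⊠_
       ; *-assoc = ⊠-assoc
       ; *-identity = ⊠-identityˡ , λ a → trans (⊠-comm a (r 1)) (⊠-identityˡ a)
       ; distrib = distribˡ , λ a b c → trans (⊠-comm (b ⊞ c) a) (trans (distribˡ a b c) (cong₂ _⊞_ (⊠-comm a b) (⊠-comm a c)))
       }
     ; *-comm = ⊠-comm }
     where open import Relation.Binary.PropositionalEquality.Algebra using (isMagma)
   toℕ≢0 : ∀ {a : F} → ¬ (a ≡ r 0) → 0 < toℕ a
   toℕ≢0 {a} h with toℕ a in e
   ... | suc _ = s≤s z≤n
   ... | zero = ⊥-elim (h (trans (sym (r-toℕ a)) (cong r e)))
   -- Over the naturals Bézout's identity has two forms; in the second one y·a is -1, and the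
   -- inverse is the negative of y.
   inverse : ∀ a → ¬ (a ≡ r 0) → ∃ λ b → a ⊠ b ≡ r 1
   inverse a h with coprime-Bézout (prime⇒coprime prime {{ℕ.>-nonZero (toℕ≢0 h)}} (toℕ<n a))
   ... | Bézout.-+ x y e = r y , trans (cong (_⊠ r y) (sym (r-toℕ a))) (trans (r-* (toℕ a) y) (trans (cong r (trans (ℕ.*-comm (toℕ a) y) (sym e)))
           (trans (sym (r-+ 1 (x ℕ.* p))) (trans (cong (r 1 ⊞_) (r0 x)) (r-+ 1 0)))))
   ... | Bézout.+- x y e = negF p (r y) , trans (trans (⊠-comm a _) (trans (sym (⊞-0 _)) (trans (cong (negF p (r y) ⊠ a ⊞_) (sym zero-sum))
           (trans (sym (⊞-assoc _ (r y ⊠ a) (r 1))) (trans (cong (_⊞ r 1) cancels) (⊞-identityˡ (r 1))))))) refl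
     where
     ⊞-0 : ∀ b → b ⊞ r 0 ≡ b
     ⊞-0 b = trans (⊞-comm b (r 0)) (⊞-identityˡ b)
     zero-sum : r y ⊠ a ⊞ r 1 ≡ r 0
     zero-sum = trans (cong (λ b → r y ⊠ b ⊞ r 1) (sym (r-toℕ a))) (trans (cong (_⊞ r 1) (r-* y (toℕ a))) (trans (r-+ _ 1)
       (trans (cong r (trans (ℕ.+-comm _ 1) e)) (r0 x))))
     cancels : negF p (r y) ⊠ a ⊞ r y ⊠ a ≡ r 0
     cancels = trans (sym (trans (⊠-comm (negF p (r y) ⊞ r y) a) (trans (distribˡ a (negF p (r y)) (r y)) (cong₂ _⊞_ (⊠-comm a (negF p (r y))) (⊠-comm a (r y))))))
       (trans (cong (_⊠ a) (neg-inverseˡ (r y))) (lift₁ (λ a → r 0 ⊠ a ≡ r 0) (λ n → r-* 0 n) a))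
   nfold-r : ∀ j → nfold _⊞_ (r 0) j (r 1) ≡ r j
   nfold-r zero    = refl
   nfold-r (suc j) = trans (cong (r 1 ⊞_) (nfold-r j)) (r-+ 1 j)
   ∑-tabulate : ∀ {A : Set} n (g : Fin n → A) f → ∑ (tabulate g) f ≡ ∑ (tabulate {n = n} (λ i → i)) (λ i → f (g i))
   ∑-tabulate zero    g f = refl
   ∑-tabulate (suc n) g f = cong (f (g Fin.zero) ℕ.+_) (trans (∑-tabulate n (λ i → g (Fin.suc i)) f) (sym (∑-tabulate n Fin.suc (λ i → f (g i)))))
   size : ∀ n → ∑ (tabulate {n = n} (λ i → i)) (λ _ → 1) ≡ n
   size zero    = refl
   size (suc n) = cong suc (trans (∑-tabulate n Fin.suc (λ _ → 1)) (size n))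
   once : ∀ n (i : Fin n) → ∑ (tabulate {n = n} (λ i → i)) (λ j → 𝟙 (does (i Fin.≟ j))) ≡ 1
   once (suc n) Fin.zero    = cong suc (trans (∑-tabulate n Fin.suc _) (∑-0 (tabulate {n = n} (λ i → i))))
   once (suc n) (Fin.suc i) = trans (∑-tabulate n Fin.suc _) (trans (∑-cong (tabulate {n = n} (λ i → i)) (λ j → same i j)) (once n i))
     where
     same : ∀ i j → 𝟙 (does (Fin.suc i Fin.≟ Fin.suc j)) ≡ 𝟙 (does (i Fin.≟ j))
     same i j with i Fin.≟ j
     ... | yes _ = refl
     ... | no _  = refl
   1<p : 1 < p
   1<p = ℕ.nonTrivial⇒n>1 p {{prime⇒nonTrivial prime}}

 primeField : FiniteField
 primeField = record
   { F = F ; _+_ = _⊞_ ; _*_ = _⊠_ ; -_ = negF p ; 0# = r 0 ; 1# = r 1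
   ; isCommutativeRing = isRing
   ; finite = record { elems = allF p ; _≟_ = Fin._≟_ ; once = once p }
   ; inverse = inverse
   ; p = p
   ; order = size p
   ; 1<p = 1<p
   ; char = λ { j pos lt e → ℕ.<-irrefl (sym (trans (sym (m<n⇒m%n≡m lt)) (trans (sym (toℕ-r j)) (trans (cong toℕ (trans (sym (nfold-r j)) e))
       (trans (toℕ-r 0) (m<n⇒m%n≡m (≤-trans (s≤s z≤n) lt))))))) pos }
   }

-- From Boolean sets of matrices to the abstract setting

module Translation (p : ℕ) .{{p≢0 : NonZero p}} (prime : Prime p) (12≤p : 12 ≤ p) (k : ℕ) (4≤K : 4 ≤ k ℕ.* k) where
 open import Data.Nat.Properties as ℕ using (≤-trans; ≤-reflexive)

 open import Defs hiding (F; act; Mat)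
 open PrimeField p prime using (primeField)
 private
   𝔽 : FiniteField
   𝔽 = primeField
   K : ℕ
   K = k ℕ.* k
   2<p : 2 < p
   2<p = ℕ.≤-trans (s≤s (s≤s (s≤s z≤n))) 12≤p
   module 𝓞 = OverField 𝔽
   module 𝓦 = 𝓞.WithScale 2<p K 4≤K
 open FieldTheory 𝔽 using (F; 0#; *-cancel0; finite; module Fᶠ; _*_; solve; _:=_; _:*_; _:-_; :0)
 open 𝓞.SL2 using (Mat; SL; SL₂; inSL₂; SL-ext; act; finite-Pt; finite-Mat; finite-Dir; Dir; ⟨_⟩; area; dir-area; dir-nonzero; find-direction; nonzero)
 open 𝓞.Charts using (module Dirᶠ; module Ptᶠ)
 open 𝓞.Incidences using (_⋆_; 0⋆; unit-coordinate; module Weights)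
 open FiniteGroup SL₂ using (ε; _∙_; _⁻¹; count; count-mono; cancelˡ′) renaming (finite to finite-SL)
 open import Data.List using (List; []; _∷_; length)
 open import Data.List.Relation.Unary.All using (All; []; _∷_)
 open import Data.List.Relation.Unary.Any using (Any; here; there)
 open import Data.Nat using (_≤ᵇ_)
 open Sums
 open Pigeonhole
 open 𝓦.Helfgott using () renaming (IsSubgroup to Subgroup)

 private module Matᶠ = Finite finite-Mat

 cardPt-count : ∀ P → cardPt p P ≡ Ptᶠ.count P
 cardPt-count P = length-filter P (allPts p)

 module _ (T : Mat → Bool) (T⊂ : ∀ M → T M ≡ true → inSL₂ M ≡ true) where
   restricted : SL → Bool
   restricted g = T (proj₁ g)
   cardMat-count : cardMat p T ≡ count restricted
   cardMat-count = trans (length-filter T (allMats p)) (trans (∑-cong (allMats p) λ M → cell M (T M) refl) (sym (∑-restrict inSL₂ (allMats p) (λ M → 𝟙 (T M)))))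
     where
     cell : ∀ M b → T M ≡ b → 𝟙 b ≡ 𝟙 (inSL₂ M) ℕ.* 𝟙 b
     cell M false _ = sym (ℕ.*-zeroʳ (𝟙 (inSL₂ M)))
     cell M true  e = cong (λ b → 𝟙 b ℕ.* 1) (sym (T⊂ M e))

 module _ (H : SL → Bool) where
   private
     go : ∀ M b → inSL₂ M ≡ b → Bool
     go M true  e = H (M , e)
     go M false _ = false
   -- The subgroups met in the flattening are predicates on `SL`, while the hypothesis on S concerns
   -- predicates on all matrices; outside SL₂ the value is false.
   extend : Mat → Bool
   extend M = go M (inSL₂ M) refl
   extend-restrict : ∀ g → extend (proj₁ g) ≡ H g
   extend-restrict (M , e) = h (inSL₂ M) refl e
     where
     h : ∀ b (e' : inSL₂ M ≡ b) (e : inSL₂ M ≡ true) → go M b e' ≡ H (M , e)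
     h true  e' e = cong H (SL-ext refl)
     h false e' e = ⊥-elim (true≢false e e')
   extend-true : ∀ M → extend M ≡ true → ∃ λ e → H (M , e) ≡ true
   extend-true M = h (inSL₂ M) refl
     where
     h : ∀ b (e' : inSL₂ M ≡ b) → go M b e' ≡ true → ∃ λ e → H (M , e) ≡ true
     h true e' x = e' , x
   extend-subgroup : Subgroup H → (∃ λ g → H g ≡ false) → IsProperSubgroupSL2 p extend
   extend-subgroup sub (g , out) = ((λ M h → proj₁ (extend-true M h)) , trans (extend-restrict ε) has-ε
       , (λ M M' h h' → product M M' (extend-true M h) (extend-true M' h')) , (λ M h → inverse M (extend-true M h)))
     , (proj₁ g , proj₂ g , trans (extend-restrict g) out)
     where
     open 𝓦.Helfgott.IsSubgroup sub
     product : ∀ M M' → ∃ (λ e → H (M , e) ≡ true) → ∃ (λ e → H (M' , e) ≡ true) → extend (_·M_ p M M') ≡ true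
     product M M' (e , h) (e' , h') = trans (extend-restrict ((M , e) ∙ (M' , e'))) (has-∙ (M , e) (M' , e') h h')
     inverse : ∀ M → ∃ (λ e → H (M , e) ≡ true) → extend (invM p M) ≡ true
     inverse M (e , h) = trans (extend-restrict ((M , e) ⁻¹)) (has-⁻¹ (M , e) h)
   module _ (S : Mat → Bool) (S⊂ : ∀ M → S M ≡ true → inSL₂ M ≡ true) (x : SL) where
     coset-count : count (λ y → S (proj₁ y) ∧ H (x ⁻¹ ∙ y)) ≤ cardMat p (_∩M_ p S (coset p (proj₁ x) extend))
     coset-count = ≤-trans (count-mono λ y h → ∧-intro (proj₁ (∧-true h)) (Matᶠ.any-intro _ (proj₁ (x ⁻¹ ∙ y))
         (∧-intro (trans (extend-restrict (x ⁻¹ ∙ y)) (proj₂ (∧-true {S (proj₁ y)} h)))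
           (does-intro (proj₁ (x ∙ (x ⁻¹ ∙ y)) Matᶠ.≟ proj₁ y) (cong proj₁ (cancelˡ′ x y))))))
       (≤-reflexive (sym (cardMat-count (_∩M_ p S (coset p (proj₁ x) extend)) λ M h → S⊂ M (proj₁ (∧-true h)))))

 image-intro : ∀ S E (g : SL) x → S (proj₁ g) ≡ true → E x ≡ true → image p S E (act g x) ≡ true
 image-intro S E g x sg ex = Matᶠ.any-intro _ (proj₁ g) (∧-intro sg (Ptᶠ.any-intro _ x (∧-intro ex (does-intro (act g x Ptᶠ.≟ act g x) refl))))

 module _ (E : Pt p → Bool) (E0 : E (origin p) ≡ false) where
   open Weights E E0
   radius≤ : ∀ k₁ → LinesContainAtMost p E k₁ → ∀ x → radius x ≤ k₁
   radius≤ k₁ lines x = ≤-trans (count-injective finite finite-Pt (_⋆ ⟨ x ⟩) (λ t → E (t ⋆ ⟨ x ⟩)) (_∩P_ p E (onLine p ⟨ x ⟩))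
       (λ t h → ∧-intro h (Fᶠ.any-intro _ t (does-intro ((t ⋆ ⟨ x ⟩) Ptᶠ.≟ (t ⋆ ⟨ x ⟩)) refl))) (λ t t' _ _ e → unit-coordinate x t t' e))
     (≤-trans (≤-reflexive (sym (cardPt-count (_∩P_ p E (onLine p ⟨ x ⟩))))) (lines ⟨ x ⟩ λ e → dir-nonzero x (cong proj₁ e , cong proj₂ e)))
   private
     parallel : Dir → Pt p → Bool
     parallel x v = area ⟨ x ⟩ v Fᶠ.== 0#
     one-direction : ∀ v → ¬ (v ≡ origin p) → Dirᶠ.count (λ x → parallel x v) ≤ 1
     one-direction v v≢0 = go (find-direction v (λ { (e , e') → v≢0 (cong₂ _,_ e e') }))
       where
       go : ∃ (λ s → ∃ λ l → ¬ (l ≡ 0#) × v ≡ (l * proj₁ ⟨ s ⟩ , l * proj₂ ⟨ s ⟩)) → Dirᶠ.count (λ x → parallel x v) ≤ 1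
       go (s , l , l≢0 , refl) = count-≤1 finite-Dir s λ x h → same x (does-true (area ⟨ x ⟩ (l ⋆ ⟨ s ⟩) Fᶠ.≟ 0#) h)
         where
         same : ∀ x → area ⟨ x ⟩ (l ⋆ ⟨ s ⟩) ≡ 0# → s ≡ x
         same x h with Dirᶠ._≟_ x s
         ... | yes q = sym q
         ... | no ne = ⊥-elim (dir-area x s ne (*-cancel0 l≢0 (trans (rearrange ⟨ x ⟩ ⟨ s ⟩) h)))
           where
           rearrange : ∀ v w → l * area v w ≡ area v (l ⋆ w)
           rearrange (a , b) (c , d) = solve 5 (λ l a b c d → l :* (a :* d :- b :* c) := a :* (l :* d) :- b :* (l :* c)) refl l a b c d
     covered : ∀ x v t → ¬ (t ≡ 0#) → onLine p v (t ⋆ ⟨ x ⟩) ≡ true → parallel x v ≡ true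
     covered x v t t≢0 h = go (any-true _ (allF p) h)
       where
       go : ∃ (λ s → _==P_ p (scale p s v) (t ⋆ ⟨ x ⟩) ≡ true) → parallel x v ≡ true
       go (s , e) = does-intro (_ Fᶠ.≟ 0#) (*-cancel0 t≢0 (trans (left ⟨ x ⟩ v) (trans (cong (λ w → area w v) (sym (does-true ((s ⋆ v) Ptᶠ.≟ (t ⋆ ⟨ x ⟩)) e))) (self v))))
         where
         left : ∀ v w → t * area v w ≡ area (t ⋆ v) w
         left (a , b) (c , d) = solve 5 (λ t a b c d → t :* (a :* d :- b :* c) := t :* a :* d :- t :* b :* c) refl t a b c d
         self : ∀ v → area (s ⋆ v) v ≡ 0#
         self (a , b) = solve 3 (λ s a b → s :* a :* b :- s :* b :* a := :0) refl s a b
   -- Every direction that meets E is parallel to some vector of the covering list, and a nonzero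
   -- vector is parallel to one direction only.
   directions≤ : ∀ k₂ → DeterminesAtMostDirections p E k₂ → Dirᶠ.count (λ x → 1 ≤ᵇ radius x) ≤ k₂
   directions≤ k₂ (vs , len , nonzero , cover) = ≤-trans (≤-trans (∑-mono Dirᶠ.elems λ x → 𝟙-bound (hit x)) (≤-reflexive (∑-swap Dirᶠ.elems vs _)))
     (≤-trans (each vs nonzero) len)
     where
     𝟙-bound : ∀ {b n} → (b ≡ true → 1 ≤ n) → 𝟙 b ≤ n
     𝟙-bound {true}  h = h refl
     𝟙-bound {false} _ = z≤n
     each : ∀ vs → All (λ v → ¬ (v ≡ origin p)) vs → ∑ vs (λ v → Dirᶠ.count (λ x → parallel x v)) ≤ length vs
     each []       []       = z≤n
     each (v ∷ vs) (n ∷ ns) = ℕ.+-mono-≤ (one-direction v n) (each vs ns)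
     hit : ∀ x → (1 ≤ᵇ radius x) ≡ true → 1 ≤ ∑ vs (λ v → 𝟙 (parallel x v))
     hit x h = go (count-∃ finite (≤ᵇ-true {1} h))
       where
       go : ∃ (λ t → E (t ⋆ ⟨ x ⟩) ≡ true) → 1 ≤ ∑ vs (λ v → 𝟙 (parallel x v))
       go (t , e) = sum vs (cover (t ⋆ ⟨ x ⟩) e)
         where
         t≢0 : ¬ (t ≡ 0#)
         t≢0 refl = true≢false e (trans (cong E (0⋆ ⟨ x ⟩)) E0)
         sum : ∀ vs → Any (λ v → onLine p v (t ⋆ ⟨ x ⟩) ≡ true) vs → 1 ≤ ∑ vs (λ v → 𝟙 (parallel x v))
         sum (v ∷ vs) (here h)  = ≤-trans (1≤𝟙 (covered x v t t≢0 h)) (ℕ.m≤m+n _ _)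
         sum (v ∷ vs) (there a) = ≤-trans (sum vs a) (ℕ.m≤n+m _ _)

 open import Data.Nat.Logarithm using (⌈log₂_⌉)
 open Parameters using (not-below; not-filling; sparse-below; first-power; first-alternative; second-power; second-alternative; fourth-alternative)
 open Calculus K 4≤K using (_≲[_]_; le)
 open 𝓦.Assembly 12≤p using (Alternatives; alternatives)

 -- `absorbed` is invoked at 3404 for the lower bound on |S|, at 1900 for the upper bound, and at 78
 -- = 2·39 for cosets, whose hypothesis comes with the exponent 2h.
 module _ (f J g h : ℕ) (0<g : 0 < g) (g<h : g < h) (absorbed : ∀ c → c ≤ 3404 → (K ℕ.^ c) ℕ.^ h ≤ p)
   (0<J : 0 < J) (J≤k : J ≤ k) (J≤2L : J ≤ 2 ℕ.* ⌈log₂ p ⌉) (p≤k^f : p ≤ k ℕ.^ f) (p<2^J : p < 2 ℕ.^ J)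
   (S : Mat → Bool) (S⊂ : ∀ M → S M ≡ true → inSL₂ M ≡ true) (S-sym : ∀ θ → S θ ≡ S (invM p θ))
   (lower : p ℕ.^ g < cardMat p S ℕ.^ h) (upper : cardMat p S ℕ.^ h < p ℕ.^ (3 ℕ.* h ℕ.∸ 2 ℕ.* g))
   (sparse : ∀ H → IsProperSubgroupSL2 p H → ∀ x → inSL2 p x ≡ true →
     cardMat p (_∩M_ p S (coset p x H)) ℕ.^ (2 ℕ.* h) ℕ.* p ℕ.^ g < cardMat p S ℕ.^ (2 ℕ.* h)) where
   private
     N : ℕ
     N = cardMat p S
     S′ : SL → Bool
     S′ = restricted S S⊂
     N≡ : N ≡ count S′
     N≡ = cardMat-count S S⊂
     0<N : 0 < count S′
     0<N = subst (0 <_) N≡ (positive h N (≤-trans (s≤s z≤n) g<h) (≤-trans (s≤s z≤n) lower))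
       where
       positive : ∀ h N → 0 < h → 0 < N ℕ.^ h → 0 < N
       positive h       (suc N) _ _ = s≤s z≤n
       positive (suc h) zero    _ ()
     0<p : 0 < p
     0<p = ≤-trans (s≤s z≤n) 12≤p
     big : ¬ (count S′ ≲[ 3404 ] 1)
     big h′ = not-below p 0<p g h 0<g N (K ℕ.^ 3404) lower (absorbed 3404 ℕ.≤-refl)
       (≤-trans (≤-reflexive N≡) (≤-trans (le h′) (≤-reflexive (ℕ.*-identityʳ (K ℕ.^ 3404)))))
     small : ¬ (p ℕ.* (p ℕ.* p) ≲[ 1900 ] count S′)
     small h′ = not-filling p 0<p g h 0<g N (K ℕ.^ 1900) g<h upper (absorbed 1900 (ℕ.≤ᵇ⇒≤ 1900 3404 _)) (≤-trans (le h′) (≤-reflexive (cong (K ℕ.^ 1900 ℕ.*_) (sym N≡))))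
     sparse′ : ∀ H → Subgroup H → (∃ λ g → H g ≡ false) → ∀ x → K ℕ.^ 39 ℕ.* count (λ y → S′ y ∧ H (x ⁻¹ ∙ y)) ≤ count S′
     sparse′ H sub proper x = ≤-trans (ℕ.*-monoʳ-≤ (K ℕ.^ 39) (coset-count H S S⊂ x)) (≤-trans
       (sparse-below p 0<p g h 0<g N (K ℕ.^ 39) _ (sparse (extend H) (extend-subgroup H sub proper) (proj₁ x) (proj₂ x))
         (≤-trans (≤-reflexive (trans (sym (ℕ.^-*-assoc (K ℕ.^ 39) 2 h)) (cong (ℕ._^ h) (ℕ.^-*-assoc K 39 2)))) (absorbed 78 (ℕ.≤ᵇ⇒≤ 78 3404 _))))
       (≤-reflexive N≡))
   module _ (E : Pt p → Bool) (E0 : E (origin p) ≡ false) (E≤p : cardPt p E ≤ p) (k₁ k₂ : ℕ)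
     (lines : LinesContainAtMost p E k₁) (directions : DeterminesAtMostDirections p E k₂) where
     private
       e = cardPt p E
       Y = cardPt p (image p S E)
       X = 512 ℕ.* ⌈log₂ p ⌉ ℕ.* Y
       Conclusion : Set
       Conclusion = (e ℕ.^ (2 ℕ.* f) ℕ.* N ℕ.^ f ℕ.* p ℕ.^ 1 ≤ X ℕ.^ (2 ℕ.* f) ℕ.* k₁ ℕ.^ f ℕ.* k₂ ℕ.^ f)
         ⊎ (e ℕ.^ (2 ℕ.* f) ℕ.* N ℕ.^ (2 ℕ.* f) ℕ.* p ℕ.^ (2 ℕ.* 1) ≤ X ℕ.^ (4 ℕ.* f) ℕ.* k₁ ℕ.^ f)
         ⊎ (e ℕ.^ (2 ℕ.* f) ℕ.* N ℕ.^ f ℕ.* p ℕ.^ 1 ≤ X ℕ.^ (2 ℕ.* f) ℕ.* k₁ ℕ.^ (2 ℕ.* f))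
         ⊎ (e ℕ.^ 2 ≤ X ℕ.* k₁)
       numeric : ∀ e' → e ≤ 3 ℕ.* e' → Alternatives J N e' Y k₁ k₂ → Conclusion
       numeric e' e≤ = λ
         { (inj₁ h) → inj₁ (first-power 512 k J L N e e' Y k₁ k₂ p f c≥ 0<J J≤k J≤2L p≤k^f e≤ (first-alternative 512 k J L N e e' Y k₁ k₂ p f c≥ 0<J J≤k J≤2L p≤k^f e≤ h))
         ; (inj₂ (inj₁ h)) → inj₂ (inj₁ (second-power 512 k J L N e e' Y k₁ k₂ p f c≥ 0<J J≤k J≤2L p≤k^f e≤ (second-alternative 512 k J L N e e' Y k₁ k₂ p f c≥ 0<J J≤k J≤2L p≤k^f e≤ h)))
         ; (inj₂ (inj₂ h)) → inj₂ (inj₂ (inj₂ (fourth-alternative 512 k J L N e e' Y k₁ k₂ p f c≥ 0<J J≤k J≤2L p≤k^f e≤ h))) }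
         where
         L = ⌈log₂ p ⌉
         c≥ : 432 ≤ 512
         c≥ = ℕ.≤ᵇ⇒≤ 432 512 _
     conclusion : Conclusion
     conclusion with ℕ.≤-<-connex e 0
     -- The averaging needs a nonempty E; for an empty one the last alternative has left side 0.
     ... | inj₁ empty = inj₂ (inj₂ (inj₂ (≤-trans (≤-reflexive (cong (ℕ._^ 2) (ℕ.n≤0⇒n≡0 empty))) z≤n)))
     ... | inj₂ 0<E = go (alternatives S′ (λ g → S-sym (proj₁ g)) sparse′ big 0<N small E E0 (image p S E) (λ g x sg ex → image-intro S E g x sg ex) k₁ k₂ J
           (radius≤ E E0 k₁ lines) (directions≤ E E0 k₂ directions) p<2^J
           (≤-trans (≤-reflexive (sym (cardPt-count E))) E≤p) (≤-trans 0<E (≤-reflexive (cardPt-count E))))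
       where
       go : (∃ λ e' → Ptᶠ.count E ≤ 3 ℕ.* e' × Alternatives J (count S′) e' (Ptᶠ.count (image p S E)) k₁ k₂) → Conclusion
       go (e' , e≤ , alt) = numeric e' (≤-trans (≤-reflexive (cardPt-count E)) e≤)
         (subst (λ n → Alternatives J n e' Y k₁ k₂) (sym N≡) (subst (λ y → Alternatives J (count S′) e' y k₁ k₂) (sym (cardPt-count (image p S E))) alt))

-- Choice of the exponents

open import Defs
open import Data.Nat using (ℕ; _+_; _*_; _^_; _∸_; _≤_; _<_; NonZero)
open import Data.Nat.Logarithm using (⌈log₂_⌉)
open import Data.Nat.Primality using (Prime)
open import Data.Bool using (Bool; true; false)
open import Data.Product using (Σ; _×_)
open import Data.Sum using (_⊎_)
open import Relation.Binary.PropositionalEquality using (_≡_)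
open import Data.Nat.Properties using (≤-trans; *-mono-≤; *-monoˡ-≤; +-mono-≤; m^n>0)
open Parameters using (module Scale; power-absorbed)

theorem1p4 :
    (g h : ℕ) → 0 < g → g < h →
    Σ ℕ λ e → Σ ℕ λ f → (0 < e) × (0 < f) × Σ ℕ λ C → Σ ℕ λ N →
    (p : ℕ) .{{_ : NonZero p}} → Prime p → N ≤ p →
    (E : Pt p → Bool) → E (origin p) ≡ false → cardPt p E ≤ p →
    (k₁ k₂ : ℕ) → LinesContainAtMost p E k₁ → DeterminesAtMostDirections p E k₂ →
    (S : Mat p → Bool) → (∀ M → S M ≡ true → inSL2 p M ≡ true) →
    (∀ θ → S θ ≡ S (invM p θ)) →
    p ^ g < cardMat p S ^ h →
    cardMat p S ^ h < p ^ (3 * h ∸ 2 * g) →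
    (∀ H → IsProperSubgroupSL2 p H → ∀ x → inSL2 p x ≡ true →
      cardMat p (_∩M_ p S (coset p x H)) ^ (2 * h) * p ^ g < cardMat p S ^ (2 * h)) →
    let sE = cardPt p E
        sS = cardMat p S
        Y = C * ⌈log₂ p ⌉ * cardPt p (image p S E)
    in (sE ^ (2 * f) * sS ^ f * p ^ e ≤ Y ^ (2 * f) * k₁ ^ f * k₂ ^ f)
       ⊎ (sE ^ (2 * f) * sS ^ (2 * f) * p ^ (2 * e) ≤ Y ^ (4 * f) * k₁ ^ f)
       ⊎ (sE ^ (2 * f) * sS ^ f * p ^ e ≤ Y ^ (2 * f) * k₁ ^ (2 * f))
       ⊎ (sE ^ 2 ≤ Y * k₁)
-- ε is 1/f, as p is at most the f-th power of the root `k₁`. The constant 512 comes from the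
-- trichotomy and also covers the 432 = 9·24·2 of the last alternative.
theorem1p4 g h 0<g g<h = 1 , Scale.f M 0<M , s≤s z≤n , Scale.0<f M 0<M , 512 , 2 ^ Scale.threshold M 0<M ,
  λ p prime large E E0 E≤p k₁ k₂ lines directions S S⊂ S-sym lower upper sparse → let k = Scale.k₁ M 0<M p large in
    Translation.conclusion p prime (Scale.12≤p M 0<M p large) k (Scale.4≤k₁² M 0<M p large)
      (Scale.f M 0<M) (suc (Scale.k M 0<M p large)) g h 0<g g<h
      (λ c le → power-absorbed k M p c h (m^n>0 2 (Scale.s M 0<M p large)) (Scale.k₁^M≤p M 0<M p large) (*-monoˡ-≤ h (+-mono-≤ le le)))
      (s≤s z≤n) (Scale.J≤k₁ M 0<M p large) (Scale.J≤2L M 0<M p large) (Scale.p≤k₁^f M 0<M p large) (Scale.p<2^J M 0<M p large)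
      S S⊂ S-sym lower upper sparse E E0 E≤p k₁ k₂ lines directions
  where
  M : ℕ
  -- Twice the largest exponent because `K` is the square of `k₁`, and times h because the bounds on
  -- |S| are stated for h-th powers.
  M = (3404 + 3404) * h
  0<M : 0 < M
  0<M = *-mono-≤ {1} {3404 + 3404} (s≤s z≤n) (≤-trans (s≤s z≤n) g<h)
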